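{- Let $\alpha,\beta$ be positive integers with $\beta > \alpha$, and let $\mathcal{P}$ be an atomic chiral polyhedron of type $\{2^{\alpha}, 2^{\beta}\}$ with rotation group $\Gamma^+(\mathcal P)=\langle\sigma_1,\sigma_2\rangle$. Then either $\mathcal{P}$ is of type $\{8, 2^{\beta}\}$ with $\beta \geq 5$ and \[ \Gamma^+(\mathcal{P}) = \Gamma^{8, 2^{\beta}}(3,\ 1 \pm 2^{\beta-2},\ -3,\ -1 \pm 2^{\beta-2}) \] (same choice of sign in both places), or $\mathcal{P}$ is of type $\{2^{\alpha}, 2^{\alpha+1}\}$ with $\alpha \geq 4$ and \[ \Gamma^+(\mathcal{P}) = \Gamma^{2^{\alpha}, 2^{\alpha+1}}(-1 + 2^{\alpha-1},\ -3 \pm 2^{\alpha-1},\ 1 + 2^{\alpha-1},\ 3 \pm 2^{\alpha-1}) \] (same choice of sign in both places).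
   Context: For integers $p,q,i_1,j_1,i_2,j_2$, $\Gamma^{p,q}(i_1,j_1,i_2,j_2)$ denotes the group with presentation $\langle \sigma_1,\sigma_2 \mid \sigma_1^p=\sigma_2^q=(\sigma_1\sigma_2)^2=1,\ \sigma_2^{ -1}\sigma_1=\sigma_1^{i_1}\sigma_2^{j_1},\ \sigma_2\sigma_1^{ -1}=\sigma_1^{i_2}\sigma_2^{j_2}\rangle$; an equality $\Gamma^+(\mathcal P)=\Gamma^{p,q}(\dots)$ means the map sending the generators $\sigma_1,\sigma_2$ of the presented group to the distinguished generators of $\Gamma^+(\mathcal P)$ is an isomorphism. An (abstract) polyhedron is a partially ordered set whose elements have rank $0$, $1$, $2$ (vertices, edges, faces), incidence meaning comparability, such that every edge is incident to exactly two vertices and two faces, whenever a vertex is incident to a face exactly two edges are incident to both, the incidence graph is connected, and for each vertex or face the subgraph of the incidence graph induced on its neighbours is connected. A flag is a mutually incident (vertex, edge, face) triple; $\Phi^i$ is the flag differing from $\Phi$ exactly in its rank-$i$ element. Type $\{p,q\}$: faces are incident to $p$ edges and vertices to $q$ edges. A polyhedron is regular if its automorphism group is flag-transitive, and chiral if its flags split into two classes with $\Phi,\Phi^i$ always in different classes and the automorphism group transitive on each class but not on all flags. For a regular or chiral polyhedron with base flag $\Phi$, $\sigma_1:\Phi\mapsto(\Phi^1)^0$ and $\sigma_2:\Phi\mapsto(\Phi^2)^1$ generate the rotation group $\Gamma^+(\mathcal P)$. Tight: exactly $2pq$ flags. $\mathcal P$ covers $\mathcal Q$ if there is a homomorphism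 $\Gamma^+(\mathcal P)\to\Gamma^+(\mathcal Q)$ sending distinguished generators to distinguished generators. A chiral polyhedron of type $\{p,q\}$ is atomic if it is tight and covers no tight chiral polyhedron of type $\{p',q\}$ with $p'<p$ or $\{p,q'\}$ with $q'<q$. -}

module Defs where

open import Data.Nat using (ℕ; zero; suc; _*_)
open import Data.Integer using (ℤ; +_; -[1+_])
open import Data.Fin using (Fin; zero; suc)
open import Data.Bool using (Bool; true; false)
open import Data.Empty using (⊥)
open import Data.List using (List; []; _∷_; _++_; replicate)
open import Data.List.Membership.Propositional using (_∈_)
open import Data.Product using (Σ; ∃; _×_; _,_; proj₁; proj₂)
open import Data.Sum using (_⊎_; inj₁; inj₂)
open import Relation.Nullary using (¬_)
open import Relation.Binary.PropositionalEquality using (_≡_; _≢_; refl; sym; trans; cong; cong₂)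
open import Relation.Binary.Construct.Closure.ReflexiveTransitive using (Star)

Exactly : {A : Set} → ℕ → (A → Set) → Set
Exactly {A} n P =
  Σ (Fin n → A) λ f →
    (∀ i j → f i ≡ f j → i ≡ j) × (∀ i → P (f i)) × (∀ a → P a → ∃ λ i → f i ≡ a)

-- A ranked poset with ranks 0,1,2: vertices V, edges E, faces F and the
-- strict order relations between elements of different ranks
-- (Bool-valued, so that incidence is proof-irrelevant).

record Pre : Set₁ where
  field
    V E F : Set
    ive : V → E → Bool
    ief : E → F → Bool
    ivf : V → F → Bool

module _ (P : Pre) where
  open Pre P

  _≤ve_ : V → E → Set
  v ≤ve e = ive v e ≡ true

  _≤ef_ : E → F → Set
  e ≤ef f = ief e f ≡ true

  _≤vf_ : V → F → Set
  v ≤vf f = ivf v f ≡ true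

  Elem : Set
  Elem = V ⊎ E ⊎ F

  Inc : Elem → Elem → Set
  Inc (inj₁ v) (inj₂ (inj₁ e)) = v ≤ve e
  Inc (inj₁ v) (inj₂ (inj₂ f)) = v ≤vf f
  Inc (inj₂ (inj₁ e)) (inj₁ v) = v ≤ve e
  Inc (inj₂ (inj₁ e)) (inj₂ (inj₂ f)) = e ≤ef f
  Inc (inj₂ (inj₂ f)) (inj₁ v) = v ≤vf f
  Inc (inj₂ (inj₂ f)) (inj₂ (inj₁ e)) = e ≤ef f
  Inc _ _ = ⊥

  InducedConnected : (Elem → Set) → Set
  InducedConnected S =
    ∀ (x y : Σ Elem S) → Star (λ a b → Inc (proj₁ a) (proj₁ b)) x y

  record IsPolyhedron : Set where
    field
      order-trans : ∀ v e f → v ≤ve e → e ≤ef f → v ≤vf f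
      edge-vertices : ∀ e → Exactly 2 (λ v → v ≤ve e)
      edge-faces : ∀ e → Exactly 2 (λ f → e ≤ef f)
      diamond : ∀ v f → v ≤vf f → Exactly 2 (λ e → v ≤ve e × e ≤ef f)
      connected : ∀ (x y : Elem) → Star Inc x y
      vertex-conn : ∀ v → InducedConnected (Inc (inj₁ v))
      face-conn : ∀ f → InducedConnected (Inc (inj₂ (inj₂ f)))

record Polyhedron : Set₁ where
  field
    pre : Pre
    isPolyhedron : IsPolyhedron pre
  open Pre pre public

module _ (P : Polyhedron) where
  open Polyhedron P

  HasType : ℕ → ℕ → Set
  HasType p q =
    (∀ f → Exactly p (λ e → _≤ef_ pre e f)) × (∀ v → Exactly q (λ e → _≤ve_ pre v e))

  record Flag : Set where
    constructor flag
    field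
      fv : V
      fe : E
      ff : F
      pve : _≤ve_ pre fv fe
      pef : _≤ef_ pre fe ff
      pvf : _≤vf_ pre fv ff

  open Flag

  _≈F_ : Flag → Flag → Set
  Φ ≈F Ψ = fv Φ ≡ fv Ψ × fe Φ ≡ fe Ψ × ff Φ ≡ ff Ψ

  Adj : Fin 3 → Flag → Flag → Set
  Adj zero Φ Ψ = fv Φ ≢ fv Ψ × fe Φ ≡ fe Ψ × ff Φ ≡ ff Ψ
  Adj (suc zero) Φ Ψ = fv Φ ≡ fv Ψ × fe Φ ≢ fe Ψ × ff Φ ≡ ff Ψ
  Adj (suc (suc zero)) Φ Ψ = fv Φ ≡ fv Ψ × fe Φ ≡ fe Ψ × ff Φ ≢ ff Ψ

  Tight : ℕ → ℕ → Set
  Tight p q =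
    Σ (Fin (2 * p * q) → Flag) λ g →
      (∀ i j → g i ≈F g j → i ≡ j) × (∀ Φ → ∃ λ i → g i ≈F Φ)

  record Aut : Set where
    field
      toV fromV : V → V
      toE fromE : E → E
      toF fromF : F → F
      invlV : ∀ x → fromV (toV x) ≡ x
      invrV : ∀ x → toV (fromV x) ≡ x
      invlE : ∀ x → fromE (toE x) ≡ x
      invrE : ∀ x → toE (fromE x) ≡ x
      invlF : ∀ x → fromF (toF x) ≡ x
      invrF : ∀ x → toF (fromF x) ≡ x
      presVE : ∀ v e → ive (toV v) (toE e) ≡ ive v e
      presEF : ∀ e f → ief (toE e) (toF f) ≡ ief e f
      presVF : ∀ v f → ivf (toV v) (toF f) ≡ ivf v f
  open Aut

  _≈A_ : Aut → Aut → Set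
  a ≈A b = (∀ x → toV a x ≡ toV b x) × (∀ x → toE a x ≡ toE b x) × (∀ x → toF a x ≡ toF b x)

  idA : Aut
  idA = record
    { toV = λ x → x ; fromV = λ x → x ; toE = λ x → x ; fromE = λ x → x
    ; toF = λ x → x ; fromF = λ x → x
    ; invlV = λ _ → refl ; invrV = λ _ → refl ; invlE = λ _ → refl
    ; invrE = λ _ → refl ; invlF = λ _ → refl ; invrF = λ _ → refl
    ; presVE = λ _ _ → refl ; presEF = λ _ _ → refl ; presVF = λ _ _ → refl }

  _∘A_ : Aut → Aut → Aut
  a ∘A b = record
    { toV = λ x → toV a (toV b x) ; fromV = λ x → fromV b (fromV a x)
    ; toE = λ x → toE a (toE b x) ; fromE = λ x → fromE b (fromE a x)
    ; toF = λ x → toF a (toF b x) ; fromF = λ x → fromF b (fromF a x)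
    ; invlV = λ x → trans (cong (fromV b) (invlV a (toV b x))) (invlV b x)
    ; invrV = λ x → trans (cong (toV a) (invrV b (fromV a x))) (invrV a x)
    ; invlE = λ x → trans (cong (fromE b) (invlE a (toE b x))) (invlE b x)
    ; invrE = λ x → trans (cong (toE a) (invrE b (fromE a x))) (invrE a x)
    ; invlF = λ x → trans (cong (fromF b) (invlF a (toF b x))) (invlF b x)
    ; invrF = λ x → trans (cong (toF a) (invrF b (fromF a x))) (invrF a x)
    ; presVE = λ v e → trans (presVE a (toV b v) (toE b e)) (presVE b v e)
    ; presEF = λ e f → trans (presEF a (toE b e) (toF b f)) (presEF b e f)
    ; presVF = λ v f → trans (presVF a (toV b v) (toF b f)) (presVF b v f) }

  invA : Aut → Aut
  invA a = record
    { toV = fromV a ; fromV = toV a ; toE = fromE a ; fromE = toE a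
    ; toF = fromF a ; fromF = toF a
    ; invlV = invrV a ; invrV = invlV a ; invlE = invrE a
    ; invrE = invlE a ; invlF = invrF a ; invrF = invlF a
    ; presVE = λ v e → sym (trans (cong₂ ive (sym (invrV a v)) (sym (invrE a e)))
                                   (presVE a (fromV a v) (fromE a e)))
    ; presEF = λ e f → sym (trans (cong₂ ief (sym (invrE a e)) (sym (invrF a f)))
                                   (presEF a (fromE a e) (fromF a f)))
    ; presVF = λ v f → sym (trans (cong₂ ivf (sym (invrV a v)) (sym (invrF a f)))
                                   (presVF a (fromV a v) (fromF a f))) }

  act : Aut → Flag → Flag
  act a Φ = record
    { fv = toV a (fv Φ) ; fe = toE a (fe Φ) ; ff = toF a (ff Φ)
    ; pve = trans (presVE a (fv Φ) (fe Φ)) (pve Φ)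
    ; pef = trans (presEF a (fe Φ) (ff Φ)) (pef Φ)
    ; pvf = trans (presVF a (fv Φ) (ff Φ)) (pvf Φ) }

  Chiral : Set
  Chiral =
    Σ (Flag → Bool) λ c →
      (∀ i Φ Ψ → Adj i Φ Ψ → c Φ ≢ c Ψ) ×
      (∀ Φ Ψ → c Φ ≡ c Ψ → ∃ λ a → act a Φ ≈F Ψ) ×
      ¬ (∀ Φ Ψ → ∃ λ a → act a Φ ≈F Ψ)

  RotGens : Flag → Aut → Aut → Set
  RotGens Φ σ₁ σ₂ =
    (∃ λ Ψ → Adj (suc zero) Φ Ψ × Adj zero Ψ (act σ₁ Φ)) ×
    (∃ λ Ψ → Adj (suc (suc zero)) Φ Ψ × Adj (suc zero) Ψ (act σ₂ Φ))

data Gen : Set where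
  s₁ s₂ : Gen

data Letter : Set where
  ⁺ ⁻ : Gen → Letter

Word : Set
Word = List Letter

invL : Letter → Letter
invL (⁺ x) = ⁻ x
invL (⁻ x) = ⁺ x

pow : Gen → ℤ → Word
pow x (+ n) = replicate n (⁺ x)
pow x -[1+ n ] = replicate (suc n) (⁻ x)

data PresEq (R : List (Word × Word)) : Word → Word → Set where
  p-refl : ∀ w → PresEq R w w
  p-sym : ∀ {w w'} → PresEq R w w' → PresEq R w' w
  p-trans : ∀ {w w' w''} → PresEq R w w' → PresEq R w' w'' → PresEq R w w''
  p-free : ∀ u v x → PresEq R (u ++ x ∷ invL x ∷ v) (u ++ v)
  p-rel : ∀ u v l r → (l , r) ∈ R → PresEq R (u ++ l ++ v) (u ++ r ++ v)

ΓRel : ℕ → ℕ → ℤ → ℤ → ℤ → ℤ → List (Word × Word)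
ΓRel p q i₁ j₁ i₂ j₂ =
  (pow s₁ (+ p) , []) ∷
  (pow s₂ (+ q) , []) ∷
  (⁺ s₁ ∷ ⁺ s₂ ∷ ⁺ s₁ ∷ ⁺ s₂ ∷ [] , []) ∷
  (⁻ s₂ ∷ ⁺ s₁ ∷ [] , pow s₁ i₁ ++ pow s₂ j₁) ∷
  (⁺ s₂ ∷ ⁻ s₁ ∷ [] , pow s₁ i₂ ++ pow s₂ j₂) ∷ []

module _ (P : Polyhedron) where

  evalL : Aut P → Aut P → Letter → Aut P
  evalL σ₁ σ₂ (⁺ s₁) = σ₁
  evalL σ₁ σ₂ (⁺ s₂) = σ₂
  evalL σ₁ σ₂ (⁻ s₁) = invA P σ₁
  evalL σ₁ σ₂ (⁻ s₂) = invA P σ₂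

  evalW : Aut P → Aut P → Word → Aut P
  evalW σ₁ σ₂ [] = idA P
  evalW σ₁ σ₂ (x ∷ w) = _∘A_ P (evalL σ₁ σ₂ x) (evalW σ₁ σ₂ w)

  RotElt : Aut P → Aut P → Set
  RotElt σ₁ σ₂ = Σ (Aut P) λ a → ∃ λ w → _≈A_ P (evalW σ₁ σ₂ w) a

  -- Γ⁺(P) = ⟨s₁,s₂ | R⟩: the map sending s_i ↦ σ_i, [w] ↦ evalW w, is a
  -- well-defined injective homomorphism (it is onto ⟨σ₁,σ₂⟩ by definition)
  Presents : Aut P → Aut P → List (Word × Word) → Set
  Presents σ₁ σ₂ R =
    (∀ w w' → PresEq R w w' → _≈A_ P (evalW σ₁ σ₂ w) (evalW σ₁ σ₂ w')) ×
    (∀ w w' → _≈A_ P (evalW σ₁ σ₂ w) (evalW σ₁ σ₂ w') → PresEq R w w')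

Covers : (P : Polyhedron) → Aut P → Aut P → (Q : Polyhedron) → Aut Q → Aut Q → Set
Covers P σ₁ σ₂ Q τ₁ τ₂ =
  Σ (RotElt P σ₁ σ₂ → RotElt Q τ₁ τ₂) λ h →
    (∀ x y → _≈A_ P (proj₁ x) (proj₁ y) → _≈A_ Q (proj₁ (h x)) (proj₁ (h y))) ×
    (∀ x y z → _≈A_ P (proj₁ z) (_∘A_ P (proj₁ x) (proj₁ y)) →
               _≈A_ Q (proj₁ (h z)) (_∘A_ Q (proj₁ (h x)) (proj₁ (h y)))) ×
    (∀ x → _≈A_ P (proj₁ x) σ₁ → _≈A_ Q (proj₁ (h x)) τ₁) ×
    (∀ x → _≈A_ P (proj₁ x) σ₂ → _≈A_ Q (proj₁ (h x)) τ₂)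

CoversTightChiral : (P : Polyhedron) → Aut P → Aut P → ℕ → ℕ → Set₁
CoversTightChiral P σ₁ σ₂ p' q' =
  Σ Polyhedron λ Q → Σ (Flag Q) λ Ψ → Σ (Aut Q) λ τ₁ → Σ (Aut Q) λ τ₂ →
    RotGens Q Ψ τ₁ τ₂ × Chiral Q × HasType Q p' q' × Tight Q p' q' ×
    Covers P σ₁ σ₂ Q τ₁ τ₂

Atomic : (P : Polyhedron) → Aut P → Aut P → ℕ → ℕ → Set₁
Atomic P σ₁ σ₂ p q =
  Tight P p q ×
  (∀ p' → p' Data.Nat.< p → ¬ CoversTightChiral P σ₁ σ₂ p' q) ×
  (∀ q' → q' Data.Nat.< q → ¬ CoversTightChiral P σ₁ σ₂ p q')

sgn : Bool → ℤ
sgn true = + 1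
sgn false = -[1+ 0 ]

{-# OPTIONS --safe #-}

-- Write a = σ₁, b = σ₂, p = 2^α, q = 2^β, y = a^(p/2), z = b^(q/2).  Tightness and chirality say
-- that Γ = ⟨a⟩⟨b⟩ with ⟨a⟩ ∩ ⟨b⟩ = 1, (ab)² = 1, and that no automorphism inverts a and b.
-- Since p < q, two of the q elements b^i a lie in one left coset of ⟨b⟩, which makes z central.
-- Atomicity says that Γ/z is regular; if y were central then Γ/y would be regular as well and,
-- as ⟨y⟩ ∩ ⟨z⟩ = 1, so would Γ.
-- Write ab²a⁻¹ = b^n a^w.  Reduction modulo central involutions shows that n is even.  Conjugating
-- by (ab)² and comparing with the inverted relation modulo z, the odd power b^(n+1) commutes with
-- a^w up to z, so a^(2w) commutes with b and hence a^w ∈ {1, y}.  If a^w = 1, all relations are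
-- symmetric under inversion and Γ is regular.  Otherwise byb⁻¹ = yz, and computing a(a⁻¹b²a)a⁻¹
-- and ba^(p/2)b⁻¹ in two ways gives (n/2)² ≡ 1 + q/4 (mod q/2) and (p/4)(n+2) ≡ q/2 (mod q),
-- whose solutions are the two families.  Their relations rewrite every word into the form
-- b^j a^i, so they present Γ.

module Submission where

open import Defs
open import Data.Nat using (ℕ; suc; _≤_; _<_; _^_; _∸_)
open import Data.Integer using (ℤ; +_; -[1+_]; _+_; _*_)
open import Data.Bool using (Bool)
open import Data.Product using (Σ; _×_)
open import Data.Sum using (_⊎_)
open import Relation.Binary.PropositionalEquality using (_≡_)

open import Level using (0ℓ)
open import Algebra.Bundles using (Group)
open import Algebra.Structures using (IsGroup)
import Algebra.Construct.DirectProduct as DirectProduct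
open import Axiom.UniquenessOfIdentityProofs.WithK using (uip)
open import Data.Nat using (zero; z≤n; s≤s; NonZero; _<ᵇ_)
import Data.Nat as ℕ
import Data.Nat.Properties as ℕP
import Data.Nat.Divisibility as ℕD
open import Data.Integer using (+[1+_]; -_; _-_)
import Data.Integer as ℤ
import Data.Integer.Properties as ℤP
open import Data.Integer.DivMod using (_%ℕ_; _/ℕ_; n%ℕd<d; a≡a%ℕn+[a/ℕn]*n)
open import Data.Integer.Divisibility.Signed
  using (_∣_; divides; ∣⇒∣ᵤ; ∣m∣n⇒∣m+n; ∣m∣n⇒∣m-n; ∣m⇒∣-m; ∣-trans; ∣-refl; _∣?_)
open import Data.Integer.Tactic.RingSolver using (solve-∀)
open import Data.Bool using (true; false; not; _∨_)
import Data.Bool.Properties as BoolP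
open import Data.Empty using (⊥; ⊥-elim)
open import Data.Fin using (Fin; toℕ; fromℕ<; zero; suc; combine; remQuot)
import Data.Fin as Fin
import Data.Fin.Properties as FinP
open import Data.List using (List; []; _∷_; _++_)
import Data.List.Properties as ListP
open import Data.List.Membership.Propositional using (_∈_)
open import Data.List.Relation.Unary.Any using (here; there)
open import Data.Product using (∃; ∃₂; _,_; proj₁; proj₂)
open import Data.Sum using (inj₁; inj₂)
import Data.Sum as Sum
open import Data.Vec using (Vec; lookup)
import Relation.Binary.Reflection as Reflection
open import Relation.Binary.Construct.Closure.ReflexiveTransitive using (Star; _◅_; _◅◅_) renaming (ε to []ˢ)
open import Relation.Binary.PropositionalEquality as ≡ using (_≢_; refl; cong; cong₂; subst; subst₂; module ≡-Reasoning)
open import Relation.Nullary using (¬_; yes; no; Dec; does)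
open import Relation.Nullary.Decidable using (decidable-stable)

-- Parity and powers of two

-- Atomicity speaks of polyhedra, the argument of relations, and much of the work is in passing
-- between the two. To conclude that a quotient such as Γ/z is regular, a tight polyhedron with this
-- rotation group has to be built: its vertices, faces and edges are the left cosets of ⟨b⟩, ⟨a⟩ and
-- ⟨ba⟩, and it is chiral unless inverting both generators preserves all relations. Conversely, if
-- the inversion preserves all relations of Γ, it induces a reflection of the polyhedron on cosets,
-- which chirality forbids. Atomicity is moreover a negative statement. Equality in a tight group is
-- decidable through normal forms, and this turns the absence of a chiral quotient into regularity.
-- The pigeonhole argument yields a central involution only in the larger of the two cyclic factors.
-- Nothing similar makes y central, and the twist byb⁻¹ = yz is what remains of chirality once Γ/z
-- is regular. The elements of Γ are words and a quotient only coarsens equality, so that one word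
-- is read in Γ, in its quotients and in the presented group alike.

Even Odd : ℤ → Set
Even x = ∃ λ k → x ≡ + 2 * k
Odd x = ∃ λ k → x ≡ + 1 + + 2 * k

parity : ∀ x → Even x ⊎ Odd x
parity (+ n) = go n
  where
  go : ∀ n → Even (+ n) ⊎ Odd (+ n)
  go zero = inj₁ (+ 0 , refl)
  go (suc n) with go n
  ... | inj₁ (k , e) = inj₂ (k , cong (λ t → + 1 + t) e)
  ... | inj₂ (k , e) = inj₁ (+ 1 + k , ≡.trans (cong (λ t → + 1 + t) e) (lem k))
    where
    lem : ∀ k → + 1 + (+ 1 + + 2 * k) ≡ + 2 * (+ 1 + k)
    lem = solve-∀
parity -[1+ n ] = go n
  where
  go : ∀ n → Even -[1+ n ] ⊎ Odd -[1+ n ]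
  go zero = inj₂ (-[1+ 0 ] , refl)
  go (suc n) with go n
  ... | inj₁ (k , e) = inj₂ (-[1+ 0 ] + k , ≡.trans (cong (λ t → -[1+ 0 ] + t) e) (lem k))
    where
    lem : ∀ k → -[1+ 0 ] + + 2 * k ≡ + 1 + + 2 * (-[1+ 0 ] + k)
    lem = solve-∀
  ... | inj₂ (k , e) = inj₁ (k , ≡.trans (cong (λ t → -[1+ 0 ] + t) e) (lem k))
    where
    lem : ∀ k → -[1+ 0 ] + (+ 1 + + 2 * k) ≡ + 2 * k
    lem = solve-∀

2*-injective : ∀ x y → + 2 * x ≡ + 2 * y → x ≡ y
2*-injective x y = ℤP.*-cancelˡ-≡ (+ 2) x y

¬even1 : ¬ (Even (+ 1))
¬even1 (k , e) = ℕP.1+n≰n (ℕD.∣⇒≤ (∣⇒∣ᵤ {+ 2} {+ 1} (divides k (≡.trans e (ℤP.*-comm (+ 2) k)))))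

even∧odd⇒⊥ : ∀ {x} → Even x → ¬ Odd x
even∧odd⇒⊥ {x} (k , e) (l , f) = ¬even1 (k - l , lem₂ k l (≡.trans (≡.sym f) e))
  where
  lem₂ : ∀ k l → + 1 + + 2 * l ≡ + 2 * k → + 1 ≡ + 2 * (k - l)
  lem₂ k l h = ≡.trans (lem₀ l) (≡.trans (cong (λ t → t - + 2 * l) h) (lem₁ k l))
    where
    lem₀ : ∀ l → + 1 ≡ + 1 + + 2 * l - + 2 * l
    lem₀ = solve-∀
    lem₁ : ∀ k l → + 2 * k - + 2 * l ≡ + 2 * (k - l)
    lem₁ = solve-∀

odd*odd : ∀ {x y} → Odd x → Odd y → Odd (x * y)
odd*odd (k , refl) (l , refl) = k + l + + 2 * (k * l) , lem k l
  where
  lem : ∀ k l → (+ 1 + + 2 * k) * (+ 1 + + 2 * l) ≡ + 1 + + 2 * (k + l + + 2 * (k * l))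
  lem = solve-∀

2^ : ℕ → ℤ
2^ k = + (2 ^ k)

2^-suc : ∀ k → 2^ (suc k) ≡ + 2 * 2^ k
2^-suc k = ℤP.pos-* 2 (2 ^ k)

2^-nonZero : ∀ {k} → NonZero (2 ^ k)
2^-nonZero {k} = ℕP.m^n≢0 2 k

abstract
  -- Opaque on purpose: all later reasoning about classes modulo `p` goes through `residue-spec`.
  residue : ∀ p .{{_ : NonZero p}} → ℤ → Fin p
  residue p x = fromℕ< (n%ℕd<d x p)

  residue-spec : ∀ p .{{_ : NonZero p}} x → + p ∣ x - + toℕ (residue p x)
  residue-spec p x = divides (x /ℕ p) (begin
    x - + toℕ (residue p x) ≡⟨ cong (λ t → x - + t) (FinP.toℕ-fromℕ< (n%ℕd<d x p)) ⟩
    x - + (x %ℕ p) ≡⟨ cong (_- + (x %ℕ p)) (a≡a%ℕn+[a/ℕn]*n x p) ⟩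
    + (x %ℕ p) + x /ℕ p * + p - + (x %ℕ p) ≡⟨ lem (+ (x %ℕ p)) (x /ℕ p * + p) ⟩
    x /ℕ p * + p ∎)
    where
    open ≡-Reasoning
    lem : ∀ r t → r + t - r ≡ t
    lem = solve-∀

∣-resp : ∀ {k x y} → x ≡ y → k ∣ x → k ∣ y
∣-resp refl d = d

∣-flip : ∀ {k} x y → k ∣ x - y → k ∣ y - x
∣-flip {k} x y d = ∣-resp (lem x y) (∣m⇒∣-m d)
  where
  lem : ∀ x y → - (x - y) ≡ y - x
  lem = solve-∀

∣-chain : ∀ {k} x y w → k ∣ x - y → k ∣ y - w → k ∣ x - w
∣-chain x y w d e = ∣-resp (lem x y w) (∣m∣n⇒∣m+n d e)
  where
  lem : ∀ x y w → x - y + (y - w) ≡ x - w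
  lem = solve-∀

-- Two numbers below `p` are less than `p` apart, so 0 is the only multiple of `p` their difference
-- can be.
∣-small : ∀ p (i j : Fin p) → + p ∣ + toℕ i - + toℕ j → i ≡ j
∣-small p i j d = FinP.toℕ-injective (ℤP.+-injective (ℤP.i-j≡0⇒i≡j _ _ (ℤP.∣i∣≡0⇒i≡0 zero-dist)))
  where
  m = toℕ i
  n = toℕ j
  small : ∀ m n → m < p → n < p → ℤ.∣ + m - + n ∣ < p
  small m n m<p n<p with ℕP.≤-total m n
  ... | inj₁ m≤n rewrite ℤP.[+m]-[+n]≡m⊖n m n | ℤP.⊖-≤ m≤n | ℤP.∣-i∣≡∣i∣ (+ (n ℕ.∸ m)) =
    ℕP.≤-<-trans (ℕP.m∸n≤m n m) n<p
  ... | inj₂ n≤m rewrite ℤP.[+m]-[+n]≡m⊖n m n | ℤP.⊖-≥ n≤m = ℕP.≤-<-trans (ℕP.m∸n≤m m n) m<p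
  zero-dist : ℤ.∣ + m - + n ∣ ≡ 0
  zero-dist with ℤ.∣ + m - + n ∣ | small m n (FinP.toℕ<n i) (FinP.toℕ<n j) | ∣⇒∣ᵤ d
  ... | zero | _ | _ = refl
  ... | suc t | t<p | p∣ = ⊥-elim (ℕP.<⇒≱ t<p (ℕD.∣⇒≤ p∣))

residue-≡⇒∣ : ∀ p .{{_ : NonZero p}} x y → residue p x ≡ residue p y → + p ∣ x - y
residue-≡⇒∣ p x y e = ∣-chain x (+ toℕ (residue p x)) y (residue-spec p x)
  (∣-flip y (+ toℕ (residue p x)) (subst (λ r → + p ∣ y - + toℕ r) (≡.sym e) (residue-spec p y)))

∣⇒residue-≡ : ∀ p .{{_ : NonZero p}} x y → + p ∣ x - y → residue p x ≡ residue p y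
∣⇒residue-≡ p x y d = ∣-small p _ _ (∣-chain (+ toℕ (residue p x)) x (+ toℕ (residue p y))
  (∣-flip x (+ toℕ (residue p x)) (residue-spec p x)) (∣-chain x y (+ toℕ (residue p y)) d (residue-spec p y)))

residue-toℕ : ∀ p .{{_ : NonZero p}} (i : Fin p) → residue p (+ toℕ i) ≡ i
residue-toℕ p i = ∣-small p _ _ (∣-flip (+ toℕ i) (+ toℕ (residue p (+ toℕ i))) (residue-spec p (+ toℕ i)))

-- Every nontrivial subgroup of a cyclic 2-group contains the involution.
reach-half : ∀ k x → ¬ (2^ (suc k) ∣ x) → ∃₂ λ m m′ → m * x ≡ 2^ k + m′ * 2^ (suc k)
reach-half k x ¬d with parity x
reach-half k x ¬d | inj₂ (j , refl) = 2^ k , j , ≡.trans (lem (2^ k) j) (cong (λ t → 2^ k + j * t) (≡.sym (2^-suc k)))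
  where
  lem : ∀ s j → s * (+ 1 + + 2 * j) ≡ s + j * (+ 2 * s)
  lem = solve-∀
reach-half zero x ¬d | inj₁ (j , refl) = ⊥-elim (¬d (divides j (ℤP.*-comm (+ 2) j)))
reach-half (suc k) x ¬d | inj₁ (j , refl) with reach-half k j ¬d′
  where
  ¬d′ : ¬ (2^ (suc k) ∣ j)
  ¬d′ (divides c refl) = ¬d (divides c (≡.trans (lem c (2^ (suc k))) (cong (c *_) (≡.sym (2^-suc (suc k))))))
    where
    lem : ∀ c s → + 2 * (c * s) ≡ c * (+ 2 * s)
    lem = solve-∀
... | m , m′ , e = m , m′ , (begin
  m * (+ 2 * j) ≡⟨ lem₁ m j ⟩
  + 2 * (m * j) ≡⟨ cong (+ 2 *_) e ⟩
  + 2 * (2^ k + m′ * 2^ (suc k)) ≡⟨ lem₂ (2^ k) m′ (2^ (suc k)) ⟩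
  + 2 * 2^ k + m′ * (+ 2 * 2^ (suc k)) ≡⟨ cong₂ (λ s t → s + m′ * t) (2^-suc k) (2^-suc (suc k)) ⟨
  2^ (suc k) + m′ * 2^ (suc (suc k)) ∎)
  where
  open ≡-Reasoning
  lem₁ : ∀ m j → m * (+ 2 * j) ≡ + 2 * (m * j)
  lem₁ = solve-∀
  lem₂ : ∀ s m t → + 2 * (s + m * t) ≡ + 2 * s + m * (+ 2 * t)
  lem₂ = solve-∀

-- The inverse is lifted one binary digit at a time. If the quotient `m′` is odd, adding 2^k to `m`
-- repairs it: the new quotient is `m′` + x, a sum of two odd numbers.
odd-invertible : ∀ k {x} → Odd x → ∃₂ λ m m′ → m * x ≡ + 1 + m′ * 2^ k
odd-invertible zero {x} _ = + 1 , x - + 1 , lem x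
  where
  lem : ∀ x → + 1 * x ≡ + 1 + (x - + 1) * + 1
  lem = solve-∀
odd-invertible (suc k) {x} o@(j , refl) with odd-invertible k o
... | m , m′ , e with parity m′
... | inj₁ (c , refl) = m , c , ≡.trans e (≡.trans (lem c (2^ k)) (cong (λ t → + 1 + c * t) (≡.sym (2^-suc k))))
  where
  lem : ∀ c s → + 1 + + 2 * c * s ≡ + 1 + c * (+ 2 * s)
  lem = solve-∀
... | inj₂ (c , refl) = m + 2^ k , c + j + + 1 , (begin
  (m + 2^ k) * x ≡⟨ lem₁ m (2^ k) x ⟩
  m * x + 2^ k * x ≡⟨ cong (_+ 2^ k * x) e ⟩
  + 1 + (+ 1 + + 2 * c) * 2^ k + 2^ k * (+ 1 + + 2 * j) ≡⟨ lem₂ c j (2^ k) ⟩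
  + 1 + (c + j + + 1) * (+ 2 * 2^ k) ≡⟨ cong (λ t → + 1 + (c + j + + 1) * t) (2^-suc k) ⟨
  + 1 + (c + j + + 1) * 2^ (suc k) ∎)
  where
  open ≡-Reasoning
  lem₁ : ∀ m s x → (m + s) * x ≡ m * x + s * x
  lem₁ = solve-∀
  lem₂ : ∀ c j s → + 1 + (+ 1 + + 2 * c) * s + s * (+ 1 + + 2 * j) ≡ + 1 + (c + j + + 1) * (+ 2 * s)
  lem₂ = solve-∀

halve-∣ : ∀ k x → 2^ (suc k) ∣ + 2 * x → 2^ k ∣ x
halve-∣ k x (divides c e) = divides c (2*-injective x (c * 2^ k)
  (≡.trans e (≡.trans (cong (c *_) (2^-suc k)) (lem c (2^ k)))))
  where
  lem : ∀ c s → c * (+ 2 * s) ≡ + 2 * (c * s)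
  lem = solve-∀

-- Groups and integer powers

-- Decides the identities that hold in every group, by free reduction of both sides. Proofs below
-- alternate such regroupings with single uses of a hypothesis.
module GroupSolver (G : Group 0ℓ 0ℓ) where
  open Group G hiding (refl)
  open import Algebra.Properties.Group G
  open import Relation.Binary.Reasoning.Setoid setoid

  infixl 7 _⊙_
  infix 9 _ⁱ

  data Expr (n : ℕ) : Set where
    var : Fin n → Expr n
    one : Expr n
    _⊙_ : Expr n → Expr n → Expr n
    _ⁱ : Expr n → Expr n

  ⟦_⟧ : ∀ {n} → Expr n → Vec Carrier n → Carrier
  ⟦ var i ⟧ ρ = lookup ρ i
  ⟦ one ⟧ ρ = ε
  ⟦ e ⊙ f ⟧ ρ = ⟦ e ⟧ ρ ∙ ⟦ f ⟧ ρ
  ⟦ e ⁱ ⟧ ρ = ⟦ e ⟧ ρ ⁻¹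

  private
    Lit : ℕ → Set
    Lit n = Bool × Fin n

    evalLit : ∀ {n} → Lit n → Vec Carrier n → Carrier
    evalLit (true , i) ρ = lookup ρ i
    evalLit (false , i) ρ = lookup ρ i ⁻¹

    evalLits : ∀ {n} → List (Lit n) → Vec Carrier n → Carrier
    evalLits [] ρ = ε
    evalLits (l ∷ w) ρ = evalLit l ρ ∙ evalLits w ρ

    push : ∀ {n} → Lit n → List (Lit n) → List (Lit n)
    push l [] = l ∷ []
    push (s , i) ((s′ , j) ∷ w) with i FinP.≟ j | s BoolP.≟ not s′
    ... | yes _ | yes _ = w
    ... | _ | _ = (s , i) ∷ (s′ , j) ∷ w

    push-sound : ∀ {n} (l : Lit n) w ρ → evalLits (push l w) ρ ≈ evalLit l ρ ∙ evalLits w ρ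
    push-sound l [] ρ = Group.refl G
    push-sound (s , i) ((s′ , j) ∷ w) ρ with i FinP.≟ j | s BoolP.≟ not s′
    push-sound (s , i) ((true , i) ∷ w) ρ | yes refl | yes refl = sym (\\-leftDividesʳ _ _)
    push-sound (s , i) ((false , i) ∷ w) ρ | yes refl | yes refl = sym (\\-leftDividesˡ _ _)
    ... | yes _ | no _ = Group.refl G
    ... | no _ | yes _ = Group.refl G
    ... | no _ | no _ = Group.refl G

    -- [norm s e w] is the reduced word of e^{±1} w.
    norm : ∀ {n} → Bool → Expr n → List (Lit n) → List (Lit n)
    norm s (var i) w = push (s , i) w
    norm s one w = w
    norm true (e ⊙ f) w = norm true e (norm true f w)
    norm false (e ⊙ f) w = norm false f (norm false e w)
    norm s (e ⁱ) w = norm (not s) e w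

    signed : ∀ {n} → Bool → Expr n → Vec Carrier n → Carrier
    signed true e ρ = ⟦ e ⟧ ρ
    signed false e ρ = ⟦ e ⟧ ρ ⁻¹

    norm-sound : ∀ {n} s (e : Expr n) w ρ → evalLits (norm s e w) ρ ≈ signed s e ρ ∙ evalLits w ρ
    norm-sound true (var i) w ρ = push-sound (true , i) w ρ
    norm-sound false (var i) w ρ = push-sound (false , i) w ρ
    norm-sound true one w ρ = sym (identityˡ _)
    norm-sound false one w ρ = sym (trans (∙-congʳ ε⁻¹≈ε) (identityˡ _))
    norm-sound true (e ⊙ f) w ρ = begin
      evalLits (norm true e (norm true f w)) ρ ≈⟨ norm-sound true e _ ρ ⟩
      ⟦ e ⟧ ρ ∙ evalLits (norm true f w) ρ ≈⟨ ∙-congˡ (norm-sound true f w ρ) ⟩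
      ⟦ e ⟧ ρ ∙ (⟦ f ⟧ ρ ∙ evalLits w ρ) ≈⟨ assoc _ _ _ ⟨
      ⟦ e ⟧ ρ ∙ ⟦ f ⟧ ρ ∙ evalLits w ρ ∎
    norm-sound false (e ⊙ f) w ρ = begin
      evalLits (norm false f (norm false e w)) ρ ≈⟨ norm-sound false f _ ρ ⟩
      ⟦ f ⟧ ρ ⁻¹ ∙ evalLits (norm false e w) ρ ≈⟨ ∙-congˡ (norm-sound false e w ρ) ⟩
      ⟦ f ⟧ ρ ⁻¹ ∙ (⟦ e ⟧ ρ ⁻¹ ∙ evalLits w ρ) ≈⟨ assoc _ _ _ ⟨
      ⟦ f ⟧ ρ ⁻¹ ∙ ⟦ e ⟧ ρ ⁻¹ ∙ evalLits w ρ ≈⟨ ∙-congʳ (⁻¹-anti-homo-∙ _ _) ⟨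
      (⟦ e ⟧ ρ ∙ ⟦ f ⟧ ρ) ⁻¹ ∙ evalLits w ρ ∎
    norm-sound true (e ⁱ) w ρ = norm-sound false e w ρ
    norm-sound false (e ⁱ) w ρ = trans (norm-sound true e w ρ) (∙-congʳ (sym (⁻¹-involutive _)))

    ⟦_⇓⟧ : ∀ {n} → Expr n → Vec Carrier n → Carrier
    ⟦ e ⇓⟧ = evalLits (norm true e [])

    correct : ∀ {n} (e : Expr n) ρ → ⟦ e ⇓⟧ ρ ≈ ⟦ e ⟧ ρ
    correct e ρ = trans (norm-sound true e [] ρ) (identityʳ _)

  open Reflection setoid var ⟦_⟧ ⟦_⇓⟧ correct public using (solve; _⊜_)

-- Both steps are written as sums that compute to constructor form, so the clauses need no
-- transport.
ℤ-ind : (P : ℤ → Set) → P (+ 0) → (∀ k → P k → P (+ 1 + k)) → (∀ k → P k → P (-[1+ 0 ] + k)) →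
  ∀ k → P k
ℤ-ind P z s d (+ zero) = z
ℤ-ind P z s d +[1+ n ] = s (+ n) (ℤ-ind P z s d (+ n))
ℤ-ind P z s d -[1+ zero ] = d (+ 0) z
ℤ-ind P z s d -[1+ suc n ] = d -[1+ n ] (ℤ-ind P z s d -[1+ n ])

-- Defined from the bare operations, so that a group and its quotients (which differ only in
-- their equality) share the same powers.
zpow : {A : Set} → (A → A → A) → A → (A → A) → A → ℤ → A
zpow _∙_ ε _⁻¹ x (+ zero) = ε
zpow _∙_ ε _⁻¹ x +[1+ n ] = x ∙ zpow _∙_ ε _⁻¹ x (+ n)
zpow _∙_ ε _⁻¹ x -[1+ zero ] = x ⁻¹
zpow _∙_ ε _⁻¹ x -[1+ suc n ] = (x ⁻¹) ∙ zpow _∙_ ε _⁻¹ x -[1+ n ]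

module Powers (G : Group 0ℓ 0ℓ) where
  open Group G hiding (refl; _-_)
  open import Algebra.Properties.Group G
  open import Relation.Binary.Reasoning.Setoid setoid
  open GroupSolver G

  infixr 8 _↑_
  _↑_ : Carrier → ℤ → Carrier
  _↑_ = zpow _∙_ ε _⁻¹

  ↑-suc : ∀ x k → x ↑ (+ 1 + k) ≈ x ∙ x ↑ k
  ↑-suc x (+ n) = Group.refl G
  ↑-suc x -[1+ zero ] = sym (inverseʳ x)
  ↑-suc x -[1+ suc n ] = sym (\\-leftDividesˡ _ _)

  ↑-pred : ∀ x k → x ↑ (-[1+ 0 ] + k) ≈ x ⁻¹ ∙ x ↑ k
  ↑-pred x (+ zero) = sym (identityʳ _)
  ↑-pred x +[1+ n ] = sym (\\-leftDividesʳ _ _)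
  ↑-pred x -[1+ n ] = Group.refl G

  ↑-cong : ∀ {x y} k → x ≈ y → x ↑ k ≈ y ↑ k
  ↑-cong (+ zero) e = Group.refl G
  ↑-cong +[1+ n ] e = ∙-cong e (↑-cong (+ n) e)
  ↑-cong -[1+ zero ] e = ⁻¹-cong e
  ↑-cong -[1+ suc n ] e = ∙-cong (⁻¹-cong e) (↑-cong -[1+ n ] e)

  ↑-≡ : ∀ x {j k} → j ≡ k → x ↑ j ≈ x ↑ k
  ↑-≡ x refl = Group.refl G

  ↑-+ : ∀ x j k → x ↑ (j + k) ≈ x ↑ j ∙ x ↑ k
  ↑-+ x j k = ℤ-ind (λ j → x ↑ (j + k) ≈ x ↑ j ∙ x ↑ k) base up down j
    where
    base : x ↑ (+ 0 + k) ≈ ε ∙ x ↑ k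
    base = trans (↑-≡ x (ℤP.+-identityˡ k)) (sym (identityˡ _))
    up : ∀ j → x ↑ (j + k) ≈ x ↑ j ∙ x ↑ k → x ↑ (+ 1 + j + k) ≈ x ↑ (+ 1 + j) ∙ x ↑ k
    up j ih = begin
      x ↑ (+ 1 + j + k) ≈⟨ ↑-≡ x (ℤP.+-assoc (+ 1) j k) ⟩
      x ↑ (+ 1 + (j + k)) ≈⟨ ↑-suc x (j + k) ⟩
      x ∙ x ↑ (j + k) ≈⟨ ∙-congˡ ih ⟩
      x ∙ (x ↑ j ∙ x ↑ k) ≈⟨ assoc _ _ _ ⟨
      x ∙ x ↑ j ∙ x ↑ k ≈⟨ ∙-congʳ (↑-suc x j) ⟨
      x ↑ (+ 1 + j) ∙ x ↑ k ∎
    down : ∀ j → x ↑ (j + k) ≈ x ↑ j ∙ x ↑ k →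
      x ↑ (-[1+ 0 ] + j + k) ≈ x ↑ (-[1+ 0 ] + j) ∙ x ↑ k
    down j ih = begin
      x ↑ (-[1+ 0 ] + j + k) ≈⟨ ↑-≡ x (ℤP.+-assoc -[1+ 0 ] j k) ⟩
      x ↑ (-[1+ 0 ] + (j + k)) ≈⟨ ↑-pred x (j + k) ⟩
      x ⁻¹ ∙ x ↑ (j + k) ≈⟨ ∙-congˡ ih ⟩
      x ⁻¹ ∙ (x ↑ j ∙ x ↑ k) ≈⟨ assoc _ _ _ ⟨
      x ⁻¹ ∙ x ↑ j ∙ x ↑ k ≈⟨ ∙-congʳ (↑-pred x j) ⟨
      x ↑ (-[1+ 0 ] + j) ∙ x ↑ k ∎

  ↑-neg : ∀ x k → x ↑ (- k) ≈ (x ↑ k) ⁻¹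
  ↑-neg x k = inverseˡ-unique _ _ (begin
    x ↑ (- k) ∙ x ↑ k ≈⟨ ↑-+ x (- k) k ⟨
    x ↑ (- k + k) ≈⟨ ↑-≡ x (ℤP.+-inverseˡ k) ⟩
    ε ∎)

  ↑-1 : ∀ x → x ↑ + 1 ≈ x
  ↑-1 x = identityʳ x

  ε↑ : ∀ k → ε ↑ k ≈ ε
  ε↑ = ℤ-ind (λ k → ε ↑ k ≈ ε) (Group.refl G)
    (λ k ih → trans (↑-suc ε k) (trans (identityˡ _) ih))
    (λ k ih → trans (↑-pred ε k) (trans (∙-congʳ ε⁻¹≈ε) (trans (identityˡ _) ih)))

  ↑-* : ∀ x j k → x ↑ (j * k) ≈ (x ↑ k) ↑ j
  ↑-* x j k = ℤ-ind (λ j → x ↑ (j * k) ≈ (x ↑ k) ↑ j) (Group.refl G)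
    (λ j ih → begin
      x ↑ ((+ 1 + j) * k) ≈⟨ ↑-≡ x (≡.trans (ℤP.*-distribʳ-+ k (+ 1) j) (cong (_+ j * k) (ℤP.*-identityˡ k))) ⟩
      x ↑ (k + j * k) ≈⟨ ↑-+ x k (j * k) ⟩
      x ↑ k ∙ x ↑ (j * k) ≈⟨ ∙-congˡ ih ⟩
      x ↑ k ∙ (x ↑ k) ↑ j ≈⟨ ↑-suc _ j ⟨
      (x ↑ k) ↑ (+ 1 + j) ∎)
    (λ j ih → begin
      x ↑ ((-[1+ 0 ] + j) * k) ≈⟨ ↑-≡ x (≡.trans (ℤP.*-distribʳ-+ k -[1+ 0 ] j) (cong (_+ j * k) (ℤP.-1*i≡-i k))) ⟩
      x ↑ (- k + j * k) ≈⟨ ↑-+ x (- k) (j * k) ⟩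
      x ↑ (- k) ∙ x ↑ (j * k) ≈⟨ ∙-cong (↑-neg x k) ih ⟩
      (x ↑ k) ⁻¹ ∙ (x ↑ k) ↑ j ≈⟨ ↑-pred _ j ⟨
      (x ↑ k) ↑ (-[1+ 0 ] + j) ∎) j

  ↑-∣ : ∀ {x n i} → x ↑ n ≈ ε → n ∣ i → x ↑ i ≈ ε
  ↑-∣ {x} {n} o (divides k refl) = trans (↑-* x k n) (trans (↑-cong k o) (ε↑ k))

  ↑-mod : ∀ x n i j → x ↑ n ≈ ε → n ∣ i - j → x ↑ i ≈ x ↑ j
  ↑-mod x n i j o d = begin
    x ↑ i ≈⟨ ↑-≡ x (shift i j) ⟩
    x ↑ (i - j + j) ≈⟨ ↑-+ x (i - j) j ⟩
    x ↑ (i - j) ∙ x ↑ j ≈⟨ ∙-congʳ (↑-∣ o d) ⟩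
    ε ∙ x ↑ j ≈⟨ identityˡ _ ⟩
    x ↑ j ∎
    where
    shift : ∀ i j → i ≡ i - j + j
    shift = solve-∀

  Commute : Carrier → Carrier → Set
  Commute x y = x ∙ y ≈ y ∙ x

  commute-ε : ∀ {x} → Commute x ε
  commute-ε = trans (identityʳ _) (sym (identityˡ _))

  commute-∙ : ∀ {x y z} → Commute x y → Commute x z → Commute x (y ∙ z)
  commute-∙ {x} {y} {z} xy xz = begin
    x ∙ (y ∙ z) ≈⟨ assoc _ _ _ ⟨
    x ∙ y ∙ z ≈⟨ ∙-congʳ xy ⟩
    y ∙ x ∙ z ≈⟨ assoc _ _ _ ⟩
    y ∙ (x ∙ z) ≈⟨ ∙-congˡ xz ⟩
    y ∙ (z ∙ x) ≈⟨ assoc _ _ _ ⟨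
    y ∙ z ∙ x ∎

  commute-⁻¹ : ∀ {x y} → Commute x y → Commute x (y ⁻¹)
  commute-⁻¹ {x} {y} xy = begin
    x ∙ y ⁻¹ ≈⟨ solve 2 (λ x y → x ⊙ y ⁱ ⊜ y ⁱ ⊙ (y ⊙ x) ⊙ y ⁱ) (Group.refl G) x y ⟩
    y ⁻¹ ∙ (y ∙ x) ∙ y ⁻¹ ≈⟨ ∙-congʳ (∙-congˡ xy) ⟨
    y ⁻¹ ∙ (x ∙ y) ∙ y ⁻¹ ≈⟨ solve 2 (λ x y → y ⁱ ⊙ (x ⊙ y) ⊙ y ⁱ ⊜ y ⁱ ⊙ x) (Group.refl G) x y ⟩
    y ⁻¹ ∙ x ∎

  commute-↑ : ∀ {x y} k → Commute x y → Commute x (y ↑ k)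
  commute-↑ (+ zero) c = commute-ε
  commute-↑ +[1+ n ] c = commute-∙ c (commute-↑ (+ n) c)
  commute-↑ -[1+ zero ] c = commute-⁻¹ c
  commute-↑ -[1+ suc n ] c = commute-∙ (commute-⁻¹ c) (commute-↑ -[1+ n ] c)

  commute-cong : ∀ {x x′ y y′} → x ≈ x′ → y ≈ y′ → Commute x y → Commute x′ y′
  commute-cong ex ey c = trans (∙-cong (sym ex) (sym ey)) (trans c (∙-cong ey ex))

  powers-commute : ∀ x j k → Commute (x ↑ j) (x ↑ k)
  powers-commute x j k = commute-↑ k (sym (commute-↑ j (Group.refl G)))

  ∙-↑ : ∀ {x y} k → Commute x y → (x ∙ y) ↑ k ≈ x ↑ k ∙ y ↑ k
  ∙-↑ {x} {y} k c = ℤ-ind (λ k → (x ∙ y) ↑ k ≈ x ↑ k ∙ y ↑ k) (sym (identityˡ _))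
    (λ k ih → begin
      (x ∙ y) ↑ (+ 1 + k) ≈⟨ ↑-suc _ k ⟩
      x ∙ y ∙ (x ∙ y) ↑ k ≈⟨ ∙-congˡ ih ⟩
      x ∙ y ∙ (x ↑ k ∙ y ↑ k) ≈⟨ interchange x y (x ↑ k) (y ↑ k) (commute-↑ k (sym c)) ⟩
      x ∙ x ↑ k ∙ (y ∙ y ↑ k) ≈⟨ ∙-cong (↑-suc x k) (↑-suc y k) ⟨
      x ↑ (+ 1 + k) ∙ y ↑ (+ 1 + k) ∎)
    (λ k ih → begin
      (x ∙ y) ↑ (-[1+ 0 ] + k) ≈⟨ ↑-pred _ k ⟩
      (x ∙ y) ⁻¹ ∙ (x ∙ y) ↑ k ≈⟨ ∙-cong (⁻¹-cong c) ih ⟩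
      (y ∙ x) ⁻¹ ∙ (x ↑ k ∙ y ↑ k) ≈⟨ ∙-congʳ (⁻¹-anti-homo-∙ y x) ⟩
      x ⁻¹ ∙ y ⁻¹ ∙ (x ↑ k ∙ y ↑ k)
        ≈⟨ interchange (x ⁻¹) (y ⁻¹) (x ↑ k) (y ↑ k) (sym (commute-⁻¹ (sym (commute-↑ k (sym c))))) ⟩
      x ⁻¹ ∙ x ↑ k ∙ (y ⁻¹ ∙ y ↑ k) ≈⟨ ∙-cong (↑-pred x k) (↑-pred y k) ⟨
      x ↑ (-[1+ 0 ] + k) ∙ y ↑ (-[1+ 0 ] + k) ∎) k
    where
    interchange : ∀ s t u v → Commute t u → s ∙ t ∙ (u ∙ v) ≈ s ∙ u ∙ (t ∙ v)
    interchange s t u v tu = begin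
      s ∙ t ∙ (u ∙ v) ≈⟨ solve 4 (λ s t u v → s ⊙ t ⊙ (u ⊙ v) ⊜ s ⊙ (t ⊙ u) ⊙ v) (Group.refl G) s t u v ⟩
      s ∙ (t ∙ u) ∙ v ≈⟨ ∙-congʳ (∙-congˡ tu) ⟩
      s ∙ (u ∙ t) ∙ v ≈⟨ solve 4 (λ s t u v → s ⊙ (u ⊙ t) ⊙ v ⊜ s ⊙ u ⊙ (t ⊙ v)) (Group.refl G) s t u v ⟩
      s ∙ u ∙ (t ∙ v) ∎

  infixl 7.5 _^ᶜ_
  -- Conjugation as a left action: `(x ^ᶜ g) ^ᶜ h` is conjugation by `h ∙ g`.
  _^ᶜ_ : Carrier → Carrier → Carrier
  x ^ᶜ g = g ∙ x ∙ g ⁻¹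

  conj-cong : ∀ {x y} g → x ≈ y → x ^ᶜ g ≈ y ^ᶜ g
  conj-cong g e = ∙-congʳ (∙-congˡ e)

  conj-∙ : ∀ x y g → (x ∙ y) ^ᶜ g ≈ x ^ᶜ g ∙ y ^ᶜ g
  conj-∙ x y g = solve 3 (λ x y g → g ⊙ (x ⊙ y) ⊙ g ⁱ ⊜ (g ⊙ x ⊙ g ⁱ) ⊙ (g ⊙ y ⊙ g ⁱ)) (Group.refl G) x y g

  conj-⁻¹ : ∀ x g → (x ⁻¹) ^ᶜ g ≈ (x ^ᶜ g) ⁻¹
  conj-⁻¹ x g = solve 2 (λ x g → g ⊙ x ⁱ ⊙ g ⁱ ⊜ (g ⊙ x ⊙ g ⁱ) ⁱ) (Group.refl G) x g

  conj-ε : ∀ g → ε ^ᶜ g ≈ ε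
  conj-ε g = solve 1 (λ g → g ⊙ one ⊙ g ⁱ ⊜ one) (Group.refl G) g

  conj-↑ : ∀ x k g → (x ↑ k) ^ᶜ g ≈ (x ^ᶜ g) ↑ k
  conj-↑ x (+ zero) g = conj-ε g
  conj-↑ x +[1+ n ] g = trans (conj-∙ x (x ↑ + n) g) (∙-congˡ (conj-↑ x (+ n) g))
  conj-↑ x -[1+ zero ] g = conj-⁻¹ x g
  conj-↑ x -[1+ suc n ] g = trans (conj-∙ (x ⁻¹) (x ↑ -[1+ n ]) g) (∙-cong (conj-⁻¹ x g) (conj-↑ x -[1+ n ] g))

  commute⇒conj : ∀ {x g} → Commute g x → x ^ᶜ g ≈ x
  commute⇒conj {x} {g} c = trans (∙-congʳ c) (//-rightDividesʳ g x)

  conj⇒commute : ∀ {x g} → x ^ᶜ g ≈ x → Commute g x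
  conj⇒commute {x} {g} e = trans (sym (//-rightDividesˡ g (g ∙ x))) (∙-congʳ e)

  involution-swap : ∀ x y → x ∙ y ∙ (x ∙ y) ≈ ε → y ∙ x ∙ (y ∙ x) ≈ ε
  involution-swap x y r = begin
    y ∙ x ∙ (y ∙ x) ≈⟨ solve 2 (λ x y → y ⊙ x ⊙ (y ⊙ x) ⊜ x ⁱ ⊙ (x ⊙ y ⊙ (x ⊙ y)) ⊙ x) (Group.refl G) x y ⟩
    x ⁻¹ ∙ (x ∙ y ∙ (x ∙ y)) ∙ x ≈⟨ ∙-congʳ (∙-congˡ r) ⟩
    x ⁻¹ ∙ ε ∙ x ≈⟨ solve 1 (λ x → x ⁱ ⊙ one ⊙ x ⊜ one) (Group.refl G) x ⟩
    ε ∎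

  -- Separates the variables: an equation between two products from ⟨a⟩⟨b⟩ becomes one between an
  -- element of ⟨a⟩ and an element of ⟨b⟩.
  cross-quotient : ∀ s t s′ t′ → s ∙ t ≈ s′ ∙ t′ → s′ ⁻¹ ∙ s ≈ t′ ∙ t ⁻¹
  cross-quotient s t s′ t′ e = begin
    s′ ⁻¹ ∙ s ≈⟨ solve 3 (λ u v w → u ⁱ ⊙ v ⊜ u ⁱ ⊙ (v ⊙ w) ⊙ w ⁱ) (Group.refl G) s′ s t ⟩
    s′ ⁻¹ ∙ (s ∙ t) ∙ t ⁻¹ ≈⟨ ∙-congʳ (∙-congˡ e) ⟩
    s′ ⁻¹ ∙ (s′ ∙ t′) ∙ t ⁻¹ ≈⟨ solve 3 (λ u v w → u ⁱ ⊙ (u ⊙ v) ⊙ w ⁱ ⊜ v ⊙ w ⁱ) (Group.refl G) s′ t′ t ⟩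
    t′ ∙ t ⁻¹ ∎

  ⁻¹-↑ : ∀ x k → (x ⁻¹) ↑ k ≈ (x ↑ k) ⁻¹
  ⁻¹-↑ x k = trans (sym (↑-* x k -[1+ 0 ])) (trans (↑-≡ x (lem k)) (↑-neg x k))
    where
    lem : ∀ k → k * -[1+ 0 ] ≡ - k
    lem = solve-∀

  -- This settles p = 2, where y is a itself: if it commutes with b, then b² = 1.
  commuting-involution : ∀ x y → Commute x y → x ↑ + 2 ≈ ε → x ∙ y ∙ (x ∙ y) ≈ ε → y ↑ + 2 ≈ ε
  commuting-involution x y c x² r = begin
    y ↑ + 2 ≈⟨ identityˡ _ ⟨
    ε ∙ y ↑ + 2 ≈⟨ ∙-congʳ x² ⟨
    x ↑ + 2 ∙ y ↑ + 2 ≈⟨ ∙-↑ (+ 2) c ⟨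
    (x ∙ y) ↑ + 2 ≈⟨ ∙-congˡ (identityʳ _) ⟩
    x ∙ y ∙ (x ∙ y) ≈⟨ r ⟩
    ε ∎

-- Tight groups

-- Like `zpow`, built from the bare operations, so that evaluating a word in a group and in its
-- quotient gives the same element.
evalAt : {A : Set} → (A → A → A) → A → (A → A) → A → A → Word → A
evalAt _∙_ ε _⁻¹ a b [] = ε
evalAt _∙_ ε _⁻¹ a b (⁺ s₁ ∷ w) = a ∙ evalAt _∙_ ε _⁻¹ a b w
evalAt _∙_ ε _⁻¹ a b (⁺ s₂ ∷ w) = b ∙ evalAt _∙_ ε _⁻¹ a b w
evalAt _∙_ ε _⁻¹ a b (⁻ s₁ ∷ w) = (a ⁻¹) ∙ evalAt _∙_ ε _⁻¹ a b w
evalAt _∙_ ε _⁻¹ a b (⁻ s₂ ∷ w) = (b ⁻¹) ∙ evalAt _∙_ ε _⁻¹ a b w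

module Evaluation (G : Group 0ℓ 0ℓ) where
  open Group G hiding (refl; _-_)
  open Powers G
  open import Algebra.Properties.Group G

  eval : Carrier → Carrier → Word → Carrier
  eval = evalAt _∙_ ε _⁻¹

  gen : Carrier → Carrier → Gen → Carrier
  gen a b s₁ = a
  gen a b s₂ = b

  eval-++ : ∀ a b u v → eval a b (u ++ v) ≈ eval a b u ∙ eval a b v
  eval-++ a b [] v = sym (identityˡ _)
  eval-++ a b (⁺ s₁ ∷ u) v = trans (∙-congˡ (eval-++ a b u v)) (sym (assoc _ _ _))
  eval-++ a b (⁺ s₂ ∷ u) v = trans (∙-congˡ (eval-++ a b u v)) (sym (assoc _ _ _))
  eval-++ a b (⁻ s₁ ∷ u) v = trans (∙-congˡ (eval-++ a b u v)) (sym (assoc _ _ _))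
  eval-++ a b (⁻ s₂ ∷ u) v = trans (∙-congˡ (eval-++ a b u v)) (sym (assoc _ _ _))

  eval-cong : ∀ {a a′ b b′} → a ≈ a′ → b ≈ b′ → ∀ w → eval a b w ≈ eval a′ b′ w
  eval-cong ea eb [] = Group.refl G
  eval-cong ea eb (⁺ s₁ ∷ w) = ∙-cong ea (eval-cong ea eb w)
  eval-cong ea eb (⁺ s₂ ∷ w) = ∙-cong eb (eval-cong ea eb w)
  eval-cong ea eb (⁻ s₁ ∷ w) = ∙-cong (⁻¹-cong ea) (eval-cong ea eb w)
  eval-cong ea eb (⁻ s₂ ∷ w) = ∙-cong (⁻¹-cong eb) (eval-cong ea eb w)

  eval-pow : ∀ a b s k → eval a b (pow s k) ≈ gen a b s ↑ k
  eval-pow a b s₁ (+ zero) = Group.refl G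
  eval-pow a b s₁ +[1+ n ] = ∙-congˡ (eval-pow a b s₁ (+ n))
  eval-pow a b s₁ -[1+ zero ] = identityʳ _
  eval-pow a b s₁ -[1+ suc n ] = ∙-congˡ (eval-pow a b s₁ -[1+ n ])
  eval-pow a b s₂ (+ zero) = Group.refl G
  eval-pow a b s₂ +[1+ n ] = ∙-congˡ (eval-pow a b s₂ (+ n))
  eval-pow a b s₂ -[1+ zero ] = identityʳ _
  eval-pow a b s₂ -[1+ suc n ] = ∙-congˡ (eval-pow a b s₂ -[1+ n ])

  module _ {a b ψ : Carrier} (ha : ψ ∙ a ≈ a ⁻¹ ∙ ψ) (hb : ψ ∙ b ≈ b ⁻¹ ∙ ψ) where
    open GroupSolver G
    open import Relation.Binary.Reasoning.Setoid setoid

    private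
      invert : ∀ {x} → ψ ∙ x ≈ x ⁻¹ ∙ ψ → ψ ∙ x ⁻¹ ≈ x ⁻¹ ⁻¹ ∙ ψ
      invert {x} h = begin
        ψ ∙ x ⁻¹ ≈⟨ solve 2 (λ x ψ → ψ ⊙ x ⁱ ⊜ x ⊙ (x ⁱ ⊙ ψ) ⊙ x ⁱ) (Group.refl G) x ψ ⟩
        x ∙ (x ⁻¹ ∙ ψ) ∙ x ⁻¹ ≈⟨ ∙-congʳ (∙-congˡ h) ⟨
        x ∙ (ψ ∙ x) ∙ x ⁻¹ ≈⟨ solve 2 (λ x ψ → x ⊙ (ψ ⊙ x) ⊙ x ⁱ ⊜ x ⁱ ⁱ ⊙ ψ) (Group.refl G) x ψ ⟩
        x ⁻¹ ⁻¹ ∙ ψ ∎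

      pass : ∀ {x x′ u u′} → ψ ∙ x ≈ x′ ∙ ψ → ψ ∙ u ≈ u′ ∙ ψ → ψ ∙ (x ∙ u) ≈ x′ ∙ u′ ∙ ψ
      pass hx hu = trans (sym (assoc _ _ _)) (trans (∙-congʳ hx) (trans (assoc _ _ _) (trans (∙-congˡ hu) (sym (assoc _ _ _)))))

    eval-reflect : ∀ w → ψ ∙ eval a b w ≈ eval (a ⁻¹) (b ⁻¹) w ∙ ψ
    eval-reflect [] = trans (identityʳ ψ) (sym (identityˡ ψ))
    eval-reflect (⁺ s₁ ∷ w) = pass ha (eval-reflect w)
    eval-reflect (⁺ s₂ ∷ w) = pass hb (eval-reflect w)
    eval-reflect (⁻ s₁ ∷ w) = pass (invert ha) (eval-reflect w)
    eval-reflect (⁻ s₂ ∷ w) = pass (invert hb) (eval-reflect w)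

  -- Regularity of the polyhedron: inverting both generators preserves all relations.
  Regular : Carrier → Carrier → Set
  Regular a b = ∀ w → eval a b w ≈ ε → eval (a ⁻¹) (b ⁻¹) w ≈ ε

  -- Moving ψ past a word inverts each generator. For a relator this reads ψ = w̄ψ, where w̄ is the
  -- word in the inverted generators, hence w̄ = 1.
  reflection⇒regular : ∀ {a b} ψ → ψ ∙ a ≈ a ⁻¹ ∙ ψ → ψ ∙ b ≈ b ⁻¹ ∙ ψ → Regular a b
  reflection⇒regular ψ ha hb w e = identityˡ-unique _ ψ (trans (sym (eval-reflect ha hb w)) (trans (∙-congˡ e) (identityʳ ψ)))

eval-hom : (G H : Group 0ℓ 0ℓ) (f : Group.Carrier G → Group.Carrier H) →
  (∀ x y → Group._≈_ H (f (Group._∙_ G x y)) (Group._∙_ H (f x) (f y))) →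
  (∀ x → Group._≈_ H (f (Group._⁻¹ G x)) (Group._⁻¹ H (f x))) →
  Group._≈_ H (f (Group.ε G)) (Group.ε H) →
  ∀ a b w → Group._≈_ H (f (Evaluation.eval G a b w)) (Evaluation.eval H (f a) (f b) w)
eval-hom G H f f-∙ f-⁻¹ f-ε a b = go
  where
  open Group H
  go : ∀ w → f (Evaluation.eval G a b w) ≈ Evaluation.eval H (f a) (f b) w
  go [] = f-ε
  go (⁺ s₁ ∷ w) = trans (f-∙ _ _) (∙-congˡ (go w))
  go (⁺ s₂ ∷ w) = trans (f-∙ _ _) (∙-congˡ (go w))
  go (⁻ s₁ ∷ w) = trans (f-∙ _ _) (∙-cong (f-⁻¹ a) (go w))
  go (⁻ s₂ ∷ w) = trans (f-∙ _ _) (∙-cong (f-⁻¹ b) (go w))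

-- What matters is its parity, which `even-relators` shows to vanish on relators.
count₂ : Word → ℤ
count₂ [] = + 0
count₂ (⁺ s₁ ∷ w) = count₂ w
count₂ (⁻ s₁ ∷ w) = count₂ w
count₂ (⁺ s₂ ∷ w) = + 1 + count₂ w
count₂ (⁻ s₂ ∷ w) = -[1+ 0 ] + count₂ w

count₁ : Word → ℤ
count₁ [] = + 0
count₁ (⁺ s₂ ∷ w) = count₁ w
count₁ (⁻ s₂ ∷ w) = count₁ w
count₁ (⁺ s₁ ∷ w) = + 1 + count₁ w
count₁ (⁻ s₁ ∷ w) = -[1+ 0 ] + count₁ w

count₂-++ : ∀ u v → count₂ (u ++ v) ≡ count₂ u + count₂ v
count₂-++ [] v = ≡.sym (ℤP.+-identityˡ _)
count₂-++ (⁺ s₁ ∷ u) v = count₂-++ u v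
count₂-++ (⁻ s₁ ∷ u) v = count₂-++ u v
count₂-++ (⁺ s₂ ∷ u) v = ≡.trans (cong (λ t → + 1 + t) (count₂-++ u v)) (≡.sym (ℤP.+-assoc (+ 1) (count₂ u) (count₂ v)))
count₂-++ (⁻ s₂ ∷ u) v = ≡.trans (cong (λ t → -[1+ 0 ] + t) (count₂-++ u v)) (≡.sym (ℤP.+-assoc -[1+ 0 ] (count₂ u) (count₂ v)))

count₂-pow₁ : ∀ k → count₂ (pow s₁ k) ≡ + 0
count₂-pow₁ (+ zero) = refl
count₂-pow₁ +[1+ n ] = count₂-pow₁ (+ n)
count₂-pow₁ -[1+ zero ] = refl
count₂-pow₁ -[1+ suc n ] = count₂-pow₁ -[1+ n ]

count₂-pow₂ : ∀ k → count₂ (pow s₂ k) ≡ k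
count₂-pow₂ (+ zero) = refl
count₂-pow₂ +[1+ n ] = cong (λ t → + 1 + t) (count₂-pow₂ (+ n))
count₂-pow₂ -[1+ zero ] = refl
count₂-pow₂ -[1+ suc n ] = cong (λ t → -[1+ 0 ] + t) (count₂-pow₂ -[1+ n ])

-- G = ⟨a⟩⟨b⟩ with ⟨a⟩ of order p, ⟨b⟩ of order q, ⟨a⟩ ∩ ⟨b⟩ = 1 and (ab)² = 1.
record IsTight (G : Group 0ℓ 0ℓ) (a b : Group.Carrier G) (p q : ℕ) : Set where
  open Group G hiding (refl; _-_)
  open Powers G
  field
    rel : a ∙ b ∙ (a ∙ b) ≈ ε
    a-order : a ↑ + p ≈ ε
    b-order : b ↑ + q ≈ ε
    normalForm : ∀ g → ∃₂ λ x y → g ≈ a ↑ x ∙ b ↑ y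
    independent : ∀ x y → a ↑ x ≈ b ↑ y → + p ∣ x × + q ∣ y

module TightProps {G : Group 0ℓ 0ℓ} {a b : Group.Carrier G} {p q : ℕ} (T : IsTight G a b p q) where
  open Group G hiding (refl; _-_)
  open Powers G
  open GroupSolver G
  open Evaluation G
  open import Algebra.Properties.Group G
  open import Relation.Binary.Reasoning.Setoid setoid
  open IsTight T public

  a-∣ : ∀ {x} → + p ∣ x → a ↑ x ≈ ε
  a-∣ = ↑-∣ a-order

  b-∣ : ∀ {x} → + q ∣ x → b ↑ x ≈ ε
  b-∣ = ↑-∣ b-order

  ∣-b : ∀ {x} → b ↑ x ≈ ε → + q ∣ x
  ∣-b {x} e = proj₂ (independent (+ 0) x (sym e))

  a-cong : ∀ x x′ → + p ∣ x - x′ → a ↑ x ≈ a ↑ x′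
  a-cong x x′ = ↑-mod a (+ p) x x′ a-order

  b-cong : ∀ x x′ → + q ∣ x - x′ → b ↑ x ≈ b ↑ x′
  b-cong x x′ = ↑-mod b (+ q) x x′ b-order

  ↑-- : ∀ c x y → c ↑ (x - y) ≈ c ↑ x ∙ (c ↑ y) ⁻¹
  ↑-- c x y = trans (↑-+ c x (- y)) (∙-congˡ (↑-neg c y))

  normalForm-unique : ∀ x y x′ y′ → a ↑ x ∙ b ↑ y ≈ a ↑ x′ ∙ b ↑ y′ → + p ∣ x - x′ × + q ∣ y - y′
  normalForm-unique x y x′ y′ e with independent (x - x′) (y′ - y) (begin
      a ↑ (x - x′) ≈⟨ ↑-- a x x′ ⟩
      a ↑ x ∙ (a ↑ x′) ⁻¹ ≈⟨ powers-comm⁻¹ ⟩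
      (a ↑ x′) ⁻¹ ∙ a ↑ x ≈⟨ cross-quotient (a ↑ x) (b ↑ y) (a ↑ x′) (b ↑ y′) e ⟩
      b ↑ y′ ∙ (b ↑ y) ⁻¹ ≈⟨ ↑-- b y′ y ⟨
      b ↑ (y′ - y) ∎)
    where
    powers-comm⁻¹ : Commute (a ↑ x) ((a ↑ x′) ⁻¹)
    powers-comm⁻¹ = commute-⁻¹ (powers-commute a x x′)
  ... | d , d′ = d , ∣-flip y′ y d′

  normalForm′ : ∀ g → ∃₂ λ y x → g ≈ b ↑ y ∙ a ↑ x
  normalForm′ g with normalForm (g ⁻¹)
  ... | x , y , e = - y , - x , (begin
    g ≈⟨ ⁻¹-involutive g ⟨
    g ⁻¹ ⁻¹ ≈⟨ ⁻¹-cong e ⟩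
    (a ↑ x ∙ b ↑ y) ⁻¹ ≈⟨ ⁻¹-anti-homo-∙ _ _ ⟩
    (b ↑ y) ⁻¹ ∙ (a ↑ x) ⁻¹ ≈⟨ ∙-cong (↑-neg b y) (↑-neg a x) ⟨
    b ↑ (- y) ∙ a ↑ (- x) ∎)

  -- Decidability is what later allows regularity to be deduced from the mere absence of a chiral
  -- cover.
  _≈?_ : ∀ g h → Dec (g ≈ h)
  g ≈? h with normalForm (g ⁻¹ ∙ h)
  ... | x , y , e with + p ∣? x | + q ∣? y
  ... | yes d | yes d′ = yes (trans (sym (identityʳ g)) (trans (∙-congˡ (sym (trans e (trans (∙-cong (a-∣ d) (b-∣ d′)) (identityˡ ε))))) (\\-leftDividesˡ g h)))
  ... | no ¬d | _ = no λ g≈h → ¬d (subst (+ p ∣_) (ℤP.+-identityʳ x) (proj₁ (normalForm-unique x y (+ 0) (+ 0)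
      (trans (sym e) (trans (∙-congˡ (sym g≈h)) (trans (inverseˡ g) (sym (identityˡ ε))))))))
  ... | yes _ | no ¬d = no λ g≈h → ¬d (subst (+ q ∣_) (ℤP.+-identityʳ y) (proj₂ (normalForm-unique x y (+ 0) (+ 0)
      (trans (sym e) (trans (∙-congˡ (sym g≈h)) (trans (inverseˡ g) (sym (identityˡ ε))))))))

  rel′ : b ∙ a ∙ (b ∙ a) ≈ ε
  rel′ = involution-swap a b rel

  -- Duality of polyhedra. Through it each statement about b and b^(q/2) also serves a and a^(p/2).
  swap : IsTight G b a q p
  swap = record
    { rel = rel′
    ; a-order = b-order
    ; b-order = a-order
    ; normalForm = normalForm′
    ; independent = λ y x e → let (d , d′) = independent x y (sym e) in d′ , d
    }

module CentralInvolution {G : Group 0ℓ 0ℓ} {a b : Group.Carrier G} {p : ℕ} .{{_ : NonZero p}} (k : ℕ)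
    (T : IsTight G a b p (2 ^ suc k)) (p≤q : p ≤ 2 ^ suc k) where
  open Group G hiding (refl; _-_)
  open Powers G
  open GroupSolver G
  open TightProps T
  open import Algebra.Properties.Group G
  open import Relation.Binary.Reasoning.Setoid setoid

  private
    q : ℕ
    q = 2 ^ suc k

    aFixes : ∀ e → Set
    aFixes e = ∃ λ l → b ↑ e ^ᶜ (a ⁻¹) ≈ b ↑ l

    x y : Fin q → ℤ
    x i = proj₁ (normalForm (b ↑ + toℕ i ∙ a))
    y i = proj₁ (proj₂ (normalForm (b ↑ + toℕ i ∙ a)))

    translate : ∀ i → b ↑ + toℕ i ∙ a ≈ a ↑ x i ∙ b ↑ y i
    translate i = proj₂ (proj₂ (normalForm (b ↑ + toℕ i ∙ a)))

    -- The extra pigeon is the coset ⟨b⟩ itself. It secures a collision even for p = q, a case that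
    -- `even-relators` meets; a translate b^i a falling into ⟨b⟩ would put a into ⟨b⟩ and so make a
    -- trivial.
    coset : Fin (suc q) → Fin p
    coset zero = residue p (+ 0)
    coset (suc i) = residue p (x i)

    -- Two of the q translates b^i a lie in the same left coset of ⟨b⟩ (or a ∈ ⟨b⟩).
    collision : a ≈ ε ⊎ ∃ λ e → ¬ (+ q ∣ e) × aFixes e
    collision with FinP.pigeonhole (s≤s p≤q) coset
    ... | zero , suc j , _ , e = inj₁ (trans (sym (↑-1 a)) (a-∣ (proj₁ (independent (+ 1) (y j - + toℕ j) (begin
      a ↑ + 1 ≈⟨ ↑-1 a ⟩
      a ≈⟨ \\-leftDividesʳ (b ↑ + toℕ j) a ⟨
      (b ↑ + toℕ j) ⁻¹ ∙ (b ↑ + toℕ j ∙ a) ≈⟨ ∙-congˡ (translate j) ⟩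
      (b ↑ + toℕ j) ⁻¹ ∙ (a ↑ x j ∙ b ↑ y j) ≈⟨ ∙-congˡ (∙-congʳ (a-cong (x j) (+ 0) (∣-flip (+ 0) (x j) (residue-≡⇒∣ p (+ 0) (x j) e)))) ⟩
      (b ↑ + toℕ j) ⁻¹ ∙ (ε ∙ b ↑ y j) ≈⟨ ∙-congˡ (identityˡ _) ⟩
      (b ↑ + toℕ j) ⁻¹ ∙ b ↑ y j ≈⟨ sym (commute-⁻¹ (powers-commute b (y j) (+ toℕ j))) ⟩
      b ↑ y j ∙ (b ↑ + toℕ j) ⁻¹ ≈⟨ ↑-- b (y j) (+ toℕ j) ⟨
      b ↑ (y j - + toℕ j) ∎)))))
    ... | suc i , suc j , s≤s i<j , e = inj₂ (+ toℕ j - + toℕ i , ¬q∣ , y j - y i , (begin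
      a ⁻¹ ∙ b ↑ (+ toℕ j - + toℕ i) ∙ a ⁻¹ ⁻¹
        ≈⟨ ∙-congʳ (∙-congˡ (trans (↑-- b (+ toℕ j) (+ toℕ i)) (commute-⁻¹ (powers-commute b (+ toℕ j) (+ toℕ i))))) ⟩
      a ⁻¹ ∙ ((b ↑ + toℕ i) ⁻¹ ∙ b ↑ + toℕ j) ∙ a ⁻¹ ⁻¹
        ≈⟨ solve 3 (λ a u v → a ⁱ ⊙ (u ⁱ ⊙ v) ⊙ a ⁱ ⁱ ⊜ (u ⊙ a) ⁱ ⊙ (v ⊙ a)) (Group.refl G) a (b ↑ + toℕ i) (b ↑ + toℕ j) ⟩
      (b ↑ + toℕ i ∙ a) ⁻¹ ∙ (b ↑ + toℕ j ∙ a) ≈⟨ ∙-cong (⁻¹-cong (translate i)) (translate j) ⟩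
      (a ↑ x i ∙ b ↑ y i) ⁻¹ ∙ (a ↑ x j ∙ b ↑ y j)
        ≈⟨ ∙-congʳ (⁻¹-cong (∙-congʳ (a-cong (x i) (x j) (residue-≡⇒∣ p (x i) (x j) e)))) ⟩
      (a ↑ x j ∙ b ↑ y i) ⁻¹ ∙ (a ↑ x j ∙ b ↑ y j)
        ≈⟨ solve 3 (λ u v w → (u ⊙ v) ⁱ ⊙ (u ⊙ w) ⊜ v ⁱ ⊙ w) (Group.refl G) (a ↑ x j) (b ↑ y i) (b ↑ y j) ⟩
      (b ↑ y i) ⁻¹ ∙ b ↑ y j ≈⟨ sym (commute-⁻¹ (powers-commute b (y j) (y i))) ⟩
      b ↑ y j ∙ (b ↑ y i) ⁻¹ ≈⟨ ↑-- b (y j) (y i) ⟨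
      b ↑ (y j - y i) ∎))
      where
      ¬q∣ : ¬ (+ q ∣ + toℕ j - + toℕ i)
      ¬q∣ d = FinP.<⇒≢ i<j (≡.sym (∣-small q j i d))

    -- The exponents e with a⁻¹b^e a in ⟨b⟩ are closed under multiples, and a suitable multiple of
    -- the one from `collision` is q/2 modulo q.
    half-fixed : a ≈ ε ⊎ aFixes (2^ k)
    half-fixed with collision
    ... | inj₁ e = inj₁ e
    ... | inj₂ (e , ¬d , l , f) with reach-half k e ¬d
    ... | m , m′ , h = inj₂ (m * l , (begin
      b ↑ 2^ k ^ᶜ (a ⁻¹) ≈⟨ conj-cong (a ⁻¹) (b-cong (2^ k) (2^ k + m′ * 2^ (suc k)) (∣-flip (2^ k + m′ * 2^ (suc k)) (2^ k) (divides m′ (lem (2^ k) (m′ * 2^ (suc k)))))) ⟩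
      b ↑ (2^ k + m′ * 2^ (suc k)) ^ᶜ (a ⁻¹) ≈⟨ conj-cong (a ⁻¹) (trans (↑-≡ b (≡.sym h)) (↑-* b m e)) ⟩
      (b ↑ e) ↑ m ^ᶜ (a ⁻¹) ≈⟨ conj-↑ (b ↑ e) m (a ⁻¹) ⟩
      (b ↑ e ^ᶜ (a ⁻¹)) ↑ m ≈⟨ ↑-cong m f ⟩
      (b ↑ l) ↑ m ≈⟨ ↑-* b m l ⟨
      b ↑ (m * l) ∎))
      where
      lem : ∀ s t → s + t - s ≡ t
      lem = solve-∀

  private
    b-half-square : (b ↑ 2^ k) ↑ + 2 ≈ ε
    b-half-square = trans (sym (↑-* b (+ 2) (2^ k))) (trans (↑-≡ b (≡.sym (2^-suc k))) b-order)

    conj-half-∣ : ∀ l → b ↑ 2^ k ^ᶜ (a ⁻¹) ≈ b ↑ l → 2^ k ∣ l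
    conj-half-∣ l f = halve-∣ k l (∣-b (begin
      b ↑ (+ 2 * l) ≈⟨ ↑-* b (+ 2) l ⟩
      (b ↑ l) ↑ + 2 ≈⟨ ↑-cong (+ 2) f ⟨
      (b ↑ 2^ k ^ᶜ (a ⁻¹)) ↑ + 2 ≈⟨ conj-↑ (b ↑ 2^ k) (+ 2) (a ⁻¹) ⟨
      (b ↑ 2^ k) ↑ + 2 ^ᶜ (a ⁻¹) ≈⟨ conj-cong (a ⁻¹) b-half-square ⟩
      ε ^ᶜ (a ⁻¹) ≈⟨ conj-ε (a ⁻¹) ⟩
      ε ∎))

    -- An exponent divisible by q/2 leaves only 1 and b^(q/2) as the conjugate. If it is 1, the
    -- conjugated element is trivial itself; in both cases it commutes with a.
    conj-half⇒commute : ∀ l → 2^ k ∣ l → b ↑ 2^ k ^ᶜ (a ⁻¹) ≈ b ↑ l → Commute a (b ↑ 2^ k)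
    conj-half⇒commute l (divides c refl) f with parity c
    ... | inj₁ (c′ , refl) = commute-cong (Group.refl G) (sym trivial) commute-ε
      where
      lem : ∀ c s → + 2 * c * s ≡ c * (+ 2 * s)
      lem = solve-∀
      f′ : b ↑ 2^ k ^ᶜ (a ⁻¹) ≈ ε
      f′ = trans f (b-∣ (divides c′ (≡.trans (lem c′ (2^ k)) (cong (c′ *_) (≡.sym (2^-suc k))))))
      trivial : b ↑ 2^ k ≈ ε
      trivial = begin
        b ↑ 2^ k ≈⟨ solve 2 (λ a u → u ⊜ a ⊙ (a ⁱ ⊙ u ⊙ a ⁱ ⁱ) ⊙ a ⁱ) (Group.refl G) a (b ↑ 2^ k) ⟩
        a ∙ (b ↑ 2^ k ^ᶜ (a ⁻¹)) ∙ a ⁻¹ ≈⟨ conj-cong a f′ ⟩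
        ε ^ᶜ a ≈⟨ conj-ε a ⟩
        ε ∎
    ... | inj₂ (c′ , refl) = commute-cong (⁻¹-involutive a) (Group.refl G) (sym (commute-⁻¹ (sym (conj⇒commute f′))))
      where
      lem : ∀ c s → (+ 1 + + 2 * c) * s - s ≡ c * (+ 2 * s)
      lem = solve-∀
      f′ : b ↑ 2^ k ^ᶜ (a ⁻¹) ≈ b ↑ 2^ k
      f′ = trans f (b-cong ((+ 1 + + 2 * c′) * 2^ k) (2^ k) (divides c′ (≡.trans (lem c′ (2^ k)) (cong (c′ *_) (≡.sym (2^-suc k))))))

  b-half-commutes : Commute a (b ↑ 2^ k)
  b-half-commutes with half-fixed
  ... | inj₁ e = trans (∙-congʳ e) (trans (identityˡ _) (trans (sym (identityʳ _)) (∙-congˡ (sym e))))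
  ... | inj₂ (l , f) = conj-half⇒commute l (conj-half-∣ l f) f

-- Quotients by a central involution

module Quotient (G : Group 0ℓ 0ℓ) (z : Group.Carrier G)
    (central : ∀ g → Powers.Commute G z g) (square : Group._≈_ G (Group._∙_ G z z) (Group.ε G)) where
  open Group G hiding (refl; _-_)
  open import Algebra.Properties.Group G
  open GroupSolver G
  open import Relation.Binary.Reasoning.Setoid setoid

  infix 4 _≈z_
  -- Equality modulo {1, z} as an explicit alternative: a relation of the quotient is read as a
  -- relation of `G` up to a factor z by case distinction.
  _≈z_ : Carrier → Carrier → Set
  g ≈z h = g ≈ h ⊎ g ≈ z ∙ h

  private
    flip : ∀ {g h} → g ≈ z ∙ h → h ≈ z ∙ g
    flip {g} {h} e = begin
      h ≈⟨ identityˡ h ⟨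
      ε ∙ h ≈⟨ ∙-congʳ square ⟨
      z ∙ z ∙ h ≈⟨ assoc z z h ⟩
      z ∙ (z ∙ h) ≈⟨ ∙-congˡ e ⟨
      z ∙ g ∎

    ≈z-trans : ∀ {g h k} → g ≈z h → h ≈z k → g ≈z k
    ≈z-trans (inj₁ e) (inj₁ f) = inj₁ (trans e f)
    ≈z-trans (inj₁ e) (inj₂ f) = inj₂ (trans e f)
    ≈z-trans (inj₂ e) (inj₁ f) = inj₂ (trans e (∙-congˡ f))
    ≈z-trans (inj₂ e) (inj₂ f) = inj₁ (trans e (sym (flip f)))

    ≈z-sym : ∀ {g h} → g ≈z h → h ≈z g
    ≈z-sym (inj₁ e) = inj₁ (sym e)
    ≈z-sym (inj₂ e) = inj₂ (flip e)

    pull : ∀ g h → g ∙ (z ∙ h) ≈ z ∙ (g ∙ h)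
    pull g h = trans (sym (assoc g z h)) (trans (∙-congʳ (sym (central g))) (assoc z g h))

    ≈z-∙-cong : ∀ {g g′ h h′} → g ≈z g′ → h ≈z h′ → g ∙ h ≈z g′ ∙ h′
    ≈z-∙-cong (inj₁ e) (inj₁ f) = inj₁ (∙-cong e f)
    ≈z-∙-cong (inj₁ e) (inj₂ f) = inj₂ (trans (∙-cong e f) (pull _ _))
    ≈z-∙-cong (inj₂ e) (inj₁ f) = inj₂ (trans (∙-cong e f) (assoc _ _ _))
    ≈z-∙-cong (inj₂ e) (inj₂ f) = inj₁ (trans (∙-cong e f) (trans (assoc _ _ _)
      (trans (∙-congˡ (pull _ _)) (sym (flip (Group.refl G))))))

    ≈z-⁻¹-cong : ∀ {g h} → g ≈z h → g ⁻¹ ≈z h ⁻¹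
    ≈z-⁻¹-cong (inj₁ e) = inj₁ (⁻¹-cong e)
    ≈z-⁻¹-cong {g} {h} (inj₂ e) = inj₂ (begin
      g ⁻¹ ≈⟨ ⁻¹-cong e ⟩
      (z ∙ h) ⁻¹ ≈⟨ ⁻¹-cong (central h) ⟩
      (h ∙ z) ⁻¹ ≈⟨ ⁻¹-anti-homo-∙ h z ⟩
      z ⁻¹ ∙ h ⁻¹ ≈⟨ ∙-congʳ (sym (inverseˡ-unique z z square)) ⟩
      z ∙ h ⁻¹ ∎)

  G/z : Group 0ℓ 0ℓ
  G/z = record
    { Carrier = Carrier ; _≈_ = _≈z_ ; _∙_ = _∙_ ; ε = ε ; _⁻¹ = _⁻¹
    ; isGroup = record
      { isMonoid = record
        { isSemigroup = record
          { isMagma = record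
            { isEquivalence = record { refl = inj₁ (Group.refl G) ; sym = ≈z-sym ; trans = ≈z-trans }
            ; ∙-cong = ≈z-∙-cong }
          ; assoc = λ x y w → inj₁ (assoc x y w) }
        ; identity = (λ x → inj₁ (identityˡ x)) , (λ x → inj₁ (identityʳ x)) }
      ; inverse = (λ x → inj₁ (inverseˡ x)) , (λ x → inj₁ (inverseʳ x))
      ; ⁻¹-cong = ≈z-⁻¹-cong } }

module _ {G : Group 0ℓ 0ℓ} {a b : Group.Carrier G} {p : ℕ} (k : ℕ) (T : IsTight G a b p (2 ^ suc k)) where
  open Group G hiding (refl; _-_)
  open Powers G
  open TightProps T

  b-half-central : Commute a (b ↑ 2^ k) → ∀ g → Commute (b ↑ 2^ k) g
  b-half-central c g = let (x , y , e) = normalForm g in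
    commute-cong (Group.refl G) (sym e) (commute-∙ (commute-↑ x (sym c)) (powers-commute b (2^ k) y))

  b-half² : b ↑ 2^ k ∙ b ↑ 2^ k ≈ ε
  b-half² = trans (sym (↑-+ b (2^ k) (2^ k))) (trans (↑-≡ b (≡.trans (lem (2^ k)) (≡.sym (2^-suc k)))) b-order)
    where
    lem : ∀ s → s + s ≡ + 2 * s
    lem = solve-∀

  -- Since z lies in ⟨b⟩, an equation between ⟨a⟩ and ⟨b⟩ modulo z is again one in `G`, with the
  -- exponent of b shifted by q/2.
  quotient-tight : (c : ∀ g → Commute (b ↑ 2^ k) g) → IsTight (Quotient.G/z G (b ↑ 2^ k) c b-half²) a b p (2 ^ k)
  quotient-tight c = record
    { rel = inj₁ rel
    ; a-order = inj₁ a-order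
    ; b-order = inj₂ (sym (identityʳ _))
    ; normalForm = λ g → let (x , y , e) = normalForm g in x , y , inj₁ e
    ; independent = indep
    }
    where
    half∣ : 2^ k ∣ 2^ (suc k)
    half∣ = divides (+ 2) (2^-suc k)
    lem : ∀ s y → s + y - s ≡ y
    lem = solve-∀
    indep : ∀ x y → a ↑ x ≈ b ↑ y ⊎ a ↑ x ≈ b ↑ 2^ k ∙ b ↑ y → + p ∣ x × 2^ k ∣ y
    indep x y (inj₁ e) = let (d , d′) = independent x y e in d , ∣-trans half∣ d′
    indep x y (inj₂ e) = let (d , d′) = independent x (2^ k + y) (trans e (sym (↑-+ b (2^ k) y))) in
      d , ∣-resp (lem (2^ k) y) (∣m∣n⇒∣m-n (∣-trans half∣ d′) ∣-refl)

module _ (G : Group 0ℓ 0ℓ) {a b : Group.Carrier G} where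
  open Group G hiding (refl; _-_)
  open Powers G
  open Evaluation G
  open GroupSolver G
  open import Algebra.Properties.Group G
  open import Relation.Binary.Reasoning.Setoid setoid

  eval-abelian : Commute a b → ∀ w → eval a b w ≈ a ↑ count₁ w ∙ b ↑ count₂ w
  eval-abelian c [] = sym (identityˡ ε)
  eval-abelian c (⁺ s₁ ∷ w) = trans (∙-congˡ (eval-abelian c w)) (trans (sym (assoc _ _ _)) (∙-congʳ (sym (↑-suc a (count₁ w)))))
  eval-abelian c (⁻ s₁ ∷ w) = trans (∙-congˡ (eval-abelian c w)) (trans (sym (assoc _ _ _)) (∙-congʳ (sym (↑-pred a (count₁ w)))))
  eval-abelian c (⁺ s₂ ∷ w) = begin
    b ∙ eval a b w ≈⟨ ∙-congˡ (eval-abelian c w) ⟩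
    b ∙ (a ↑ count₁ w ∙ b ↑ count₂ w) ≈⟨ assoc _ _ _ ⟨
    b ∙ a ↑ count₁ w ∙ b ↑ count₂ w ≈⟨ ∙-congʳ (commute-↑ (count₁ w) (sym c)) ⟩
    a ↑ count₁ w ∙ b ∙ b ↑ count₂ w ≈⟨ assoc _ _ _ ⟩
    a ↑ count₁ w ∙ (b ∙ b ↑ count₂ w) ≈⟨ ∙-congˡ (↑-suc b (count₂ w)) ⟨
    a ↑ count₁ w ∙ b ↑ (+ 1 + count₂ w) ∎
  eval-abelian c (⁻ s₂ ∷ w) = begin
    b ⁻¹ ∙ eval a b w ≈⟨ ∙-congˡ (eval-abelian c w) ⟩
    b ⁻¹ ∙ (a ↑ count₁ w ∙ b ↑ count₂ w) ≈⟨ assoc _ _ _ ⟨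
    b ⁻¹ ∙ a ↑ count₁ w ∙ b ↑ count₂ w ≈⟨ ∙-congʳ (sym (commute-⁻¹ (sym (commute-↑ (count₁ w) (sym c))))) ⟩
    a ↑ count₁ w ∙ b ⁻¹ ∙ b ↑ count₂ w ≈⟨ assoc _ _ _ ⟩
    a ↑ count₁ w ∙ (b ⁻¹ ∙ b ↑ count₂ w) ≈⟨ ∙-congˡ (↑-pred b (count₂ w)) ⟨
    a ↑ count₁ w ∙ b ↑ (-[1+ 0 ] + count₂ w) ∎

  involutions-commute : a ∙ a ≈ ε → b ∙ b ≈ ε → a ∙ b ∙ (a ∙ b) ≈ ε → Commute a b
  involutions-commute a² b² r = begin
    a ∙ b ≈⟨ solve 2 (λ a b → a ⊙ b ⊜ (a ⊙ b ⊙ (a ⊙ b)) ⊙ b ⁱ ⊙ a ⁱ) (Group.refl G) a b ⟩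
    a ∙ b ∙ (a ∙ b) ∙ b ⁻¹ ∙ a ⁻¹ ≈⟨ ∙-cong (∙-cong r (sym (inverseˡ-unique b b b²))) (sym (inverseˡ-unique a a a²)) ⟩
    ε ∙ b ∙ a ≈⟨ ∙-congʳ (identityˡ b) ⟩
    b ∙ a ∎

EvenRelators : (G : Group 0ℓ 0ℓ) (a b : Group.Carrier G) → Set
EvenRelators G a b = ∀ w → Group._≈_ G (Evaluation.eval G a b w) (Group.ε G) → Even (count₂ w)

-- ⟨a, b²⟩ has index 2: quotients by central involutions reduce to p, q ≤ 2.
even-relators : ∀ {G a b} α β → IsTight G a b (2 ^ α) (2 ^ suc β) → EvenRelators G a b
even-relators {G} {a} {b} α β T with α ℕ.≤? suc β
even-relators {G} {a} {b} α (suc β) T | yes α≤β = λ w e →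
  even-relators α β (quotient-tight (suc β) T (b-half-central (suc β) T c)) w (inj₁ e)
  where
  c : Powers.Commute G a (Powers._↑_ G b (2^ (suc β)))
  c = CentralInvolution.b-half-commutes {{2^-nonZero {α}}} (suc β) T (ℕP.^-monoʳ-≤ 2 α≤β)
even-relators zero β T | no α≰β = ⊥-elim (α≰β z≤n)
-- Here p exceeds q and the central involution lies in ⟨a⟩, so p is halved. The other branch halves
-- q only while q ≥ 4, so the parity of the exponent of b is never lost.
even-relators {G} {a} {b} (suc α) β T | no α≰β = λ w e →
  even-relators α β (TightProps.swap (quotient-tight α (TightProps.swap T) (b-half-central α (TightProps.swap T) c))) w (inj₁ e)
  where
  c : Powers.Commute G b (Powers._↑_ G a (2^ α))
  c = CentralInvolution.b-half-commutes {{2^-nonZero {suc β}}} α (TightProps.swap T) (ℕP.^-monoʳ-≤ 2 (ℕP.<⇒≤ (ℕP.≰⇒> α≰β)))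
-- Now p divides 2 and q = 2. Two involutions whose product is an involution commute, and in the
-- abelian group the exponent sum of b in a relator is a multiple of q.
even-relators {G} {a} {b} α zero T | yes α≤1 = λ w e →
  let (divides k d) = proj₂ (independent (count₁ w) (- count₂ w) (begin
        a ↑ count₁ w ≈⟨ //-rightDividesʳ (b ↑ count₂ w) (a ↑ count₁ w) ⟨
        a ↑ count₁ w ∙ b ↑ count₂ w ∙ (b ↑ count₂ w) ⁻¹ ≈⟨ ∙-congʳ (eval-abelian G comm w) ⟨
        eval a b w ∙ (b ↑ count₂ w) ⁻¹ ≈⟨ ∙-congʳ e ⟩
        ε ∙ (b ↑ count₂ w) ⁻¹ ≈⟨ identityˡ _ ⟩
        (b ↑ count₂ w) ⁻¹ ≈⟨ ↑-neg b (count₂ w) ⟨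
        b ↑ (- count₂ w) ∎))
  in - k , lem (count₂ w) k d
  where
  open Group G hiding (refl; _-_)
  open Powers G
  open Evaluation G
  open TightProps T
  open import Algebra.Properties.Group G
  open import Relation.Binary.Reasoning.Setoid setoid
  lem : ∀ c k → - c ≡ k * + 2 → c ≡ + 2 * (- k)
  lem c k e = ≡.trans (≡.sym (ℤP.neg-involutive c)) (≡.trans (cong -_ e) (lem′ k))
    where
    lem′ : ∀ k → - (k * + 2) ≡ + 2 * (- k)
    lem′ = solve-∀
  square : ∀ {x} → x ↑ + 2 ≈ ε → x ∙ x ≈ ε
  square {x} e = trans (∙-congˡ (sym (identityʳ x))) e
  2^α∣2 : ∀ α → α ≤ 1 → 2^ α ∣ + 2
  2^α∣2 zero _ = divides (+ 2) refl
  2^α∣2 (suc zero) _ = divides (+ 1) refl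
  2^α∣2 (suc (suc _)) (s≤s ())
  comm : Commute a b
  comm = involutions-commute G (square (a-∣ (2^α∣2 α α≤1))) (square b-order) rel

-- Stated for an arbitrary group with two chosen elements, because it is applied to G × G and to an
-- abstractly presented group. The set of all b^y a^x is closed under left multiplication by the
-- generators once a and a⁻¹ conjugate b² to elements of the form b^m a^e whose two factors commute.
module Closure (G : Group 0ℓ 0ℓ) (a b : Group.Carrier G) where
  open Group G hiding (refl; _-_)
  open Powers G
  open Evaluation G
  open GroupSolver G
  open import Algebra.Properties.Group G
  open import Relation.Binary.Reasoning.Setoid setoid

  b-double : ∀ k → b ↑ (+ 2 * k) ≈ (b ∙ b) ↑ k
  b-double k = trans (↑-≡ b (ℤP.*-comm (+ 2) k)) (trans (↑-* b k (+ 2)) (↑-cong k (∙-congˡ (identityʳ b))))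

  module _ (r : a ∙ b ∙ (a ∙ b) ≈ ε) where
    ab≈ : a ∙ b ≈ b ⁻¹ ∙ a ⁻¹
    ab≈ = trans (inverseˡ-unique (a ∙ b) (a ∙ b) r) (⁻¹-anti-homo-∙ a b)

    a⁻¹≈ : a ⁻¹ ≈ b ∙ a ∙ b
    a⁻¹≈ = begin
      a ⁻¹ ≈⟨ solve 2 (λ a b → a ⁱ ⊜ b ⊙ (b ⁱ ⊙ a ⁱ)) (Group.refl G) a b ⟩
      b ∙ (b ⁻¹ ∙ a ⁻¹) ≈⟨ ∙-congˡ ab≈ ⟨
      b ∙ (a ∙ b) ≈⟨ assoc b a b ⟨
      b ∙ a ∙ b ∎

    -- As a⁻¹ = bab and the inner b commutes with b², the conjugate by a determines the conjugate by
    -- a⁻¹.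
    conj-a⁻¹ : (b ∙ b) ^ᶜ (a ⁻¹) ≈ ((b ∙ b) ^ᶜ a) ^ᶜ b
    conj-a⁻¹ = begin
      a ⁻¹ ∙ (b ∙ b) ∙ a ⁻¹ ⁻¹ ≈⟨ ∙-cong (∙-congʳ a⁻¹≈) (⁻¹-cong a⁻¹≈) ⟩
      b ∙ a ∙ b ∙ (b ∙ b) ∙ (b ∙ a ∙ b) ⁻¹ ≈⟨ solve 2 (λ a b → b ⊙ a ⊙ b ⊙ (b ⊙ b) ⊙ (b ⊙ a ⊙ b) ⁱ ⊜ b ⊙ (a ⊙ (b ⊙ b) ⊙ a ⁱ) ⊙ b ⁱ) (Group.refl G) a b ⟩
      ((b ∙ b) ^ᶜ a) ^ᶜ b ∎

    -- With `ba⁻¹≈`, this translates between the conjugates of b² and the last two defining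
    -- relations of Γ^{p,q}; both directions of the translation are used later.
    b⁻¹a≈ : b ⁻¹ ∙ a ≈ a ⁻¹ ∙ (b ∙ (b ∙ b) ^ᶜ a) ⁻¹
    b⁻¹a≈ = begin
      b ⁻¹ ∙ a ≈⟨ solve 2 (λ a b → b ⁱ ⊙ a ⊜ a ⁱ ⊙ (b ⊙ (b ⁱ ⊙ a ⁱ ⊙ b ⊙ a ⁱ)) ⁱ) (Group.refl G) a b ⟩
      a ⁻¹ ∙ (b ∙ (b ⁻¹ ∙ a ⁻¹ ∙ b ∙ a ⁻¹)) ⁻¹ ≈⟨ ∙-congˡ (⁻¹-cong (∙-congˡ (∙-congʳ (∙-congʳ ab≈)))) ⟨
      a ⁻¹ ∙ (b ∙ (a ∙ b ∙ b ∙ a ⁻¹)) ⁻¹ ≈⟨ solve 2 (λ a b → a ⁱ ⊙ (b ⊙ (a ⊙ b ⊙ b ⊙ a ⁱ)) ⁱ ⊜ a ⁱ ⊙ (b ⊙ (a ⊙ (b ⊙ b) ⊙ a ⁱ)) ⁱ) (Group.refl G) a b ⟩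
      a ⁻¹ ∙ (b ∙ (b ∙ b) ^ᶜ a) ⁻¹ ∎

    ba⁻¹≈ : b ∙ a ⁻¹ ≈ a ∙ (b ∙ b) ^ᶜ (a ⁻¹) ∙ b
    ba⁻¹≈ = begin
      b ∙ a ⁻¹ ≈⟨ ∙-congˡ a⁻¹≈ ⟩
      b ∙ (b ∙ a ∙ b) ≈⟨ solve 2 (λ a b → b ⊙ (b ⊙ a ⊙ b) ⊜ a ⊙ (a ⁱ ⊙ (b ⊙ b) ⊙ a ⁱ ⁱ) ⊙ b) (Group.refl G) a b ⟩
      a ∙ (b ∙ b) ^ᶜ (a ⁻¹) ∙ b ∎

  private
    push : ∀ {g m e} → Commute (b ↑ m) (a ↑ e) → (b ∙ b) ^ᶜ g ≈ b ↑ m ∙ a ↑ e →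
      ∀ k → g ∙ (b ∙ b) ↑ k ≈ b ↑ (k * m) ∙ a ↑ (k * e) ∙ g
    push {g} {m} {e} c f k = begin
      g ∙ (b ∙ b) ↑ k ≈⟨ //-rightDividesˡ g _ ⟨
      (b ∙ b) ↑ k ^ᶜ g ∙ g ≈⟨ ∙-congʳ (conj-↑ (b ∙ b) k g) ⟩
      ((b ∙ b) ^ᶜ g) ↑ k ∙ g ≈⟨ ∙-congʳ (↑-cong k f) ⟩
      (b ↑ m ∙ a ↑ e) ↑ k ∙ g ≈⟨ ∙-congʳ (∙-↑ k c) ⟩
      (b ↑ m) ↑ k ∙ (a ↑ e) ↑ k ∙ g ≈⟨ ∙-congʳ (∙-cong (↑-* b k m) (↑-* a k e)) ⟨
      b ↑ (k * m) ∙ a ↑ (k * e) ∙ g ∎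

  module _ {m e m′ e′ : ℤ} (r : a ∙ b ∙ (a ∙ b) ≈ ε)
      (c : Commute (b ↑ m) (a ↑ e)) (f : (b ∙ b) ^ᶜ a ≈ b ↑ m ∙ a ↑ e)
      (c′ : Commute (b ↑ m′) (a ↑ e′)) (f′ : (b ∙ b) ^ᶜ (a ⁻¹) ≈ b ↑ m′ ∙ a ↑ e′) where

    private
      InBA : Carrier → Set
      InBA g = ∃₂ λ y x → g ≈ b ↑ y ∙ a ↑ x

      even : ∀ k x → InBA (a ∙ ((b ∙ b) ↑ k ∙ a ↑ x))
      even k x = k * m , k * e + (+ 1 + x) , (begin
        a ∙ ((b ∙ b) ↑ k ∙ a ↑ x) ≈⟨ assoc _ _ _ ⟨
        a ∙ (b ∙ b) ↑ k ∙ a ↑ x ≈⟨ ∙-congʳ (push c f k) ⟩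
        b ↑ (k * m) ∙ a ↑ (k * e) ∙ a ∙ a ↑ x ≈⟨ solve 4 (λ s t u v → s ⊙ t ⊙ u ⊙ v ⊜ s ⊙ (t ⊙ (u ⊙ v))) (Group.refl G) _ _ _ _ ⟩
        b ↑ (k * m) ∙ (a ↑ (k * e) ∙ (a ∙ a ↑ x)) ≈⟨ ∙-congˡ (∙-congˡ (↑-suc a x)) ⟨
        b ↑ (k * m) ∙ (a ↑ (k * e) ∙ a ↑ (+ 1 + x)) ≈⟨ ∙-congˡ (↑-+ a (k * e) (+ 1 + x)) ⟨
        b ↑ (k * m) ∙ a ↑ (k * e + (+ 1 + x)) ∎)

      even′ : ∀ k x → InBA (a ⁻¹ ∙ ((b ∙ b) ↑ k ∙ a ↑ x))
      even′ k x = k * m′ , k * e′ + (-[1+ 0 ] + x) , (begin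
        a ⁻¹ ∙ ((b ∙ b) ↑ k ∙ a ↑ x) ≈⟨ assoc _ _ _ ⟨
        a ⁻¹ ∙ (b ∙ b) ↑ k ∙ a ↑ x ≈⟨ ∙-congʳ (push c′ f′ k) ⟩
        b ↑ (k * m′) ∙ a ↑ (k * e′) ∙ a ⁻¹ ∙ a ↑ x ≈⟨ solve 4 (λ s t u v → s ⊙ t ⊙ u ⊙ v ⊜ s ⊙ (t ⊙ (u ⊙ v))) (Group.refl G) _ _ _ _ ⟩
        b ↑ (k * m′) ∙ (a ↑ (k * e′) ∙ (a ⁻¹ ∙ a ↑ x)) ≈⟨ ∙-congˡ (∙-congˡ (↑-pred a x)) ⟨
        b ↑ (k * m′) ∙ (a ↑ (k * e′) ∙ a ↑ (-[1+ 0 ] + x)) ≈⟨ ∙-congˡ (↑-+ a (k * e′) (-[1+ 0 ] + x)) ⟨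
        b ↑ (k * m′) ∙ a ↑ (k * e′ + (-[1+ 0 ] + x)) ∎)

      InBA-cong : ∀ {g h} → g ≈ h → InBA h → InBA g
      InBA-cong eq (y , x , e) = y , x , trans eq e

      b∙ : ∀ {g} → InBA g → InBA (b ∙ g)
      b∙ (y , x , e) = + 1 + y , x , trans (∙-congˡ e) (trans (sym (assoc _ _ _)) (∙-congʳ (sym (↑-suc b y))))

      b⁻¹∙ : ∀ {g} → InBA g → InBA (b ⁻¹ ∙ g)
      b⁻¹∙ (y , x , e) = -[1+ 0 ] + y , x , trans (∙-congˡ e) (trans (sym (assoc _ _ _)) (∙-congʳ (sym (↑-pred b y))))

      a∙ : ∀ {g} → InBA g → InBA (a ∙ g)
      a∙ (y , x , eq) with parity y
      ... | inj₁ (k , refl) = InBA-cong (∙-congˡ (trans eq (∙-congʳ (b-double k)))) (even k x)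
      -- For an odd exponent, ab = b⁻¹a⁻¹ reduces the claim to a⁻¹ passing an even power of b.
      ... | inj₂ (k , refl) = InBA-cong (begin
          a ∙ _ ≈⟨ ∙-congˡ eq ⟩
          a ∙ (b ↑ (+ 1 + + 2 * k) ∙ a ↑ x) ≈⟨ ∙-congˡ (∙-congʳ (trans (↑-suc b (+ 2 * k)) (∙-congˡ (b-double k)))) ⟩
          a ∙ (b ∙ (b ∙ b) ↑ k ∙ a ↑ x) ≈⟨ solve 4 (λ s t u v → s ⊙ (t ⊙ u ⊙ v) ⊜ s ⊙ t ⊙ (u ⊙ v)) (Group.refl G) _ _ _ _ ⟩
          a ∙ b ∙ ((b ∙ b) ↑ k ∙ a ↑ x) ≈⟨ ∙-congʳ (ab≈ r) ⟩
          b ⁻¹ ∙ a ⁻¹ ∙ ((b ∙ b) ↑ k ∙ a ↑ x) ≈⟨ assoc _ _ _ ⟩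
          b ⁻¹ ∙ (a ⁻¹ ∙ ((b ∙ b) ↑ k ∙ a ↑ x)) ∎) (b⁻¹∙ (even′ k x))

      ba≈ : a ⁻¹ ∙ b ⁻¹ ≈ b ∙ a
      ba≈ = begin
        a ⁻¹ ∙ b ⁻¹ ≈⟨ solve 2 (λ a b → a ⁱ ⊙ b ⁱ ⊜ b ⊙ (b ⁱ ⊙ a ⁱ) ⊙ b ⁱ) (Group.refl G) a b ⟩
        b ∙ (b ⁻¹ ∙ a ⁻¹) ∙ b ⁻¹ ≈⟨ ∙-congʳ (∙-congˡ (ab≈ r)) ⟨
        b ∙ (a ∙ b) ∙ b ⁻¹ ≈⟨ solve 2 (λ a b → b ⊙ (a ⊙ b) ⊙ b ⁱ ⊜ b ⊙ a) (Group.refl G) a b ⟩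
        b ∙ a ∎

      a⁻¹∙ : ∀ {g} → InBA g → InBA (a ⁻¹ ∙ g)
      a⁻¹∙ (y , x , eq) with parity y
      ... | inj₁ (k , refl) = InBA-cong (∙-congˡ (trans eq (∙-congʳ (b-double k)))) (even′ k x)
      -- The odd exponent is split as -1 + 2(k + 1), so that a⁻¹ meets b⁻¹ and a⁻¹b⁻¹ = ba applies.
      ... | inj₂ (k , refl) = InBA-cong (begin
          a ⁻¹ ∙ _ ≈⟨ ∙-congˡ eq ⟩
          a ⁻¹ ∙ (b ↑ (+ 1 + + 2 * k) ∙ a ↑ x) ≈⟨ ∙-congˡ (∙-congʳ (trans (↑-≡ b (lem k)) (trans (↑-pred b (+ 2 * (+ 1 + k))) (∙-congˡ (b-double (+ 1 + k)))))) ⟩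
          a ⁻¹ ∙ (b ⁻¹ ∙ (b ∙ b) ↑ (+ 1 + k) ∙ a ↑ x) ≈⟨ solve 4 (λ s t u v → s ⊙ (t ⊙ u ⊙ v) ⊜ s ⊙ t ⊙ (u ⊙ v)) (Group.refl G) _ _ _ _ ⟩
          a ⁻¹ ∙ b ⁻¹ ∙ ((b ∙ b) ↑ (+ 1 + k) ∙ a ↑ x) ≈⟨ ∙-congʳ ba≈ ⟩
          b ∙ a ∙ ((b ∙ b) ↑ (+ 1 + k) ∙ a ↑ x) ≈⟨ assoc _ _ _ ⟩
          b ∙ (a ∙ ((b ∙ b) ↑ (+ 1 + k) ∙ a ↑ x)) ∎) (b∙ (even (+ 1 + k) x))
        where
        lem : ∀ k → + 1 + + 2 * k ≡ -[1+ 0 ] + + 2 * (+ 1 + k)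
        lem = solve-∀

    closure : ∀ w → ∃₂ λ y x → eval a b w ≈ b ↑ y ∙ a ↑ x
    closure [] = + 0 , + 0 , sym (identityˡ ε)
    closure (⁺ s₁ ∷ w) = a∙ (closure w)
    closure (⁻ s₁ ∷ w) = a⁻¹∙ (closure w)
    closure (⁺ s₂ ∷ w) = b∙ (closure w)
    closure (⁻ s₂ ∷ w) = b⁻¹∙ (closure w)

module _ {G : Group 0ℓ 0ℓ} {a b : Group.Carrier G} {p q : ℕ} (T : IsTight G a b p q) where
  open Group G hiding (refl; _-_)
  open Powers G
  open Evaluation G
  open GroupSolver G
  open TightProps T
  open import Algebra.Properties.Group G
  open import Relation.Binary.Reasoning.Setoid setoid

  private
    G² : Group 0ℓ 0ℓ
    G² = DirectProduct.group G G
    module ↑² = Powers G²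
    -- The superscript marks a pair and not a square. A single normal form in G × G holds for (a, b)
    -- and for (a⁻¹, b⁻¹) with the same exponents.
    a² b² : Carrier × Carrier
    a² = a , a ⁻¹
    b² = b , b ⁻¹

    ↑²-spec : ∀ x y k → (x , y) ↑².↑ k ≡ (x ↑ k , y ↑ k)
    ↑²-spec x y (+ zero) = refl
    ↑²-spec x y +[1+ n ] rewrite ↑²-spec x y (+ n) = refl
    ↑²-spec x y -[1+ zero ] = refl
    ↑²-spec x y -[1+ suc n ] rewrite ↑²-spec x y -[1+ n ] = refl

    eval²-spec : ∀ w → Evaluation.eval G² a² b² w ≡ (eval a b w , eval (a ⁻¹) (b ⁻¹) w)
    eval²-spec [] = refl
    eval²-spec (⁺ s₁ ∷ w) rewrite eval²-spec w = refl
    eval²-spec (⁻ s₁ ∷ w) rewrite eval²-spec w = refl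
    eval²-spec (⁺ s₂ ∷ w) rewrite eval²-spec w = refl
    eval²-spec (⁻ s₂ ∷ w) rewrite eval²-spec w = refl

  -- The relations are symmetric under inversion, so every word has the same normal form
  -- in the generators (a, b) and in (a⁻¹, b⁻¹).
  ⟨b²⟩-normal⇒regular : ∀ n → (b ∙ b) ^ᶜ a ≈ b ↑ n → Regular a b
  ⟨b²⟩-normal⇒regular n f w ew = from-nf (Closure.closure G² a² b² {n} {+ 0} {n} {+ 0} r comm f¹ comm f² w)
    where
    module H = Group G²
    f′ : (b ∙ b) ^ᶜ (a ⁻¹) ≈ b ↑ n
    f′ = trans (Closure.conj-a⁻¹ G a b rel) (trans (conj-cong b f) (commute⇒conj (commute-↑ n (Group.refl G))))
    r : (a² H.∙ b² H.∙ (a² H.∙ b²)) H.≈ H.ε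
    r = rel , (begin
      a ⁻¹ ∙ b ⁻¹ ∙ (a ⁻¹ ∙ b ⁻¹) ≈⟨ solve 2 (λ a b → a ⁱ ⊙ b ⁱ ⊙ (a ⁱ ⊙ b ⁱ) ⊜ (b ⊙ a ⊙ (b ⊙ a)) ⁱ) (Group.refl G) a b ⟩
      (b ∙ a ∙ (b ∙ a)) ⁻¹ ≈⟨ ⁻¹-cong rel′ ⟩
      ε ⁻¹ ≈⟨ ε⁻¹≈ε ⟩
      ε ∎)
    comm : ↑².Commute (b² ↑².↑ n) H.ε
    comm = ↑².commute-ε
    b²n : ∀ {g h} → g ≈ b ↑ n → h ≈ (b ⁻¹) ↑ n → (g , h) H.≈ (b² ↑².↑ n H.∙ H.ε)
    b²n eg eh rewrite ↑²-spec b (b ⁻¹) n = trans eg (sym (identityʳ _)) , trans eh (sym (identityʳ _))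
    -- Inversion exchanges the conjugates by a and by a⁻¹. Both are b^n, so the hypothesis of
    -- `closure` takes the same form in both coordinates.
    f¹ : ((b² H.∙ b²) ↑².^ᶜ a²) H.≈ (b² ↑².↑ n H.∙ H.ε)
    f¹ = b²n f (begin
      a ⁻¹ ∙ (b ⁻¹ ∙ b ⁻¹) ∙ a ⁻¹ ⁻¹ ≈⟨ solve 2 (λ a b → a ⁱ ⊙ (b ⁱ ⊙ b ⁱ) ⊙ a ⁱ ⁱ ⊜ (a ⁱ ⊙ (b ⊙ b) ⊙ a ⁱ ⁱ) ⁱ) (Group.refl G) a b ⟩
      ((b ∙ b) ^ᶜ (a ⁻¹)) ⁻¹ ≈⟨ ⁻¹-cong f′ ⟩
      (b ↑ n) ⁻¹ ≈⟨ ⁻¹-↑ b n ⟨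
      (b ⁻¹) ↑ n ∎)
    f² : ((b² H.∙ b²) ↑².^ᶜ (a² H.⁻¹)) H.≈ (b² ↑².↑ n H.∙ H.ε)
    f² = b²n f′ (begin
      a ⁻¹ ⁻¹ ∙ (b ⁻¹ ∙ b ⁻¹) ∙ a ⁻¹ ⁻¹ ⁻¹ ≈⟨ solve 2 (λ a b → a ⁱ ⁱ ⊙ (b ⁱ ⊙ b ⁱ) ⊙ a ⁱ ⁱ ⁱ ⊜ (a ⊙ (b ⊙ b) ⊙ a ⁱ) ⁱ) (Group.refl G) a b ⟩
      ((b ∙ b) ^ᶜ a) ⁻¹ ≈⟨ ⁻¹-cong f ⟩
      (b ↑ n) ⁻¹ ≈⟨ ⁻¹-↑ b n ⟨
      (b ⁻¹) ↑ n ∎)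
    from-nf : (∃₂ λ y x → Evaluation.eval G² a² b² w H.≈ (b² ↑².↑ y H.∙ a² ↑².↑ x)) → eval (a ⁻¹) (b ⁻¹) w ≈ ε
    from-nf (y , x , h) rewrite eval²-spec w | ↑²-spec b (b ⁻¹) y | ↑²-spec a (a ⁻¹) x = begin
      eval (a ⁻¹) (b ⁻¹) w ≈⟨ proj₂ h ⟩
      (b ⁻¹) ↑ y ∙ (a ⁻¹) ↑ x ≈⟨ ∙-cong (⁻¹-↑ b y) (⁻¹-↑ a x) ⟩
      (b ↑ y) ⁻¹ ∙ (a ↑ x) ⁻¹ ≈⟨ ∙-cong (⁻¹-cong (b-∣ (proj₂ d))) (⁻¹-cong (a-∣ (proj₁ d))) ⟩
      ε ⁻¹ ∙ ε ⁻¹ ≈⟨ solve 0 (one ⁱ ⊙ one ⁱ ⊜ one) (Group.refl G) ⟩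
      ε ∎
      where
      y′ : ∀ y → - - y ≡ y
      y′ = solve-∀
      -- In the first coordinate b^y a^x = 1, so independence makes both exponents vanish, and then
      -- the second coordinate is trivial too.
      d : + p ∣ x × + q ∣ y
      d = let (d₁ , d₂) = independent x (- y) (trans (inverseʳ-unique (b ↑ y) (a ↑ x) (trans (sym (proj₁ h)) ew)) (sym (↑-neg b y)))
          in d₁ , ∣-resp (y′ y) (∣m⇒∣-m d₂)

-- Classification

module Involutions {G : Group 0ℓ 0ℓ} {a b : Group.Carrier G} (α β : ℕ)
    (T : IsTight G a b (2 ^ suc α) (2 ^ suc β)) where
  open Group G hiding (refl; _-_)
  open Powers G
  y z : Carrier
  y = a ↑ 2^ α
  z = b ↑ 2^ β

-- The relations of a chiral group, with n = 2m:  b⁻¹a = a⁻¹ y b^(-n-1)  and  ba⁻¹ = a y b^(n+1) z.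
record ChiralRelations {G : Group 0ℓ 0ℓ} {a b : Group.Carrier G} (α β : ℕ)
    (T : IsTight G a b (2 ^ suc α) (2 ^ suc β)) : Set where
  open Group G hiding (refl; _-_)
  open Powers G
  open Involutions α β T
  field
    m : ℤ
    rel₁ : b ⁻¹ ∙ a ≈ a ⁻¹ ∙ (b ∙ (b ∙ b) ↑ m ∙ y) ⁻¹
    rel₂ : b ∙ a ⁻¹ ≈ a ∙ (y ∙ (b ∙ b) ↑ m ∙ z) ∙ b
    m-odd : Odd m
    -- With q = 2^(β+1), p = 2^(γ+3) and n = 2m these are the two congruences of the overview. The
    -- first is doubled so that it is read modulo q; the second comes together with the bound p ≥ 8.
    m-square : 2^ (suc β) ∣ + 2 * (m * m) - (+ 2 + 2^ β)
    p-large : ∃ λ γ → α ≡ suc (suc γ) × 2^ (suc β) ∣ 2^ γ * (+ 4 * (m + + 1)) + 2^ β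

module Classification {G : Group 0ℓ 0ℓ} {a b : Group.Carrier G} (α β : ℕ)
    (T : IsTight G a b (2 ^ suc α) (2 ^ suc β))
    (z-commutes : Powers.Commute G a (Involutions.z α β T))
    (regular-mod-z : Evaluation.Regular (Quotient.G/z G (Involutions.z α β T) (b-half-central β T z-commutes) (b-half² β T)) a b)
    (y-not-central : ¬ Powers.Commute G (Involutions.y α β T) b) where
  open Group G hiding (refl; _-_)
  open Powers G
  open Evaluation G
  open GroupSolver G
  open TightProps T
  open Closure G a b using (b-double; conj-a⁻¹; b⁻¹a≈; ba⁻¹≈)
  open import Algebra.Properties.Group G
  open import Relation.Binary.Reasoning.Setoid setoid
  open Involutions α β T

  private
    z-central : ∀ g → Commute z g
    z-central = b-half-central β T z-commutes

    z² : z ∙ z ≈ ε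
    z² = b-half² β T

    y² : y ∙ y ≈ ε
    y² = b-half² α swap

    y⁻¹ : y ⁻¹ ≈ y
    y⁻¹ = sym (inverseˡ-unique y y y²)

    c : Carrier
    c = b ∙ b

    n w : ℤ
    n = proj₁ (normalForm′ (c ^ᶜ a))
    w = proj₁ (proj₂ (normalForm′ (c ^ᶜ a)))

    conj-c : c ^ᶜ a ≈ b ↑ n ∙ a ↑ w
    conj-c = proj₂ (proj₂ (normalForm′ (c ^ᶜ a)))

    -- The relation `conj-c` written as a word, because both `even-relators` and regularity modulo z
    -- are statements about words.
    relator : Word
    relator = ⁺ s₁ ∷ ⁺ s₂ ∷ ⁺ s₂ ∷ ⁻ s₁ ∷ (pow s₁ (- w) ++ pow s₂ (- n))

    eval-tail : ∀ s t → eval s t (pow s₁ (- w) ++ pow s₂ (- n)) ≈ (s ↑ w) ⁻¹ ∙ (t ↑ n) ⁻¹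
    eval-tail s t = trans (eval-++ s t (pow s₁ (- w)) (pow s₂ (- n)))
      (∙-cong (trans (eval-pow s t s₁ (- w)) (↑-neg s w)) (trans (eval-pow s t s₂ (- n)) (↑-neg t n)))

    relator≈ε : eval a b relator ≈ ε
    relator≈ε = begin
      a ∙ (b ∙ (b ∙ (a ⁻¹ ∙ eval a b (pow s₁ (- w) ++ pow s₂ (- n))))) ≈⟨ ∙-congˡ (∙-congˡ (∙-congˡ (∙-congˡ (eval-tail a b)))) ⟩
      a ∙ (b ∙ (b ∙ (a ⁻¹ ∙ ((a ↑ w) ⁻¹ ∙ (b ↑ n) ⁻¹)))) ≈⟨ solve 4 (λ a b u v → a ⊙ (b ⊙ (b ⊙ (a ⁱ ⊙ (u ⁱ ⊙ v ⁱ)))) ⊜ a ⊙ (b ⊙ b) ⊙ a ⁱ ⊙ (v ⊙ u) ⁱ) (Group.refl G) a b (a ↑ w) (b ↑ n) ⟩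
      c ^ᶜ a ∙ (b ↑ n ∙ a ↑ w) ⁻¹ ≈⟨ ∙-congʳ conj-c ⟩
      (b ↑ n ∙ a ↑ w) ∙ (b ↑ n ∙ a ↑ w) ⁻¹ ≈⟨ inverseʳ _ ⟩
      ε ∎

    -- The exponent sum of b in the relator is 2 - n.
    n-even : Even n
    n-even = from (even-relators (suc α) β T relator relator≈ε)
      where
      count : count₂ relator ≡ + 1 + (+ 1 + (+ 0 + - n))
      count = cong (λ t → + 1 + (+ 1 + t)) (≡.trans (count₂-++ (pow s₁ (- w)) (pow s₂ (- n))) (cong₂ _+_ (count₂-pow₁ (- w)) (count₂-pow₂ (- n))))
      lem : ∀ n k → + 1 + (+ 1 + (+ 0 + - n)) ≡ + 2 * k → n ≡ + 2 * (+ 1 - k)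
      lem n k e = ≡.trans (lem₁ n) (≡.trans (cong (λ t → + 2 - t) e) (lem₂ k))
        where
        lem₁ : ∀ n → n ≡ + 2 - (+ 1 + (+ 1 + (+ 0 + - n)))
        lem₁ = solve-∀
        lem₂ : ∀ k → + 2 - + 2 * k ≡ + 2 * (+ 1 - k)
        lem₂ = solve-∀
      from : Even (count₂ relator) → Even n
      from (k , e) = + 1 - k , lem n k (≡.trans (≡.sym count) e)

    m : ℤ
    m = proj₁ n-even

    N : Carrier
    N = c ↑ m

    bⁿ : b ↑ n ≈ N
    bⁿ = trans (↑-≡ b (proj₂ n-even)) (b-double m)

    -- The exponent n + 1 is odd, hence invertible modulo q: b is a power of `b ↑ o`, and whatever
    -- commutes with the latter commutes with b.
    o : ℤ
    o = + 1 + n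

    o-odd : Odd o
    o-odd = m , cong (λ t → + 1 + t) (proj₂ n-even)

    bᵒ : b ↑ o ≈ b ∙ N
    bᵒ = trans (↑-suc b n) (∙-congˡ bⁿ)

    inverse-o : ∃₂ λ l l′ → l * o ≡ + 1 + l′ * 2^ (suc β)
    inverse-o = odd-invertible (suc β) o-odd

    b-from-bᵒ : (b ↑ o) ↑ proj₁ inverse-o ≈ b
    b-from-bᵒ = let (l , l′ , e) = inverse-o in begin
      (b ↑ o) ↑ l ≈⟨ ↑-* b l o ⟨
      b ↑ (l * o) ≈⟨ b-cong (l * o) (+ 1) (divides l′ (≡.trans (cong (_- + 1) e) (lem l′ (2^ (suc β))))) ⟩
      b ↑ + 1 ≈⟨ ↑-1 b ⟩
      b ∎
      where
      lem : ∀ l s → + 1 + l * s - + 1 ≡ l * s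
      lem = solve-∀

    commute-b : ∀ {g} → Commute g (b ↑ o) → Commute g b
    commute-b {g} h = commute-cong (Group.refl G) b-from-bᵒ (commute-↑ (proj₁ inverse-o) h)

    Sign : Carrier → Set
    Sign ζ = ζ ≈ ε ⊎ ζ ≈ z

    sign-central : ∀ {ζ} → Sign ζ → ∀ g → Commute ζ g
    sign-central (inj₁ e) g = sym (commute-cong (Group.refl G) (sym e) commute-ε)
    sign-central (inj₂ e) g = commute-cong (sym e) (Group.refl G) (z-central g)

    sign² : ∀ {ζ} → Sign ζ → ζ ∙ ζ ≈ ε
    sign² (inj₁ e) = trans (∙-cong e e) (identityˡ ε)
    sign² (inj₂ e) = trans (∙-cong e e) z²

    -- Regularity modulo z confines this element to {1, z}. It measures how far the inverted
    -- relation fails in Γ itself.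
    inverted-relator : Carrier
    inverted-relator = eval (a ⁻¹) (b ⁻¹) relator

    inverted-sign : Sign inverted-relator
    inverted-sign = Sum.map₂ (λ e → trans e (identityʳ z)) (regular-mod-z relator (inj₁ relator≈ε))

    ζ : Carrier
    ζ = inverted-relator

    inverted : a ↑ w ∙ b ↑ n ≈ c ^ᶜ (a ⁻¹) ∙ ζ
    inverted = sym (begin
      c ^ᶜ (a ⁻¹) ∙ ζ ≈⟨ ∙-congˡ (∙-congˡ (∙-congˡ (∙-congˡ (∙-congˡ (eval-tail (a ⁻¹) (b ⁻¹)))))) ⟩
      c ^ᶜ (a ⁻¹) ∙ (a ⁻¹ ∙ (b ⁻¹ ∙ (b ⁻¹ ∙ (a ⁻¹ ⁻¹ ∙ (((a ⁻¹) ↑ w) ⁻¹ ∙ ((b ⁻¹) ↑ n) ⁻¹)))))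
        ≈⟨ solve 4 (λ a b u v → (a ⁱ ⊙ (b ⊙ b) ⊙ a ⁱ ⁱ) ⊙ (a ⁱ ⊙ (b ⁱ ⊙ (b ⁱ ⊙ (a ⁱ ⁱ ⊙ (u ⁱ ⊙ v ⁱ))))) ⊜ u ⁱ ⊙ v ⁱ) (Group.refl G) a b ((a ⁻¹) ↑ w) ((b ⁻¹) ↑ n) ⟩
      ((a ⁻¹) ↑ w) ⁻¹ ∙ ((b ⁻¹) ↑ n) ⁻¹ ≈⟨ ∙-cong (double a w) (double b n) ⟩
      a ↑ w ∙ b ↑ n ∎)
      where
      double : ∀ x k → ((x ⁻¹) ↑ k) ⁻¹ ≈ x ↑ k
      double x k = trans (⁻¹-cong (⁻¹-↑ x k)) (⁻¹-involutive _)

    -- Comparing with conj-a⁻¹, a^w commutes with b^(n+1) up to z.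
    bᵒ-conj : b ↑ o ^ᶜ (a ↑ w) ≈ b ↑ o ∙ ζ
    bᵒ-conj = begin
      a ↑ w ∙ b ↑ o ∙ (a ↑ w) ⁻¹ ≈⟨ ∙-congʳ (∙-congˡ (trans (↑-suc b n) (commute-↑ n (Group.refl G)))) ⟩
      a ↑ w ∙ (b ↑ n ∙ b) ∙ (a ↑ w) ⁻¹ ≈⟨ solve 3 (λ u v b → u ⊙ (v ⊙ b) ⊙ u ⁱ ⊜ (u ⊙ v) ⊙ b ⊙ u ⁱ) (Group.refl G) (a ↑ w) (b ↑ n) b ⟩
      a ↑ w ∙ b ↑ n ∙ b ∙ (a ↑ w) ⁻¹ ≈⟨ ∙-congʳ (∙-congʳ inverted) ⟩
      c ^ᶜ (a ⁻¹) ∙ ζ ∙ b ∙ (a ↑ w) ⁻¹ ≈⟨ ∙-congʳ (∙-congʳ (∙-congʳ (trans (conj-a⁻¹ rel) (conj-cong b conj-c)))) ⟩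
      (b ↑ n ∙ a ↑ w) ^ᶜ b ∙ ζ ∙ b ∙ (a ↑ w) ⁻¹ ≈⟨ ∙-congʳ (trans (assoc _ _ _) (trans (∙-congˡ (sign-central inverted-sign b)) (sym (assoc _ _ _)))) ⟩
      (b ↑ n ∙ a ↑ w) ^ᶜ b ∙ b ∙ ζ ∙ (a ↑ w) ⁻¹ ≈⟨ trans (assoc _ _ _) (trans (∙-congˡ (sign-central inverted-sign _)) (sym (assoc _ _ _))) ⟩
      (b ↑ n ∙ a ↑ w) ^ᶜ b ∙ b ∙ (a ↑ w) ⁻¹ ∙ ζ ≈⟨ ∙-congʳ (solve 3 (λ u v b → b ⊙ (v ⊙ u) ⊙ b ⁱ ⊙ b ⊙ u ⁱ ⊜ b ⊙ v) (Group.refl G) (a ↑ w) (b ↑ n) b) ⟩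
      b ∙ b ↑ n ∙ ζ ≈⟨ ∙-congʳ (↑-suc b n) ⟨
      b ↑ o ∙ ζ ∎

    -- Conjugating `b ↑ o` by a^w multiplies it by ζ, so conjugating twice multiplies it by ζ² = 1.
    a²ʷ-commutes : Commute (a ↑ (+ 2 * w)) b
    a²ʷ-commutes = commute-b (conj⇒commute (begin
      b ↑ o ^ᶜ (a ↑ (+ 2 * w)) ≈⟨ ∙-cong (∙-congʳ a²ʷ) (⁻¹-cong a²ʷ) ⟩
      b ↑ o ^ᶜ (a ↑ w ∙ a ↑ w) ≈⟨ solve 2 (λ u v → (u ⊙ u) ⊙ v ⊙ (u ⊙ u) ⁱ ⊜ u ⊙ (u ⊙ v ⊙ u ⁱ) ⊙ u ⁱ) (Group.refl G) (a ↑ w) (b ↑ o) ⟩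
      (b ↑ o ^ᶜ (a ↑ w)) ^ᶜ (a ↑ w) ≈⟨ conj-cong _ bᵒ-conj ⟩
      (b ↑ o ∙ ζ) ^ᶜ (a ↑ w) ≈⟨ conj-∙ _ _ _ ⟩
      b ↑ o ^ᶜ (a ↑ w) ∙ ζ ^ᶜ (a ↑ w) ≈⟨ ∙-cong bᵒ-conj (commute⇒conj (sym (sign-central inverted-sign _))) ⟩
      b ↑ o ∙ ζ ∙ ζ ≈⟨ assoc _ _ _ ⟩
      b ↑ o ∙ (ζ ∙ ζ) ≈⟨ ∙-congˡ (sign² inverted-sign) ⟩
      b ↑ o ∙ ε ≈⟨ identityʳ _ ⟩
      b ↑ o ∎))
      where
      a²ʷ : a ↑ (+ 2 * w) ≈ a ↑ w ∙ a ↑ w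
      a²ʷ = trans (↑-* a (+ 2) w) (∙-congˡ (identityʳ _))

    -- A nontrivial power of a has y among its own powers, so if it commuted with b, then y would.
    a-core-free : ∀ x → Commute (a ↑ x) b → 2^ (suc α) ∣ x
    a-core-free x comm with 2^ (suc α) ∣? x
    ... | yes d = d
    ... | no ¬d with reach-half α x ¬d
    ... | l , l′ , e = ⊥-elim (y-not-central (commute-cong y≈ (Group.refl G) (sym (commute-↑ l (sym comm)))))
      where
      lem : ∀ s t → s + t - s ≡ t
      lem = solve-∀
      y≈ : (a ↑ x) ↑ l ≈ y
      y≈ = trans (sym (↑-* a l x)) (trans (↑-≡ a e) (a-cong (2^ α + l′ * 2^ (suc α)) (2^ α) (divides l′ (lem (2^ α) (l′ * 2^ (suc α))))))

    a-half : ∀ w → 2^ α ∣ w → a ↑ w ≈ ε ⊎ a ↑ w ≈ y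
    a-half w (divides k e) with parity k
    ... | inj₁ (k′ , f) = inj₁ (a-∣ (divides k′ (≡.trans e (≡.trans (cong (_* 2^ α) f) (≡.trans (lem k′ (2^ α)) (cong (k′ *_) (≡.sym (2^-suc α))))))))
      where
      lem : ∀ k s → + 2 * k * s ≡ k * (+ 2 * s)
      lem = solve-∀
    ... | inj₂ (k′ , f) = inj₂ (a-cong w (2^ α) (divides k′ (≡.trans (cong (_- 2^ α) (≡.trans e (cong (_* 2^ α) f))) (≡.trans (lem k′ (2^ α)) (cong (k′ *_) (≡.sym (2^-suc α)))))))
      where
      lem : ∀ k s → (+ 1 + + 2 * k) * s - s ≡ k * (+ 2 * s)
      lem = solve-∀

    aʷ : a ↑ w ≈ ε ⊎ a ↑ w ≈ y
    aʷ = a-half w (halve-∣ α w (a-core-free (+ 2 * w) a²ʷ-commutes))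

    module Twisted (aʷ≈y : a ↑ w ≈ y) where
      A₁ : c ^ᶜ a ≈ N ∙ y
      A₁ = trans conj-c (∙-cong bⁿ aʷ≈y)

      -- If ζ were 1, then y = a^w would commute with `b ↑ o` and therefore with b.
      ζ≈z : ζ ≈ z
      ζ≈z = Sum.[_,_]′ contra (λ e → e) inverted-sign
        where
        contra : ζ ≈ ε → ζ ≈ z
        contra e = ⊥-elim (y-not-central (commute-b (conj⇒commute (trans (∙-cong (∙-congʳ (sym aʷ≈y)) (⁻¹-cong (sym aʷ≈y)))
          (trans bᵒ-conj (trans (∙-congˡ e) (identityʳ _)))))))

      bᵒ-conj-y : b ↑ o ^ᶜ y ≈ b ↑ o ∙ z
      bᵒ-conj-y = trans (∙-cong (∙-congʳ (sym aʷ≈y)) (⁻¹-cong (sym aʷ≈y))) (trans bᵒ-conj (∙-congˡ ζ≈z))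

      -- Conjugation by y multiplies `b ↑ o` by z, hence fixes its square, and b² is a power of that
      -- square.
      y-c : Commute y c
      y-c = commute-cong (Group.refl G) c≈ (commute-↑ (proj₁ inverse-o) (conj⇒commute sq))
        where
        sq : (b ↑ o ∙ b ↑ o) ^ᶜ y ≈ b ↑ o ∙ b ↑ o
        sq = begin
          (b ↑ o ∙ b ↑ o) ^ᶜ y ≈⟨ conj-∙ _ _ _ ⟩
          b ↑ o ^ᶜ y ∙ b ↑ o ^ᶜ y ≈⟨ ∙-cong bᵒ-conj-y bᵒ-conj-y ⟩
          (b ↑ o ∙ z) ∙ (b ↑ o ∙ z) ≈⟨ ∙-congˡ (z-central _) ⟨
          (b ↑ o ∙ z) ∙ (z ∙ b ↑ o) ≈⟨ solve 2 (λ u v → (u ⊙ v) ⊙ (v ⊙ u) ⊜ u ⊙ (v ⊙ v) ⊙ u) (Group.refl G) (b ↑ o) z ⟩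
          b ↑ o ∙ (z ∙ z) ∙ b ↑ o ≈⟨ ∙-congʳ (trans (∙-congˡ z²) (identityʳ _)) ⟩
          b ↑ o ∙ b ↑ o ∎
        c≈ : (b ↑ o ∙ b ↑ o) ↑ proj₁ inverse-o ≈ c
        c≈ = trans (∙-↑ (proj₁ inverse-o) (Group.refl G)) (∙-cong b-from-bᵒ b-from-bᵒ)

      y-N : Commute y N
      y-N = commute-↑ m y-c

      -- In b^(n+1) = bN the factor `N` commutes with y, so the z gained under conjugation must come
      -- from b alone.
      b-conj-y : b ^ᶜ y ≈ b ∙ z
      b-conj-y = ∙-cancelʳ N (b ^ᶜ y) (b ∙ z) (begin
        b ^ᶜ y ∙ N ≈⟨ ∙-congˡ (commute⇒conj y-N) ⟨
        b ^ᶜ y ∙ N ^ᶜ y ≈⟨ conj-∙ b N y ⟨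
        (b ∙ N) ^ᶜ y ≈⟨ conj-cong y bᵒ ⟨
        b ↑ o ^ᶜ y ≈⟨ bᵒ-conj-y ⟩
        b ↑ o ∙ z ≈⟨ ∙-congʳ bᵒ ⟩
        b ∙ N ∙ z ≈⟨ trans (assoc _ _ _) (∙-congˡ (sym (z-central N))) ⟩
        b ∙ (z ∙ N) ≈⟨ assoc _ _ _ ⟨
        b ∙ z ∙ N ∎)

      y-conj-b : y ^ᶜ b ≈ y ∙ z
      y-conj-b = begin
        b ∙ y ∙ b ⁻¹ ≈⟨ ∙-congʳ (∙-congʳ (trans (∙-congˡ z²) (identityʳ b))) ⟨
        b ∙ (z ∙ z) ∙ y ∙ b ⁻¹ ≈⟨ solve 3 (λ b y z → b ⊙ (z ⊙ z) ⊙ y ⊙ b ⁱ ⊜ b ⊙ z ⊙ (z ⊙ y) ⊙ b ⁱ) (Group.refl G) b y z ⟩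
        b ∙ z ∙ (z ∙ y) ∙ b ⁻¹ ≈⟨ ∙-congʳ (∙-cong (sym b-conj-y) (z-central y)) ⟩
        b ^ᶜ y ∙ (y ∙ z) ∙ b ⁻¹ ≈⟨ solve 3 (λ b y z → y ⊙ b ⊙ y ⁱ ⊙ (y ⊙ z) ⊙ b ⁱ ⊜ y ⊙ (b ⊙ z) ⊙ b ⁱ) (Group.refl G) b y z ⟩
        y ∙ (b ∙ z) ∙ b ⁻¹ ≈⟨ ∙-congʳ (∙-congˡ (z-central b)) ⟨
        y ∙ (z ∙ b) ∙ b ⁻¹ ≈⟨ solve 3 (λ b y z → y ⊙ (z ⊙ b) ⊙ b ⁱ ⊜ y ⊙ z) (Group.refl G) b y z ⟩
        y ∙ z ∎

      b-N : Commute b N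
      b-N = commute-↑ m (commute-∙ (Group.refl G) (Group.refl G))

      A₂ : c ^ᶜ (a ⁻¹) ≈ N ∙ y ∙ z
      A₂ = begin
        c ^ᶜ (a ⁻¹) ≈⟨ trans (conj-a⁻¹ rel) (conj-cong b A₁) ⟩
        (N ∙ y) ^ᶜ b ≈⟨ conj-∙ N y b ⟩
        N ^ᶜ b ∙ y ^ᶜ b ≈⟨ ∙-cong (commute⇒conj b-N) y-conj-b ⟩
        N ∙ (y ∙ z) ≈⟨ assoc _ _ _ ⟨
        N ∙ y ∙ z ∎

      y-a : Commute a y
      y-a = commute-↑ (2^ α) (Group.refl G)

      N-conj-a : N ^ᶜ a ≈ N ↑ m ∙ y ↑ m
      N-conj-a = trans (conj-↑ c m a) (trans (↑-cong m A₁) (∙-↑ m (sym y-N)))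

      g : Carrier
      g = a ∙ a

      c-conj-g′ : c ^ᶜ g ≈ N ^ᶜ a ∙ y
      c-conj-g′ = begin
        c ^ᶜ g ≈⟨ solve 2 (λ a c → (a ⊙ a) ⊙ c ⊙ (a ⊙ a) ⁱ ⊜ a ⊙ (a ⊙ c ⊙ a ⁱ) ⊙ a ⁱ) (Group.refl G) a c ⟩
        (c ^ᶜ a) ^ᶜ a ≈⟨ conj-cong a A₁ ⟩
        (N ∙ y) ^ᶜ a ≈⟨ conj-∙ N y a ⟩
        N ^ᶜ a ∙ y ^ᶜ a ≈⟨ ∙-congˡ (commute⇒conj y-a) ⟩
        N ^ᶜ a ∙ y ∎

      -- The right sides of `A₁` and `A₂` differ by z, which a centralises. Conjugating `A₂` by a
      -- returns c, whereas conjugating `A₁` by a gives the conjugate of c by a².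
      c-conj-g : c ^ᶜ g ≈ c ∙ z
      c-conj-g = sym (begin
        c ∙ z ≈⟨ ∙-congʳ (solve 2 (λ a c → c ⊜ a ⊙ (a ⁱ ⊙ c ⊙ a ⁱ ⁱ) ⊙ a ⁱ) (Group.refl G) a c) ⟩
        (c ^ᶜ (a ⁻¹)) ^ᶜ a ∙ z ≈⟨ ∙-congʳ (conj-cong a A₂) ⟩
        (N ∙ y ∙ z) ^ᶜ a ∙ z ≈⟨ ∙-congʳ (conj-∙ (N ∙ y) z a) ⟩
        (N ∙ y) ^ᶜ a ∙ z ^ᶜ a ∙ z ≈⟨ ∙-congʳ (∙-cong (conj-∙ N y a) (commute⇒conj z-commutes)) ⟩
        N ^ᶜ a ∙ y ^ᶜ a ∙ z ∙ z ≈⟨ trans (assoc _ _ _) (trans (∙-congˡ z²) (identityʳ _)) ⟩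
        N ^ᶜ a ∙ y ^ᶜ a ≈⟨ ∙-congˡ (commute⇒conj y-a) ⟩
        N ^ᶜ a ∙ y ≈⟨ c-conj-g′ ⟨
        c ^ᶜ g ∎)

      c≈b² : c ≈ b ↑ + 2
      c≈b² = ∙-congˡ (sym (identityʳ b))

      N≈ : N ≈ b ↑ (+ 2 * m)
      N≈ = sym (b-double m)

      -- Here c^g is computed in two ways, as cz and as N^m y^m y. The resulting equation lies
      -- between ⟨a⟩ and ⟨b⟩, so each side is trivial: one side makes m + 1 even, the other gives
      -- the square congruence.
      square-relation : a ↑ ((m + + 1) * 2^ α) ≈ b ↑ (+ 2 + 2^ β - + 2 * (m * m))
      square-relation = begin
        a ↑ ((m + + 1) * 2^ α) ≈⟨ ↑-* a (m + + 1) (2^ α) ⟩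
        y ↑ (m + + 1) ≈⟨ ↑-+ y m (+ 1) ⟩
        y ↑ m ∙ y ↑ + 1 ≈⟨ ∙-congˡ (↑-1 y) ⟩
        y ↑ m ∙ y ≈⟨ solve 3 (λ u v w → v ⊙ w ⊜ u ⁱ ⊙ (u ⊙ v ⊙ w)) (Group.refl G) (N ↑ m) (y ↑ m) y ⟩
        (N ↑ m) ⁻¹ ∙ (N ↑ m ∙ y ↑ m ∙ y) ≈⟨ ∙-congˡ (trans (∙-congʳ (sym N-conj-a)) (trans (sym c-conj-g′) c-conj-g)) ⟩
        (N ↑ m) ⁻¹ ∙ (c ∙ z) ≈⟨ ∙-cong (⁻¹-cong (trans (↑-cong m N≈) (sym (↑-* b m (+ 2 * m))))) (∙-congʳ c≈b²) ⟩
        (b ↑ (m * (+ 2 * m))) ⁻¹ ∙ (b ↑ + 2 ∙ z) ≈⟨ ∙-cong (sym (↑-neg b (m * (+ 2 * m)))) (sym (↑-+ b (+ 2) (2^ β))) ⟩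
        b ↑ (- (m * (+ 2 * m))) ∙ b ↑ (+ 2 + 2^ β) ≈⟨ ↑-+ b (- (m * (+ 2 * m))) (+ 2 + 2^ β) ⟨
        b ↑ (- (m * (+ 2 * m)) + (+ 2 + 2^ β)) ≈⟨ ↑-≡ b (lem m (2^ β)) ⟩
        b ↑ (+ 2 + 2^ β - + 2 * (m * m)) ∎
        where
        lem : ∀ m s → - (m * (+ 2 * m)) + (+ 2 + s) ≡ + 2 + s - + 2 * (m * m)
        lem = solve-∀

      square-∣ : 2^ (suc α) ∣ (m + + 1) * 2^ α × 2^ (suc β) ∣ + 2 + 2^ β - + 2 * (m * m)
      square-∣ = independent ((m + + 1) * 2^ α) (+ 2 + 2^ β - + 2 * (m * m)) square-relation

      m+1-even : Even (m + + 1)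
      m+1-even = from (proj₁ square-∣)
        where
        lem : ∀ k s → k * (+ 2 * s) ≡ + 2 * k * s
        lem = solve-∀
        from : 2^ (suc α) ∣ (m + + 1) * 2^ α → Even (m + + 1)
        from (divides k e) = k , ℤP.*-cancelʳ-≡ (m + + 1) (+ 2 * k) (2^ α) {{2^-nonZero {α}}} (≡.trans e (≡.trans (cong (k *_) (2^-suc α)) (lem k (2^ α))))

      odd-m : Odd m
      odd-m = let (k , e) = m+1-even in k - + 1 , lem m k e
        where
        lem : ∀ m k → m + + 1 ≡ + 2 * k → m ≡ + 1 + + 2 * (k - + 1)
        lem m k e = ≡.trans (lem₁ m) (≡.trans (cong (_- + 1) e) (lem₂ k))
          where
          lem₁ : ∀ m → m ≡ m + + 1 - + 1
          lem₁ = solve-∀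
          lem₂ : ∀ k → + 2 * k - + 1 ≡ + 1 + + 2 * (k - + 1)
          lem₂ = solve-∀

      R₁ : b ⁻¹ ∙ a ≈ a ⁻¹ ∙ (b ∙ N ∙ y) ⁻¹
      R₁ = trans (b⁻¹a≈ rel) (∙-congˡ (⁻¹-cong (trans (∙-congˡ A₁) (sym (assoc _ _ _)))))

      R₂ : b ∙ a ⁻¹ ≈ a ∙ (y ∙ N ∙ z) ∙ b
      R₂ = trans (ba⁻¹≈ rel) (∙-congʳ (∙-congˡ (trans A₂ (∙-congʳ (sym y-N)))))

      -- The failure of b to invert a² under conjugation, see `g-conj-b`.
      Y : Carrier
      Y = c ∙ N ∙ y

      g-conj-b : g ^ᶜ b ≈ g ⁻¹ ∙ Y ⁻¹
      g-conj-b = begin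
        b ∙ (a ∙ a) ∙ b ⁻¹ ≈⟨ solve 2 (λ a b → b ⊙ (a ⊙ a) ⊙ b ⁱ ⊜ (b ⊙ a ⊙ (b ⊙ a)) ⊙ a ⁱ ⊙ (b ⁱ ⊙ a) ⊙ b ⁱ) (Group.refl G) a b ⟩
        b ∙ a ∙ (b ∙ a) ∙ a ⁻¹ ∙ (b ⁻¹ ∙ a) ∙ b ⁻¹ ≈⟨ ∙-congʳ (∙-cong (trans (∙-congʳ rel′) (identityˡ _)) R₁) ⟩
        a ⁻¹ ∙ (a ⁻¹ ∙ (b ∙ N ∙ y) ⁻¹) ∙ b ⁻¹ ≈⟨ solve 4 (λ a b n y → a ⁱ ⊙ (a ⁱ ⊙ (b ⊙ n ⊙ y) ⁱ) ⊙ b ⁱ ⊜ (a ⊙ a) ⁱ ⊙ (b ⊙ b ⊙ n ⊙ y) ⁱ) (Group.refl G) a b N y ⟩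
        g ⁻¹ ∙ Y ⁻¹ ∎

      cN≈ : c ∙ N ≈ b ↑ (+ 2 * (m + + 1))
      cN≈ = trans (∙-cong c≈b² N≈) (trans (sym (↑-+ b (+ 2) (+ 2 * m))) (↑-≡ b (lem m)))
        where
        lem : ∀ m → + 2 + + 2 * m ≡ + 2 * (m + + 1)
        lem = solve-∀

      g-cc : Commute g (c ∙ c)
      g-cc = conj⇒commute (begin
        (c ∙ c) ^ᶜ g ≈⟨ conj-∙ c c g ⟩
        c ^ᶜ g ∙ c ^ᶜ g ≈⟨ ∙-cong c-conj-g c-conj-g ⟩
        (c ∙ z) ∙ (c ∙ z) ≈⟨ ∙-congˡ (z-central c) ⟨
        (c ∙ z) ∙ (z ∙ c) ≈⟨ solve 2 (λ u v → (u ⊙ v) ⊙ (v ⊙ u) ⊜ u ⊙ (v ⊙ v) ⊙ u) (Group.refl G) c z ⟩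
        c ∙ (z ∙ z) ∙ c ≈⟨ ∙-congʳ (trans (∙-congˡ z²) (identityʳ _)) ⟩
        c ∙ c ∎)

      -- The element cN is c^(m+1) with m + 1 even, hence a power of c², and squaring c removes the
      -- z by which a² moves it.
      g-cN : Commute g (c ∙ N)
      g-cN = commute-cong (Group.refl G) (sym eq) (commute-↑ (proj₁ m+1-even) g-cc)
        where
        eq : c ∙ N ≈ (c ∙ c) ↑ proj₁ m+1-even
        eq = let (j , e) = m+1-even in begin
          c ∙ N ≈⟨ ↑-suc c m ⟨
          c ↑ (+ 1 + m) ≈⟨ ↑-≡ c (≡.trans (ℤP.+-comm (+ 1) m) (≡.trans e (ℤP.*-comm (+ 2) j))) ⟩
          c ↑ (j * + 2) ≈⟨ ↑-* c j (+ 2) ⟩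
          (c ↑ + 2) ↑ j ≈⟨ ↑-cong j (∙-congˡ (identityʳ c)) ⟩
          (c ∙ c) ↑ j ∎

      g-Y : Commute g Y
      g-Y = commute-∙ g-cN (sym (commute-∙ (sym y-a) (sym y-a)))

      YY≈ : Y ∙ Y ≈ b ↑ (+ 4 * (m + + 1))
      YY≈ = begin
        c ∙ N ∙ y ∙ (c ∙ N ∙ y) ≈⟨ ∙-congʳ (commute-∙ y-c y-N) ⟨
        y ∙ (c ∙ N) ∙ (c ∙ N ∙ y) ≈⟨ ∙-congˡ (commute-∙ y-c y-N) ⟨
        y ∙ (c ∙ N) ∙ (y ∙ (c ∙ N)) ≈⟨ ∙-congʳ (commute-∙ y-c y-N) ⟩
        c ∙ N ∙ y ∙ (y ∙ (c ∙ N)) ≈⟨ solve 2 (λ u y → u ⊙ y ⊙ (y ⊙ u) ⊜ u ⊙ (y ⊙ y) ⊙ u) (Group.refl G) (c ∙ N) y ⟩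
        c ∙ N ∙ (y ∙ y) ∙ (c ∙ N) ≈⟨ ∙-congʳ (trans (∙-congˡ y²) (identityʳ _)) ⟩
        c ∙ N ∙ (c ∙ N) ≈⟨ ∙-cong cN≈ cN≈ ⟩
        b ↑ (+ 2 * (m + + 1)) ∙ b ↑ (+ 2 * (m + + 1)) ≈⟨ ↑-+ b (+ 2 * (m + + 1)) (+ 2 * (m + + 1)) ⟨
        b ↑ (+ 2 * (m + + 1) + + 2 * (m + + 1)) ≈⟨ ↑-≡ b (lem (m + + 1)) ⟩
        b ↑ (+ 4 * (m + + 1)) ∎
        where
        lem : ∀ t → + 2 * t + + 2 * t ≡ + 4 * t
        lem = solve-∀

      -- The fourth power of a. Passing from a² to a⁴ replaces `Y` by its square, in which y cancels
      -- and a pure power of b remains.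
      h : Carrier
      h = g ∙ g

      h-conj-b : h ^ᶜ b ≈ h ⁻¹ ∙ (Y ∙ Y) ⁻¹
      h-conj-b = begin
        (g ∙ g) ^ᶜ b ≈⟨ conj-∙ g g b ⟩
        g ^ᶜ b ∙ g ^ᶜ b ≈⟨ ∙-cong g-conj-b g-conj-b ⟩
        (g ⁻¹ ∙ Y ⁻¹) ∙ (g ⁻¹ ∙ Y ⁻¹) ≈⟨ solve 2 (λ g y → (g ⁱ ⊙ y ⁱ) ⊙ (g ⁱ ⊙ y ⁱ) ⊜ g ⁱ ⊙ (g ⊙ y) ⁱ ⊙ y ⁱ) (Group.refl G) g Y ⟩
        g ⁻¹ ∙ (g ∙ Y) ⁻¹ ∙ Y ⁻¹ ≈⟨ ∙-congʳ (∙-congˡ (⁻¹-cong g-Y)) ⟩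
        g ⁻¹ ∙ (Y ∙ g) ⁻¹ ∙ Y ⁻¹ ≈⟨ solve 2 (λ g y → g ⁱ ⊙ (y ⊙ g) ⁱ ⊙ y ⁱ ⊜ (g ⊙ g) ⁱ ⊙ (y ⊙ y) ⁱ) (Group.refl G) g Y ⟩
        h ⁻¹ ∙ (Y ∙ Y) ⁻¹ ∎

      hᵏ-conj-b : ∀ k → h ↑ k ^ᶜ b ≈ (h ↑ k) ⁻¹ ∙ ((Y ∙ Y) ↑ k) ⁻¹
      hᵏ-conj-b k = begin
        h ↑ k ^ᶜ b ≈⟨ conj-↑ h k b ⟩
        (h ^ᶜ b) ↑ k ≈⟨ ↑-cong k h-conj-b ⟩
        (h ⁻¹ ∙ (Y ∙ Y) ⁻¹) ↑ k ≈⟨ ∙-↑ k (commute-⁻¹ (sym (commute-⁻¹ (sym hYY)))) ⟩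
        (h ⁻¹) ↑ k ∙ ((Y ∙ Y) ⁻¹) ↑ k ≈⟨ ∙-cong (⁻¹-↑ h k) (⁻¹-↑ (Y ∙ Y) k) ⟩
        (h ↑ k) ⁻¹ ∙ ((Y ∙ Y) ↑ k) ⁻¹ ∎
        where
        g-YY : Commute g (Y ∙ Y)
        g-YY = commute-∙ g-Y g-Y
        hYY : Commute h (Y ∙ Y)
        hYY = sym (commute-∙ (sym g-YY) (sym g-YY))

      y∉B : ∀ k → ¬ (y ≈ b ↑ k)
      y∉B k e = from (proj₁ (independent (2^ α) k e))
        where
        lem : ∀ k s → k * (+ 2 * s) ≡ + 2 * k * s
        lem = solve-∀
        from : ¬ (2^ (suc α) ∣ 2^ α)
        from (divides l f) = ¬even1 (l , ℤP.*-cancelʳ-≡ (+ 1) (+ 2 * l) (2^ α) {{2^-nonZero {α}}}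
          (≡.trans (ℤP.*-identityˡ (2^ α)) (≡.trans f (≡.trans (cong (l *_) (2^-suc α)) (lem l (2^ α))))))

      g≈a² : g ≈ a ↑ + 2
      g≈a² = ∙-congˡ (sym (identityʳ a))

      -- For p = 2 and p = 4 the formula for the conjugate of a² by b would express y as a power of
      -- b. For p ≥ 8, y is the 2^γ-th power of a⁴. Its conjugate by b is yz on one side and y times
      -- the inverse of Y^(2^(γ+1)) on the other, so z is a known power of b.
      large : ∀ δ → α ≡ δ → ∃ λ γ → α ≡ suc (suc γ) × 2^ (suc β) ∣ 2^ γ * (+ 4 * (m + + 1)) + 2^ β
      large zero eq = ⊥-elim (y∉B (- (+ 2 * (m + + 1))) (begin
        y ≈⟨ solve 2 (λ u y → y ⊜ u ⁱ ⊙ (u ⊙ y)) (Group.refl G) (c ∙ N) y ⟩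
        (c ∙ N) ⁻¹ ∙ Y ≈⟨ ∙-congˡ Y≈ε ⟩
        (c ∙ N) ⁻¹ ∙ ε ≈⟨ identityʳ _ ⟩
        (c ∙ N) ⁻¹ ≈⟨ trans (⁻¹-cong cN≈) (sym (↑-neg b (+ 2 * (m + + 1)))) ⟩
        b ↑ (- (+ 2 * (m + + 1))) ∎))
        where
        g≈ε : g ≈ ε
        g≈ε = trans g≈a² (a-∣ (∣-resp (cong (λ t → 2^ (suc t)) eq) ∣-refl))
        Y≈ε : Y ≈ ε
        Y≈ε = begin
          Y ≈⟨ solve 2 (λ g y → y ⊜ (g ⁱ ⊙ y ⁱ) ⁱ ⊙ g ⁱ) (Group.refl G) g Y ⟩
          (g ⁻¹ ∙ Y ⁻¹) ⁻¹ ∙ g ⁻¹ ≈⟨ ∙-congʳ (⁻¹-cong (sym g-conj-b)) ⟩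
          (g ^ᶜ b) ⁻¹ ∙ g ⁻¹ ≈⟨ ∙-cong (⁻¹-cong (conj-cong b g≈ε)) (⁻¹-cong g≈ε) ⟩
          (ε ^ᶜ b) ⁻¹ ∙ ε ⁻¹ ≈⟨ solve 1 (λ b → (b ⊙ one ⊙ b ⁱ) ⁱ ⊙ one ⁱ ⊜ one) (Group.refl G) b ⟩
          ε ∎
      large (suc zero) eq = ⊥-elim (y∉B (- (+ 2 * (m + + 1)) + - 2^ β) (begin
        y ≈⟨ solve 2 (λ y z → y ⊜ y ⊙ z ⊙ z ⁱ) (Group.refl G) y z ⟩
        y ∙ z ∙ z ⁻¹ ≈⟨ ∙-congʳ y-conj-b ⟨
        y ^ᶜ b ∙ z ⁻¹ ≈⟨ ∙-congʳ (conj-cong b y≈g) ⟩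
        g ^ᶜ b ∙ z ⁻¹ ≈⟨ ∙-congʳ g-conj-b ⟩
        g ⁻¹ ∙ Y ⁻¹ ∙ z ⁻¹ ≈⟨ ∙-congʳ (∙-congʳ (⁻¹-cong y≈g)) ⟨
        y ⁻¹ ∙ Y ⁻¹ ∙ z ⁻¹ ≈⟨ ∙-congʳ (solve 2 (λ u y → y ⁱ ⊙ (u ⊙ y) ⁱ ⊜ (y ⊙ y) ⁱ ⊙ u ⁱ) (Group.refl G) (c ∙ N) y) ⟩
        (y ∙ y) ⁻¹ ∙ (c ∙ N) ⁻¹ ∙ z ⁻¹ ≈⟨ ∙-congʳ (trans (∙-congʳ (trans (⁻¹-cong y²) ε⁻¹≈ε)) (identityˡ _)) ⟩
        (c ∙ N) ⁻¹ ∙ z ⁻¹ ≈⟨ ∙-cong (trans (⁻¹-cong cN≈) (sym (↑-neg b (+ 2 * (m + + 1))))) (sym (↑-neg b (2^ β))) ⟩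
        b ↑ (- (+ 2 * (m + + 1))) ∙ b ↑ (- 2^ β) ≈⟨ ↑-+ b (- (+ 2 * (m + + 1))) (- 2^ β) ⟨
        b ↑ (- (+ 2 * (m + + 1)) + - 2^ β) ∎))
        where
        y≈g : y ≈ g
        y≈g = trans (↑-≡ a (cong 2^ eq)) (sym g≈a²)
      large (suc (suc γ)) eq = γ , eq , ∣-b (begin
        b ↑ (2^ γ * (+ 4 * (m + + 1)) + 2^ β) ≈⟨ ↑-+ b (2^ γ * (+ 4 * (m + + 1))) (2^ β) ⟩
        b ↑ (2^ γ * (+ 4 * (m + + 1))) ∙ z ≈⟨ ∙-congʳ (trans (↑-* b (2^ γ) (+ 4 * (m + + 1))) (↑-cong (2^ γ) (sym YY≈))) ⟩
        W ∙ z ≈⟨ ∙-congˡ z≈ ⟩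
        W ∙ W ⁻¹ ≈⟨ inverseʳ W ⟩
        ε ∎)
        where
        W : Carrier
        W = (Y ∙ Y) ↑ 2^ γ
        lem : ∀ s → s * + 4 ≡ + 2 * (+ 2 * s)
        lem = solve-∀
        hᵏ≈y : h ↑ 2^ γ ≈ y
        hᵏ≈y = begin
          h ↑ 2^ γ ≈⟨ ↑-cong (2^ γ) (trans (∙-cong g≈a² g≈a²) (sym (↑-+ a (+ 2) (+ 2)))) ⟩
          (a ↑ + 4) ↑ 2^ γ ≈⟨ ↑-* a (2^ γ) (+ 4) ⟨
          a ↑ (2^ γ * + 4) ≈⟨ ↑-≡ a (≡.trans (lem (2^ γ)) (≡.trans (cong (+ 2 *_) (≡.sym (2^-suc γ))) (≡.trans (≡.sym (2^-suc (suc γ))) (cong 2^ (≡.sym eq))))) ⟩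
          y ∎
        z≈ : z ≈ W ⁻¹
        z≈ = ∙-cancelˡ y z (W ⁻¹) (begin
          y ∙ z ≈⟨ y-conj-b ⟨
          y ^ᶜ b ≈⟨ conj-cong b hᵏ≈y ⟨
          h ↑ 2^ γ ^ᶜ b ≈⟨ hᵏ-conj-b (2^ γ) ⟩
          (h ↑ 2^ γ) ⁻¹ ∙ W ⁻¹ ≈⟨ ∙-congʳ (trans (⁻¹-cong hᵏ≈y) y⁻¹) ⟩
          y ∙ W ⁻¹ ∎)

      chiral-relations : ChiralRelations α β T
      chiral-relations = record
        { m = m ; rel₁ = R₁ ; rel₂ = R₂ ; m-odd = odd-m
        ; m-square = ∣-flip (+ 2 + 2^ β) (+ 2 * (m * m)) (proj₂ square-∣)
        ; p-large = large α refl }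

  classification : Regular a b ⊎ ChiralRelations α β T
  classification = Sum.map
    (λ e → ⟨b²⟩-normal⇒regular T n (trans conj-c (trans (∙-congˡ e) (identityʳ _)))) Twisted.chiral-relations aʷ

-- Exponents and presentations

-- A comparison of 2-adic valuations: with `o` odd, 2^k can divide the right side only for k ≤ l.
2^-*-split : ∀ k l {i o} → Odd o → 2^ k * i ≡ 2^ l * o → ∃ λ δ → l ≡ k ℕ.+ δ × i ≡ 2^ δ * o
2^-*-split zero l {i} _ e = l , refl , ≡.trans (≡.sym (ℤP.*-identityˡ i)) e
2^-*-split (suc k) zero {i} {o} odd e = ⊥-elim (even∧odd⇒⊥ (2^ k * i , lem) odd)
  where
  lem : o ≡ + 2 * (2^ k * i)
  lem = ≡.trans (≡.sym (ℤP.*-identityˡ o)) (≡.trans (≡.sym e) (≡.trans (cong (_* i) (2^-suc k)) (ℤP.*-assoc (+ 2) (2^ k) i)))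
2^-*-split (suc k) (suc l) {i} {o} odd e =
  let (δ , f , h) = 2^-*-split k l {i} {o} odd (2*-injective _ _ (begin
        + 2 * (2^ k * i) ≡⟨ ℤP.*-assoc (+ 2) (2^ k) i ⟨
        + 2 * 2^ k * i ≡⟨ cong (_* i) (2^-suc k) ⟨
        2^ (suc k) * i ≡⟨ e ⟩
        2^ (suc l) * o ≡⟨ cong (_* o) (2^-suc l) ⟩
        + 2 * 2^ l * o ≡⟨ ℤP.*-assoc (+ 2) (2^ l) o ⟩
        + 2 * (2^ l * o) ∎))
  in δ , cong suc f , h
  where open ≡-Reasoning

2^-*-injective : ∀ k l {o o′} → Odd o → Odd o′ → 2^ k * o ≡ 2^ l * o′ → k ≡ l
2^-*-injective k l {o} {o′} odd odd′ e = from (2^-*-split k l odd′ e)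
  where
  from : (∃ λ δ → l ≡ k ℕ.+ δ × o ≡ 2^ δ * o′) → k ≡ l
  from (zero , f , _) = ≡.sym (≡.trans f (ℕP.+-identityʳ k))
  from (suc δ , _ , h) = ⊥-elim (even∧odd⇒⊥ (2^ δ * o′ , ≡.trans h (≡.trans (cong (_* o′) (2^-suc δ)) (ℤP.*-assoc (+ 2) (2^ δ) o′))) odd)

even*ˡ : ∀ {x} y → Even x → Even (x * y)
even*ˡ y (k , refl) = k * y , ℤP.*-assoc (+ 2) k y

-- As `u` is odd, the whole power of 2 sits in `x`.
odd-cofactor : ∀ k {x u o} → Odd u → Odd o → x * u ≡ 2^ k * o → ∃ λ o′ → Odd o′ × x ≡ 2^ k * o′
odd-cofactor zero {x} {u} {o} ou oo e with parity x
... | inj₁ ev = ⊥-elim (even∧odd⇒⊥ (subst Even (≡.trans e (ℤP.*-identityˡ o)) (even*ˡ u ev)) oo)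
... | inj₂ od = x , od , ≡.sym (ℤP.*-identityˡ x)
odd-cofactor (suc k) {x} {u} {o} ou oo e with parity x
... | inj₂ od = ⊥-elim (even∧odd⇒⊥ (2^ k * o , ≡.trans e (≡.trans (cong (_* o) (2^-suc k)) (ℤP.*-assoc (+ 2) (2^ k) o))) (odd*odd od ou))
... | inj₁ (x′ , refl) =
  let (o′ , odd , h) = odd-cofactor k {x′} ou oo (2*-injective _ _ (≡.trans (≡.sym (ℤP.*-assoc (+ 2) x′ u))
        (≡.trans e (≡.trans (cong (_* o) (2^-suc k)) (ℤP.*-assoc (+ 2) (2^ k) o)))))
  in o′ , odd , ≡.trans (cong (+ 2 *_) h) (≡.trans (≡.sym (ℤP.*-assoc (+ 2) (2^ k) o′)) (cong (_* o′) (≡.sym (2^-suc k))))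

consecutive-even : ∀ j → ∃ λ i → j * (j + + 1) ≡ + 2 * i
consecutive-even j with parity j
... | inj₁ (k , refl) = k * (+ 2 * k + + 1) , ℤP.*-assoc (+ 2) k _
... | inj₂ (k , refl) = (+ 1 + + 2 * k) * (k + + 1) , lem k
  where
  lem : ∀ k → (+ 1 + + 2 * k) * (+ 1 + + 2 * k + + 1) ≡ + 2 * ((+ 1 + + 2 * k) * (k + + 1))
  lem = solve-∀

-- With p = 2^(γ+3) and q = 2^(β+1), the first case is p = 8 and the second q = 2p. The factor
-- 2^(2+δ) is q/8, so m is -1 or 1 up to an odd multiple of q/8.
data Exponents (γ β : ℕ) (m : ℤ) : Set where
  first : ∀ δ o → γ ≡ 0 → β ≡ 4 ℕ.+ δ → Odd o → m ≡ 2^ (2 ℕ.+ δ) * o - + 1 → Exponents γ β m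
  second : ∀ δ o → 3 ℕ.+ γ ≡ β → β ≡ 4 ℕ.+ δ → Odd o → m ≡ 2^ (2 ℕ.+ δ) * o + + 1 → Exponents γ β m

2^-+ : ∀ k l → 2^ (k ℕ.+ l) ≡ 2^ k * 2^ l
2^-+ k l = ≡.trans (cong +_ (ℕP.^-distribˡ-+-* 2 k l)) (ℤP.pos-* (2 ^ k) (2 ^ l))

-- For m = 2j + 1 the square congruence says that 8j(j+1) is 2^β times an odd number. Of the
-- consecutive factors j and j + 1 one is odd, so the other carries the full power of 2. If it is j,
-- then m + 1 is twice an odd number and the second congruence forces 2^(γ+3) = 2^β. If it is j + 1,
-- then 4(m+1) is already 2^β times an odd number and γ = 0.
solve-exponents : ∀ γ β m → Odd m → 2^ (suc β) ∣ + 2 * (m * m) - (+ 2 + 2^ β) →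
  2^ (suc β) ∣ 2^ γ * (+ 4 * (m + + 1)) + 2^ β → Exponents γ β m
solve-exponents γ β m (j , refl) (divides k e) (divides l f) = cases (parity j)
  where
  open ≡-Reasoning
  i : ℤ
  i = proj₁ (consecutive-even j)
  step₁ : 2^ 4 * i ≡ 2^ β * (+ 1 + + 2 * k)
  step₁ = begin
    + 16 * i ≡⟨ lem₁ i ⟩
    + 8 * (+ 2 * i) ≡⟨ cong (+ 8 *_) (proj₂ (consecutive-even j)) ⟨
    + 8 * (j * (j + + 1)) ≡⟨ lem₂ j (2^ β) ⟩
    + 2 * ((+ 1 + + 2 * j) * (+ 1 + + 2 * j)) - (+ 2 + 2^ β) + 2^ β ≡⟨ cong (_+ 2^ β) e ⟩
    k * 2^ (suc β) + 2^ β ≡⟨ cong (λ t → k * t + 2^ β) (2^-suc β) ⟩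
    k * (+ 2 * 2^ β) + 2^ β ≡⟨ lem₃ k (2^ β) ⟩
    2^ β * (+ 1 + + 2 * k) ∎
    where
    lem₁ : ∀ i → + 16 * i ≡ + 8 * (+ 2 * i)
    lem₁ = solve-∀
    lem₂ : ∀ j s → + 8 * (j * (j + + 1)) ≡ + 2 * ((+ 1 + + 2 * j) * (+ 1 + + 2 * j)) - (+ 2 + s) + s
    lem₂ = solve-∀
    lem₃ : ∀ k s → k * (+ 2 * s) + s ≡ s * (+ 1 + + 2 * k)
    lem₃ = solve-∀
  split : ∃ λ δ → β ≡ 4 ℕ.+ δ × i ≡ 2^ δ * (+ 1 + + 2 * k)
  split = 2^-*-split 4 β (k , refl) step₁
  δ : ℕ
  δ = proj₁ split
  step₂ : j * (j + + 1) ≡ 2^ (suc δ) * (+ 1 + + 2 * k)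
  step₂ = begin
    j * (j + + 1) ≡⟨ proj₂ (consecutive-even j) ⟩
    + 2 * i ≡⟨ cong (+ 2 *_) (proj₂ (proj₂ split)) ⟩
    + 2 * (2^ δ * (+ 1 + + 2 * k)) ≡⟨ ℤP.*-assoc (+ 2) (2^ δ) _ ⟨
    + 2 * 2^ δ * (+ 1 + + 2 * k) ≡⟨ cong (_* (+ 1 + + 2 * k)) (2^-suc δ) ⟨
    2^ (suc δ) * (+ 1 + + 2 * k) ∎
  step₃ : 2^ γ * (+ 4 * (+ 1 + + 2 * j + + 1)) ≡ 2^ β * (+ 1 + + 2 * (l - + 1))
  step₃ = begin
    2^ γ * (+ 4 * (+ 1 + + 2 * j + + 1)) ≡⟨ lem₁ (2^ γ * (+ 4 * (+ 1 + + 2 * j + + 1))) (2^ β) ⟩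
    2^ γ * (+ 4 * (+ 1 + + 2 * j + + 1)) + 2^ β - 2^ β ≡⟨ cong (_- 2^ β) f ⟩
    l * 2^ (suc β) - 2^ β ≡⟨ cong (λ t → l * t - 2^ β) (2^-suc β) ⟩
    l * (+ 2 * 2^ β) - 2^ β ≡⟨ lem₂ l (2^ β) ⟩
    2^ β * (+ 1 + + 2 * (l - + 1)) ∎
    where
    lem₁ : ∀ x s → x ≡ x + s - s
    lem₁ = solve-∀
    lem₂ : ∀ l s → l * (+ 2 * s) - s ≡ s * (+ 1 + + 2 * (l - + 1))
    lem₂ = solve-∀
  second-case : (∃ λ o → Odd o × j ≡ 2^ (suc δ) * o) → Exponents γ β (+ 1 + + 2 * j)
  second-case (o , odd , h) = second δ o (2^-*-injective (3 ℕ.+ γ) β (2^ δ * o , refl) (l - + 1 , refl) (begin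
      2^ (3 ℕ.+ γ) * (+ 1 + + 2 * (2^ δ * o)) ≡⟨ cong (_* (+ 1 + + 2 * (2^ δ * o))) (2^-+ 3 γ) ⟩
      + 8 * 2^ γ * (+ 1 + + 2 * (2^ δ * o)) ≡⟨ lem₁ (2^ γ) (2^ δ) o ⟩
      2^ γ * (+ 4 * (+ 1 + + 2 * (+ 2 * 2^ δ * o) + + 1)) ≡⟨ cong (λ t → 2^ γ * (+ 4 * (+ 1 + + 2 * (t * o) + + 1))) (2^-suc δ) ⟨
      2^ γ * (+ 4 * (+ 1 + + 2 * (2^ (suc δ) * o) + + 1)) ≡⟨ cong (λ t → 2^ γ * (+ 4 * (+ 1 + + 2 * t + + 1))) h ⟨
      2^ γ * (+ 4 * (+ 1 + + 2 * j + + 1)) ≡⟨ step₃ ⟩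
      2^ β * (+ 1 + + 2 * (l - + 1)) ∎)) (proj₁ (proj₂ split)) odd (begin
      + 1 + + 2 * j ≡⟨ cong (λ t → + 1 + + 2 * t) h ⟩
      + 1 + + 2 * (2^ (suc δ) * o) ≡⟨ lem₂ (2^ (suc δ)) o ⟩
      + 2 * 2^ (suc δ) * o + + 1 ≡⟨ cong (λ t → t * o + + 1) (2^-suc (suc δ)) ⟨
      2^ (2 ℕ.+ δ) * o + + 1 ∎)
    where
    lem₁ : ∀ g d o → + 8 * g * (+ 1 + + 2 * (d * o)) ≡ g * (+ 4 * (+ 1 + + 2 * (+ 2 * d * o) + + 1))
    lem₁ = solve-∀
    lem₂ : ∀ s o → + 1 + + 2 * (s * o) ≡ + 2 * s * o + + 1
    lem₂ = solve-∀
  first-case : (∃ λ o → Odd o × j + + 1 ≡ 2^ (suc δ) * o) → Exponents γ β (+ 1 + + 2 * j)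
  first-case (o , odd , h) = first δ o
      (ℕP.+-cancelʳ-≡ (4 ℕ.+ δ) γ 0 (≡.trans (2^-*-injective (γ ℕ.+ (4 ℕ.+ δ)) β odd (l - + 1 , refl) (begin
        2^ (γ ℕ.+ (4 ℕ.+ δ)) * o ≡⟨ cong (_* o) (≡.trans (2^-+ γ (4 ℕ.+ δ)) (cong (2^ γ *_) (2^-+ 3 (suc δ)))) ⟩
        2^ γ * (+ 8 * 2^ (suc δ)) * o ≡⟨ lem₁ (2^ γ) (2^ (suc δ)) o ⟩
        2^ γ * (+ 8 * (2^ (suc δ) * o)) ≡⟨ cong (λ t → 2^ γ * (+ 8 * t)) h ⟨
        2^ γ * (+ 8 * (j + + 1)) ≡⟨ lem₂ (2^ γ) j ⟩
        2^ γ * (+ 4 * (+ 1 + + 2 * j + + 1)) ≡⟨ step₃ ⟩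
        2^ β * (+ 1 + + 2 * (l - + 1)) ∎)) (proj₁ (proj₂ split))))
      (proj₁ (proj₂ split)) odd (begin
      + 1 + + 2 * j ≡⟨ lem₃ j ⟩
      + 2 * (j + + 1) - + 1 ≡⟨ cong (λ t → + 2 * t - + 1) h ⟩
      + 2 * (2^ (suc δ) * o) - + 1 ≡⟨ cong (_- + 1) (ℤP.*-assoc (+ 2) (2^ (suc δ)) o) ⟨
      + 2 * 2^ (suc δ) * o - + 1 ≡⟨ cong (λ t → t * o - + 1) (2^-suc (suc δ)) ⟨
      2^ (2 ℕ.+ δ) * o - + 1 ∎)
    where
    lem₁ : ∀ g d o → g * (+ 8 * d) * o ≡ g * (+ 8 * (d * o))
    lem₁ = solve-∀
    lem₂ : ∀ g j → g * (+ 8 * (j + + 1)) ≡ g * (+ 4 * (+ 1 + + 2 * j + + 1))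
    lem₂ = solve-∀
    lem₃ : ∀ j → + 1 + + 2 * j ≡ + 2 * (j + + 1) - + 1
    lem₃ = solve-∀
  cases : Even j ⊎ Odd j → Exponents γ β (+ 1 + + 2 * j)
  cases (inj₁ (t , h)) = second-case (odd-cofactor (suc δ) {j} {j + + 1} (t , ≡.trans (cong (_+ + 1) h) (ℤP.+-comm (+ 2 * t) (+ 1))) (k , refl) step₂)
  cases (inj₂ odd) = first-case (odd-cofactor (suc δ) {j + + 1} {j} odd (k , refl) (≡.trans (ℤP.*-comm (j + + 1) j) step₂))

-- Words, presented groups and the normal form in them

invW : Word → Word
invW [] = []
invW (x ∷ w) = invW w ++ invL x ∷ []

invL-involutive : ∀ x → invL (invL x) ≡ x
invL-involutive (⁺ _) = refl
invL-involutive (⁻ _) = refl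

-- Serves both the rotation group and the presented groups. They have the same carrier, so a
-- homomorphism between them that respects the generators is the identity on words.
module WordGroup (_≈_ : Word → Word → Set) (≈-refl : ∀ {u} → u ≈ u)
    (≈-sym : ∀ {u v} → u ≈ v → v ≈ u) (≈-trans : ∀ {u v w} → u ≈ v → v ≈ w → u ≈ w)
    (++-cong : ∀ {u u′ v v′} → u ≈ u′ → v ≈ v′ → (u ++ v) ≈ (u′ ++ v′))
    (cancel : ∀ x → (x ∷ invL x ∷ []) ≈ []) where

  private
    reflexive : ∀ {u v} → u ≡ v → u ≈ v
    reflexive refl = ≈-refl

    invʳ : ∀ w → (w ++ invW w) ≈ []
    invʳ [] = ≈-refl
    invʳ (x ∷ w) = ≈-trans (reflexive (cong (x ∷_) (≡.sym (ListP.++-assoc w (invW w) (invL x ∷ [])))))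
      (≈-trans (++-cong {x ∷ []} ≈-refl (++-cong (invʳ w) (≈-refl {invL x ∷ []}))) (cancel x))

    invˡ : ∀ w → (invW w ++ w) ≈ []
    invˡ [] = ≈-refl
    invˡ (x ∷ w) = ≈-trans (reflexive (ListP.++-assoc (invW w) (invL x ∷ []) (x ∷ w)))
      (≈-trans (++-cong (≈-refl {invW w}) (++-cong {invL x ∷ x ∷ []} {[]} {w} {w}
        (subst (λ t → (invL x ∷ t ∷ []) ≈ []) (invL-involutive x) (cancel (invL x))) ≈-refl)) (invˡ w))

    inv-cong : ∀ {u v} → u ≈ v → invW u ≈ invW v
    inv-cong {u} {v} e =
      ≈-trans (reflexive (≡.sym (ListP.++-identityʳ (invW u))))
      (≈-trans (++-cong (≈-refl {invW u}) (≈-sym (invʳ v)))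
      (≈-trans (++-cong (≈-refl {invW u}) (++-cong (≈-sym e) (≈-refl {invW v})))
      (≈-trans (reflexive (≡.sym (ListP.++-assoc (invW u) u (invW v)))) (++-cong (invˡ u) ≈-refl))))

  wordGroup : Group 0ℓ 0ℓ
  wordGroup = record
    { Carrier = Word ; _≈_ = _≈_ ; _∙_ = _++_ ; ε = [] ; _⁻¹ = invW
    ; isGroup = record
      { isMonoid = record
        { isSemigroup = record
          { isMagma = record
            { isEquivalence = record { refl = ≈-refl ; sym = ≈-sym ; trans = ≈-trans }
            ; ∙-cong = ++-cong }
          ; assoc = λ u v w → reflexive (ListP.++-assoc u v w) }
        ; identity = (λ w → ≈-refl) , (λ w → reflexive (ListP.++-identityʳ w)) }
      ; inverse = invˡ , invʳ
      ; ⁻¹-cong = inv-cong } }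

word₁ word₂ : Word
word₁ = ⁺ s₁ ∷ []
word₂ = ⁺ s₂ ∷ []

eval-word : ∀ w → evalAt _++_ [] invW word₁ word₂ w ≡ w
eval-word [] = refl
eval-word (⁺ s₁ ∷ w) = cong (⁺ s₁ ∷_) (eval-word w)
eval-word (⁺ s₂ ∷ w) = cong (⁺ s₂ ∷_) (eval-word w)
eval-word (⁻ s₁ ∷ w) = cong (⁻ s₁ ∷_) (eval-word w)
eval-word (⁻ s₂ ∷ w) = cong (⁻ s₂ ∷_) (eval-word w)

module _ (R : List (Word × Word)) where
  private
    cast : ∀ {u u′ v v′} → u ≡ u′ → v ≡ v′ → PresEq R u v → PresEq R u′ v′
    cast refl refl e = e

    prepend : ∀ t {u v} → PresEq R u v → PresEq R (t ++ u) (t ++ v)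
    prepend t (p-refl w) = p-refl _
    prepend t (p-sym e) = p-sym (prepend t e)
    prepend t (p-trans e f) = p-trans (prepend t e) (prepend t f)
    prepend t (p-free u v x) = cast (ListP.++-assoc t u _) (ListP.++-assoc t u _) (p-free (t ++ u) v x)
    prepend t (p-rel u v l r i) = cast (ListP.++-assoc t u _) (ListP.++-assoc t u _) (p-rel (t ++ u) v l r i)

    append : ∀ t {u v} → PresEq R u v → PresEq R (u ++ t) (v ++ t)
    append t (p-refl w) = p-refl _
    append t (p-sym e) = p-sym (append t e)
    append t (p-trans e f) = p-trans (append t e) (append t f)
    append t (p-free u v x) = cast (≡.sym (ListP.++-assoc u _ t)) (≡.sym (ListP.++-assoc u v t)) (p-free u (v ++ t) x)
    append t (p-rel u v l r i) = cast (assoc₃ l) (assoc₃ r) (p-rel u (v ++ t) l r i)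
      where
      assoc₃ : ∀ l → u ++ l ++ (v ++ t) ≡ (u ++ l ++ v) ++ t
      assoc₃ l = ≡.sym (≡.trans (ListP.++-assoc u (l ++ v) t) (cong (u ++_) (ListP.++-assoc l v t)))

    pres-cong : ∀ {u u′ v v′} → PresEq R u u′ → PresEq R v v′ → PresEq R (u ++ v) (u′ ++ v′)
    pres-cong {u′ = u′} {v} e f = p-trans (append v e) (prepend u′ f)

  open WordGroup (PresEq R) (p-refl _) p-sym p-trans pres-cong (p-free [] [])
    public renaming (wordGroup to presentedGroup)

-- Applied to Γ, where it identifies the exponents, and to the presented group, where the order
-- relations together with `R₁` and `R₂` must yield the normal form. In the latter neither
-- centrality of z nor its product relation with y may be assumed; both are recovered as far as
-- necessary.
module ChiralPresentation (G : Group 0ℓ 0ℓ) (a b : Group.Carrier G) (α β : ℕ) (m i₁ j₁ i₂ j₂ : ℤ)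
    (a-order : Group._≈_ G (Powers._↑_ G a (2^ (suc α))) (Group.ε G))
    (b-order : Group._≈_ G (Powers._↑_ G b (2^ (suc β))) (Group.ε G))
    (i₁≡ : 2^ (suc α) ∣ i₁ - (-[1+ 0 ] + 2^ α)) (j₁≡ : 2^ (suc β) ∣ j₁ - - (+ 1 + + 2 * m))
    (i₂≡ : 2^ (suc α) ∣ i₂ - (+ 1 + 2^ α)) (j₂≡ : 2^ (suc β) ∣ j₂ - (+ 2 * m + 2^ β + + 1)) where
  open Group G hiding (refl; _-_)
  open Powers G
  open Evaluation G
  open GroupSolver G
  open Closure G a b
  open import Algebra.Properties.Group G
  open import Relation.Binary.Reasoning.Setoid setoid

  private
    c y z N : Carrier
    c = b ∙ b
    y = a ↑ 2^ α
    z = b ↑ 2^ β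
    N = c ↑ m

    half² : ∀ x k → x ↑ 2^ (suc k) ≈ ε → x ↑ 2^ k ∙ x ↑ 2^ k ≈ ε
    half² x k o = trans (sym (↑-+ x (2^ k) (2^ k))) (trans (↑-≡ x (≡.trans (lem (2^ k)) (≡.sym (2^-suc k)))) o)
      where
      lem : ∀ s → s + s ≡ + 2 * s
      lem = solve-∀

    y² : y ∙ y ≈ ε
    y² = half² a α a-order

    z² : z ∙ z ≈ ε
    z² = half² b β b-order

    y⁻¹ : y ⁻¹ ≈ y
    y⁻¹ = sym (inverseˡ-unique y y y²)

  exponents₁ : a ↑ i₁ ∙ b ↑ j₁ ≈ a ⁻¹ ∙ (b ∙ N ∙ y) ⁻¹
  exponents₁ = begin
    a ↑ i₁ ∙ b ↑ j₁ ≈⟨ ∙-cong (↑-mod a _ i₁ (-[1+ 0 ] + 2^ α) a-order i₁≡) (↑-mod b _ j₁ (- (+ 1 + + 2 * m)) b-order j₁≡) ⟩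
    a ↑ (-[1+ 0 ] + 2^ α) ∙ b ↑ (- (+ 1 + + 2 * m)) ≈⟨ ∙-cong (↑-pred a (2^ α)) (↑-neg b (+ 1 + + 2 * m)) ⟩
    a ⁻¹ ∙ y ∙ (b ↑ (+ 1 + + 2 * m)) ⁻¹ ≈⟨ ∙-cong (∙-congˡ (sym y⁻¹)) (⁻¹-cong (trans (↑-suc b (+ 2 * m)) (∙-congˡ (b-double m)))) ⟩
    a ⁻¹ ∙ y ⁻¹ ∙ (b ∙ N) ⁻¹ ≈⟨ solve 3 (λ a y u → a ⁱ ⊙ y ⁱ ⊙ u ⁱ ⊜ a ⁱ ⊙ (u ⊙ y) ⁱ) (Group.refl G) a y (b ∙ N) ⟩
    a ⁻¹ ∙ (b ∙ N ∙ y) ⁻¹ ∎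

  exponents₂ : a ↑ i₂ ∙ b ↑ j₂ ≈ a ∙ (y ∙ N ∙ z) ∙ b
  exponents₂ = begin
    a ↑ i₂ ∙ b ↑ j₂ ≈⟨ ∙-cong (↑-mod a _ i₂ (+ 1 + 2^ α) a-order i₂≡) (↑-mod b _ j₂ (+ 2 * m + 2^ β + + 1) b-order j₂≡) ⟩
    a ↑ (+ 1 + 2^ α) ∙ b ↑ (+ 2 * m + 2^ β + + 1) ≈⟨ ∙-cong (↑-suc a (2^ α)) (trans (↑-+ b (+ 2 * m + 2^ β) (+ 1)) (∙-cong (↑-+ b (+ 2 * m) (2^ β)) (↑-1 b))) ⟩
    a ∙ y ∙ (b ↑ (+ 2 * m) ∙ z ∙ b) ≈⟨ ∙-congˡ (∙-congʳ (∙-congʳ (b-double m))) ⟩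
    a ∙ y ∙ (N ∙ z ∙ b) ≈⟨ solve 5 (λ a y n z b → a ⊙ y ⊙ (n ⊙ z ⊙ b) ⊜ a ⊙ (y ⊙ n ⊙ z) ⊙ b) (Group.refl G) a y N z b ⟩
    a ∙ (y ∙ N ∙ z) ∙ b ∎

  module _ (r : a ∙ b ∙ (a ∙ b) ≈ ε) (even : Even (2^ β))
      (R₁ : b ⁻¹ ∙ a ≈ a ↑ i₁ ∙ b ↑ j₁) (R₂ : b ∙ a ⁻¹ ≈ a ↑ i₂ ∙ b ↑ j₂) where
    private
      A₁ : c ^ᶜ a ≈ N ∙ y
      A₁ = ∙-cancelˡ b _ _ (trans (⁻¹-injective (∙-cancelˡ (a ⁻¹) _ _ (trans (sym (b⁻¹a≈ r)) (trans R₁ exponents₁)))) (assoc b N y))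

      A₂ : c ^ᶜ (a ⁻¹) ≈ y ∙ N ∙ z
      A₂ = ∙-cancelˡ a _ _ (∙-cancelʳ b _ _ (trans (sym (ba⁻¹≈ r)) (trans R₂ exponents₂)))

      b-N : Commute b N
      b-N = commute-↑ m (commute-∙ (Group.refl G) (Group.refl G))

      b-z : Commute b z
      b-z = commute-↑ (2^ β) (Group.refl G)

      c-N : Commute c N
      c-N = sym (commute-∙ (sym b-N) (sym b-N))

      c-z : Commute c z
      c-z = sym (commute-∙ (sym b-z) (sym b-z))

      N-z : Commute N z
      N-z = sym (commute-↑ m (sym c-z))

      first-image : y ∙ N ∙ z ≈ N ∙ y ^ᶜ b
      first-image = begin
        y ∙ N ∙ z ≈⟨ A₂ ⟨
        c ^ᶜ (a ⁻¹) ≈⟨ trans (conj-a⁻¹ r) (conj-cong b A₁) ⟩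
        (N ∙ y) ^ᶜ b ≈⟨ conj-∙ N y b ⟩
        N ^ᶜ b ∙ y ^ᶜ b ≈⟨ ∙-congʳ (commute⇒conj b-N) ⟩
        N ∙ y ^ᶜ b ∎

      -- Conjugating by b after a⁻¹ is conjugating by ba⁻¹, which `R₂` rewrites. The factors of that
      -- product that are powers of b fix c, so only a and y act.
      second-image : (y ∙ N ∙ z) ^ᶜ b ≈ y ∙ N
      second-image = begin
        (y ∙ N ∙ z) ^ᶜ b ≈⟨ conj-cong b A₂ ⟨
        (c ^ᶜ (a ⁻¹)) ^ᶜ b ≈⟨ solve 3 (λ a b c → b ⊙ (a ⁱ ⊙ c ⊙ a ⁱ ⁱ) ⊙ b ⁱ ⊜ (b ⊙ a ⁱ) ⊙ c ⊙ (b ⊙ a ⁱ) ⁱ) (Group.refl G) a b c ⟩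
        c ^ᶜ (b ∙ a ⁻¹) ≈⟨ ∙-cong (∙-congʳ eq) (⁻¹-cong eq) ⟩
        c ^ᶜ (a ∙ (y ∙ N ∙ z) ∙ b) ≈⟨ solve 6 (λ a y n z b c → (a ⊙ (y ⊙ n ⊙ z) ⊙ b) ⊙ c ⊙ (a ⊙ (y ⊙ n ⊙ z) ⊙ b) ⁱ ⊜ a ⊙ (y ⊙ ((n ⊙ z ⊙ b) ⊙ c ⊙ (n ⊙ z ⊙ b) ⁱ) ⊙ y ⁱ) ⊙ a ⁱ) (Group.refl G) a y N z b c ⟩
        ((c ^ᶜ (N ∙ z ∙ b)) ^ᶜ y) ^ᶜ a ≈⟨ conj-cong a (conj-cong y (commute⇒conj (sym (commute-∙ (commute-∙ c-N c-z) (sym (commute-∙ (Group.refl G) (Group.refl G))))))) ⟩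
        (c ^ᶜ y) ^ᶜ a ≈⟨ solve 3 (λ a y c → a ⊙ (y ⊙ c ⊙ y ⁱ) ⊙ a ⁱ ⊜ (a ⊙ y) ⊙ c ⊙ (a ⊙ y) ⁱ) (Group.refl G) a y c ⟩
        c ^ᶜ (a ∙ y) ≈⟨ ∙-cong (∙-congʳ ay) (⁻¹-cong ay) ⟩
        c ^ᶜ (y ∙ a) ≈⟨ solve 3 (λ a y c → (y ⊙ a) ⊙ c ⊙ (y ⊙ a) ⁱ ⊜ y ⊙ (a ⊙ c ⊙ a ⁱ) ⊙ y ⁱ) (Group.refl G) a y c ⟩
        (c ^ᶜ a) ^ᶜ y ≈⟨ conj-cong y A₁ ⟩
        (N ∙ y) ^ᶜ y ≈⟨ solve 2 (λ n y → y ⊙ (n ⊙ y) ⊙ y ⁱ ⊜ y ⊙ n) (Group.refl G) N y ⟩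
        y ∙ N ∎
        where
        eq : b ∙ a ⁻¹ ≈ a ∙ (y ∙ N ∙ z) ∙ b
        eq = trans R₂ exponents₂
        ay : a ∙ y ≈ y ∙ a
        ay = commute-↑ (2^ α) (Group.refl G)

      -- Obtained by feeding one image into the other: N times `second-image` contains N times the
      -- conjugate of y by b, which `first-image` evaluates; the two factors z then cancel.
      y-N : Commute y N
      y-N = sym (∙-cancelʳ N (N ∙ y) (y ∙ N) (begin
        N ∙ y ∙ N ≈⟨ assoc N y N ⟩
        N ∙ (y ∙ N) ≈⟨ ∙-congˡ second-image ⟨
        N ∙ (y ∙ N ∙ z) ^ᶜ b ≈⟨ ∙-congˡ (trans (conj-∙ (y ∙ N) z b) (∙-cong (conj-∙ y N b) (commute⇒conj b-z))) ⟩
        N ∙ (y ^ᶜ b ∙ N ^ᶜ b ∙ z) ≈⟨ ∙-congˡ (∙-congʳ (∙-congˡ (commute⇒conj b-N))) ⟩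
        N ∙ (y ^ᶜ b ∙ N ∙ z) ≈⟨ solve 3 (λ n u z → n ⊙ (u ⊙ n ⊙ z) ⊜ (n ⊙ u) ⊙ (n ⊙ z)) (Group.refl G) N (y ^ᶜ b) z ⟩
        N ∙ y ^ᶜ b ∙ (N ∙ z) ≈⟨ ∙-congʳ first-image ⟨
        y ∙ N ∙ z ∙ (N ∙ z) ≈⟨ ∙-congˡ N-z ⟩
        y ∙ N ∙ z ∙ (z ∙ N) ≈⟨ solve 3 (λ y n z → y ⊙ n ⊙ z ⊙ (z ⊙ n) ⊜ y ⊙ n ⊙ (z ⊙ z) ⊙ n) (Group.refl G) y N z ⟩
        y ∙ N ∙ (z ∙ z) ∙ N ≈⟨ ∙-congʳ (trans (∙-congˡ z²) (identityʳ _)) ⟩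
        y ∙ N ∙ N ∎))

      y-conj-b : y ^ᶜ b ≈ y ∙ z
      y-conj-b = ∙-cancelˡ N _ _ (trans (sym first-image) (trans (∙-congʳ y-N) (assoc N y z)))

      y-c : Commute y c
      y-c = sym (conj⇒commute (begin
        y ^ᶜ (b ∙ b) ≈⟨ solve 2 (λ b y → (b ⊙ b) ⊙ y ⊙ (b ⊙ b) ⁱ ⊜ b ⊙ (b ⊙ y ⊙ b ⁱ) ⊙ b ⁱ) (Group.refl G) b y ⟩
        (y ^ᶜ b) ^ᶜ b ≈⟨ conj-cong b y-conj-b ⟩
        (y ∙ z) ^ᶜ b ≈⟨ conj-∙ y z b ⟩
        y ^ᶜ b ∙ z ^ᶜ b ≈⟨ ∙-cong y-conj-b (commute⇒conj b-z) ⟩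
        y ∙ z ∙ z ≈⟨ trans (assoc y z z) (trans (∙-congˡ z²) (identityʳ y)) ⟩
        y ∎))

      -- Since q/2 is even, z is a power of b², and y therefore commutes with it.
      z≈ : z ≈ c ↑ proj₁ even
      z≈ = trans (↑-≡ b (proj₂ even)) (b-double (proj₁ even))

      y-z : Commute y z
      y-z = commute-cong (Group.refl G) (sym z≈) (commute-↑ (proj₁ even) y-c)

      N≈ : N ≈ b ↑ (+ 2 * m)
      N≈ = sym (b-double m)

      Nz≈ : N ∙ z ≈ b ↑ (+ 2 * m + 2^ β)
      Nz≈ = trans (∙-congʳ N≈) (sym (↑-+ b (+ 2 * m) (2^ β)))

    chiral-normalForm : ∀ w → ∃₂ λ s t → eval a b w ≈ b ↑ s ∙ a ↑ t
    chiral-normalForm = closure {+ 2 * m} {2^ α} {+ 2 * m + 2^ β} {2^ α} r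
      (commute-cong N≈ (Group.refl G) (sym y-N)) (trans A₁ (∙-congʳ N≈))
      (commute-cong Nz≈ (Group.refl G) (sym (commute-∙ y-N y-z)))
      (trans A₂ (trans (trans (assoc y N z) (commute-∙ y-N y-z)) (∙-congʳ Nz≈)))

module WordPresentation (_≈_ : Word → Word → Set) (≈-refl : ∀ {u} → u ≈ u)
    (≈-sym : ∀ {u v} → u ≈ v → v ≈ u) (≈-trans : ∀ {u v w} → u ≈ v → v ≈ w → u ≈ w)
    (++-cong : ∀ {u u′ v v′} → u ≈ u′ → v ≈ v′ → (u ++ v) ≈ (u′ ++ v′))
    (cancel : ∀ x → (x ∷ invL x ∷ []) ≈ []) where

  open WordGroup _≈_ ≈-refl ≈-sym ≈-trans ++-cong cancel public

  PresentedBy : List (Word × Word) → Set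
  PresentedBy R = (∀ w w′ → PresEq R w w′ → w ≈ w′) × (∀ w w′ → w ≈ w′ → PresEq R w w′)

  private
    reflexive : ∀ {u v} → u ≡ v → u ≈ v
    reflexive refl = ≈-refl

  sound : ∀ {R} → (∀ {l r} → (l , r) ∈ R → l ≈ r) → ∀ {w w′} → PresEq R w w′ → w ≈ w′
  sound h (p-refl w) = ≈-refl
  sound h (p-sym e) = ≈-sym (sound h e)
  sound h (p-trans e f) = ≈-trans (sound h e) (sound h f)
  sound h (p-free u v x) = ++-cong (≈-refl {u}) (++-cong (cancel x) (≈-refl {v}))
  sound h (p-rel u v l r i) = ++-cong (≈-refl {u}) (++-cong (h i) (≈-refl {v}))

  relation : ∀ {R l r} → (l , r) ∈ R → PresEq R l r
  relation {R} {l} {r} i = subst₂ (PresEq R) (ListP.++-identityʳ l) (ListP.++-identityʳ r) (p-rel [] [] l r i)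

  private
    G : Group 0ℓ 0ℓ
    G = wordGroup
    module ↑G = Powers G

  pow≈ : ∀ s k → pow s k ≈ (Evaluation.gen G word₁ word₂ s ↑G.↑ k)
  pow≈ s k = ≈-trans (reflexive (≡.sym (eval-word (pow s k)))) (Evaluation.eval-pow G word₁ word₂ s k)

  module _ (α β : ℕ) (T : IsTight G word₁ word₂ (2 ^ suc α) (2 ^ suc β)) (C : ChiralRelations α β T) where
    open ChiralRelations C
    open TightProps T

    module _ (even : Even (2^ β)) (i₁ j₁ i₂ j₂ : ℤ)
        (i₁≡ : 2^ (suc α) ∣ i₁ - (-[1+ 0 ] + 2^ α)) (j₁≡ : 2^ (suc β) ∣ j₁ - - (+ 1 + + 2 * m))
        (i₂≡ : 2^ (suc α) ∣ i₂ - (+ 1 + 2^ α)) (j₂≡ : 2^ (suc β) ∣ j₂ - (+ 2 * m + 2^ β + + 1)) where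
      private
        R : List (Word × Word)
        R = ΓRel (2 ^ suc α) (2 ^ suc β) i₁ j₁ i₂ j₂

        H : Group 0ℓ 0ℓ
        H = presentedGroup R
        module H = Group H
        module ↑H = Powers H

        powH : ∀ s k → PresEq R (pow s k) (Evaluation.gen H word₁ word₂ s ↑H.↑ k)
        powH s k = p-trans (H.reflexive (≡.sym (eval-word (pow s k)))) (Evaluation.eval-pow H word₁ word₂ s k)

        a-orderH : PresEq R (word₁ ↑H.↑ 2^ (suc α)) []
        a-orderH = p-trans (p-sym (powH s₁ (2^ (suc α)))) (relation (here refl))

        b-orderH : PresEq R (word₂ ↑H.↑ 2^ (suc β)) []
        b-orderH = p-trans (p-sym (powH s₂ (2^ (suc β)))) (relation (there (here refl)))

        module PG = ChiralPresentation G word₁ word₂ α β m i₁ j₁ i₂ j₂ a-order b-order i₁≡ j₁≡ i₂≡ j₂≡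
        module PH = ChiralPresentation H word₁ word₂ α β m i₁ j₁ i₂ j₂ a-orderH b-orderH i₁≡ j₁≡ i₂≡ j₂≡

        holds : ∀ {l r} → (l , r) ∈ R → l ≈ r
        holds (here refl) = ≈-trans (pow≈ s₁ (2^ (suc α))) a-order
        holds (there (here refl)) = ≈-trans (pow≈ s₂ (2^ (suc β))) b-order
        holds (there (there (here refl))) = rel
        holds (there (there (there (here refl)))) =
          ≈-trans rel₁ (≈-trans (≈-sym PG.exponents₁) (≈-sym (++-cong (pow≈ s₁ i₁) (pow≈ s₂ j₁))))
        holds (there (there (there (there (here refl))))) =
          ≈-trans rel₂ (≈-trans (≈-sym PG.exponents₂) (≈-sym (++-cong (pow≈ s₁ i₂) (pow≈ s₂ j₂))))

        normalFormH : ∀ w → ∃₂ λ s t → PresEq R w ((word₂ ↑H.↑ s) ++ (word₁ ↑H.↑ t))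
        normalFormH w =
          let (s , t , e) = PH.chiral-normalForm (relation (there (there (here refl)))) even
                (p-trans (relation (there (there (there (here refl))))) (H.∙-cong (powH s₁ i₁) (powH s₂ j₁)))
                (p-trans (relation (there (there (there (there (here refl)))))) (H.∙-cong (powH s₁ i₂) (powH s₂ j₂))) w
          in s , t , p-trans (H.reflexive (≡.sym (eval-word w))) e

        -- The relations reduce w to b^s a^t. As they hold in Γ, that product is trivial there,
        -- independence gives q | s and p | t, and the order relations remove both powers already in
        -- the presented group.
        trivial : ∀ w → w ≈ [] → PresEq R w []
        trivial w e = from (normalFormH w)
          where
          neg : ∀ y → - - y ≡ y
          neg = solve-∀
          from : (∃₂ λ s t → PresEq R w ((word₂ ↑H.↑ s) ++ (word₁ ↑H.↑ t))) → PresEq R w []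
          from (s , t , f) = p-trans f (H.∙-cong (↑H.↑-∣ b-orderH (∣-resp (neg s) (∣m⇒∣-m (proj₂ d)))) (↑H.↑-∣ a-orderH (proj₁ d)))
            where
            open import Algebra.Properties.Group G using (inverseʳ-unique)
            d : 2^ (suc α) ∣ t × 2^ (suc β) ∣ - s
            d = independent t (- s) (≈-trans (inverseʳ-unique (word₂ ↑G.↑ s) (word₁ ↑G.↑ t) (≈-trans (≈-sym (sound holds f)) e)) (≈-sym (↑G.↑-neg word₂ s)))

      presentedBy : PresentedBy R
      presentedBy = (λ w w′ → sound holds) , λ w w′ e →
        HP.x∙y⁻¹≈ε⇒x≈y w w′ (trivial (w ++ invW w′) (GP.x≈y⇒x∙y⁻¹≈ε e))
        where
        import Algebra.Properties.Group H as HP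
        import Algebra.Properties.Group G as GP

    -- The exponents contain 2m = (q/4)o + 2t with t = 1 or -1, taken modulo q, so only o modulo 4
    -- matters. The minus sign makes `s` the sign that appears in j₁.
    sign-choice : ∀ o → Odd o → ∃ λ s → ∃ λ k → o ≡ + 4 * k - sgn s
    sign-choice o (j , e) with parity j
    ... | inj₁ (k , f) = false , k , ≡.trans e (≡.trans (cong (λ t → + 1 + + 2 * t) f) (lem k))
      where
      lem : ∀ k → + 1 + + 2 * (+ 2 * k) ≡ + 4 * k - -[1+ 0 ]
      lem = solve-∀
    ... | inj₂ (k , f) = true , k + + 1 , ≡.trans e (≡.trans (cong (λ t → + 1 + + 2 * t) f) (lem k))
      where
      lem : ∀ k → + 1 + + 2 * (+ 1 + + 2 * k) ≡ + 4 * (k + + 1) - + 1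
      lem = solve-∀

    Conclusion : Set
    Conclusion =
      (suc α ≡ 3 × 5 ≤ suc β × Σ Bool (λ s → PresentedBy
        (ΓRel 8 (2 ^ suc β) (+ 3) (+ 1 + sgn s * + (2 ^ (suc β ∸ 2)))
                            (-[1+ 2 ]) (-[1+ 0 ] + sgn s * + (2 ^ (suc β ∸ 2))))))
      ⊎
      (suc β ≡ suc (suc α) × 4 ≤ suc α × Σ Bool (λ s → PresentedBy
        (ΓRel (2 ^ suc α) (2 ^ suc (suc α)) (-[1+ 0 ] + + (2 ^ (suc α ∸ 1))) (-[1+ 2 ] + sgn s * + (2 ^ (suc α ∸ 1)))
                                  (+ 1 + + (2 ^ (suc α ∸ 1))) (+ 3 + sgn s * + (2 ^ (suc α ∸ 1))))))

    conclusion : Conclusion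
    conclusion = from p-large
      where
      half-sgn : Bool → ℤ
      half-sgn true = + 0
      half-sgn false = -[1+ 0 ]

      sgn≡ : ∀ s → sgn s ≡ + 1 + + 2 * half-sgn s
      sgn≡ true = refl
      sgn≡ false = refl

      module _ (δ : ℕ) where
        D : ℤ
        D = 2^ (2 ℕ.+ δ)

        3+δ : 2^ (3 ℕ.+ δ) ≡ + 2 * D
        3+δ = 2^-suc (2 ℕ.+ δ)

        4+δ : 2^ (4 ℕ.+ δ) ≡ + 4 * D
        4+δ = ≡.trans (2^-suc (3 ℕ.+ δ)) (≡.trans (cong (+ 2 *_) 3+δ) (≡.sym (ℤP.*-assoc (+ 2) (+ 2) D)))

        5+δ : 2^ (5 ℕ.+ δ) ≡ + 8 * D
        5+δ = ≡.trans (2^-suc (4 ℕ.+ δ)) (≡.trans (cong (+ 2 *_) 4+δ) (≡.sym (ℤP.*-assoc (+ 2) (+ 4) D)))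

        -- With t = ±1, both families have m = 2^(δ+2) o + t, j₁ = -(1 + 2t) ± 2^(δ+3)
        -- and j₂ = 1 + 2t ± 2^(δ+3).
        j₁-congruence : ∀ s k o t → o ≡ + 4 * k - sgn s →
          2^ (5 ℕ.+ δ) ∣ - (+ 1 + + 2 * t) + sgn s * 2^ (3 ℕ.+ δ) - - (+ 1 + + 2 * (D * o + t))
        j₁-congruence s k o t refl = divides k (≡.trans (cong (λ r → - (+ 1 + + 2 * t) + sgn s * r - - (+ 1 + + 2 * (D * (+ 4 * k - sgn s) + t))) 3+δ)
          (≡.trans (lem (sgn s) k D t) (cong (k *_) (≡.sym 5+δ))))
          where
          lem : ∀ s k d t → - (+ 1 + + 2 * t) + s * (+ 2 * d) - - (+ 1 + + 2 * (d * (+ 4 * k - s) + t)) ≡ k * (+ 8 * d)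
          lem = solve-∀

        -- An odd s satisfies 2 - s ≡ s modulo 4, so the additional q/2 turns -s q/4 into s q/4.
        -- This is why the same sign occurs in both places.
        j₂-congruence : ∀ s k o t → o ≡ + 4 * k - sgn s →
          2^ (5 ℕ.+ δ) ∣ + 1 + + 2 * t + sgn s * 2^ (3 ℕ.+ δ) - (+ 2 * (D * o + t) + 2^ (4 ℕ.+ δ) + + 1)
        j₂-congruence s k o t refl = divides (half-sgn s - k) (≡.trans
          (cong₂ (λ r r′ → + 1 + + 2 * t + sgn s * r - (+ 2 * (D * (+ 4 * k - sgn s) + t) + r′ + + 1)) 3+δ 4+δ)
          (≡.trans (cong (λ u → + 1 + + 2 * t + u * (+ 2 * D) - (+ 2 * (D * (+ 4 * k - u) + t) + + 4 * D + + 1)) (sgn≡ s))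
          (≡.trans (lem (half-sgn s) k D t) (cong ((half-sgn s - k) *_) (≡.sym 5+δ)))))
          where
          lem : ∀ h k d t → + 1 + + 2 * t + (+ 1 + + 2 * h) * (+ 2 * d) - (+ 2 * (d * (+ 4 * k - (+ 1 + + 2 * h)) + t) + + 4 * d + + 1)
            ≡ (h - k) * (+ 8 * d)
          lem = solve-∀

        even-half : Even (2^ (4 ℕ.+ δ))
        even-half = 2^ (3 ℕ.+ δ) , 2^-suc (3 ℕ.+ δ)

      family : ∀ γ → α ≡ suc (suc γ) → Exponents γ β m → Conclusion
      -- For p = 8 the exponents -1 + p/2 and 1 + p/2 are 3 and 5, and 5 ≡ -3 modulo 8.
      family γ refl (first δ o refl refl odd m≡) = inj₁ (refl , ℕP.m≤m+n 5 δ , s , presentedBy (even-half δ)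
          (+ 3) (+ 1 + sgn s * 2^ (3 ℕ.+ δ)) -[1+ 2 ] (-[1+ 0 ] + sgn s * 2^ (3 ℕ.+ δ))
          (divides (+ 0) refl) (subst (λ x → 2^ (5 ℕ.+ δ) ∣ + 1 + sgn s * 2^ (3 ℕ.+ δ) - - (+ 1 + + 2 * x)) (≡.sym m≡) (j₁-congruence δ s k o -[1+ 0 ] e))
          (divides -[1+ 0 ] refl) (subst (λ x → 2^ (5 ℕ.+ δ) ∣ -[1+ 0 ] + sgn s * 2^ (3 ℕ.+ δ) - (+ 2 * x + 2^ (4 ℕ.+ δ) + + 1)) (≡.sym m≡) (j₂-congruence δ s k o -[1+ 0 ] e)))
        where
        choice : ∃ λ s → ∃ λ k → o ≡ + 4 * k - sgn s
        choice = sign-choice o odd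
        s : Bool
        s = proj₁ choice
        k : ℤ
        k = proj₁ (proj₂ choice)
        e : o ≡ + 4 * k - sgn s
        e = proj₂ (proj₂ choice)
      -- For q = 2p the term q/4 equals p/2, so 2^(3+δ) is the constant in all four exponents.
      family γ refl (second δ o refl refl odd m≡) = inj₂ (refl , ℕP.m≤m+n 4 δ , s , presentedBy (even-half δ)
          (-[1+ 0 ] + 2^ (3 ℕ.+ δ)) (-[1+ 2 ] + sgn s * 2^ (3 ℕ.+ δ)) (+ 1 + 2^ (3 ℕ.+ δ)) (+ 3 + sgn s * 2^ (3 ℕ.+ δ))
          (self (-[1+ 0 ] + 2^ (3 ℕ.+ δ))) (subst (λ x → 2^ (5 ℕ.+ δ) ∣ -[1+ 2 ] + sgn s * 2^ (3 ℕ.+ δ) - - (+ 1 + + 2 * x)) (≡.sym m≡) (j₁-congruence δ s k o (+ 1) e))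
          (self (+ 1 + 2^ (3 ℕ.+ δ))) (subst (λ x → 2^ (5 ℕ.+ δ) ∣ + 3 + sgn s * 2^ (3 ℕ.+ δ) - (+ 2 * x + 2^ (4 ℕ.+ δ) + + 1)) (≡.sym m≡) (j₂-congruence δ s k o (+ 1) e)))
        where
        choice : ∃ λ s → ∃ λ k → o ≡ + 4 * k - sgn s
        choice = sign-choice o odd
        s : Bool
        s = proj₁ choice
        k : ℤ
        k = proj₁ (proj₂ choice)
        e : o ≡ + 4 * k - sgn s
        e = proj₂ (proj₂ choice)
        self : ∀ {n} x → n ∣ x - x
        self x = divides (+ 0) (ℤP.+-inverseʳ x)

      from : (∃ λ γ → α ≡ suc (suc γ) × 2^ (suc β) ∣ 2^ γ * (+ 4 * (m + + 1)) + 2^ β) → Conclusion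
      from (γ , eq , d) = family γ eq (solve-exponents γ β m m-odd m-square d)

-- Flags and automorphisms

module _ {A : Set} {Q : A → Set} (two : Exactly 2 Q) where
  private
    f : Fin 2 → A
    f = proj₁ two

    opposite : Fin 2 → Fin 2
    opposite zero = suc zero
    opposite (suc zero) = zero

    opposite-≢ : ∀ i → i ≢ opposite i
    opposite-≢ zero ()
    opposite-≢ (suc zero) ()

    ≢-≢⇒≡ : ∀ (i j k : Fin 2) → i ≢ j → i ≢ k → j ≡ k
    ≢-≢⇒≡ zero zero k i≢j _ = ⊥-elim (i≢j refl)
    ≢-≢⇒≡ zero (suc zero) zero _ i≢k = ⊥-elim (i≢k refl)
    ≢-≢⇒≡ zero (suc zero) (suc zero) _ _ = refl
    ≢-≢⇒≡ (suc zero) (suc zero) k i≢j _ = ⊥-elim (i≢j refl)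
    ≢-≢⇒≡ (suc zero) zero (suc zero) _ i≢k = ⊥-elim (i≢k refl)
    ≢-≢⇒≡ (suc zero) zero zero _ _ = refl

  two-other : ∀ x → Q x → ∃ λ y → Q y × x ≢ y
  two-other x qx with proj₂ (proj₂ (proj₂ two)) x qx
  ... | i , refl = f (opposite i) , proj₁ (proj₂ (proj₂ two)) (opposite i) , λ e → opposite-≢ i (proj₁ (proj₂ two) _ _ e)

  two-unique : ∀ {x y y′} → Q x → Q y → Q y′ → x ≢ y → x ≢ y′ → y ≡ y′
  two-unique qx qy qy′ x≢y x≢y′
    with proj₂ (proj₂ (proj₂ two)) _ qx | proj₂ (proj₂ (proj₂ two)) _ qy | proj₂ (proj₂ (proj₂ two)) _ qy′
  ... | i , refl | j , refl | k , refl = cong f (≢-≢⇒≡ i j k (λ e → x≢y (cong f e)) (λ e → x≢y′ (cong f e)))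

  -- The types of vertices, edges and faces come without decidable equality, but inside a
  -- two-element set equality can be decided through the indices.
  two-dec : ∀ {x y} → Q x → Q y → x ≡ y ⊎ x ≢ y
  two-dec qx qy with proj₂ (proj₂ (proj₂ two)) _ qx | proj₂ (proj₂ (proj₂ two)) _ qy
  ... | i , refl | j , refl with i FinP.≟ j
  ... | yes i≡j = inj₁ (cong f i≡j)
  ... | no i≢j = inj₂ λ e → i≢j (proj₁ (proj₂ two) i j e)

⇔⇒≡ : ∀ {x y} → (x ≡ true → y ≡ true) → (y ≡ true → x ≡ true) → y ≡ x
⇔⇒≡ {true} f g = f refl
⇔⇒≡ {false} {true} f g = ≡.sym (g refl)
⇔⇒≡ {false} {false} f g = refl

pattern #0 = zero
pattern #1 = suc zero
pattern #2 = suc (suc zero)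

module FlagGraph (P : Polyhedron) where
  open Polyhedron P
  open IsPolyhedron isPolyhedron
  open Flag
  open Aut

  -- Incidence is Bool-valued, so incidence proofs are unique and flags may be compared by
  -- propositional equality.
  ≈F⇒≡ : ∀ {Φ Ψ : Flag P} → _≈F_ P Φ Ψ → Φ ≡ Ψ
  ≈F⇒≡ {flag v e f ve ef vf} {flag .v .e .f ve′ ef′ vf′} (refl , refl , refl)
    with refl ← uip ve ve′ | refl ← uip ef ef′ | refl ← uip vf vf′ = refl

  private
    neighbour : ∀ i Φ → ∃ λ (Ψ : Flag P) → Adj P i Φ Ψ
    neighbour #0 (flag v e f ve ef vf) =
      let (v′ , v′e , v≢v′) = two-other (edge-vertices e) v ve
      in flag v′ e f v′e ef (order-trans v′ e f v′e ef) , v≢v′ , refl , refl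
    neighbour #1 (flag v e f ve ef vf) =
      let (e′ , (ve′ , e′f) , e≢e′) = two-other (diamond v f vf) e (ve , ef)
      in flag v e′ f ve′ e′f vf , refl , e≢e′ , refl
    neighbour #2 (flag v e f ve ef vf) =
      let (f′ , ef′ , f≢f′) = two-other (edge-faces e) f ef
      in flag v e f′ ve ef′ (order-trans v e f′ ve ef′) , refl , refl , f≢f′

  adj : Fin 3 → Flag P → Flag P
  adj i Φ = proj₁ (neighbour i Φ)

  adj-spec : ∀ i Φ → Adj P i Φ (adj i Φ)
  adj-spec i Φ = proj₂ (neighbour i Φ)

  private
    Adj-unique : ∀ i {Φ Ψ Ψ′} → Adj P i Φ Ψ → Adj P i Φ Ψ′ → Ψ ≡ Ψ′
    Adj-unique #0 {Φ} {Ψ} {Ψ′} (d , refl , refl) (d′ , refl , refl) =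
      ≈F⇒≡ (two-unique (edge-vertices (fe Φ)) (pve Φ) (pve Ψ) (pve Ψ′) d d′ , refl , refl)
    Adj-unique #1 {Φ} {Ψ} {Ψ′} (refl , d , refl) (refl , d′ , refl) =
      ≈F⇒≡ (refl , two-unique (diamond (fv Φ) (ff Φ) (pvf Φ)) (pve Φ , pef Φ) (pve Ψ , pef Ψ) (pve Ψ′ , pef Ψ′) d d′ , refl)
    Adj-unique #2 {Φ} {Ψ} {Ψ′} (refl , refl , d) (refl , refl , d′) =
      ≈F⇒≡ (refl , refl , two-unique (edge-faces (fe Φ)) (pef Φ) (pef Ψ) (pef Ψ′) d d′)

  Adj⇒≡ : ∀ i {Φ Ψ} → Adj P i Φ Ψ → Ψ ≡ adj i Φ
  Adj⇒≡ i {Φ} d = Adj-unique i d (adj-spec i Φ)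

  Adj-sym : ∀ i {Φ Ψ} → Adj P i Φ Ψ → Adj P i Ψ Φ
  Adj-sym #0 (d , e , f) = (λ x → d (≡.sym x)) , ≡.sym e , ≡.sym f
  Adj-sym #1 (v , d , f) = ≡.sym v , (λ x → d (≡.sym x)) , ≡.sym f
  Adj-sym #2 (v , e , d) = ≡.sym v , ≡.sym e , (λ x → d (≡.sym x))

  adj-involutive : ∀ i Φ → adj i (adj i Φ) ≡ Φ
  adj-involutive i Φ = ≡.sym (Adj⇒≡ i (Adj-sym i (adj-spec i Φ)))

  -- Without η, so that unification does not expand automorphisms into their fields.
  record Automorphism : Set where
    no-eta-equality
    constructor wrap
    field aut : Aut P
  open Automorphism public

  infixr 5 _·_
  _·_ : Automorphism → Flag P → Flag P
  g · Φ = act P (aut g) Φ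

  private
    to-injV : ∀ (a : Aut P) {x y} → toV a x ≡ toV a y → x ≡ y
    to-injV a {x} {y} e = ≡.trans (≡.sym (invlV a x)) (≡.trans (cong (fromV a) e) (invlV a y))
    to-injE : ∀ (a : Aut P) {x y} → toE a x ≡ toE a y → x ≡ y
    to-injE a {x} {y} e = ≡.trans (≡.sym (invlE a x)) (≡.trans (cong (fromE a) e) (invlE a y))
    to-injF : ∀ (a : Aut P) {x y} → toF a x ≡ toF a y → x ≡ y
    to-injF a {x} {y} e = ≡.trans (≡.sym (invlF a x)) (≡.trans (cong (fromF a) e) (invlF a y))

    Adj-act : ∀ i a {Φ Ψ} → Adj P i Φ Ψ → Adj P i (act P a Φ) (act P a Ψ)
    Adj-act #0 a (d , e , f) = (λ x → d (to-injV a x)) , cong (toE a) e , cong (toF a) f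
    Adj-act #1 a (v , d , f) = cong (toV a) v , (λ x → d (to-injE a x)) , cong (toF a) f
    Adj-act #2 a (v , e , d) = cong (toV a) v , cong (toE a) e , (λ x → d (to-injF a x))

  act-adj : ∀ i g Φ → g · adj i Φ ≡ adj i (g · Φ)
  act-adj i g Φ = Adj⇒≡ i (Adj-act i (aut g) (adj-spec i Φ))

  adj-02 : ∀ (Φ : Flag P) → adj #0 (adj #2 Φ) ≡ adj #2 (adj #0 Φ)
  adj-02 Φ = ≡.sym (Adj⇒≡ #0 {adj #2 Φ} {adj #2 (adj #0 Φ)}
    ( (λ e → proj₁ (adj-spec #0 Φ) (≡.trans v₂ (≡.trans e (≡.sym v₂₀))))
    , ≡.trans (≡.sym e₂) (≡.trans e₀ e₂₀)
    , two-unique (edge-faces (fe Φ)) (pef Φ)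
        (subst (λ e → _≤ef_ pre e (ff (adj #2 Φ))) (≡.sym e₂) (pef (adj #2 Φ)))
        (subst (λ e → _≤ef_ pre e (ff (adj #2 (adj #0 Φ)))) (≡.sym (≡.trans e₀ e₂₀)) (pef (adj #2 (adj #0 Φ))))
        (proj₂ (proj₂ (adj-spec #2 Φ)))
        (λ e → proj₂ (proj₂ (adj-spec #2 (adj #0 Φ))) (≡.trans (≡.sym (proj₂ (proj₂ (adj-spec #0 Φ)))) e)) ))
    where
    v₂ = proj₁ (adj-spec #2 Φ)
    v₂₀ = proj₁ (adj-spec #2 (adj #0 Φ))
    e₂ = proj₁ (proj₂ (adj-spec #2 Φ))
    e₀ = proj₁ (proj₂ (adj-spec #0 Φ))
    e₂₀ = proj₁ (proj₂ (adj-spec #2 (adj #0 Φ)))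

  same-VE : ∀ {Φ Ψ : Flag P} → fv Φ ≡ fv Ψ → fe Φ ≡ fe Ψ → Ψ ≡ Φ ⊎ Ψ ≡ adj #2 Φ
  same-VE {Φ} {Ψ} refl refl with two-dec (edge-faces (fe Φ)) (pef Φ) (pef Ψ)
  ... | inj₁ e = inj₁ (≈F⇒≡ (refl , refl , ≡.sym e))
  ... | inj₂ d = inj₂ (Adj⇒≡ #2 {Φ} {Ψ} (refl , refl , d))

  same-VF : ∀ {Φ Ψ : Flag P} → fv Φ ≡ fv Ψ → ff Φ ≡ ff Ψ → Ψ ≡ Φ ⊎ Ψ ≡ adj #1 Φ
  same-VF {Φ} {Ψ} refl refl with two-dec (diamond (fv Φ) (ff Φ) (pvf Φ)) (pve Φ , pef Φ) (pve Ψ , pef Ψ)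
  ... | inj₁ e = inj₁ (≈F⇒≡ (refl , ≡.sym e , refl))
  ... | inj₂ d = inj₂ (Adj⇒≡ #1 (refl , d , refl))

  same-EF : ∀ {Φ Ψ : Flag P} → fe Φ ≡ fe Ψ → ff Φ ≡ ff Ψ → Ψ ≡ Φ ⊎ Ψ ≡ adj #0 Φ
  same-EF {Φ} {Ψ} refl refl with two-dec (edge-vertices (fe Φ)) (pve Φ) (pve Ψ)
  ... | inj₁ e = inj₁ (≈F⇒≡ (≡.sym e , refl , refl))
  ... | inj₂ d = inj₂ (Adj⇒≡ #0 {Φ} {Ψ} (d , refl , refl))

  Closed : (Flag P → Set) → Fin 3 → Set
  Closed Q i = ∀ Ψ → Q Ψ → Q (adj i Ψ)

  private
    On : Elem pre → Flag P → Set
    On (inj₁ v) Ψ = v ≡ fv Ψ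
    On (inj₂ (inj₁ e)) Ψ = e ≡ fe Ψ
    On (inj₂ (inj₂ f)) Ψ = f ≡ ff Ψ

    transfer : ∀ Q i {Φ Ψ} → Closed Q i → Ψ ≡ Φ ⊎ Ψ ≡ adj i Φ → Q Φ → Q Ψ
    transfer Q i cl (inj₁ refl) q = q
    transfer Q i cl (inj₂ refl) q = cl _ q

    module _ (Q : Flag P → Set) (cl₁ : Closed Q #1) (cl₂ : Closed Q #2) (v : V) where
      link-step-V : ∀ (x y : Σ (Elem pre) (Inc pre (inj₁ v))) → Inc pre (proj₁ x) (proj₁ y) →
        (∀ Ψ → v ≡ fv Ψ → On (proj₁ x) Ψ → Q Ψ) → ∀ Ψ → v ≡ fv Ψ → On (proj₁ y) Ψ → Q Ψ
      link-step-V (inj₂ (inj₁ e) , ve) (inj₂ (inj₂ f) , vf) ef h Ψ refl refl =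
        transfer Q #1 cl₁ (same-VF {flag v e f ve ef vf} {Ψ} refl refl) (h (flag v e f ve ef vf) refl refl)
      link-step-V (inj₂ (inj₂ f) , vf) (inj₂ (inj₁ e) , ve) ef h Ψ refl refl =
        transfer Q #2 cl₂ (same-VE {flag v e f ve ef vf} {Ψ} refl refl) (h (flag v e f ve ef vf) refl refl)

      link-walk-V : ∀ {x y} → Star (λ a b → Inc pre (proj₁ a) (proj₁ b)) x y →
        (∀ Ψ → v ≡ fv Ψ → On (proj₁ x) Ψ → Q Ψ) → ∀ Ψ → v ≡ fv Ψ → On (proj₁ y) Ψ → Q Ψ
      link-walk-V []ˢ h = h
      link-walk-V {x} (_◅_ {j = j} s w) h = link-walk-V w (link-step-V x j s h)

    module _ (Q : Flag P → Set) (cl₀ : Closed Q #0) (cl₁ : Closed Q #1) (f : F) where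
      link-step-F : ∀ (x y : Σ (Elem pre) (Inc pre (inj₂ (inj₂ f)))) → Inc pre (proj₁ x) (proj₁ y) →
        (∀ Ψ → f ≡ ff Ψ → On (proj₁ x) Ψ → Q Ψ) → ∀ Ψ → f ≡ ff Ψ → On (proj₁ y) Ψ → Q Ψ
      link-step-F (inj₂ (inj₁ e) , ef) (inj₁ v , vf) ve h Ψ refl refl =
        transfer Q #1 cl₁ (same-VF {flag v e f ve ef vf} {Ψ} refl refl) (h (flag v e f ve ef vf) refl refl)
      link-step-F (inj₁ v , vf) (inj₂ (inj₁ e) , ef) ve h Ψ refl refl =
        transfer Q #0 cl₀ (same-EF {flag v e f ve ef vf} {Ψ} refl refl) (h (flag v e f ve ef vf) refl refl)

      link-step-F (inj₂ (inj₁ _) , _) (inj₂ (inj₁ _) , _) ()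
      link-step-F (inj₂ (inj₁ _) , _) (inj₂ (inj₂ _) , ())

      link-walk-F : ∀ {x y} → Star (λ a b → Inc pre (proj₁ a) (proj₁ b)) x y →
        (∀ Ψ → f ≡ ff Ψ → On (proj₁ x) Ψ → Q Ψ) → ∀ Ψ → f ≡ ff Ψ → On (proj₁ y) Ψ → Q Ψ
      link-walk-F []ˢ h = h
      link-walk-F {x} (_◅_ {j = j} s w) h = link-walk-F w (link-step-F x j s h)

  -- A walk in the link of the vertex alternates between edges and faces, and each of its steps
  -- spans a flag with the vertex. Along the walk the flag changes by 1- and 2-adjacency only.
  vertex-induction : ∀ Q → Closed Q #1 → Closed Q #2 → ∀ Φ Ψ → fv Φ ≡ fv Ψ → Q Φ → Q Ψ
  vertex-induction Q cl₁ cl₂ Φ Ψ refl q =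
    link-walk-V Q cl₁ cl₂ (fv Φ) (vertex-conn (fv Φ) (inj₂ (inj₁ (fe Φ)) , pve Φ) (inj₂ (inj₁ (fe Ψ)) , pve Ψ))
      (λ Ψ′ e e′ → transfer Q #2 cl₂ (same-VE e e′) q) Ψ refl refl

  face-induction : ∀ Q → Closed Q #0 → Closed Q #1 → ∀ Φ Ψ → ff Φ ≡ ff Ψ → Q Φ → Q Ψ
  face-induction Q cl₀ cl₁ Φ Ψ refl q =
    link-walk-F Q cl₀ cl₁ (ff Φ) (face-conn (ff Φ) (inj₂ (inj₁ (fe Φ)) , pef Φ) (inj₂ (inj₁ (fe Ψ)) , pef Ψ))
      (λ Ψ′ e e′ → transfer Q #0 cl₀ (same-EF e′ e) q) Ψ refl refl

  module _ (Q : Flag P → Set) (cl : ∀ i → Closed Q i) where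
    private
      edge-step : ∀ Φ Ψ → fe Φ ≡ fe Ψ → Q Φ → Q Ψ
      edge-step Φ Ψ refl q with two-dec (edge-vertices (fe Φ)) (pve Φ) (pve Ψ)
      ... | inj₁ e = transfer Q #2 (cl #2) (same-VE e refl) q
      ... | inj₂ d = transfer Q #2 (cl #2) (same-VE {adj #0 Φ} {Ψ}
        (two-unique (edge-vertices (fe Φ)) (pve Φ) (subst (_≤ve_ pre _) (≡.sym (proj₁ (proj₂ (adj-spec #0 Φ)))) (pve (adj #0 Φ))) (pve Ψ) (proj₁ (adj-spec #0 Φ)) d)
        (≡.sym (proj₁ (proj₂ (adj-spec #0 Φ))))) (cl #0 Φ q)

      spread : ∀ x Φ Ψ → On x Φ → On x Ψ → Q Φ → Q Ψ
      spread (inj₁ v) Φ Ψ refl e = vertex-induction Q (cl #1) (cl #2) Φ Ψ e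
      spread (inj₂ (inj₁ _)) Φ Ψ refl e = edge-step Φ Ψ e
      spread (inj₂ (inj₂ _)) Φ Ψ refl e = face-induction Q (cl #0) (cl #1) Φ Ψ e

      common : ∀ x y → Inc pre x y → ∃ λ (Φ : Flag P) → On x Φ × On y Φ
      common (inj₁ v) (inj₂ (inj₁ e)) ve =
        let f = proj₁ (edge-faces e) zero ; ef = proj₁ (proj₂ (proj₂ (edge-faces e))) zero
        in flag v e f ve ef (order-trans v e f ve ef) , refl , refl
      common (inj₁ v) (inj₂ (inj₂ f)) vf =
        let e = proj₁ (diamond v f vf) zero ; (ve , ef) = proj₁ (proj₂ (proj₂ (diamond v f vf))) zero
        in flag v e f ve ef vf , refl , refl
      common (inj₂ (inj₁ e)) (inj₁ v) ve = let (Φ , x , y) = common (inj₁ v) (inj₂ (inj₁ e)) ve in Φ , y , x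
      common (inj₂ (inj₁ e)) (inj₂ (inj₂ f)) ef =
        let v = proj₁ (edge-vertices e) zero ; ve = proj₁ (proj₂ (proj₂ (edge-vertices e))) zero
        in flag v e f ve ef (order-trans v e f ve ef) , refl , refl
      common (inj₂ (inj₂ f)) (inj₁ v) vf = let (Φ , x , y) = common (inj₁ v) (inj₂ (inj₂ f)) vf in Φ , y , x
      common (inj₂ (inj₂ f)) (inj₂ (inj₁ e)) ef = let (Φ , x , y) = common (inj₂ (inj₁ e)) (inj₂ (inj₂ f)) ef in Φ , y , x

      walk : ∀ {x y} → Star (Inc pre) x y → (∀ Ψ → On x Ψ → Q Ψ) → ∀ Ψ → On y Ψ → Q Ψ
      walk []ˢ h = h
      walk {x} (_◅_ {j = j} s w) h = walk w λ Ψ o →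
        let (Φ , o₁ , o₂) = common x j s in spread j Φ Ψ o₂ o (h Φ o₁)

    -- Flag-connectedness: consecutive elements of a walk in the incidence graph share a flag, and
    -- any two flags through a common element are linked by adjacencies.
    flag-induction : ∀ Φ → Q Φ → ∀ Ψ → Q Ψ
    flag-induction Φ q Ψ = walk (connected (inj₁ (fv Φ)) (inj₁ (fv Ψ)))
      (λ Ψ′ o → vertex-induction Q (cl #1) (cl #2) Φ Ψ′ o q) Ψ refl

  edge-flag : ∀ e → ∃ λ (Φ : Flag P) → fe Φ ≡ e
  edge-flag e =
    let f = proj₁ (edge-faces e) zero ; ef = proj₁ (proj₂ (proj₂ (edge-faces e))) zero
        v = proj₁ (edge-vertices e) zero ; ve = proj₁ (proj₂ (proj₂ (edge-vertices e))) zero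
    in flag v e f ve ef (order-trans v e f ve ef) , refl

  module _ (Φ₀ : Flag P) where
    vertex-flag : ∀ v → ∃ λ (Φ : Flag P) → fv Φ ≡ v
    vertex-flag v with connected (inj₁ v) (inj₂ (inj₁ (fe Φ₀)))
    ... | _◅_ {j = inj₂ (inj₁ e)} ve _ =
      let f = proj₁ (edge-faces e) zero ; ef = proj₁ (proj₂ (proj₂ (edge-faces e))) zero
      in flag v e f ve ef (order-trans v e f ve ef) , refl
    ... | _◅_ {j = inj₂ (inj₂ f)} vf _ =
      let e = proj₁ (diamond v f vf) zero ; (ve , ef) = proj₁ (proj₂ (proj₂ (diamond v f vf))) zero
      in flag v e f ve ef vf , refl

    face-flag : ∀ f → ∃ λ (Φ : Flag P) → ff Φ ≡ f
    face-flag f with connected (inj₂ (inj₂ f)) (inj₂ (inj₁ (fe Φ₀)))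
    ... | _◅_ {j = inj₂ (inj₁ e)} ef _ =
      let v = proj₁ (edge-vertices e) zero ; ve = proj₁ (proj₂ (proj₂ (edge-vertices e))) zero
      in flag v e f ve ef (order-trans v e f ve ef) , refl
    ... | _◅_ {j = inj₁ v} vf _ =
      let e = proj₁ (diamond v f vf) zero ; (ve , ef) = proj₁ (proj₂ (proj₂ (diamond v f vf))) zero
      in flag v e f ve ef vf , refl

  -- The automorphism group and its free action on flags

  infix 4 _≈ᴬ_
  record _≈ᴬ_ (g h : Automorphism) : Set where
    constructor pointwise
    field toPointwise : _≈A_ P (aut g) (aut h)
  open _≈ᴬ_ public

  -- Abstract, so that unification treats composition as injective.
  abstract
    compose : Automorphism → Automorphism → Automorphism
    compose g h = wrap (_∘A_ P (aut g) (aut h))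

    idᴬ : Automorphism
    idᴬ = wrap (idA P)

    invᴬ : Automorphism → Automorphism
    invᴬ g = wrap (invA P (aut g))

    -- With `identity-wrap` and `inverse-wrap`, the bridge from the opaque operations to those of
    -- the statement.
    compose-wrap : ∀ g h → wrap (_∘A_ P (aut g) (aut h)) ≈ᴬ compose g h
    compose-wrap g h = pointwise ((λ _ → refl) , (λ _ → refl) , (λ _ → refl))

    identity-wrap : wrap (idA P) ≈ᴬ idᴬ
    identity-wrap = pointwise ((λ _ → refl) , (λ _ → refl) , (λ _ → refl))

    inverse-wrap : ∀ g → wrap (invA P (aut g)) ≈ᴬ invᴬ g
    inverse-wrap g = pointwise ((λ _ → refl) , (λ _ → refl) , (λ _ → refl))

    to-compose : ∀ k g h → (∀ x → toV (aut k) x ≡ toV (aut g) (toV (aut h) x)) → (∀ x → toE (aut k) x ≡ toE (aut g) (toE (aut h) x)) →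
      (∀ x → toF (aut k) x ≡ toF (aut g) (toF (aut h) x)) → k ≈ᴬ compose g h
    to-compose k g h p q r = pointwise (p , q , r)

    to-inverse : ∀ k g → (∀ x → toV (aut k) x ≡ fromV (aut g) x) → (∀ x → toE (aut k) x ≡ fromE (aut g) x) →
      (∀ x → toF (aut k) x ≡ fromF (aut g) x) → k ≈ᴬ invᴬ g
    to-inverse k g p q r = pointwise (p , q , r)

    to-identity : ∀ k → (∀ x → toV (aut k) x ≡ x) → (∀ x → toE (aut k) x ≡ x) → (∀ x → toF (aut k) x ≡ x) → k ≈ᴬ idᴬ
    to-identity k p q r = pointwise (p , q , r)

    isAutGroup : IsGroup _≈ᴬ_ compose idᴬ invᴬ
    isAutGroup = record
      { isMonoid = record
        { isSemigroup = record
          { isMagma = record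
            { isEquivalence = record
              { refl = pointwise ((λ _ → refl) , (λ _ → refl) , (λ _ → refl))
              ; sym = λ (pointwise (p , q , r)) → pointwise ((λ x → ≡.sym (p x)) , (λ x → ≡.sym (q x)) , (λ x → ≡.sym (r x)))
              ; trans = λ (pointwise (p , q , r)) (pointwise (p′ , q′ , r′)) → pointwise
                  ((λ x → ≡.trans (p x) (p′ x)) , (λ x → ≡.trans (q x) (q′ x)) , (λ x → ≡.trans (r x) (r′ x))) }
            ; ∙-cong = λ {a} {a′} {b} {b′} (pointwise (p , q , r)) (pointwise (p′ , q′ , r′)) → pointwise
                ((λ x → ≡.trans (p (toV (aut b) x)) (cong (toV (aut a′)) (p′ x))) ,
                (λ x → ≡.trans (q (toE (aut b) x)) (cong (toE (aut a′)) (q′ x))) ,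
                (λ x → ≡.trans (r (toF (aut b) x)) (cong (toF (aut a′)) (r′ x)))) }
          ; assoc = λ _ _ _ → pointwise ((λ _ → refl) , (λ _ → refl) , (λ _ → refl)) }
        ; identity = (λ _ → pointwise ((λ _ → refl) , (λ _ → refl) , (λ _ → refl)))
                   , (λ _ → pointwise ((λ _ → refl) , (λ _ → refl) , (λ _ → refl))) }
      ; inverse = (λ g → let a = aut g in pointwise (invlV a , invlE a , invlF a))
                , (λ g → let a = aut g in pointwise (invrV a , invrE a , invrF a))
      ; ⁻¹-cong = λ {g} {h} (pointwise (p , q , r)) → let a = aut g ; b = aut h in pointwise
          ((λ x → to-injV a (≡.trans (invrV a x) (≡.sym (≡.trans (p (fromV b x)) (invrV b x))))) ,
          (λ x → to-injE a (≡.trans (invrE a x) (≡.sym (≡.trans (q (fromE b x)) (invrE b x))))) ,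
          (λ x → to-injF a (≡.trans (invrF a x) (≡.sym (≡.trans (r (fromF b x)) (invrF b x)))))) }

    act-∘ : ∀ g h Φ → compose g h · Φ ≡ g · h · Φ
    act-∘ g h Φ = ≈F⇒≡ (refl , refl , refl)

    act-id : ∀ Φ → idᴬ · Φ ≡ Φ
    act-id Φ = ≈F⇒≡ (refl , refl , refl)

    act-inv : ∀ g Φ → invᴬ g · g · Φ ≡ Φ
    act-inv g Φ = ≈F⇒≡ (invlV (aut g) _ , invlE (aut g) _ , invlF (aut g) _)

  autGroup : Group 0ℓ 0ℓ
  autGroup = record { isGroup = isAutGroup }

  act-cong : ∀ {g h} Φ → g ≈ᴬ h → g · Φ ≡ h · Φ
  act-cong Φ (pointwise (p , q , r)) = ≈F⇒≡ (p (fv Φ) , q (fe Φ) , r (ff Φ))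

  -- Automorphisms commute with adjacency, so agreement on one flag spreads to all flags, and every
  -- vertex, edge and face lies in a flag.
  act-determines : ∀ {g h} Φ → g · Φ ≡ h · Φ → g ≈ᴬ h
  act-determines {g} {h} Φ e = pointwise (
    (λ v → let (Ψ , p) = vertex-flag Φ v in subst (λ v → toV (aut g) v ≡ toV (aut h) v) p (cong fv (all Ψ))) ,
    (λ x → let (Ψ , p) = edge-flag x in subst (λ x → toE (aut g) x ≡ toE (aut h) x) p (cong fe (all Ψ))) ,
    (λ f → let (Ψ , p) = face-flag Φ f in subst (λ f → toF (aut g) f ≡ toF (aut h) f) p (cong ff (all Ψ))))
    where
    all : ∀ Ψ → g · Ψ ≡ h · Ψ
    all = flag-induction (λ Ψ → g · Ψ ≡ h · Ψ)
      (λ i Ψ e → ≡.trans (act-adj i g Ψ) (≡.trans (cong (adj i) e) (≡.sym (act-adj i h Ψ)))) Φ e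

-- The rotation group of a tight chiral polyhedron

injective⇒surjective : ∀ {n} (f : Fin n → Fin n) → (∀ i j → f i ≡ f j → i ≡ j) → ∀ j → ∃ λ i → f i ≡ j
injective⇒surjective {n} f inj j = from (FinP.pigeonhole (ℕP.n<1+n n) g)
  where
  g : Fin (suc n) → Fin n
  g zero = j
  g (suc i) = f i
  from : (∃₂ λ i k → i Fin.< k × g i ≡ g k) → ∃ λ i → f i ≡ j
  from (zero , suc i , _ , e) = i , ≡.sym e
  from (suc i , suc k , s≤s i<k , e) = ⊥-elim (FinP.<⇒≢ i<k (inj i k e))

splitIndex : ∀ p q → Fin (2 ℕ.* p ℕ.* q) → (Fin 2 × Fin p) × Fin q
splitIndex p q i = remQuot {2} p (proj₁ (remQuot {2 ℕ.* p} q i)) , proj₂ (remQuot {2 ℕ.* p} q i)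

joinIndex : ∀ p q → (Fin 2 × Fin p) × Fin q → Fin (2 ℕ.* p ℕ.* q)
joinIndex p q ((i , x) , y) = combine (combine i x) y

join-split : ∀ p q i → joinIndex p q (splitIndex p q i) ≡ i
join-split p q i = ≡.trans (cong (λ t → combine t (proj₂ (remQuot {2 ℕ.* p} q i))) (FinP.combine-remQuot {2} p (proj₁ (remQuot {2 ℕ.* p} q i))))
  (FinP.combine-remQuot {2 ℕ.* p} q i)

split-join : ∀ p q t → splitIndex p q (joinIndex p q t) ≡ t
split-join p q ((i , x) , y) = ≡.trans (cong (λ (s , y) → remQuot {2} p s , y) (FinP.remQuot-combine (combine i x) y))
  (cong (_, y) (FinP.remQuot-combine i x))

module Rotations (P : Polyhedron) (σ₁ σ₂ : Aut P) where
  open FlagGraph P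
  open Group autGroup using () renaming (_∙_ to _∙ᴬ_; _⁻¹ to _⁻¹ᴬ)
  private
    module A = Group autGroup
    module ↑A = Powers autGroup

  ς₁ ς₂ : Automorphism
  ς₁ = wrap σ₁
  ς₂ = wrap σ₂

  ev : Word → Automorphism
  ev w = wrap (evalW P σ₁ σ₂ w)

  ev-∷ : ∀ x w → ev (x ∷ w) ≈ᴬ wrap (evalL P σ₁ σ₂ x) ∙ᴬ ev w
  ev-∷ x w = compose-wrap (wrap (evalL P σ₁ σ₂ x)) (ev w)

  ev-++ : ∀ u v → ev (u ++ v) ≈ᴬ ev u ∙ᴬ ev v
  ev-++ [] v = A.trans (A.sym (A.identityˡ (ev v))) (A.∙-congʳ (A.sym identity-wrap))
  ev-++ (x ∷ u) v = A.trans (ev-∷ x (u ++ v)) (A.trans (A.∙-congˡ (ev-++ u v))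
    (A.trans (A.sym (A.assoc _ _ _)) (A.∙-congʳ (A.sym (ev-∷ x u)))))

  infix 4 _≈Γ_
  record _≈Γ_ (u v : Word) : Set where
    constructor evaluate
    field evaluation : ev u ≈ᴬ ev v
  open _≈Γ_ public

  ≈Γ-refl : ∀ {u} → u ≈Γ u
  ≈Γ-refl = evaluate A.refl

  ≈Γ-sym : ∀ {u v} → u ≈Γ v → v ≈Γ u
  ≈Γ-sym (evaluate e) = evaluate (A.sym e)

  ≈Γ-trans : ∀ {u v w} → u ≈Γ v → v ≈Γ w → u ≈Γ w
  ≈Γ-trans (evaluate e) (evaluate f) = evaluate (A.trans e f)

  ≈Γ-cong : ∀ {u u′ v v′} → u ≈Γ u′ → v ≈Γ v′ → (u ++ v) ≈Γ (u′ ++ v′)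
  ≈Γ-cong {u} {u′} {v} {v′} (evaluate e) (evaluate f) =
    evaluate (A.trans (ev-++ u v) (A.trans (A.∙-cong e f) (A.sym (ev-++ u′ v′))))

  private
    letter-inverse : ∀ x → wrap (evalL P σ₁ σ₂ x) ∙ᴬ wrap (evalL P σ₁ σ₂ (invL x)) ≈ᴬ A.ε
    letter-inverse (⁺ s₁) = A.trans (A.∙-congˡ (inverse-wrap ς₁)) (A.inverseʳ ς₁)
    letter-inverse (⁺ s₂) = A.trans (A.∙-congˡ (inverse-wrap ς₂)) (A.inverseʳ ς₂)
    letter-inverse (⁻ s₁) = A.trans (A.∙-congʳ (inverse-wrap ς₁)) (A.inverseˡ ς₁)
    letter-inverse (⁻ s₂) = A.trans (A.∙-congʳ (inverse-wrap ς₂)) (A.inverseˡ ς₂)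

  ≈Γ-cancel : ∀ x → (x ∷ invL x ∷ []) ≈Γ []
  ≈Γ-cancel x = evaluate (A.trans (ev-∷ x (invL x ∷ [])) (A.trans (A.∙-congˡ (A.trans (ev-∷ (invL x) [])
      (A.trans (A.∙-congˡ identity-wrap) (A.identityʳ _)))) (A.trans (letter-inverse x) (A.sym identity-wrap))))

  -- The group ⟨σ₁, σ₂⟩ with words as elements, equal when they evaluate to the same automorphism.
  -- Thus `Presents` compares two equalities on the same set of words.
  Γ : Group 0ℓ 0ℓ
  Γ = WordGroup.wordGroup _≈Γ_ ≈Γ-refl ≈Γ-sym ≈Γ-trans ≈Γ-cong ≈Γ-cancel

  ev-⁻¹ : ∀ w → ev (invW w) ≈ᴬ (ev w) ⁻¹ᴬ
  ev-⁻¹ w = inverseˡ-unique (ev (invW w)) (ev w)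
    (A.trans (A.sym (ev-++ (invW w) w)) (A.trans (evaluation (Group.inverseˡ Γ w)) identity-wrap))
    where open import Algebra.Properties.Group autGroup using (inverseˡ-unique)

  ev-↑ : ∀ w k → ev (Powers._↑_ Γ w k) ≈ᴬ (ev w ↑A.↑ k)
  ev-↑ w k = ℤ-ind (λ k → ev (Powers._↑_ Γ w k) ≈ᴬ (ev w ↑A.↑ k)) identity-wrap
    (λ k ih → begin
      ev (w ↑Γ (+ 1 + k)) ≈⟨ evaluation (Powers.↑-suc Γ w k) ⟩
      ev (w ++ (w ↑Γ k)) ≈⟨ ev-++ w (w ↑Γ k) ⟩
      ev w ∙ᴬ ev (w ↑Γ k) ≈⟨ A.∙-congˡ ih ⟩
      ev w ∙ᴬ (ev w ↑A.↑ k) ≈⟨ ↑A.↑-suc (ev w) k ⟨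
      (ev w ↑A.↑ (+ 1 + k)) ∎)
    (λ k ih → begin
      ev (w ↑Γ (-[1+ 0 ] + k)) ≈⟨ evaluation (Powers.↑-pred Γ w k) ⟩
      ev (invW w ++ (w ↑Γ k)) ≈⟨ ev-++ (invW w) (w ↑Γ k) ⟩
      ev (invW w) ∙ᴬ ev (w ↑Γ k) ≈⟨ A.∙-cong (ev-⁻¹ w) ih ⟩
      (ev w) ⁻¹ᴬ ∙ᴬ (ev w ↑A.↑ k) ≈⟨ ↑A.↑-pred (ev w) k ⟨
      (ev w ↑A.↑ (-[1+ 0 ] + k)) ∎) k
    where
    open import Relation.Binary.Reasoning.Setoid A.setoid
    _↑Γ_ : Word → ℤ → Word
    _↑Γ_ = Powers._↑_ Γ

  ev-gen₁ : ev word₁ ≈ᴬ ς₁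
  ev-gen₁ = A.trans (ev-∷ (⁺ s₁) []) (A.trans (A.∙-congˡ identity-wrap) (A.identityʳ ς₁))

  ev-gen₂ : ev word₂ ≈ᴬ ς₂
  ev-gen₂ = A.trans (ev-∷ (⁺ s₂) []) (A.trans (A.∙-congˡ identity-wrap) (A.identityʳ ς₂))

  ev-word₁ : ∀ k → ev (Powers._↑_ Γ word₁ k) ≈ᴬ (ς₁ ↑A.↑ k)
  ev-word₁ k = A.trans (ev-↑ word₁ k) (↑A.↑-cong k ev-gen₁)

  ev-word₂ : ∀ k → ev (Powers._↑_ Γ word₂ k) ≈ᴬ (ς₂ ↑A.↑ k)
  ev-word₂ k = A.trans (ev-↑ word₂ k) (↑A.↑-cong k ev-gen₂)

  module Based (Φ : Flag P) (rot : RotGens P Φ σ₁ σ₂) where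
    act-ς₁ : (ς₁ · Φ) ≡ adj #0 (adj #1 Φ)
    act-ς₁ = let ((Ψ , d , d′) , _) = rot in
      ≡.trans (Adj⇒≡ #0 {Ψ} {ς₁ · Φ} d′) (cong (adj #0) (Adj⇒≡ #1 {Φ} {Ψ} d))

    act-ς₂ : (ς₂ · Φ) ≡ adj #1 (adj #2 Φ)
    act-ς₂ = let (_ , (Ψ , d , d′)) = rot in
      ≡.trans (Adj⇒≡ #1 {Ψ} {ς₂ · Φ} d′) (cong (adj #1) (Adj⇒≡ #2 {Φ} {Ψ} d))

    act-ς₁-adj₀ : (ς₁ · (adj #0 Φ)) ≡ adj #1 Φ
    act-ς₁-adj₀ = ≡.trans (act-adj #0 ς₁ Φ) (≡.trans (cong (adj #0) act-ς₁) (adj-involutive #0 _))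

    act-ς₂-adj₁ : (ς₂ · (adj #1 Φ)) ≡ adj #2 Φ
    act-ς₂-adj₁ = ≡.trans (act-adj #1 ς₂ Φ) (≡.trans (cong (adj #1) act-ς₂) (adj-involutive #1 _))

    -- Automorphisms act on the left, so it is σ₂σ₁ that is the half-turn about the base edge. For
    -- this reason ba, and not ab, generates the edge stabiliser below.
    act-ς₂ς₁ : ((ς₂ ∙ᴬ ς₁) · Φ) ≡ adj #0 (adj #2 Φ)
    act-ς₂ς₁ = ≡.trans (act-∘ ς₂ ς₁ Φ) (≡.trans (cong (ς₂ ·_) act-ς₁)
      (≡.trans (act-adj #0 ς₂ (adj #1 Φ)) (cong (adj #0) act-ς₂-adj₁)))

    ς₂ς₁-involution : (ς₂ ∙ᴬ ς₁ ∙ᴬ (ς₂ ∙ᴬ ς₁)) ≈ᴬ A.ε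
    ς₂ς₁-involution = act-determines {ς₂ ∙ᴬ ς₁ ∙ᴬ (ς₂ ∙ᴬ ς₁)} {A.ε} Φ (begin
      ((ς₂ ∙ᴬ ς₁ ∙ᴬ (ς₂ ∙ᴬ ς₁)) · Φ) ≡⟨ act-∘ (ς₂ ∙ᴬ ς₁) (ς₂ ∙ᴬ ς₁) Φ ⟩
      ((ς₂ ∙ᴬ ς₁) · (((ς₂ ∙ᴬ ς₁) · Φ))) ≡⟨ cong (((ς₂ ∙ᴬ ς₁) ·_)) act-ς₂ς₁ ⟩
      ((ς₂ ∙ᴬ ς₁) · (adj #0 (adj #2 Φ))) ≡⟨ ≡.trans (act-adj #0 (ς₂ ∙ᴬ ς₁) (adj #2 Φ)) (cong (adj #0) (act-adj #2 (ς₂ ∙ᴬ ς₁) Φ)) ⟩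
      adj #0 (adj #2 (((ς₂ ∙ᴬ ς₁) · Φ))) ≡⟨ cong (λ Ψ → adj #0 (adj #2 Ψ)) (≡.trans act-ς₂ς₁ (adj-02 Φ)) ⟩
      adj #0 (adj #2 (adj #2 (adj #0 Φ))) ≡⟨ cong (adj #0) (adj-involutive #2 (adj #0 Φ)) ⟩
      adj #0 (adj #0 Φ) ≡⟨ adj-involutive #0 Φ ⟩
      Φ ≡⟨ act-id Φ ⟨
      (A.ε · Φ) ∎)
      where open ≡.≡-Reasoning

    ς₁ς₂-involution : (ς₁ ∙ᴬ ς₂ ∙ᴬ (ς₁ ∙ᴬ ς₂)) ≈ᴬ A.ε
    ς₁ς₂-involution = ↑A.involution-swap ς₂ ς₁ ς₂ς₁-involution

    -- Conjugation by an automorphism taking Φ to Φ¹ inverts the generators.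
    reflection⇒regular : ∀ ψ → ψ · Φ ≡ adj #1 Φ → Evaluation.Regular autGroup ς₁ ς₂
    reflection⇒regular ψ h = Evaluation.reflection⇒regular autGroup ψ inverts₁ inverts₂
      where
      open ≡.≡-Reasoning
      inverts₁ : ψ ∙ᴬ ς₁ ≈ᴬ ς₁ ⁻¹ᴬ ∙ᴬ ψ
      inverts₁ = act-determines {ψ ∙ᴬ ς₁} {ς₁ ⁻¹ᴬ ∙ᴬ ψ} Φ (begin
        (ψ ∙ᴬ ς₁) · Φ ≡⟨ ≡.trans (act-∘ ψ ς₁ Φ) (cong (ψ ·_) act-ς₁) ⟩
        ψ · adj #0 (adj #1 Φ) ≡⟨ ≡.trans (act-adj #0 ψ (adj #1 Φ)) (cong (adj #0) (act-adj #1 ψ Φ)) ⟩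
        adj #0 (adj #1 (ψ · Φ)) ≡⟨ cong (adj #0) (≡.trans (cong (adj #1) h) (adj-involutive #1 Φ)) ⟩
        adj #0 Φ ≡⟨ ≡.trans (cong (ς₁ ⁻¹ᴬ ·_) (≡.sym act-ς₁-adj₀)) (act-inv ς₁ (adj #0 Φ)) ⟨
        ς₁ ⁻¹ᴬ · adj #1 Φ ≡⟨ ≡.trans (act-∘ (ς₁ ⁻¹ᴬ) ψ Φ) (cong (ς₁ ⁻¹ᴬ ·_) h) ⟨
        (ς₁ ⁻¹ᴬ ∙ᴬ ψ) · Φ ∎)
      ς₂⁻¹Φ : ς₂ ⁻¹ᴬ · Φ ≡ adj #2 (adj #1 Φ)
      ς₂⁻¹Φ = ≡.trans (cong (ς₂ ⁻¹ᴬ ·_) (≡.sym (≡.trans (act-adj #2 ς₂ (adj #1 Φ)) (≡.trans (cong (adj #2) act-ς₂-adj₁) (adj-involutive #2 Φ)))))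
        (act-inv ς₂ (adj #2 (adj #1 Φ)))
      inverts₂ : ψ ∙ᴬ ς₂ ≈ᴬ ς₂ ⁻¹ᴬ ∙ᴬ ψ
      inverts₂ = act-determines {ψ ∙ᴬ ς₂} {ς₂ ⁻¹ᴬ ∙ᴬ ψ} Φ (begin
        (ψ ∙ᴬ ς₂) · Φ ≡⟨ ≡.trans (act-∘ ψ ς₂ Φ) (cong (ψ ·_) act-ς₂) ⟩
        ψ · adj #1 (adj #2 Φ) ≡⟨ ≡.trans (act-adj #1 ψ (adj #2 Φ)) (cong (adj #1) (act-adj #2 ψ Φ)) ⟩
        adj #1 (adj #2 (ψ · Φ)) ≡⟨ cong (λ Ψ → adj #1 (adj #2 Ψ)) h ⟩
        adj #1 (adj #2 (adj #1 Φ)) ≡⟨ ≡.trans (act-adj #1 (ς₂ ⁻¹ᴬ) Φ) (cong (adj #1) ς₂⁻¹Φ) ⟨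
        ς₂ ⁻¹ᴬ · adj #1 Φ ≡⟨ ≡.trans (act-∘ (ς₂ ⁻¹ᴬ) ψ Φ) (cong (ς₂ ⁻¹ᴬ ·_) h) ⟨
        (ς₂ ⁻¹ᴬ ∙ᴬ ψ) · Φ ∎)

  module ChiralRotations (Φ : Flag P) (rot : RotGens P Φ σ₁ σ₂) (chiral : Chiral P) where
    open Based Φ rot public
    open Polyhedron P
    open IsPolyhedron isPolyhedron
    open Flag
    open Aut

    toV-cong : ∀ {a b} → a ≈ᴬ b → ∀ x → toV (aut a) x ≡ toV (aut b) x
    toV-cong (pointwise (p , _ , _)) = p

    toE-cong : ∀ {a b} → a ≈ᴬ b → ∀ x → toE (aut a) x ≡ toE (aut b) x
    toE-cong (pointwise (_ , p , _)) = p

    toF-cong : ∀ {a b} → a ≈ᴬ b → ∀ x → toF (aut a) x ≡ toF (aut b) x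
    toF-cong (pointwise (_ , _ , p)) = p

    colour : Flag P → Bool
    colour = proj₁ chiral

    adj-colour : ∀ i Ψ → colour (adj i Ψ) ≡ not (colour Ψ)
    adj-colour i Ψ = BoolP.¬-not (λ e → proj₁ (proj₂ chiral) i Ψ (adj i Ψ) (adj-spec i Ψ) (≡.sym e))

    -- An automorphism changing the colour of one flag would make P flag-transitive.
    act-colour : ∀ a Ψ → colour ((a · Ψ)) ≡ colour Ψ
    act-colour a Ψ with colour ((a · Ψ)) BoolP.≟ colour Ψ
    ... | yes e = e
    ... | no ne = ⊥-elim (proj₂ (proj₂ (proj₂ chiral)) transitive)
      where
      move : ∀ Φ₁ Φ₂ → colour Φ₁ ≡ colour Φ₂ → ∃ λ g → g · Φ₁ ≡ Φ₂
      move Φ₁ Φ₂ e = let (g , h) = proj₁ (proj₂ (proj₂ chiral)) Φ₁ Φ₂ e in wrap g , ≈F⇒≡ h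
      third : ∀ {x y z : Bool} → x ≢ y → z ≢ y → x ≡ z
      third x≢y z≢y = ≡.trans (BoolP.¬-not x≢y) (≡.sym (BoolP.¬-not z≢y))
      chain : ∀ Φ₁ Φ₂ s t u {Ψ₁ Ψ₂} → s · Φ₁ ≡ Ψ₁ → t · Ψ₁ ≡ Ψ₂ → u · Ψ₂ ≡ Φ₂ → ∃ λ g → _≈F_ P (act P g Φ₁) Φ₂
      chain Φ₁ Φ₂ s t u refl refl refl = _∘A_ P (aut u) (_∘A_ P (aut t) (aut s)) , refl , refl , refl
      transitive : ∀ Φ₁ Φ₂ → ∃ λ g → _≈F_ P (act P g Φ₁) Φ₂
      transitive Φ₁ Φ₂ with colour Φ₁ BoolP.≟ colour Φ₂ | colour Φ₁ BoolP.≟ colour Ψ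
      ... | yes e | _ = proj₁ (proj₂ (proj₂ chiral)) Φ₁ Φ₂ e
      ... | no n₁₂ | yes e₁ =
        let (s , p) = move Φ₁ Ψ e₁
            (u , q) = move (a · Ψ) Φ₂ (third ne (λ e → n₁₂ (≡.trans e₁ (≡.sym e))))
        in chain Φ₁ Φ₂ s a u p refl q
      ... | no n₁₂ | no n₁ =
        let (s , p) = move Φ₁ (a · Ψ) (third n₁ ne)
            (u , q) = move Ψ Φ₂ (third {y = colour Φ₁} (λ e → n₁ (≡.sym e)) (λ e → n₁₂ (≡.sym e)))
        in chain Φ₁ Φ₂ s (a ⁻¹ᴬ) u p (act-inv a Ψ) q

    act≢adj : ∀ g i → (g · Φ) ≢ adj i Φ
    act≢adj g i e = BoolP.not-¬ refl (≡.trans (≡.sym (act-colour g Φ)) (≡.trans (cong colour e) (adj-colour i Φ)))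

    fixes-base : ∀ g i → (g · Φ) ≡ Φ ⊎ (g · Φ) ≡ adj i Φ → g ≈ᴬ A.ε
    fixes-base g i (inj₁ e) = act-determines Φ (≡.trans e (≡.sym (act-id Φ)))
    fixes-base g i (inj₂ e) = ⊥-elim (act≢adj g i e)

    -- Treats σ₁ around the base face (i = 0) and σ₂⁻¹ around the base vertex (i = 2) together: the
    -- flags there are the images of Φ and Φ^i under the powers of `s`, because alternating i- and
    -- 1-adjacency stays in this set.
    module Cycle (i : Fin 3) (s : Automorphism) (h : (s · (adj i Φ)) ≡ adj #1 Φ) where
      private
        InOrbit : Flag P → Set
        InOrbit Ψ = ∃ λ k → Ψ ≡ ((s ↑A.↑ k) · Φ) ⊎ Ψ ≡ ((s ↑A.↑ k) · (adj i Φ))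

        act-suc : ∀ k Ψ → ((s ↑A.↑ (k + + 1)) · Ψ) ≡ ((s ↑A.↑ k) · ((s · Ψ)))
        act-suc k Ψ = ≡.trans (act-cong Ψ (A.trans (↑A.↑-+ s k (+ 1)) (A.∙-congˡ (↑A.↑-1 s))))
          (act-∘ (s ↑A.↑ k) s Ψ)

        orbit-i : Closed InOrbit i
        orbit-i Ψ (k , inj₁ refl) = k , inj₂ (≡.sym (act-adj i (s ↑A.↑ k) Φ))
        orbit-i Ψ (k , inj₂ refl) = k , inj₁ (≡.trans (≡.sym (act-adj i (s ↑A.↑ k) (adj i Φ))) (cong (((s ↑A.↑ k) ·_)) (adj-involutive i Φ)))

        orbit-1 : Closed InOrbit #1
        orbit-1 Ψ (k , inj₁ refl) = k + + 1 , inj₂ (≡.trans (≡.sym (act-adj #1 (s ↑A.↑ k) Φ))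
          (≡.trans (cong (((s ↑A.↑ k) ·_)) (≡.sym h)) (≡.sym (act-suc k (adj i Φ)))))
        orbit-1 Ψ (k , inj₂ refl) = k - + 1 , inj₁ (begin
          adj #1 (((s ↑A.↑ k) · (adj i Φ))) ≡⟨ act-adj #1 (s ↑A.↑ k) (adj i Φ) ⟨
          ((s ↑A.↑ k) · (adj #1 (adj i Φ))) ≡⟨ cong (λ t → ((s ↑A.↑ t) · (adj #1 (adj i Φ)))) (lem k) ⟩
          ((s ↑A.↑ (k - + 1 + + 1)) · (adj #1 (adj i Φ))) ≡⟨ act-suc (k - + 1) (adj #1 (adj i Φ)) ⟩
          ((s ↑A.↑ (k - + 1)) · ((s · (adj #1 (adj i Φ))))) ≡⟨ cong (((s ↑A.↑ (k - + 1)) ·_)) (≡.trans (act-adj #1 s (adj i Φ)) (≡.trans (cong (adj #1) h) (adj-involutive #1 Φ))) ⟩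
          ((s ↑A.↑ (k - + 1)) · Φ) ∎)
          where
          open ≡.≡-Reasoning
          lem : ∀ k → k ≡ k - + 1 + + 1
          lem = solve-∀

        base : InOrbit Φ
        base = + 0 , inj₁ (≡.sym (act-id Φ))

      face-orbit : i ≡ #0 → ∀ Ψ → ff Φ ≡ ff Ψ → InOrbit Ψ
      face-orbit refl Ψ e = face-induction InOrbit orbit-i orbit-1 Φ Ψ e base

      vertex-orbit : i ≡ #2 → ∀ Ψ → fv Φ ≡ fv Ψ → InOrbit Ψ
      vertex-orbit refl Ψ e = vertex-induction InOrbit orbit-1 orbit-i Φ Ψ e base

      -- The order of s is the number n of edges around the common face or vertex.
      module Order (Cell : E → Set) (n : ℕ) {{_ : NonZero n}} (cell : Exactly n Cell)
          (inside : ∀ k → Cell (toE (aut (s ↑A.↑ k)) (fe Φ)))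
          (covered : ∀ e → Cell e → ∃ λ k → e ≡ toE (aut (s ↑A.↑ k)) (fe Φ))
          (free : ∀ k → toE (aut (s ↑A.↑ k)) (fe Φ) ≡ fe Φ → (s ↑A.↑ k) ≈ᴬ A.ε) where
        private
          edge : ℤ → E
          edge k = toE (aut (s ↑A.↑ k)) (fe Φ)

          edge-≡⇒ : ∀ j k → edge j ≡ edge k → (s ↑A.↑ (k - j)) ≈ᴬ A.ε
          edge-≡⇒ j k e = free (k - j) (begin
            toE (aut (s ↑A.↑ (k - j))) (fe Φ) ≡⟨ toE-cong (A.trans (↑A.↑-≡ s (ℤP.+-comm k (- j))) (A.trans (↑A.↑-+ s (- j) k)
                (A.trans (A.∙-congʳ (A.trans (↑A.↑-neg s j) (A.sym (inverse-wrap (s ↑A.↑ j))))) (A.sym (compose-wrap _ (s ↑A.↑ k)))))) (fe Φ) ⟩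
            fromE (aut (s ↑A.↑ j)) (edge k) ≡⟨ cong (fromE (aut (s ↑A.↑ j))) e ⟨
            fromE (aut (s ↑A.↑ j)) (edge j) ≡⟨ invlE (aut (s ↑A.↑ j)) (fe Φ) ⟩
            fe Φ ∎)
            where open ≡.≡-Reasoning

          index : ∀ k → ∃ λ j → proj₁ cell j ≡ edge k
          index k = proj₂ (proj₂ (proj₂ cell)) (edge k) (inside k)

          κ : Fin n → ℤ
          κ j = proj₁ (covered (proj₁ cell j) (proj₁ (proj₂ (proj₂ cell)) j))

          κ-spec : ∀ j → proj₁ cell j ≡ edge (κ j)
          κ-spec j = proj₂ (covered (proj₁ cell j) (proj₁ (proj₂ (proj₂ cell)) j))

          period-large : ∀ M {{_ : NonZero M}} → (s ↑A.↑ + M) ≈ᴬ A.ε → n ≤ M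
          period-large M o = FinP.injective⇒≤ {f = λ j → residue M (κ j)} λ {j} {k} e →
            proj₁ (proj₂ cell) j k (≡.trans (κ-spec j) (≡.trans
              (toE-cong (↑A.↑-mod s (+ M) (κ j) (κ k) o (residue-≡⇒∣ M (κ j) (κ k) e)) (fe Φ)) (≡.sym (κ-spec k))))

          period : ∃ λ M → suc M ≤ n × (s ↑A.↑ + suc M) ≈ᴬ A.ε
          period = from (FinP.pigeonhole (ℕP.n<1+n n) (λ k → proj₁ (index (+ toℕ k))))
            where
            from : (∃₂ λ j k → j Fin.< k × proj₁ (index (+ toℕ j)) ≡ proj₁ (index (+ toℕ k))) → ∃ λ M → suc M ≤ n × (s ↑A.↑ + suc M) ≈ᴬ A.ε
            from (j , k , j<k , e) = toℕ k ℕ.∸ suc (toℕ j) , bound , A.trans (↑A.↑-≡ s diff)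
                (edge-≡⇒ (+ toℕ j) (+ toℕ k) (≡.trans (≡.sym (proj₂ (index (+ toℕ j)))) (≡.trans (cong (proj₁ cell) e) (proj₂ (index (+ toℕ k))))))
              where
              suc-diff : suc (toℕ k ℕ.∸ suc (toℕ j)) ≡ toℕ k ℕ.∸ toℕ j
              suc-diff = ≡.sym (ℕP.+-∸-assoc 1 j<k)
              bound : suc (toℕ k ℕ.∸ suc (toℕ j)) ≤ n
              bound = subst (_≤ n) (≡.sym suc-diff) (ℕP.≤-trans (ℕP.m∸n≤m (toℕ k) (toℕ j)) (ℕP.≤-pred (FinP.toℕ<n k)))
              diff : + suc (toℕ k ℕ.∸ suc (toℕ j)) ≡ + toℕ k - + toℕ j
              diff = ≡.trans (cong +_ suc-diff) (≡.trans (≡.sym (ℤP.⊖-≥ (ℕP.<⇒≤ j<k))) (≡.sym (ℤP.[+m]-[+n]≡m⊖n (toℕ k) (toℕ j))))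

        -- Among the exponents 0 to n two give the same edge, so by freeness some period is at most
        -- n. No period is shorter, since the n edges have exponents in distinct classes modulo any
        -- period.
        order : (s ↑A.↑ + n) ≈ᴬ A.ε
        order = let (M , M≤n , o) = period in
          subst (λ t → (s ↑A.↑ + t) ≈ᴬ A.ε) (ℕP.≤-antisym M≤n (period-large (suc M) o)) o

        order-∣ : ∀ k → (s ↑A.↑ k) ≈ᴬ A.ε → + n ∣ k
        order-∣ k o = from (toℕ r) refl
          where
          r : Fin n
          r = residue n k
          from : ∀ t → toℕ r ≡ t → + n ∣ k
          from zero e = ∣-resp (ℤP.+-identityʳ k) (subst (λ t → + n ∣ k - + t) e (residue-spec n k))
          from (suc t) e = ⊥-elim (ℕP.<⇒≱ (FinP.toℕ<n r) (subst (n ≤_) (≡.sym e) (period-large (suc t)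
            (A.trans (A.sym (↑A.↑-mod s (+ n) k (+ suc t) order (subst (λ t → + n ∣ k - + t) e (residue-spec n k)))) o))))

module Stabilizer (P : Polyhedron) {X : Set} (op : FlagGraph.Automorphism P → X → X)
    (op-cong : ∀ {g h} → FlagGraph._≈ᴬ_ P g h → ∀ x → op g x ≡ op h x)
    (op-∘ : ∀ g h x → op (FlagGraph.compose P g h) x ≡ op g (op h x))
    (op-id : ∀ x → op (FlagGraph.idᴬ P) x ≡ x) where
  open FlagGraph P
  private
    module A = Group autGroup
    module ↑A = Powers autGroup

  op-inv : ∀ g x → op (g A.⁻¹) (op g x) ≡ x
  op-inv g x = ≡.trans (≡.sym (op-∘ (g A.⁻¹) g x)) (≡.trans (op-cong (A.inverseˡ g) x) (op-id x))

  fix-⁻¹ : ∀ g x → op g x ≡ x → op (g A.⁻¹) x ≡ x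
  fix-⁻¹ g x e = ≡.trans (cong (op (g A.⁻¹)) (≡.sym e)) (op-inv g x)

  fix-↑ : ∀ g x → op g x ≡ x → ∀ k → op (g ↑A.↑ k) x ≡ x
  fix-↑ g x e = ℤ-ind (λ k → op (g ↑A.↑ k) x ≡ x) (op-id x)
    (λ k ih → ≡.trans (op-cong (↑A.↑-suc g k) x) (≡.trans (op-∘ g (g ↑A.↑ k) x) (≡.trans (cong (op g) ih) e)))
    (λ k ih → ≡.trans (op-cong (↑A.↑-pred g k) x) (≡.trans (op-∘ (g A.⁻¹) (g ↑A.↑ k) x) (≡.trans (cong (op (g A.⁻¹)) ih) (fix-⁻¹ g x e))))

module TightRotations (P : Polyhedron) (Φ : Flag P) (σ₁ σ₂ : Aut P) (rot : RotGens P Φ σ₁ σ₂) (chiral : Chiral P)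
    (p q : ℕ) {{_ : NonZero p}} {{_ : NonZero q}} (ht : HasType P p q) (tight : Tight P p q) where
  open FlagGraph P
  open Rotations P σ₁ σ₂
  open ChiralRotations Φ rot chiral
  open Polyhedron P
  open IsPolyhedron isPolyhedron
  open Flag
  open Aut
  private
    module A = Group autGroup
    module ↑A = Powers autGroup

  opV : Automorphism → V → V
  opV g = toV (aut g)

  opE : Automorphism → E → E
  opE g = toE (aut g)

  opF : Automorphism → F → F
  opF g = toF (aut g)

  opV-∘ : ∀ g h x → opV (compose g h) x ≡ opV g (opV h x)
  opV-∘ g h x = ≡.sym (toV-cong (compose-wrap g h) x)

  opE-∘ : ∀ g h x → opE (compose g h) x ≡ opE g (opE h x)
  opE-∘ g h x = ≡.sym (toE-cong (compose-wrap g h) x)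

  opF-∘ : ∀ g h x → opF (compose g h) x ≡ opF g (opF h x)
  opF-∘ g h x = ≡.sym (toF-cong (compose-wrap g h) x)

  private
    opV-id : ∀ x → opV A.ε x ≡ x
    opV-id x = ≡.sym (toV-cong identity-wrap x)

    opE-id : ∀ x → opE A.ε x ≡ x
    opE-id x = ≡.sym (toE-cong identity-wrap x)

    opF-id : ∀ x → opF A.ε x ≡ x
    opF-id x = ≡.sym (toF-cong identity-wrap x)

    module SV = Stabilizer P opV toV-cong opV-∘ opV-id
    module SE = Stabilizer P opE toE-cong opE-∘ opE-id
    module SF = Stabilizer P opF toF-cong opF-∘ opF-id

  v₀ : V
  v₀ = fv Φ

  e₀ : E
  e₀ = fe Φ

  f₀ : F
  f₀ = ff Φ

  ς₁-f₀ : opF ς₁ f₀ ≡ f₀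
  ς₁-f₀ = ≡.trans (cong (opF ς₁) (proj₂ (proj₂ (adj-spec #0 Φ)))) (≡.trans (cong ff act-ς₁-adj₀) (≡.sym (proj₂ (proj₂ (adj-spec #1 Φ)))))

  ς₂-v₀ : opV ς₂ v₀ ≡ v₀
  ς₂-v₀ = ≡.trans (cong (opV ς₂) (proj₁ (adj-spec #1 Φ))) (≡.trans (cong fv act-ς₂-adj₁) (≡.sym (proj₁ (adj-spec #2 Φ))))

  private
    ς₁ᵏ-f₀ : ∀ k → opF (ς₁ ↑A.↑ k) f₀ ≡ f₀
    ς₁ᵏ-f₀ = SF.fix-↑ ς₁ f₀ ς₁-f₀

    ς₂ᵏ-v₀ : ∀ k → opV (ς₂ ↑A.↑ k) v₀ ≡ v₀
    ς₂ᵏ-v₀ = SV.fix-↑ ς₂ v₀ ς₂-v₀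

    module FaceCycle where
      inside : ∀ k → _≤ef_ pre (opE (ς₁ ↑A.↑ k) e₀) f₀
      inside k = subst (λ f → ief (opE (ς₁ ↑A.↑ k) e₀) f ≡ true) (ς₁ᵏ-f₀ k) (≡.trans (presEF (aut (ς₁ ↑A.↑ k)) e₀ f₀) (pef Φ))

      covered : ∀ e → _≤ef_ pre e f₀ → ∃ λ k → e ≡ opE (ς₁ ↑A.↑ k) e₀
      covered e ef = from (Cycle.face-orbit #0 ς₁ act-ς₁-adj₀ refl Ψ refl)
        where
        v = proj₁ (edge-vertices e) zero
        ve = proj₁ (proj₂ (proj₂ (edge-vertices e))) zero
        Ψ : Flag P
        Ψ = flag v e f₀ ve ef (order-trans v e f₀ ve ef)
        from : (∃ λ k → Ψ ≡ (ς₁ ↑A.↑ k) · Φ ⊎ Ψ ≡ (ς₁ ↑A.↑ k) · adj #0 Φ) → ∃ λ k → e ≡ opE (ς₁ ↑A.↑ k) e₀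
        from (k , inj₁ h) = k , cong fe h
        from (k , inj₂ h) = k , ≡.trans (cong fe h) (cong (opE (ς₁ ↑A.↑ k)) (≡.sym (proj₁ (proj₂ (adj-spec #0 Φ)))))

      free : ∀ k → opE (ς₁ ↑A.↑ k) e₀ ≡ e₀ → (ς₁ ↑A.↑ k) ≈ᴬ A.ε
      free k e = fixes-base (ς₁ ↑A.↑ k) #0 (same-EF {Φ} {(ς₁ ↑A.↑ k) · Φ} (≡.sym e) (≡.sym (ς₁ᵏ-f₀ k)))

    module VertexCycle where
      -- `Cycle` wants Φ^i to be sent to Φ¹; σ₂ sends Φ¹ to Φ², whence the inverse.
      τ : Automorphism
      τ = ς₂ A.⁻¹

      τ-adj₂ : τ · adj #2 Φ ≡ adj #1 Φ
      τ-adj₂ = ≡.trans (cong (τ ·_) (≡.sym act-ς₂-adj₁)) (act-inv ς₂ (adj #1 Φ))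

      τᵏ-v₀ : ∀ k → opV (τ ↑A.↑ k) v₀ ≡ v₀
      τᵏ-v₀ = SV.fix-↑ τ v₀ (SV.fix-⁻¹ ς₂ v₀ ς₂-v₀)

      inside : ∀ k → _≤ve_ pre v₀ (opE (τ ↑A.↑ k) e₀)
      inside k = subst (λ v → ive v (opE (τ ↑A.↑ k) e₀) ≡ true) (τᵏ-v₀ k) (≡.trans (presVE (aut (τ ↑A.↑ k)) v₀ e₀) (pve Φ))

      covered : ∀ e → _≤ve_ pre v₀ e → ∃ λ k → e ≡ opE (τ ↑A.↑ k) e₀
      covered e ve = from (Cycle.vertex-orbit #2 τ τ-adj₂ refl Ψ refl)
        where
        f = proj₁ (edge-faces e) zero
        ef = proj₁ (proj₂ (proj₂ (edge-faces e))) zero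
        Ψ : Flag P
        Ψ = flag v₀ e f ve ef (order-trans v₀ e f ve ef)
        from : (∃ λ k → Ψ ≡ (τ ↑A.↑ k) · Φ ⊎ Ψ ≡ (τ ↑A.↑ k) · adj #2 Φ) → ∃ λ k → e ≡ opE (τ ↑A.↑ k) e₀
        from (k , inj₁ h) = k , cong fe h
        from (k , inj₂ h) = k , ≡.trans (cong fe h) (cong (opE (τ ↑A.↑ k)) (≡.sym (proj₁ (proj₂ (adj-spec #2 Φ)))))

      free : ∀ k → opE (τ ↑A.↑ k) e₀ ≡ e₀ → (τ ↑A.↑ k) ≈ᴬ A.ε
      free k e = fixes-base (τ ↑A.↑ k) #2 (same-VE {Φ} {(τ ↑A.↑ k) · Φ} (≡.sym (τᵏ-v₀ k)) (≡.sym e))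

    module O₁ = Cycle.Order #0 ς₁ act-ς₁-adj₀ (λ e → _≤ef_ pre e f₀) p (proj₁ ht f₀) FaceCycle.inside FaceCycle.covered FaceCycle.free
    module O₂ = Cycle.Order #2 VertexCycle.τ VertexCycle.τ-adj₂ (λ e → _≤ve_ pre v₀ e) q (proj₂ ht v₀)
      VertexCycle.inside VertexCycle.covered VertexCycle.free

    ς₂-order : (ς₂ ↑A.↑ + q) ≈ᴬ A.ε
    ς₂-order = ⁻¹-injective (A.trans (A.sym (↑A.⁻¹-↑ ς₂ (+ q))) (A.trans O₂.order (A.sym ε⁻¹≈ε)))
      where open import Algebra.Properties.Group autGroup using (⁻¹-injective; ε⁻¹≈ε)

    ς₂-∣ : ∀ k → (ς₂ ↑A.↑ k) ≈ᴬ A.ε → + q ∣ k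
    ς₂-∣ k e = O₂.order-∣ k (A.trans (↑A.⁻¹-↑ ς₂ k) (A.trans (A.⁻¹-cong e) ε⁻¹≈ε))
      where open import Algebra.Properties.Group autGroup using (ε⁻¹≈ε)

  -- Only two flags contain the base vertex and face, Φ and Φ¹, and chirality excludes the second as
  -- an image of Φ. This yields ⟨σ₁⟩ ∩ ⟨σ₂⟩ = 1.
  fixes-VF : ∀ g → opV g v₀ ≡ v₀ → opF g f₀ ≡ f₀ → g ≈ᴬ A.ε
  fixes-VF g e f = fixes-base g #1 (same-VF {Φ} {g · Φ} (≡.sym e) (≡.sym f))

  private
    intersection : ∀ x y → (ς₁ ↑A.↑ x) ≈ᴬ (ς₂ ↑A.↑ y) → + p ∣ x × + q ∣ y
    intersection x y e = O₁.order-∣ x trivial , ς₂-∣ y (A.trans (A.sym e) trivial)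
      where
      trivial : (ς₁ ↑A.↑ x) ≈ᴬ A.ε
      trivial = fixes-VF (ς₁ ↑A.↑ x) (≡.trans (toV-cong e v₀) (ς₂ᵏ-v₀ y)) (ς₁ᵏ-f₀ x)

    rotation : Fin p → Fin q → Automorphism
    rotation x y = (ς₁ ↑A.↑ + toℕ x) A.∙ (ς₂ ↑A.↑ + toℕ y)

    rotation-injective : ∀ x y x′ y′ → rotation x y ≈ᴬ rotation x′ y′ → x ≡ x′ × y ≡ y′
    rotation-injective x y x′ y′ e =
      let (d , d′) = intersection (- + toℕ x′ + + toℕ x) (+ toℕ y′ - + toℕ y)
            (A.trans (↑A.↑-+ ς₁ (- + toℕ x′) (+ toℕ x)) (A.trans (A.∙-congʳ (↑A.↑-neg ς₁ (+ toℕ x′)))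
              (A.trans (quotient e) (A.sym (A.trans (↑A.↑-+ ς₂ (+ toℕ y′) (- + toℕ y)) (A.∙-congˡ (↑A.↑-neg ς₂ (+ toℕ y))))))))
      in ∣-small p x x′ (∣-resp (ℤP.+-comm (- + toℕ x′) (+ toℕ x)) d) , ≡.sym (∣-small q y′ y d′)
      where
      quotient : ∀ {s t s′ t′} → s A.∙ t ≈ᴬ s′ A.∙ t′ → s′ A.⁻¹ A.∙ s ≈ᴬ t′ A.∙ t A.⁻¹
      quotient {s} {t} {s′} {t′} = ↑A.cross-quotient s t s′ t′

    base : Fin 2 → Flag P
    base zero = Φ
    base (suc zero) = adj #0 Φ

    enumerate : (Fin 2 × Fin p) × Fin q → Flag P
    enumerate ((i , x) , y) = rotation x y · base i

    rotation-flag : ∀ x y x′ y′ → rotation x y · Φ ≡ rotation x′ y′ · Φ → x ≡ x′ × y ≡ y′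
    rotation-flag x y x′ y′ e = rotation-injective x y x′ y′ (act-determines Φ e)

    ≢-colour : ∀ g h → g · Φ ≢ h · adj #0 Φ
    ≢-colour g h e = BoolP.not-¬ refl (≡.trans (≡.sym (act-colour g Φ)) (≡.trans (cong colour e)
      (≡.trans (act-colour h (adj #0 Φ)) (adj-colour #0 Φ))))

    enumerate-injective : ∀ s t → enumerate s ≡ enumerate t → s ≡ t
    enumerate-injective ((zero , x) , y) ((zero , x′) , y′) e =
      let (h , k) = rotation-flag x y x′ y′ e in cong₂ (λ x y → (zero , x) , y) h k
    enumerate-injective ((zero , x) , y) ((suc zero , x′) , y′) e = ⊥-elim (≢-colour (rotation x y) (rotation x′ y′) e)
    enumerate-injective ((suc zero , x) , y) ((zero , x′) , y′) e = ⊥-elim (≢-colour (rotation x′ y′) (rotation x y) (≡.sym e))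
    enumerate-injective ((suc zero , x) , y) ((suc zero , x′) , y′) e =
      let (h , k) = rotation-flag x y x′ y′ (≡.trans (≡.sym (adj-involutive #0 (rotation x y · Φ))) (≡.trans (cong (adj #0)
            (≡.trans (≡.sym (act-adj #0 (rotation x y) Φ)) (≡.trans e (act-adj #0 (rotation x′ y′) Φ)))) (adj-involutive #0 (rotation x′ y′ · Φ))))
      in cong₂ (λ x y → (suc zero , x) , y) h k

    -- By tightness, the 2pq flags a^x b^y Φ and a^x b^y Φ⁰ are all the flags.
    all-flags : ∀ Ψ → ∃ λ t → enumerate t ≡ Ψ
    all-flags Ψ = splitIndex p q (proj₁ hit) , ≈F⇒≡ same
      where
      index : Flag P → Fin (2 ℕ.* p ℕ.* q)
      index Ψ = proj₁ (proj₂ (proj₂ tight) Ψ)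
      index-spec : ∀ Ψ → proj₁ tight (index Ψ) ≡ Ψ
      index-spec Ψ = ≈F⇒≡ (proj₂ (proj₂ (proj₂ tight) Ψ))
      index-injective : ∀ Ψ Ψ′ → index Ψ ≡ index Ψ′ → Ψ ≡ Ψ′
      index-injective Ψ Ψ′ e = ≡.trans (≡.sym (index-spec Ψ)) (≡.trans (cong (proj₁ tight) e) (index-spec Ψ′))
      hit : ∃ λ i → index (enumerate (splitIndex p q i)) ≡ index Ψ
      hit = injective⇒surjective (λ i → index (enumerate (splitIndex p q i)))
        (λ i j e → ≡.trans (≡.sym (join-split p q i)) (≡.trans (cong (joinIndex p q) (enumerate-injective (splitIndex p q i) (splitIndex p q j) (index-injective (enumerate (splitIndex p q i)) (enumerate (splitIndex p q j)) e))) (join-split p q j)))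
        (index Ψ)
      same : _≈F_ P (enumerate (splitIndex p q (proj₁ hit))) Ψ
      same = let e = index-injective (enumerate (splitIndex p q (proj₁ hit))) Ψ (proj₂ hit) in cong fv e , cong fe e , cong ff e

  even-flag : ∀ Ψ → colour Ψ ≡ colour Φ → ∃₂ λ x y → ((ς₁ ↑A.↑ x) A.∙ (ς₂ ↑A.↑ y)) · Φ ≡ Ψ
  even-flag Ψ c = from (all-flags Ψ)
    where
    from : (∃ λ t → enumerate t ≡ Ψ) → ∃₂ λ x y → ((ς₁ ↑A.↑ x) A.∙ (ς₂ ↑A.↑ y)) · Φ ≡ Ψ
    from (((zero , x) , y) , e) = + toℕ x , + toℕ y , e
    from (((suc zero , x) , y) , e) = ⊥-elim (BoolP.not-¬ refl (≡.trans (≡.sym c) (≡.trans (cong colour (≡.sym e))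
      (≡.trans (act-colour (rotation x y) (adj #0 Φ)) (adj-colour #0 Φ)))))

  private
    _↑_ : Word → ℤ → Word
    _↑_ = Powers._↑_ Γ

    ev-product : ∀ x y → ev ((word₁ ↑ x) ++ (word₂ ↑ y)) ≈ᴬ (ς₁ ↑A.↑ x) A.∙ (ς₂ ↑A.↑ y)
    ev-product x y = A.trans (ev-++ (word₁ ↑ x) (word₂ ↑ y)) (A.∙-cong (ev-word₁ x) (ev-word₂ y))

  Γ-tight : IsTight Γ word₁ word₂ p q
  Γ-tight = record
    { rel = evaluate (A.trans (ev-++ (word₁ ++ word₂) (word₁ ++ word₂)) (A.trans (A.∙-cong ab ab) (A.trans ς₁ς₂-involution (A.sym identity-wrap))))
    ; a-order = evaluate (A.trans (ev-word₁ (+ p)) (A.trans O₁.order (A.sym identity-wrap)))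
    ; b-order = evaluate (A.trans (ev-word₂ (+ q)) (A.trans ς₂-order (A.sym identity-wrap)))
    ; normalForm = λ w → let (x , y , e) = even-flag (ev w · Φ) (act-colour (ev w) Φ)
        in x , y , evaluate (A.trans (A.sym (act-determines Φ e)) (A.sym (ev-product x y)))
    ; independent = λ x y e → intersection x y (A.trans (A.sym (ev-word₁ x)) (A.trans (evaluation e) (ev-word₂ y)))
    }
    where
    ab : ev (word₁ ++ word₂) ≈ᴬ ς₁ A.∙ ς₂
    ab = A.trans (ev-++ word₁ word₂) (A.∙-cong ev-gen₁ ev-gen₂)

  -- If inverting the generators preserves all relations, it induces an automorphism taking Φ to Φ¹.
  module Reflect (regular : Evaluation.Regular Γ word₁ word₂) where
    private
      bar : Word → Word
      bar = evalAt _++_ [] invW (invW word₁) (invW word₂)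

      bar-bar : ∀ w → bar (bar w) ≡ w
      bar-bar [] = refl
      bar-bar (⁺ s₁ ∷ w) = cong (⁺ s₁ ∷_) (bar-bar w)
      bar-bar (⁺ s₂ ∷ w) = cong (⁺ s₂ ∷_) (bar-bar w)
      bar-bar (⁻ s₁ ∷ w) = cong (⁻ s₁ ∷_) (bar-bar w)
      bar-bar (⁻ s₂ ∷ w) = cong (⁻ s₂ ∷_) (bar-bar w)

      module G = Group Γ
      open import Algebra.Properties.Group Γ using (inverseʳ-unique; x∙y⁻¹≈ε⇒x≈y; x≈y⇒x∙y⁻¹≈ε)

      bar-++ : ∀ u v → bar (u ++ v) ≈Γ bar u ++ bar v
      bar-++ = Evaluation.eval-++ Γ (invW word₁) (invW word₂)

      bar-ε : ∀ w → w ≈Γ [] → bar w ≈Γ []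
      bar-ε w e = regular w (G.trans (G.reflexive (eval-word w)) e)

      bar-inv : ∀ w → bar (invW w) ≈Γ invW (bar w)
      bar-inv w = inverseʳ-unique (bar w) (bar (invW w)) (G.trans (G.sym (bar-++ w (invW w))) (bar-ε (w ++ invW w) (G.inverseʳ w)))

      bar-cong : ∀ {u v} → u ≈Γ v → bar u ≈Γ bar v
      bar-cong {u} {v} e = x∙y⁻¹≈ε⇒x≈y (bar u) (bar v) (G.trans (G.∙-congˡ (G.sym (bar-inv v)))
        (G.trans (G.sym (bar-++ u (invW v))) (bar-ε (u ++ invW v) (x≈y⇒x∙y⁻¹≈ε e))))

      bar-pow₁ : ∀ k → ev (bar (pow s₁ k)) ≈ᴬ ((ς₁ A.⁻¹) ↑A.↑ k)
      bar-pow₁ k = A.trans (evaluation (Evaluation.eval-pow Γ (invW word₁) (invW word₂) s₁ k))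
        (A.trans (ev-↑ (invW word₁) k) (↑A.↑-cong k (A.trans (ev-⁻¹ word₁) (A.⁻¹-cong ev-gen₁))))

      bar-pow₂ : ∀ k → ev (bar (pow s₂ k)) ≈ᴬ ((ς₂ A.⁻¹) ↑A.↑ k)
      bar-pow₂ k = A.trans (evaluation (Evaluation.eval-pow Γ (invW word₁) (invW word₂) s₂ k))
        (A.trans (ev-↑ (invW word₂) k) (↑A.↑-cong k (A.trans (ev-⁻¹ word₂) (A.⁻¹-cong ev-gen₂))))

      pow≈ : ∀ s k → pow s k ≈Γ (Evaluation.gen Γ word₁ word₂ s ↑ k)
      pow≈ s k = G.trans (G.reflexive (≡.sym (eval-word (pow s k)))) (Evaluation.eval-pow Γ word₁ word₂ s k)

      from-ε : ∀ {w} → ev w ≈ᴬ A.ε → w ≈Γ []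
      from-ε e = evaluate (A.trans e (A.sym identity-wrap))

      -- The stabilisers of the base vertex, face and edge are found to be ⟨b⟩, ⟨a⟩ and ⟨ba⟩. They
      -- control whether a map given on words descends to vertices, faces and edges.
      stabilizer-V : ∀ d → opV (ev d) v₀ ≡ v₀ → ∃ λ k → d ≈Γ pow s₂ k
      stabilizer-V d e = let (x , y , f) = IsTight.normalForm Γ-tight d in y ,
        G.trans f (G.trans (G.∙-congʳ (from-ε (A.trans (ev-word₁ x) (fixes-VF (ς₁ ↑A.↑ x) (fixed x y f) (ς₁ᵏ-f₀ x))))) (G.sym (pow≈ s₂ y)))
        where
        fixed : ∀ x y → d ≈Γ (word₁ ↑ x) ++ (word₂ ↑ y) → opV (ς₁ ↑A.↑ x) v₀ ≡ v₀
        fixed x y f = ≡.trans (cong (opV (ς₁ ↑A.↑ x)) (≡.sym (ς₂ᵏ-v₀ y))) (≡.trans (≡.sym (opV-∘ (ς₁ ↑A.↑ x) (ς₂ ↑A.↑ y) v₀))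
          (≡.trans (toV-cong (A.sym (A.trans (evaluation f) (ev-product x y))) v₀) e))

      stabilizer-F : ∀ d → opF (ev d) f₀ ≡ f₀ → ∃ λ k → d ≈Γ pow s₁ k
      stabilizer-F d e = let (y , x , f) = TightProps.normalForm′ Γ-tight d in x ,
        G.trans f (G.trans (G.∙-congʳ (from-ε (A.trans (ev-word₂ y) (fixes-VF (ς₂ ↑A.↑ y) (ς₂ᵏ-v₀ y) (fixed x y f))))) (G.sym (pow≈ s₁ x)))
        where
        fixed : ∀ x y → d ≈Γ (word₂ ↑ y) ++ (word₁ ↑ x) → opF (ς₂ ↑A.↑ y) f₀ ≡ f₀
        fixed x y f = ≡.trans (cong (opF (ς₂ ↑A.↑ y)) (≡.sym (ς₁ᵏ-f₀ x))) (≡.trans (≡.sym (opF-∘ (ς₂ ↑A.↑ y) (ς₁ ↑A.↑ x) f₀))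
          (≡.trans (toF-cong (A.sym (A.trans (evaluation f) (A.trans (ev-++ (word₂ ↑ y) (word₁ ↑ x)) (A.∙-cong (ev-word₂ y) (ev-word₁ x))))) f₀) e))

      stabilizer-E : ∀ d → opE (ev d) e₀ ≡ e₀ → d ≈Γ [] ⊎ d ≈Γ word₂ ++ word₁
      stabilizer-E d e with two-dec (edge-vertices e₀) (pve Φ) (subst (_≤ve_ pre (fv (ev d · Φ))) e (pve (ev d · Φ)))
      ... | inj₁ same = inj₁ (from-ε (fixes-base (ev d) #2 (same-VE {Φ} {ev d · Φ} same (≡.sym e))))
      ... | inj₂ other = inj₂ (rotated (same-VE {adj #0 Φ} {ev d · Φ}
          (two-unique (edge-vertices e₀) (pve Φ) (subst (_≤ve_ pre (fv (adj #0 Φ))) (≡.sym (proj₁ (proj₂ (adj-spec #0 Φ)))) (pve (adj #0 Φ)))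
            (subst (_≤ve_ pre (fv (ev d · Φ))) e (pve (ev d · Φ))) (proj₁ (adj-spec #0 Φ)) other)
          (≡.sym (≡.trans e (proj₁ (proj₂ (adj-spec #0 Φ)))))))
        where
        rotated : ev d · Φ ≡ adj #0 Φ ⊎ ev d · Φ ≡ adj #2 (adj #0 Φ) → d ≈Γ word₂ ++ word₁
        rotated (inj₁ h) = ⊥-elim (act≢adj (ev d) #0 h)
        rotated (inj₂ h) = evaluate (A.trans (act-determines {ev d} {ς₂ A.∙ ς₁} Φ (≡.trans h (≡.trans (≡.sym (adj-02 Φ)) (≡.sym act-ς₂ς₁))))
          (A.sym (A.trans (ev-++ word₂ word₁) (A.∙-cong ev-gen₂ ev-gen₁))))

      module WellDefined {X : Set} (op : Automorphism → X → X) (op-cong : ∀ {g h} → g ≈ᴬ h → ∀ x → op g x ≡ op h x)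
          (op-∘ : ∀ g h x → op (compose g h) x ≡ op g (op h x)) (op-id : ∀ x → op A.ε x ≡ x) (x₀ x₁ : X)
          (stabilizer : ∀ d → op (ev d) x₀ ≡ x₀ → op (ev (bar d)) x₁ ≡ x₁) where
        private module S = Stabilizer P op op-cong op-∘ op-id

        well-defined : ∀ u v → op (ev u) x₀ ≡ op (ev v) x₀ → op (ev (bar u)) x₁ ≡ op (ev (bar v)) x₁
        well-defined u v e = begin
          op (ev (bar u)) x₁ ≡⟨ cong (op (ev (bar u))) (stabilizer (invW u ++ v) fixed) ⟨
          op (ev (bar u)) (op (ev (bar (invW u ++ v))) x₁) ≡⟨ op-∘ (ev (bar u)) (ev (bar (invW u ++ v))) x₁ ⟨
          op (compose (ev (bar u)) (ev (bar (invW u ++ v)))) x₁ ≡⟨ op-cong (A.sym (ev-++ (bar u) (bar (invW u ++ v)))) x₁ ⟩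
          op (ev (bar u ++ bar (invW u ++ v))) x₁ ≡⟨ op-cong (evaluation (G.sym (bar-++ u (invW u ++ v)))) x₁ ⟩
          op (ev (bar (u ++ (invW u ++ v)))) x₁ ≡⟨ op-cong (evaluation (bar-cong {u ++ (invW u ++ v)} {v} (G.trans (G.sym (G.assoc u (invW u) v)) (G.∙-congʳ (G.inverseʳ u))))) x₁ ⟩
          op (ev (bar v)) x₁ ∎
          where
          open ≡.≡-Reasoning
          fixed : op (ev (invW u ++ v)) x₀ ≡ x₀
          fixed = ≡.trans (op-cong (A.trans (ev-++ (invW u) v) (A.∙-congʳ (ev-⁻¹ u))) x₀)
            (≡.trans (op-∘ (ev u A.⁻¹) (ev v) x₀) (≡.trans (cong (op (ev u A.⁻¹)) (≡.sym e)) (S.op-inv (ev u) x₀)))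

      -- The edge of Φ¹. Inversion takes the stabiliser generator ba of the base edge to b⁻¹a⁻¹,
      -- which fixes this edge; so the reflection has to send the base edge here, while it keeps the
      -- base vertex and face.
      e₁ : E
      e₁ = opE ς₁ e₀

      ς₂e₁ : opE ς₂ e₁ ≡ e₀
      ς₂e₁ = ≡.trans (≡.sym (opE-∘ ς₂ ς₁ e₀)) (≡.trans (cong fe act-ς₂ς₁)
        (≡.sym (≡.trans (proj₁ (proj₂ (adj-spec #2 Φ))) (proj₁ (proj₂ (adj-spec #0 (adj #2 Φ)))))))

      stable-V : ∀ d → opV (ev d) v₀ ≡ v₀ → opV (ev (bar d)) v₀ ≡ v₀
      stable-V d e = let (k , f) = stabilizer-V d e in
        ≡.trans (toV-cong (A.trans (evaluation (bar-cong f)) (bar-pow₂ k)) v₀) (SV.fix-↑ (ς₂ A.⁻¹) v₀ (SV.fix-⁻¹ ς₂ v₀ ς₂-v₀) k)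

      stable-F : ∀ d → opF (ev d) f₀ ≡ f₀ → opF (ev (bar d)) f₀ ≡ f₀
      stable-F d e = let (k , f) = stabilizer-F d e in
        ≡.trans (toF-cong (A.trans (evaluation (bar-cong f)) (bar-pow₁ k)) f₀) (SF.fix-↑ (ς₁ A.⁻¹) f₀ (SF.fix-⁻¹ ς₁ f₀ ς₁-f₀) k)

      stable-E : ∀ d → opE (ev d) e₀ ≡ e₀ → opE (ev (bar d)) e₁ ≡ e₁
      stable-E d e = from (stabilizer-E d e)
        where
        bar-ba : ev (invW word₂ ++ invW word₁) ≈ᴬ (ς₂ A.⁻¹) A.∙ (ς₁ A.⁻¹)
        bar-ba = A.trans (ev-++ (invW word₂) (invW word₁)) (A.∙-cong (A.trans (ev-⁻¹ word₂) (A.⁻¹-cong ev-gen₂)) (A.trans (ev-⁻¹ word₁) (A.⁻¹-cong ev-gen₁)))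
        from : d ≈Γ [] ⊎ d ≈Γ word₂ ++ word₁ → opE (ev (bar d)) e₁ ≡ e₁
        from (inj₁ f) = toE-cong (evaluation (bar-cong f)) e₁
        from (inj₂ f) = ≡.trans (toE-cong (A.trans (evaluation (bar-cong f)) bar-ba) e₁) (≡.trans (opE-∘ (ς₂ A.⁻¹) (ς₁ A.⁻¹) e₁)
          (≡.trans (cong (opE (ς₂ A.⁻¹)) (SE.op-inv ς₁ e₀)) (≡.trans (cong (opE (ς₂ A.⁻¹)) (≡.sym ς₂e₁)) (SE.op-inv ς₂ e₁))))

      module WV = WellDefined opV toV-cong opV-∘ opV-id v₀ v₀ stable-V
      module WE = WellDefined opE toE-cong opE-∘ opE-id e₀ e₁ stable-E
      module WF = WellDefined opF toF-cong opF-∘ opF-id f₀ f₀ stable-F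

      word-of : ∀ Ψ → colour Ψ ≡ colour Φ → ∃ λ w → ev w · Φ ≡ Ψ
      word-of Ψ c = let (x , y , e) = even-flag Ψ c in (word₁ ↑ x) ++ (word₂ ↑ y) , ≡.trans (act-cong Φ (ev-product x y)) e

      -- One of Ψ and Ψ^i has the colour of Φ and is thus an image of Φ under a word. The two agree
      -- in the ranks other than i, so every incident pair of such ranks is reached.
      word-near : ∀ i Ψ → ∃ λ w → ev w · Φ ≡ Ψ ⊎ ev w · Φ ≡ adj i Ψ
      word-near i Ψ with colour Ψ BoolP.≟ colour Φ
      ... | yes c = let (w , e) = word-of Ψ c in w , inj₁ e
      ... | no c = let (w , e) = word-of (adj i Ψ) (≡.trans (adj-colour i Ψ) (≡.sym (BoolP.¬-not (λ h → c (≡.sym h))))) in w , inj₂ e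

      word-VE : ∀ v e → _≤ve_ pre v e → ∃ λ w → opV (ev w) v₀ ≡ v × opE (ev w) e₀ ≡ e
      word-VE v e ve = from (word-near #2 Ψ)
        where
        f = proj₁ (edge-faces e) zero
        ef = proj₁ (proj₂ (proj₂ (edge-faces e))) zero
        Ψ : Flag P
        Ψ = flag v e f ve ef (order-trans v e f ve ef)
        from : (∃ λ w → ev w · Φ ≡ Ψ ⊎ ev w · Φ ≡ adj #2 Ψ) → ∃ λ w → opV (ev w) v₀ ≡ v × opE (ev w) e₀ ≡ e
        from (w , inj₁ h) = w , cong fv h , cong fe h
        from (w , inj₂ h) = w , ≡.trans (cong fv h) (≡.sym (proj₁ (adj-spec #2 Ψ))) , ≡.trans (cong fe h) (≡.sym (proj₁ (proj₂ (adj-spec #2 Ψ))))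

      word-VF : ∀ v f → _≤vf_ pre v f → ∃ λ w → opV (ev w) v₀ ≡ v × opF (ev w) f₀ ≡ f
      word-VF v f vf = from (word-near #1 Ψ)
        where
        e = proj₁ (diamond v f vf) zero
        vef = proj₁ (proj₂ (proj₂ (diamond v f vf))) zero
        Ψ : Flag P
        Ψ = flag v e f (proj₁ vef) (proj₂ vef) vf
        from : (∃ λ w → ev w · Φ ≡ Ψ ⊎ ev w · Φ ≡ adj #1 Ψ) → ∃ λ w → opV (ev w) v₀ ≡ v × opF (ev w) f₀ ≡ f
        from (w , inj₁ h) = w , cong fv h , cong ff h
        from (w , inj₂ h) = w , ≡.trans (cong fv h) (≡.sym (proj₁ (adj-spec #1 Ψ))) , ≡.trans (cong ff h) (≡.sym (proj₂ (proj₂ (adj-spec #1 Ψ))))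

      word-EF : ∀ e f → _≤ef_ pre e f → ∃ λ w → opE (ev w) e₀ ≡ e × opF (ev w) f₀ ≡ f
      word-EF e f ef = from (word-near #0 Ψ)
        where
        v = proj₁ (edge-vertices e) zero
        ve = proj₁ (proj₂ (proj₂ (edge-vertices e))) zero
        Ψ : Flag P
        Ψ = flag v e f ve ef (order-trans v e f ve ef)
        from : (∃ λ w → ev w · Φ ≡ Ψ ⊎ ev w · Φ ≡ adj #0 Ψ) → ∃ λ w → opE (ev w) e₀ ≡ e × opF (ev w) f₀ ≡ f
        from (w , inj₁ h) = w , cong fe h , cong ff h
        from (w , inj₂ h) = w , ≡.trans (cong fe h) (≡.sym (proj₁ (proj₂ (adj-spec #0 Ψ)))) , ≡.trans (cong ff h) (≡.sym (proj₂ (proj₂ (adj-spec #0 Ψ))))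

      word-V : ∀ v → ∃ λ w → opV (ev w) v₀ ≡ v
      word-V v = let (Ψ , e) = vertex-flag Φ v ; (w , h , _) = word-VE (fv Ψ) (fe Ψ) (pve Ψ) in w , ≡.trans h e

      word-E : ∀ e → ∃ λ w → opE (ev w) e₀ ≡ e
      word-E e = let (Ψ , h) = edge-flag e ; (w , _ , k) = word-VE (fv Ψ) (fe Ψ) (pve Ψ) in w , ≡.trans k h

      word-F : ∀ f → ∃ λ w → opF (ev w) f₀ ≡ f
      word-F f = let (Ψ , h) = face-flag Φ f ; (w , _ , k) = word-VF (fv Ψ) (ff Ψ) (pvf Ψ) in w , ≡.trans k h

      -- Some word taking the base vertex to `v` is chosen and its inversion applied instead;
      -- `ψV-spec` shows that the choice is immaterial. Edges and faces are treated alike.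
      ψV : V → V
      ψV v = opV (ev (bar (proj₁ (word-V v)))) v₀

      ψE : E → E
      ψE e = opE (ev (bar (proj₁ (word-E e)))) e₁

      ψF : F → F
      ψF f = opF (ev (bar (proj₁ (word-F f)))) f₀

      ψV-spec : ∀ w → ψV (opV (ev w) v₀) ≡ opV (ev (bar w)) v₀
      ψV-spec w = WV.well-defined (proj₁ (word-V (opV (ev w) v₀))) w (proj₂ (word-V (opV (ev w) v₀)))

      ψE-spec : ∀ w → ψE (opE (ev w) e₀) ≡ opE (ev (bar w)) e₁
      ψE-spec w = WE.well-defined (proj₁ (word-E (opE (ev w) e₀))) w (proj₂ (word-E (opE (ev w) e₀)))

      ψF-spec : ∀ w → ψF (opF (ev w) f₀) ≡ opF (ev (bar w)) f₀
      ψF-spec w = WF.well-defined (proj₁ (word-F (opF (ev w) f₀))) w (proj₂ (word-F (opF (ev w) f₀)))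

      ψψV : ∀ v → ψV (ψV v) ≡ v
      ψψV v = let (w , e) = word-V v in ≡.trans (ψV-spec (bar w)) (≡.trans (cong (λ u → opV (ev u) v₀) (bar-bar w)) e)

      ψψF : ∀ f → ψF (ψF f) ≡ f
      ψψF f = let (w , e) = word-F f in ≡.trans (ψF-spec (bar w)) (≡.trans (cong (λ u → opF (ev u) f₀) (bar-bar w)) e)

      ev-∙ς₁ : ∀ u → opE (ev u) e₁ ≡ opE (ev (u ++ word₁)) e₀
      ev-∙ς₁ u = ≡.trans (≡.sym (opE-∘ (ev u) ς₁ e₀)) (toE-cong (A.sym (A.trans (ev-++ u word₁) (A.∙-congˡ ev-gen₁))) e₀)

      -- The base edge is not fixed here: w e₀ goes to w̄ a e₀, where w̄ is the inversion of w, and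
      -- then to w a⁻¹ e₁, which is w e₀ again.
      ψψE : ∀ e → ψE (ψE e) ≡ e
      ψψE e = let (w , h) = word-E e in begin
        ψE (opE (ev (bar w)) e₁) ≡⟨ cong ψE (ev-∙ς₁ (bar w)) ⟩
        ψE (opE (ev (bar w ++ word₁)) e₀) ≡⟨ ψE-spec (bar w ++ word₁) ⟩
        opE (ev (bar (bar w ++ word₁))) e₁ ≡⟨ toE-cong (evaluation (bar-++ (bar w) word₁)) e₁ ⟩
        opE (ev (bar (bar w) ++ invW word₁)) e₁ ≡⟨ cong (λ u → opE (ev (u ++ invW word₁)) e₁) (bar-bar w) ⟩
        opE (ev (w ++ invW word₁)) e₁ ≡⟨ toE-cong (A.trans (ev-++ w (invW word₁)) (A.∙-congˡ (A.trans (ev-⁻¹ word₁) (A.⁻¹-cong ev-gen₁)))) e₁ ⟩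
        opE (compose (ev w) (ς₁ A.⁻¹)) e₁ ≡⟨ opE-∘ (ev w) (ς₁ A.⁻¹) e₁ ⟩
        opE (ev w) (opE (ς₁ A.⁻¹) e₁) ≡⟨ cong (opE (ev w)) (SE.op-inv ς₁ e₀) ⟩
        opE (ev w) e₀ ≡⟨ h ⟩
        e ∎
        where open ≡.≡-Reasoning

      v₀≤e₁ : _≤ve_ pre v₀ e₁
      v₀≤e₁ = subst₂ (_≤ve_ pre) (≡.trans (cong fv act-ς₁-adj₀) (≡.sym (proj₁ (adj-spec #1 Φ))))
        (cong (opE ς₁) (≡.sym (proj₁ (proj₂ (adj-spec #0 Φ))))) (pve (ς₁ · adj #0 Φ))

      e₁≤f₀ : _≤ef_ pre e₁ f₀
      e₁≤f₀ = subst (_≤ef_ pre e₁) ς₁-f₀ (pef (ς₁ · Φ))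

      mono-VE : ∀ v e → _≤ve_ pre v e → _≤ve_ pre (ψV v) (ψE e)
      mono-VE v e h = from (word-VE v e h)
        where
        from : (∃ λ w → opV (ev w) v₀ ≡ v × opE (ev w) e₀ ≡ e) → _≤ve_ pre (ψV v) (ψE e)
        from (w , refl , refl) = subst₂ (_≤ve_ pre) (≡.sym (ψV-spec w)) (≡.sym (ψE-spec w)) (≡.trans (presVE (aut (ev (bar w))) v₀ e₁) v₀≤e₁)

      mono-EF : ∀ e f → _≤ef_ pre e f → _≤ef_ pre (ψE e) (ψF f)
      mono-EF e f h = from (word-EF e f h)
        where
        from : (∃ λ w → opE (ev w) e₀ ≡ e × opF (ev w) f₀ ≡ f) → _≤ef_ pre (ψE e) (ψF f)
        from (w , refl , refl) = subst₂ (_≤ef_ pre) (≡.sym (ψE-spec w)) (≡.sym (ψF-spec w)) (≡.trans (presEF (aut (ev (bar w))) e₁ f₀) e₁≤f₀)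

      mono-VF : ∀ v f → _≤vf_ pre v f → _≤vf_ pre (ψV v) (ψF f)
      mono-VF v f h = from (word-VF v f h)
        where
        from : (∃ λ w → opV (ev w) v₀ ≡ v × opF (ev w) f₀ ≡ f) → _≤vf_ pre (ψV v) (ψF f)
        from (w , refl , refl) = subst₂ (_≤vf_ pre) (≡.sym (ψV-spec w)) (≡.sym (ψF-spec w)) (≡.trans (presVF (aut (ev (bar w))) v₀ f₀) (pvf Φ))

      ψ : Aut P
      ψ = record
        { toV = ψV ; fromV = ψV ; toE = ψE ; fromE = ψE ; toF = ψF ; fromF = ψF
        ; invlV = ψψV ; invrV = ψψV ; invlE = ψψE ; invrE = ψψE ; invlF = ψψF ; invrF = ψψF
        ; presVE = λ v e → ⇔⇒≡ (mono-VE v e) (λ h → subst₂ (_≤ve_ pre) (ψψV v) (ψψE e) (mono-VE (ψV v) (ψE e) h))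
        ; presEF = λ e f → ⇔⇒≡ (mono-EF e f) (λ h → subst₂ (_≤ef_ pre) (ψψE e) (ψψF f) (mono-EF (ψE e) (ψF f) h))
        ; presVF = λ v f → ⇔⇒≡ (mono-VF v f) (λ h → subst₂ (_≤vf_ pre) (ψψV v) (ψψF f) (mono-VF (ψV v) (ψF f) h)) }

      ψΦ : wrap ψ · Φ ≡ adj #1 Φ
      ψΦ = ≡.trans (≈F⇒≡ {wrap ψ · Φ} {ς₁ · adj #0 Φ}
          ( ≡.trans (ψV-spec []) (≡.sym (≡.trans (cong fv act-ς₁-adj₀) (≡.sym (proj₁ (adj-spec #1 Φ)))))
          , ≡.trans (ψE-spec []) (cong (opE ς₁) (proj₁ (proj₂ (adj-spec #0 Φ))))
          , ≡.trans (ψF-spec []) (≡.sym (≡.trans (cong ff act-ς₁-adj₀) (≡.sym (proj₂ (proj₂ (adj-spec #1 Φ)))))) ))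
        act-ς₁-adj₀

    not-regular : ⊥
    not-regular = act≢adj (wrap ψ) #1 ψΦ

-- The polyhedron of cosets of a tight group

module Cosets {G : Group 0ℓ 0ℓ} {a b : Group.Carrier G} {p q : ℕ} {{_ : NonZero p}} (T : IsTight G a b p q) where
  open Group G hiding (refl; _-_)
  open Powers G
  open GroupSolver G
  open TightProps T
  open import Algebra.Properties.Group G
  open import Relation.Binary.Reasoning.Setoid setoid

  private
    x y : Carrier → ℤ
    x g = proj₁ (normalForm g)
    y g = proj₁ (proj₂ (normalForm g))

    nf : ∀ g → g ≈ a ↑ x g ∙ b ↑ y g
    nf g = proj₂ (proj₂ (normalForm g))

  -- The left coset g⟨b⟩, numbered by the exponent of a in the normal form. This makes cosets of a
  -- setoid group into elements of a finite type.
  coset : Carrier → Fin p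
  coset g = residue p (x g)

  coset-∙b : ∀ {g h} k → h ≈ g ∙ b ↑ k → coset g ≡ coset h
  coset-∙b {g} {h} k e = ≡.sym (∣⇒residue-≡ p (x h) (x g) (proj₁ (normalForm-unique (x h) (y h) (x g) (y g + k) (begin
    a ↑ x h ∙ b ↑ y h ≈⟨ nf h ⟨
    h ≈⟨ e ⟩
    g ∙ b ↑ k ≈⟨ ∙-congʳ (nf g) ⟩
    a ↑ x g ∙ b ↑ y g ∙ b ↑ k ≈⟨ assoc _ _ _ ⟩
    a ↑ x g ∙ (b ↑ y g ∙ b ↑ k) ≈⟨ ∙-congˡ (↑-+ b (y g) k) ⟨
    a ↑ x g ∙ b ↑ (y g + k) ∎))))

  coset-≡⇒ : ∀ g h → coset g ≡ coset h → ∃ λ k → h ≈ g ∙ b ↑ k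
  coset-≡⇒ g h e = - y g + y h , (begin
    h ≈⟨ nf h ⟩
    a ↑ x h ∙ b ↑ y h ≈⟨ ∙-congʳ (a-cong (x g) (x h) (residue-≡⇒∣ p (x g) (x h) e)) ⟨
    a ↑ x g ∙ b ↑ y h ≈⟨ solve 3 (λ u v w → u ⊙ w ⊜ (u ⊙ v) ⊙ (v ⁱ ⊙ w)) (Group.refl G) (a ↑ x g) (b ↑ y g) (b ↑ y h) ⟩
    a ↑ x g ∙ b ↑ y g ∙ ((b ↑ y g) ⁻¹ ∙ b ↑ y h) ≈⟨ ∙-cong (nf g) (∙-congʳ (↑-neg b (y g))) ⟨
    g ∙ (b ↑ (- y g) ∙ b ↑ y h) ≈⟨ ∙-congˡ (↑-+ b (- y g) (y h)) ⟨
    g ∙ b ↑ (- y g + y h) ∎)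

  coset-cong : ∀ {g h} → g ≈ h → coset g ≡ coset h
  coset-cong {g} e = coset-∙b (+ 0) (trans (sym e) (sym (identityʳ g)))

  coset-left : ∀ g {h k} → coset h ≡ coset k → coset (g ∙ h) ≡ coset (g ∙ k)
  coset-left g {h} {k} e = let (l , f) = coset-≡⇒ h k e in coset-∙b l (trans (∙-congˡ f) (sym (assoc g h (b ↑ l))))

  coset-a : ∀ (i : Fin p) → coset (a ↑ + toℕ i) ≡ i
  coset-a i = ≡.trans (∣⇒residue-≡ p (x g) (+ toℕ i) (proj₁ (normalForm-unique (x g) (y g) (+ toℕ i) (+ 0) (trans (sym (nf g)) (sym (identityʳ g))))))
    (residue-toℕ p i)
    where
    g : Carrier
    g = a ↑ + toℕ i

exactly-two : ∀ {A : Set} {Q : A → Set} x y → x ≢ y → Q x → Q y → (∀ w → Q w → w ≡ x ⊎ w ≡ y) → Exactly 2 Q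
exactly-two {A} {Q} x y x≢y qx qy only = f , inj , holds , λ w qw → from (only w qw)
  where
  f : Fin 2 → A
  f zero = x
  f (suc zero) = y
  inj : ∀ i j → f i ≡ f j → i ≡ j
  inj zero zero _ = refl
  inj zero (suc zero) e = ⊥-elim (x≢y e)
  inj (suc zero) zero e = ⊥-elim (x≢y (≡.sym e))
  inj (suc zero) (suc zero) _ = refl
  holds : ∀ i → Q (f i)
  holds zero = qx
  holds (suc zero) = qy
  from : ∀ {w} → w ≡ x ⊎ w ≡ y → ∃ λ i → f i ≡ w
  from (inj₁ e) = zero , ≡.sym e
  from (inj₂ e) = suc zero , ≡.sym e

true-∨ : ∀ {x y} → x ∨ y ≡ true → x ≡ true ⊎ y ≡ true
true-∨ {true} _ = inj₁ refl
true-∨ {false} e = inj₂ e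

does-true : ∀ {A : Set} (d : Dec A) → does d ≡ true → A
does-true (yes x) _ = x

true-does : ∀ {A : Set} (d : Dec A) → A → does d ≡ true
true-does (yes _) _ = refl
true-does (no ¬x) x = ⊥-elim (¬x x)

-- Vertices, faces and edges are the left cosets of ⟨b⟩, ⟨a⟩ and ⟨ba⟩, incident when they intersect.
-- For p, q > 1 neither generator is trivial, which keeps the two ends of an edge and its two faces
-- distinct.
module CosetPolyhedron {G : Group 0ℓ 0ℓ} {a b : Group.Carrier G} {p q : ℕ} {{_ : NonZero p}} {{_ : NonZero q}}
    (T : IsTight G a b p q) (p≢1 : ¬ (+ p ∣ + 1)) (q≢1 : ¬ (+ q ∣ + 1)) where
  open Group G hiding (refl; _-_)
  open Powers G
  open GroupSolver G
  open TightProps T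
  open import Algebra.Properties.Group G
  open import Relation.Binary.Reasoning.Setoid setoid
  private
    module CV = Cosets T
    module CF = Cosets swap

  vx : Carrier → Fin p
  vx = CV.coset

  fy : Carrier → Fin q
  fy = CF.coset

  private
    determined : ∀ {g h} → vx g ≡ vx h → fy g ≡ fy h → g ≈ h
    determined {g} {h} e f =
      let (y , hy) = CV.coset-≡⇒ g h e
          (x , hx) = CF.coset-≡⇒ g h f
          (d , _) = independent x y (∙-cancelˡ g (a ↑ x) (b ↑ y) (trans (sym hx) hy))
      in sym (trans hx (trans (∙-congˡ (a-∣ d)) (identityʳ g)))

    -- The common element of a vertex coset and a face coset. Factoring the quotient of their
    -- representatives as b^y a^x gives a^v b^y = b^f a^(-x), which lies in both.
    element : Fin p → Fin q → Carrier
    element v f = a ↑ + toℕ v ∙ b ↑ proj₁ (normalForm′ ((a ↑ + toℕ v) ⁻¹ ∙ b ↑ + toℕ f))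

    vx-element : ∀ v f → vx (element v f) ≡ v
    vx-element v f = ≡.trans (≡.sym (CV.coset-∙b (proj₁ (normalForm′ ((a ↑ + toℕ v) ⁻¹ ∙ b ↑ + toℕ f))) (Group.refl G))) (CV.coset-a v)

    fy-element : ∀ v f → fy (element v f) ≡ f
    fy-element v f = let (y , x , e) = normalForm′ ((a ↑ + toℕ v) ⁻¹ ∙ b ↑ + toℕ f) in
      ≡.trans (CF.coset-∙b x (begin
        b ↑ + toℕ f ≈⟨ \\-leftDividesˡ (a ↑ + toℕ v) (b ↑ + toℕ f) ⟨
        a ↑ + toℕ v ∙ ((a ↑ + toℕ v) ⁻¹ ∙ b ↑ + toℕ f) ≈⟨ ∙-congˡ e ⟩
        a ↑ + toℕ v ∙ (b ↑ y ∙ a ↑ x) ≈⟨ assoc _ _ _ ⟨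
        a ↑ + toℕ v ∙ b ↑ y ∙ a ↑ x ∎)) (CF.coset-a f)

    element-vf : ∀ h → element (vx h) (fy h) ≈ h
    element-vf h = determined (vx-element (vx h) (fy h)) (fy-element (vx h) (fy h))

    infix 9 _′
    -- The other element of the edge coset h⟨ba⟩, as (ba)² = 1.
    _′ : Carrier → Carrier
    h ′ = h ∙ (b ∙ a)

    ′-cong : ∀ {g h} → g ≈ h → g ′ ≈ h ′
    ′-cong = ∙-congʳ

    ′-involutive : ∀ h → h ′ ′ ≈ h
    ′-involutive h = trans (assoc _ _ _) (trans (∙-congˡ rel′) (identityʳ h))

    ′-left : ∀ g h → (g ∙ h) ′ ≈ g ∙ h ′
    ′-left g h = assoc g h (b ∙ a)

    a∉B : ∀ k → ¬ (a ≈ b ↑ k)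
    a∉B k e = p≢1 (proj₁ (independent (+ 1) k (trans (↑-1 a) e)))

    b∉A : ∀ k → ¬ (b ≈ a ↑ k)
    b∉A k e = q≢1 (proj₂ (independent k (+ 1) (trans (sym e) (sym (↑-1 b)))))

    vx-′ : ∀ h → vx h ≢ vx (h ′)
    vx-′ h e = let (k , f) = CV.coset-≡⇒ h (h ′) e in
      a∉B (-[1+ 0 ] + k) (trans (sym (\\-leftDividesʳ b a)) (trans (∙-congˡ (∙-cancelˡ h (b ∙ a) (b ↑ k) f)) (sym (↑-pred b k))))

    fy-′ : ∀ h → fy h ≢ fy (h ′)
    fy-′ h e = let (k , f) = CF.coset-≡⇒ h (h ′) e in
      b∉A (k + -[1+ 0 ]) (trans (sym (//-rightDividesʳ a b)) (trans (∙-congʳ (∙-cancelˡ h (b ∙ a) (a ↑ k) f)) (sym (↑-+ a k -[1+ 0 ]))))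

  private
    less : Carrier → Bool
    less h = toℕ (vx h) <ᵇ toℕ (vx (h ′))

    less-cong : ∀ {g h} → g ≈ h → less g ≡ less h
    less-cong e = cong₂ (λ s t → toℕ s <ᵇ toℕ t) (CV.coset-cong e) (CV.coset-cong (′-cong e))

    less-′ : ∀ h → less h ≡ false → less (h ′) ≡ true
    less-′ h e = ≡.trans (cong (λ t → toℕ (vx (h ′)) <ᵇ toℕ t) (CV.coset-cong (′-involutive h)))
      (flip (toℕ (vx h)) (toℕ (vx (h ′))) e (λ f → vx-′ h (FinP.toℕ-injective f)))
      where
      flip : ∀ m n → (m <ᵇ n) ≡ false → m ≢ n → (n <ᵇ m) ≡ true
      flip zero zero _ ne = ⊥-elim (ne refl)
      flip (suc m) zero _ _ = refl
      flip (suc m) (suc n) e ne = flip m n e (λ f → ne (cong suc f))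

    less-irreflexive : ∀ h → less h ≡ true → less (h ′) ≡ true → ⊥
    less-irreflexive h e f = asym (toℕ (vx h)) (toℕ (vx (h ′))) e
      (≡.trans (cong (λ t → toℕ (vx (h ′)) <ᵇ toℕ t) (CV.coset-cong (sym (′-involutive h)))) f)
      where
      asym : ∀ m n → (m <ᵇ n) ≡ true → (n <ᵇ m) ≡ true → ⊥
      asym (suc m) (suc n) e f = asym m n e f

  -- The edge {h, hba} is represented by its element with the smaller vertex.
  Edge : Set
  Edge = Σ (Fin p) λ v → Σ (Fin q) λ f → less (element v f) ≡ true

  private
    edge-≡ : ∀ {e e′ : Edge} → proj₁ e ≡ proj₁ e′ → proj₁ (proj₂ e) ≡ proj₁ (proj₂ e′) → e ≡ e′
    edge-≡ {v , f , l} {.v , .f , l′} refl refl with refl ← uip l l′ = refl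

    member : Edge → Carrier
    member (v , f , _) = element v f

    member-injective : ∀ {e e′} → member e ≈ member e′ → e ≡ e′
    member-injective {v , f , _} {v′ , f′ , _} h = edge-≡
      (≡.trans (≡.sym (vx-element v f)) (≡.trans (CV.coset-cong h) (vx-element v′ f′)))
      (≡.trans (≡.sym (fy-element v f)) (≡.trans (CF.coset-cong h) (fy-element v′ f′)))

    canonical : ∀ h → less h ≡ true → Edge
    canonical h l = vx h , fy h , ≡.trans (less-cong (element-vf h)) l

    choose : ∀ h x → less h ≡ x → Edge
    choose h true l = canonical h l
    choose h false l = canonical (h ′) (less-′ h l)

  rep : Carrier → Edge
  rep h = choose h (less h) refl

  private
    member-rep : ∀ h → member (rep h) ≈ h ⊎ member (rep h) ≈ h ′
    member-rep h = go (less h) refl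
      where
      go : ∀ x (l : less h ≡ x) → member (choose h x l) ≈ h ⊎ member (choose h x l) ≈ h ′
      go true l = inj₁ (element-vf h)
      go false l = inj₂ (element-vf (h ′))

    rep-unique : ∀ {h e} → member e ≈ h ⊎ member e ≈ h ′ → rep h ≡ e
    rep-unique {h} {e} m = go (member-rep h) m
      where
      ℓ : ∀ e → less (member e) ≡ true
      ℓ (_ , _ , l) = l
      go : member (rep h) ≈ h ⊎ member (rep h) ≈ h ′ → member e ≈ h ⊎ member e ≈ h ′ → rep h ≡ e
      go (inj₁ s) (inj₁ t) = member-injective (trans s (sym t))
      go (inj₂ s) (inj₂ t) = member-injective (trans s (sym t))
      go (inj₁ s) (inj₂ t) = ⊥-elim (less-irreflexive h (≡.trans (less-cong (sym s)) (ℓ (rep h))) (≡.trans (less-cong (sym t)) (ℓ e)))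
      go (inj₂ s) (inj₁ t) = ⊥-elim (less-irreflexive h (≡.trans (less-cong (sym t)) (ℓ e)) (≡.trans (less-cong (sym s)) (ℓ (rep h))))

    rep-member : ∀ e → rep (member e) ≡ e
    rep-member e = rep-unique (inj₁ (Group.refl G))

    rep-cong : ∀ {g h} → g ≈ h → rep g ≡ rep h
    rep-cong {g} {h} e = rep-unique (Sum.map (λ s → trans s (sym e)) (λ s → trans s (′-cong (sym e))) (member-rep h))

    rep-′ : ∀ h → rep (h ′) ≡ rep h
    rep-′ h = rep-unique (Sum.swap (Sum.map (λ s → trans s (sym (′-involutive h))) (λ s → s) (member-rep h)))

    rep-≡⇒ : ∀ g h → rep g ≡ rep h → g ≈ h ⊎ g ≈ h ′
    rep-≡⇒ g h e = go (subst (λ x → member x ≈ g ⊎ member x ≈ g ′) e (member-rep g)) (member-rep h)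
      where
      go : member (rep h) ≈ g ⊎ member (rep h) ≈ g ′ → member (rep h) ≈ h ⊎ member (rep h) ≈ h ′ → g ≈ h ⊎ g ≈ h ′
      go (inj₁ s) (inj₁ t) = inj₁ (trans (sym s) t)
      go (inj₁ s) (inj₂ t) = inj₂ (trans (sym s) t)
      go (inj₂ s) (inj₁ t) = inj₂ (trans (sym (′-involutive g)) (′-cong (trans (sym s) t)))
      go (inj₂ s) (inj₂ t) = inj₁ (trans (sym (′-involutive g)) (trans (′-cong (trans (sym s) t)) (′-involutive h)))

    rep-vx : ∀ g h → rep g ≡ rep h → vx g ≡ vx h → g ≈ h
    rep-vx g h e f = Sum.[_,_]′ (λ s → s) (λ s → ⊥-elim (vx-′ h (≡.trans (≡.sym f) (CV.coset-cong s)))) (rep-≡⇒ g h e)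

    rep-fy : ∀ g h → rep g ≡ rep h → fy g ≡ fy h → g ≈ h
    rep-fy g h e f = Sum.[_,_]′ (λ s → s) (λ s → ⊥-elim (fy-′ h (≡.trans (≡.sym f) (CF.coset-cong s)))) (rep-≡⇒ g h e)

  pre : Pre
  pre = record
    { V = Fin p ; E = Edge ; F = Fin q
    ; ive = λ v e → does (v FinP.≟ vx (member e)) ∨ does (v FinP.≟ vx (member e ′))
    ; ief = λ e f → does (f FinP.≟ fy (member e)) ∨ does (f FinP.≟ fy (member e ′))
    -- Every vertex coset meets every face coset because G = ⟨a⟩⟨b⟩.
    ; ivf = λ _ _ → true }

  private
    ve⇒ : ∀ v e → _≤ve_ pre v e → ∃ λ h → rep h ≡ e × vx h ≡ v
    ve⇒ v e l = Sum.[_,_]′ (λ s → member e , rep-member e , ≡.sym (does-true (v FinP.≟ _) s))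
      (λ s → member e ′ , ≡.trans (rep-′ (member e)) (rep-member e) , ≡.sym (does-true (v FinP.≟ _) s)) (true-∨ l)

    ef⇒ : ∀ e f → _≤ef_ pre e f → ∃ λ h → rep h ≡ e × fy h ≡ f
    ef⇒ e f l = Sum.[_,_]′ (λ s → member e , rep-member e , ≡.sym (does-true (f FinP.≟ _) s))
      (λ s → member e ′ , ≡.trans (rep-′ (member e)) (rep-member e) , ≡.sym (does-true (f FinP.≟ _) s)) (true-∨ l)

    ∨-true : ∀ {x y} → x ≡ true ⊎ y ≡ true → x ∨ y ≡ true
    ∨-true {true} _ = refl
    ∨-true {false} (inj₂ e) = e

    ⇒ve : ∀ h → _≤ve_ pre (vx h) (rep h)
    ⇒ve h = ∨-true (Sum.map (λ s → true-does (vx h FinP.≟ _) (CV.coset-cong (sym s)))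
      (λ s → true-does (vx h FinP.≟ _) (CV.coset-cong (trans (sym (′-involutive h)) (′-cong (sym s))))) (member-rep h))

    ⇒ef : ∀ h → _≤ef_ pre (rep h) (fy h)
    ⇒ef h = ∨-true (Sum.map (λ s → true-does (fy h FinP.≟ _) (CF.coset-cong (sym s)))
      (λ s → true-does (fy h FinP.≟ _) (CF.coset-cong (trans (sym (′-involutive h)) (′-cong (sym s))))) (member-rep h))

    ⇒ve′ : ∀ h → _≤ve_ pre (vx (h ′)) (rep h)
    ⇒ve′ h = subst (_≤ve_ pre (vx (h ′))) (rep-′ h) (⇒ve (h ′))

    ⇒ef′ : ∀ h → _≤ef_ pre (rep h) (fy (h ′))
    ⇒ef′ h = subst (λ e → _≤ef_ pre e (fy (h ′))) (rep-′ h) (⇒ef (h ′))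

    ve-cases : ∀ v h → _≤ve_ pre v (rep h) → v ≡ vx h ⊎ v ≡ vx (h ′)
    ve-cases v h l = let (k , r , e) = ve⇒ v (rep h) l in
      Sum.map (λ s → ≡.trans (≡.sym e) (CV.coset-cong s)) (λ s → ≡.trans (≡.sym e) (CV.coset-cong s)) (rep-≡⇒ k h r)

    ef-cases : ∀ h f → _≤ef_ pre (rep h) f → f ≡ fy h ⊎ f ≡ fy (h ′)
    ef-cases h f l = let (k , r , e) = ef⇒ (rep h) f l in
      Sum.map (λ s → ≡.trans (≡.sym e) (CF.coset-cong s)) (λ s → ≡.trans (≡.sym e) (CF.coset-cong s)) (rep-≡⇒ k h r)

    vx-∙b : ∀ h k → vx (h ∙ b ↑ k) ≡ vx h
    vx-∙b h k = ≡.sym (CV.coset-∙b k (Group.refl G))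

    fy-∙a : ∀ h k → fy (h ∙ a ↑ k) ≡ fy h
    fy-∙a h k = ≡.sym (CF.coset-∙b k (Group.refl G))

    ba≈ : b ∙ a ≈ a ⁻¹ ∙ b ⁻¹
    ba≈ = trans (inverseˡ-unique (b ∙ a) (b ∙ a) rel′) (⁻¹-anti-homo-∙ b a)

    fy-′-b : ∀ h → fy (h ′) ≡ fy (h ∙ b)
    fy-′-b h = ≡.trans (CF.coset-cong (trans (sym (assoc h b a)) (∙-congˡ (sym (↑-1 a))))) (fy-∙a (h ∙ b) (+ 1))

    vx-′-a : ∀ h → vx (h ′) ≡ vx (h ∙ a ⁻¹)
    vx-′-a h = ≡.trans (CV.coset-cong (trans (∙-congˡ ba≈) (sym (assoc h (a ⁻¹) (b ⁻¹))))) (vx-∙b (h ∙ a ⁻¹) -[1+ 0 ])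

  private
    module PolyhedronAxioms where
      edge-vertices : ∀ e → Exactly 2 (λ v → _≤ve_ pre v e)
      edge-vertices e = subst (λ e → Exactly 2 (λ v → _≤ve_ pre v e)) (rep-member e)
        (exactly-two (vx h) (vx (h ′)) (vx-′ h) (⇒ve h) (⇒ve′ h) (λ v → ve-cases v h))
        where
        h : Carrier
        h = member e

      edge-faces : ∀ e → Exactly 2 (λ f → _≤ef_ pre e f)
      edge-faces e = subst (λ e → Exactly 2 (λ f → _≤ef_ pre e f)) (rep-member e)
        (exactly-two (fy h) (fy (h ′)) (fy-′ h) (⇒ef h) (⇒ef′ h) (λ f → ef-cases h f))
        where
        h : Carrier
        h = member e

      diamond : ∀ v f → _≤vf_ pre v f → Exactly 2 (λ e → _≤ve_ pre v e × _≤ef_ pre e f)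
      diamond v f _ = subst₂ Between (vx-element v f) (fy-element v f) between
        where
        Between : Fin p → Fin q → Set
        Between v f = Exactly 2 (λ e → _≤ve_ pre v e × _≤ef_ pre e f)
        g k : Carrier
        g = element v f
        -- The second edge between the vertex and the face of `g`: gb⁻¹ lies in the same vertex
        -- coset, and its partner gb⁻¹ba = ga in the same face coset.
        k = g ∙ b ⁻¹
        k′≈ : k ′ ≈ g ∙ a
        k′≈ = solve 3 (λ g a b → g ⊙ b ⁱ ⊙ (b ⊙ a) ⊜ g ⊙ a) (Group.refl G) g a b
        vk : vx k ≡ vx g
        vk = vx-∙b g -[1+ 0 ]
        fk : fy (k ′) ≡ fy g
        fk = ≡.trans (CF.coset-cong (trans k′≈ (∙-congˡ (sym (↑-1 a))))) (fy-∙a g (+ 1))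
        distinct : rep g ≢ rep k
        distinct e = Sum.[_,_]′
          (λ s → b∉A (+ 0) (⁻¹-injective (∙-cancelˡ g (b ⁻¹) (ε ⁻¹) (trans (sym s) (trans (sym (identityʳ g)) (∙-congˡ (sym ε⁻¹≈ε)))))))
          (λ s → a∉B (+ 0) (∙-cancelˡ g a ε (trans (sym k′≈) (trans (sym s) (sym (identityʳ g))))))
          (rep-≡⇒ g k e)
        only : ∀ e → _≤ve_ pre (vx g) e × _≤ef_ pre e (fy g) → e ≡ rep g ⊎ e ≡ rep k
        only e (ve , ef) = from (ve⇒ (vx g) e ve)
          where
          from : (∃ λ h → rep h ≡ e × vx h ≡ vx g) → e ≡ rep g ⊎ e ≡ rep k
          from (h , refl , vh) = Sum.map (λ s → rep-cong (determined vh (≡.sym s))) other (ef-cases h (fy g) ef)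
            where
            other : fy g ≡ fy (h ′) → rep h ≡ rep k
            -- From h = g b^y and hba = g a^x follows a^(x-1) = b^(y+1), hence y ≡ -1 modulo q and h
            -- = k.
            other s =
              let (y , hy) = CV.coset-≡⇒ g h (≡.sym vh)
                  (x , hx) = CF.coset-≡⇒ g (h ′) s
                  (_ , d) = independent (x - + 1) (y + + 1) (begin
                    a ↑ (x - + 1) ≈⟨ trans (↑-+ a x -[1+ 0 ]) (∙-congʳ (trans (sym (\\-leftDividesʳ g (a ↑ x))) (∙-congˡ (trans (sym hx) (∙-congʳ hy))))) ⟩
                    g ⁻¹ ∙ (g ∙ b ↑ y ∙ (b ∙ a)) ∙ a ⁻¹ ≈⟨ solve 4 (λ g u b a → g ⁱ ⊙ (g ⊙ u ⊙ (b ⊙ a)) ⊙ a ⁱ ⊜ u ⊙ b) (Group.refl G) g (b ↑ y) b a ⟩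
                    b ↑ y ∙ b ≈⟨ trans (↑-+ b y (+ 1)) (∙-congˡ (↑-1 b)) ⟨
                    b ↑ (y + + 1) ∎)
              in rep-cong (trans hy (∙-congˡ (b-cong y -[1+ 0 ] d)))

        on-k : _≤ve_ pre (vx g) (rep k) × _≤ef_ pre (rep k) (fy g)
        on-k = subst (λ v → _≤ve_ pre v (rep k)) vk (⇒ve k) , subst (_≤ef_ pre (rep k)) fk (⇒ef′ k)
        between : Between (vx g) (fy g)
        between = exactly-two {Q = λ e → _≤ve_ pre (vx g) e × _≤ef_ pre e (fy g)} (rep g) (rep k) distinct (⇒ve g , ⇒ef g) on-k only

      Link : ∀ {S : Elem pre → Set} → Σ (Elem pre) S → Σ (Elem pre) S → Set
      Link x y = Inc pre (proj₁ x) (proj₁ y)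

      V⇄ : ∀ v v′ → Star (Inc pre) (inj₁ v) (inj₁ v′)
      V⇄ v v′ = _◅_ {j = inj₂ (inj₂ (fy ε))} refl (_◅_ {j = inj₁ v′} refl []ˢ)

      connected : ∀ x y → Star (Inc pre) x y
      connected x y = toVertex x ◅◅ V⇄ (near x) (near y) ◅◅ fromVertex y
        where
        near : Elem pre → Fin p
        near (inj₁ v) = v
        near (inj₂ (inj₁ e)) = vx (member e)
        near (inj₂ (inj₂ f)) = vx ε
        on : ∀ e → _≤ve_ pre (vx (member e)) e
        on e = subst (_≤ve_ pre (vx (member e))) (rep-member e) (⇒ve (member e))
        toVertex : ∀ x → Star (Inc pre) x (inj₁ (near x))
        toVertex (inj₁ v) = []ˢ
        toVertex (inj₂ (inj₁ e)) = _◅_ {j = inj₁ (vx (member e))} (on e) []ˢ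
        toVertex (inj₂ (inj₂ f)) = _◅_ {j = inj₁ (vx ε)} refl []ˢ
        fromVertex : ∀ x → Star (Inc pre) (inj₁ (near x)) x
        fromVertex (inj₁ v) = []ˢ
        fromVertex (inj₂ (inj₁ e)) = _◅_ {j = inj₂ (inj₁ e)} (on e) []ˢ
        fromVertex (inj₂ (inj₂ f)) = _◅_ {j = inj₂ (inj₂ f)} refl []ˢ

      module VertexLink (v : Fin p) where
        El : Set
        El = Σ (Elem pre) (Inc pre (inj₁ v))

        g : Carrier
        g = element v (fy ε)

        face : Fin q → El
        face f = inj₂ (inj₂ f) , refl

        on : ∀ {e} h → rep h ≡ e → vx h ≡ v → _≤ve_ pre v e
        on h r e = subst₂ (_≤ve_ pre) e r (⇒ve h)

        step : ∀ h → vx h ≡ v → Star Link (face (fy h)) (face (fy (h ∙ b))) × Star Link (face (fy (h ∙ b))) (face (fy h))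
        step h e =
          (_◅_ {j = inj₂ (inj₁ (rep h)) , on h refl e} (⇒ef h) (_◅_ {j = face (fy (h ∙ b))} ef′ []ˢ)) ,
          (_◅_ {j = inj₂ (inj₁ (rep h)) , on h refl e} ef′ (_◅_ {j = face (fy h)} (⇒ef h) []ˢ))
          where
          ef′ : _≤ef_ pre (rep h) (fy (h ∙ b))
          ef′ = subst (_≤ef_ pre (rep h)) (fy-′-b h) (⇒ef′ h)

        Joined : ℤ → Set
        Joined k = Star Link (face (fy g)) (face (fy (g ∙ b ↑ k))) × Star Link (face (fy (g ∙ b ↑ k))) (face (fy g))

        at : ∀ k → vx (g ∙ b ↑ k) ≡ v
        at k = ≡.trans (vx-∙b g k) (vx-element v (fy ε))

        -- The link of a vertex is a cycle: the faces of g b^k and g b^(k+1) share the edge of g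
        -- b^k. Walks are kept in both directions so that none has to be reversed.
        joined : ∀ k → Joined k
        joined = ℤ-ind Joined
          (subst (λ f → Star Link (face (fy g)) (face f) × Star Link (face f) (face (fy g))) (CF.coset-cong (sym (identityʳ g))) ([]ˢ , []ˢ))
          (λ k (s , t) → let (u , w) = step (g ∙ b ↑ k) (at k) in
            subst (λ f → Star Link (face (fy g)) (face f) × Star Link (face f) (face (fy g))) (CF.coset-cong (next k)) (s ◅◅ u , w ◅◅ t))
          (λ k (s , t) → let (u , w) = step (g ∙ b ↑ (-[1+ 0 ] + k)) (at (-[1+ 0 ] + k))
                             (u′ , w′) = subst (λ f → Star Link (face (fy (g ∙ b ↑ (-[1+ 0 ] + k)))) (face f) × Star Link (face f) (face (fy (g ∙ b ↑ (-[1+ 0 ] + k))))) (CF.coset-cong (prev k)) (u , w)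
            in s ◅◅ w′ , u′ ◅◅ t)
          where
          next : ∀ k → g ∙ b ↑ k ∙ b ≈ g ∙ b ↑ (+ 1 + k)
          next k = trans (assoc _ _ _) (∙-congˡ (trans (sym (commute-↑ k (Group.refl G))) (sym (↑-suc b k))))
          prev : ∀ k → g ∙ b ↑ (-[1+ 0 ] + k) ∙ b ≈ g ∙ b ↑ k
          prev k = trans (next (-[1+ 0 ] + k)) (∙-congˡ (↑-≡ b (lem k)))
            where
            lem : ∀ k → + 1 + (-[1+ 0 ] + k) ≡ k
            lem = solve-∀

        toFace : (x : El) → ∃ λ h → vx h ≡ v × Star Link x (face (fy h)) × Star Link (face (fy h)) x
        toFace (inj₂ (inj₁ e) , ve) = let (h , r , e′) = ve⇒ v e ve in h , e′ ,
          _◅_ {j = face (fy h)} (subst (λ e → _≤ef_ pre e (fy h)) r (⇒ef h)) []ˢ ,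
          _◅_ {j = inj₂ (inj₁ e) , ve} (subst (λ e → _≤ef_ pre e (fy h)) r (⇒ef h)) []ˢ
        toFace (inj₂ (inj₂ f) , i) with refl ← uip i refl = element v f , vx-element v f ,
          subst (λ f′ → Star Link (face f) (face f′) × Star Link (face f′) (face f)) (≡.sym (fy-element v f)) ([]ˢ , []ˢ)

        centre : ∀ h → vx h ≡ v → Star Link (face (fy g)) (face (fy h)) × Star Link (face (fy h)) (face (fy g))
        centre h e = let (k , f) = CV.coset-≡⇒ g h (≡.trans (vx-element v (fy ε)) (≡.sym e)) in
          subst (λ f → Star Link (face (fy g)) (face f) × Star Link (face f) (face (fy g))) (CF.coset-cong (sym f)) (joined k)

        link : (x y : El) → Star Link x y
        link x y = let (h , e , s , _) = toFace x ; (h′ , e′ , _ , t) = toFace y in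
          s ◅◅ proj₂ (centre h e) ◅◅ proj₁ (centre h′ e′) ◅◅ t

      module FaceLink (f : Fin q) where
        El : Set
        El = Σ (Elem pre) (Inc pre (inj₂ (inj₂ f)))

        g : Carrier
        g = element (vx ε) f

        vertex : Fin p → El
        vertex v = inj₁ v , refl

        on : ∀ {e} h → rep h ≡ e → fy h ≡ f → _≤ef_ pre e f
        on h r e = subst₂ (_≤ef_ pre) r e (⇒ef h)

        step : ∀ h → fy h ≡ f → Star Link (vertex (vx h)) (vertex (vx (h ∙ a ⁻¹))) × Star Link (vertex (vx (h ∙ a ⁻¹))) (vertex (vx h))
        step h e =
          (_◅_ {j = inj₂ (inj₁ (rep h)) , on h refl e} (⇒ve h) (_◅_ {j = vertex (vx (h ∙ a ⁻¹))} ve′ []ˢ)) ,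
          (_◅_ {j = inj₂ (inj₁ (rep h)) , on h refl e} ve′ (_◅_ {j = vertex (vx h)} (⇒ve h) []ˢ))
          where
          ve′ : _≤ve_ pre (vx (h ∙ a ⁻¹)) (rep h)
          ve′ = subst (λ v → _≤ve_ pre v (rep h)) (vx-′-a h) (⇒ve′ h)

        Joined : ℤ → Set
        Joined k = Star Link (vertex (vx g)) (vertex (vx (g ∙ a ↑ k))) × Star Link (vertex (vx (g ∙ a ↑ k))) (vertex (vx g))

        at : ∀ k → fy (g ∙ a ↑ k) ≡ f
        at k = ≡.trans (fy-∙a g k) (fy-element (vx ε) f)

        joined : ∀ k → Joined k
        joined = ℤ-ind Joined
          (subst (λ v → Star Link (vertex (vx g)) (vertex v) × Star Link (vertex v) (vertex (vx g))) (CV.coset-cong (sym (identityʳ g))) ([]ˢ , []ˢ))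
          (λ k (s , t) → let (u , w) = step (g ∙ a ↑ (+ 1 + k)) (at (+ 1 + k))
                             (u′ , w′) = subst (λ v → Star Link (vertex (vx (g ∙ a ↑ (+ 1 + k)))) (vertex v) × Star Link (vertex v) (vertex (vx (g ∙ a ↑ (+ 1 + k))))) (CV.coset-cong (prev k)) (u , w)
            in s ◅◅ w′ , u′ ◅◅ t)
          (λ k (s , t) → let (u , w) = step (g ∙ a ↑ k) (at k) in
            subst (λ v → Star Link (vertex (vx g)) (vertex v) × Star Link (vertex v) (vertex (vx g))) (CV.coset-cong (next k)) (s ◅◅ u , w ◅◅ t))
          where
          next : ∀ k → g ∙ a ↑ k ∙ a ⁻¹ ≈ g ∙ a ↑ (-[1+ 0 ] + k)
          next k = trans (assoc _ _ _) (∙-congˡ (trans (sym (commute-↑ k (sym (commute-⁻¹ (Group.refl G))))) (sym (↑-pred a k))))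
          prev : ∀ k → g ∙ a ↑ (+ 1 + k) ∙ a ⁻¹ ≈ g ∙ a ↑ k
          prev k = trans (next (+ 1 + k)) (∙-congˡ (↑-≡ a (lem k)))
            where
            lem : ∀ k → -[1+ 0 ] + (+ 1 + k) ≡ k
            lem = solve-∀

        toVertex : (x : El) → ∃ λ h → fy h ≡ f × Star Link x (vertex (vx h)) × Star Link (vertex (vx h)) x
        toVertex (inj₂ (inj₁ e) , ef) = let (h , r , e′) = ef⇒ e f ef in h , e′ ,
          _◅_ {j = vertex (vx h)} (subst (_≤ve_ pre (vx h)) r (⇒ve h)) []ˢ ,
          _◅_ {j = inj₂ (inj₁ e) , ef} (subst (_≤ve_ pre (vx h)) r (⇒ve h)) []ˢ
        toVertex (inj₁ v , i) with refl ← uip i refl = element v f , fy-element v f ,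
          subst (λ v′ → Star Link (vertex v) (vertex v′) × Star Link (vertex v′) (vertex v)) (≡.sym (vx-element v f)) ([]ˢ , []ˢ)

        centre : ∀ h → fy h ≡ f → Star Link (vertex (vx g)) (vertex (vx h)) × Star Link (vertex (vx h)) (vertex (vx g))
        centre h e = let (k , r) = CF.coset-≡⇒ g h (≡.trans (fy-element (vx ε) f) (≡.sym e)) in
          subst (λ v → Star Link (vertex (vx g)) (vertex v) × Star Link (vertex v) (vertex (vx g))) (CV.coset-cong (sym r)) (joined k)

        link : (x y : El) → Star Link x y
        link x y = let (h , e , s , _) = toVertex x ; (h′ , e′ , _ , t) = toVertex y in
          s ◅◅ proj₂ (centre h e) ◅◅ proj₁ (centre h′ e′) ◅◅ t

  cosetPolyhedron : Polyhedron
  cosetPolyhedron = record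
    { pre = pre
    ; isPolyhedron = record
      { order-trans = λ _ _ _ _ _ → refl
      ; edge-vertices = PolyhedronAxioms.edge-vertices
      ; edge-faces = PolyhedronAxioms.edge-faces
      ; diamond = PolyhedronAxioms.diamond
      ; connected = PolyhedronAxioms.connected
      ; vertex-conn = PolyhedronAxioms.VertexLink.link
      ; face-conn = PolyhedronAxioms.FaceLink.link } }

  private
    Q : Polyhedron
    Q = cosetPolyhedron

  hasType : HasType Q p q
  hasType = faces , vertices
    where
    faces : ∀ f → Exactly p (λ e → _≤ef_ pre e f)
    faces f = (λ v → rep (element v f)) ,
      (λ v v′ r → ≡.trans (≡.sym (vx-element v f)) (≡.trans (CV.coset-cong (rep-fy _ _ r (≡.trans (fy-element v f) (≡.sym (fy-element v′ f))))) (vx-element v′ f))) ,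
      (λ v → subst (_≤ef_ pre (rep (element v f))) (fy-element v f) (⇒ef (element v f))) ,
      λ e l → let (h , r , e′) = ef⇒ e f l in vx h , ≡.trans (rep-cong (trans (≈-≡ (cong (element (vx h)) (≡.sym e′))) (element-vf h))) r
      where
      ≈-≡ : ∀ {g h} → g ≡ h → g ≈ h
      ≈-≡ refl = Group.refl G
    vertices : ∀ v → Exactly q (λ e → _≤ve_ pre v e)
    vertices v = (λ f → rep (element v f)) ,
      (λ f f′ r → ≡.trans (≡.sym (fy-element v f)) (≡.trans (CF.coset-cong (rep-vx _ _ r (≡.trans (vx-element v f) (≡.sym (vx-element v f′))))) (fy-element v f′))) ,
      (λ f → subst (λ v → _≤ve_ pre v (rep (element v f))) (vx-element v f) (subst (λ e → _≤ve_ pre (vx (element v f)) e) (rep-cong (≈-≡ (cong (λ v → element v f) (≡.sym (vx-element v f))))) (⇒ve (element v f)))) ,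
      λ e l → let (h , r , e′) = ve⇒ v e l in fy h , ≡.trans (rep-cong (trans (≈-≡ (cong (λ v → element v (fy h)) (≡.sym e′))) (element-vf h))) r
      where
      ≈-≡ : ∀ {g h} → g ≡ h → g ≈ h
      ≈-≡ refl = Group.refl G

  ≈F⇒≡ : ∀ {Φ Ψ : Flag Q} → _≈F_ Q Φ Ψ → Φ ≡ Ψ
  ≈F⇒≡ = FlagGraph.≈F⇒≡ Q
  open Flag

  -- Flags correspond to two copies of `G`: the three cosets of `h`, or the same with the vertex
  -- replaced by the other end of the edge. The copies become the two colour classes.
  flagAt : Fin 2 → Carrier → Flag Q
  flagAt zero h = flag (vx h) (rep h) (fy h) (⇒ve h) (⇒ef h) refl
  flagAt (suc zero) h = flag (vx (h ′)) (rep h) (fy h) (⇒ve′ h) (⇒ef h) refl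

  private
    flagAt-cong : ∀ i {g h} → g ≈ h → flagAt i g ≡ flagAt i h
    flagAt-cong zero e = ≈F⇒≡ (CV.coset-cong e , rep-cong e , CF.coset-cong e)
    flagAt-cong (suc zero) e = ≈F⇒≡ (CV.coset-cong (′-cong e) , rep-cong e , CF.coset-cong e)

    flagAt-injective : ∀ i j g h → flagAt i g ≡ flagAt j h → i ≡ j × g ≈ h
    flagAt-injective zero zero g h e = refl , rep-fy g h (cong fe e) (cong ff e)
    flagAt-injective (suc zero) (suc zero) g h e = refl , rep-fy g h (cong fe e) (cong ff e)
    flagAt-injective zero (suc zero) g h e = ⊥-elim (vx-′ h (≡.trans (CV.coset-cong (sym (rep-fy g h (cong fe e) (cong ff e)))) (cong fv e)))
    flagAt-injective (suc zero) zero g h e = ⊥-elim (vx-′ g (≡.sym (≡.trans (cong fv e) (CV.coset-cong (sym (rep-fy g h (cong fe e) (cong ff e)))))))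

    flagAt-surjective : ∀ Ψ → ∃₂ λ i h → flagAt i h ≡ Ψ
    flagAt-surjective (flag v e f ve ef vf) = from (ef⇒ e f ef)
      where
      from : (∃ λ h → rep h ≡ e × fy h ≡ f) → ∃₂ λ i h → flagAt i h ≡ flag v e f ve ef vf
      from (h , refl , refl) = Sum.[_,_]′
        (λ s → zero , h , ≈F⇒≡ (≡.sym s , refl , refl))
        (λ s → suc zero , h , ≈F⇒≡ (≡.sym s , refl , refl)) (ve-cases v h ve)

  tight : Tight Q p q
  tight = (λ i → at (splitIndex p q i)) , (λ i j e → ≡.trans (≡.sym (join-split p q i)) (≡.trans (cong (joinIndex p q) (at-injective (splitIndex p q i) (splitIndex p q j) (≈F⇒≡ {at (splitIndex p q i)} {at (splitIndex p q j)} e))) (join-split p q j))) ,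
    λ Ψ → let (t , e) = at-surjective Ψ in joinIndex p q t , ≈F (≡.trans (cong at (split-join p q t)) e)
    where
    at : (Fin 2 × Fin p) × Fin q → Flag Q
    at ((i , v) , f) = flagAt i (element v f)
    ≈F : ∀ {Φ Ψ : Flag Q} → Φ ≡ Ψ → _≈F_ Q Φ Ψ
    ≈F refl = refl , refl , refl
    at-injective : ∀ s t → at s ≡ at t → s ≡ t
    at-injective ((i , v) , f) ((j , v′) , f′) e = let (ij , h) = flagAt-injective i j (element v f) (element v′ f′) e in
      cong₂ _,_ (cong₂ _,_ ij (≡.trans (≡.sym (vx-element v f)) (≡.trans (CV.coset-cong h) (vx-element v′ f′))))
        (≡.trans (≡.sym (fy-element v f)) (≡.trans (CF.coset-cong h) (fy-element v′ f′)))
    at-surjective : ∀ Ψ → ∃ λ t → at t ≡ Ψ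
    at-surjective Ψ = let (i , h , e) = flagAt-surjective Ψ in ((i , vx h) , fy h) , ≡.trans (flagAt-cong i (element-vf h)) e

  private
    -- Left multiplication on vertex cosets; `fy ε` merely selects a representative of the coset, as
    -- `trV-vx` confirms.
    trV : Carrier → Fin p → Fin p
    trV g v = vx (g ∙ element v (fy ε))

    trF : Carrier → Fin q → Fin q
    trF g f = fy (g ∙ element (vx ε) f)

    trE : Carrier → Edge → Edge
    trE g e = rep (g ∙ member e)

    trV-vx : ∀ g h → trV g (vx h) ≡ vx (g ∙ h)
    trV-vx g h = CV.coset-left g (vx-element (vx h) (fy ε))

    trF-fy : ∀ g h → trF g (fy h) ≡ fy (g ∙ h)
    trF-fy g h = CF.coset-left g (fy-element (vx ε) (fy h))

    trE-rep : ∀ g h → trE g (rep h) ≡ rep (g ∙ h)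
    trE-rep g h = Sum.[_,_]′ (λ s → rep-cong (∙-congˡ s)) (λ s → ≡.trans (rep-cong (trans (∙-congˡ s) (sym (′-left g h)))) (rep-′ (g ∙ h))) (member-rep h)

    trV-∘ : ∀ g h v → trV g (trV h v) ≡ trV (g ∙ h) v
    trV-∘ g h v = ≡.trans (trV-vx g (h ∙ element v (fy ε))) (CV.coset-cong (sym (assoc g h (element v (fy ε)))))

    trF-∘ : ∀ g h f → trF g (trF h f) ≡ trF (g ∙ h) f
    trF-∘ g h f = ≡.trans (trF-fy g (h ∙ element (vx ε) f)) (CF.coset-cong (sym (assoc g h (element (vx ε) f))))

    trE-∘ : ∀ g h e → trE g (trE h e) ≡ trE (g ∙ h) e
    trE-∘ g h e = ≡.trans (trE-rep g (h ∙ member e)) (rep-cong (sym (assoc g h (member e))))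

    trV-ε : ∀ {g} → g ≈ ε → ∀ v → trV g v ≡ v
    trV-ε e v = ≡.trans (CV.coset-cong (trans (∙-congʳ e) (identityˡ _))) (vx-element v (fy ε))

    trF-ε : ∀ {g} → g ≈ ε → ∀ f → trF g f ≡ f
    trF-ε e f = ≡.trans (CF.coset-cong (trans (∙-congʳ e) (identityˡ _))) (fy-element (vx ε) f)

    trE-ε : ∀ {g} → g ≈ ε → ∀ x → trE g x ≡ x
    trE-ε e x = ≡.trans (rep-cong (trans (∙-congʳ e) (identityˡ _))) (rep-member x)

    mono-VE : ∀ g v e → _≤ve_ pre v e → _≤ve_ pre (trV g v) (trE g e)
    mono-VE g v e l = from (ve⇒ v e l)
      where
      from : (∃ λ h → rep h ≡ e × vx h ≡ v) → _≤ve_ pre (trV g v) (trE g e)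
      from (h , refl , refl) = subst₂ (_≤ve_ pre) (≡.sym (trV-vx g h)) (≡.sym (trE-rep g h)) (⇒ve (g ∙ h))

    mono-EF : ∀ g e f → _≤ef_ pre e f → _≤ef_ pre (trE g e) (trF g f)
    mono-EF g e f l = from (ef⇒ e f l)
      where
      from : (∃ λ h → rep h ≡ e × fy h ≡ f) → _≤ef_ pre (trE g e) (trF g f)
      from (h , refl , refl) = subst₂ (_≤ef_ pre) (≡.sym (trE-rep g h)) (≡.sym (trF-fy g h)) (⇒ef (g ∙ h))

    backV : ∀ g v → trV (g ⁻¹) (trV g v) ≡ v
    backV g v = ≡.trans (trV-∘ (g ⁻¹) g v) (trV-ε (inverseˡ g) v)

    backE : ∀ g e → trE (g ⁻¹) (trE g e) ≡ e
    backE g e = ≡.trans (trE-∘ (g ⁻¹) g e) (trE-ε (inverseˡ g) e)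

    backF : ∀ g f → trF (g ⁻¹) (trF g f) ≡ f
    backF g f = ≡.trans (trF-∘ (g ⁻¹) g f) (trF-ε (inverseˡ g) f)

  -- Abstract, to keep translations from unfolding to their (large) records of proofs.
  abstract
    translation : Carrier → Aut Q
    translation g = record
      { toV = trV g ; fromV = trV (g ⁻¹) ; toE = trE g ; fromE = trE (g ⁻¹) ; toF = trF g ; fromF = trF (g ⁻¹)
      ; invlV = backV g ; invrV = λ v → ≡.trans (trV-∘ g (g ⁻¹) v) (trV-ε (inverseʳ g) v)
      ; invlE = backE g ; invrE = λ e → ≡.trans (trE-∘ g (g ⁻¹) e) (trE-ε (inverseʳ g) e)
      ; invlF = backF g ; invrF = λ f → ≡.trans (trF-∘ g (g ⁻¹) f) (trF-ε (inverseʳ g) f)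
      ; presVE = λ v e → ⇔⇒≡ (mono-VE g v e) (λ l → subst₂ (_≤ve_ pre) (backV g v) (backE g e) (mono-VE (g ⁻¹) (trV g v) (trE g e) l))
      ; presEF = λ e f → ⇔⇒≡ (mono-EF g e f) (λ l → subst₂ (_≤ef_ pre) (backE g e) (backF g f) (mono-EF (g ⁻¹) (trE g e) (trF g f) l))
      ; presVF = λ _ _ → refl }

    translation-cong : ∀ {g h} → g ≈ h → _≈A_ Q (translation g) (translation h)
    translation-cong e = (λ v → CV.coset-cong (∙-congʳ e)) , (λ x → rep-cong (∙-congʳ e)) , (λ f → CF.coset-cong (∙-congʳ e))

    translation-injective : ∀ {g h} → _≈A_ Q (translation g) (translation h) → g ≈ h
    translation-injective {g} {h} (eV , _ , eF) = trans (sym (identityʳ g)) (trans (determined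
      (≡.trans (≡.sym (trV-vx g ε)) (≡.trans (eV (vx ε)) (trV-vx h ε))) (≡.trans (≡.sym (trF-fy g ε)) (≡.trans (eF (fy ε)) (trF-fy h ε)))) (identityʳ h))

    translation-flag : ∀ g i h → act Q (translation g) (flagAt i h) ≡ flagAt i (g ∙ h)
    translation-flag g zero h = ≈F⇒≡ (trV-vx g h , trE-rep g h , trF-fy g h)
    translation-flag g (suc zero) h = ≈F⇒≡ (≡.trans (trV-vx g (h ′)) (CV.coset-cong (sym (′-left g h))) , trE-rep g h , trF-fy g h)

    translation-∘V : ∀ g h x → Aut.toV (translation (g ∙ h)) x ≡ Aut.toV (translation g) (Aut.toV (translation h) x)
    translation-∘V g h x = ≡.sym (trV-∘ g h x)

    translation-∘E : ∀ g h x → Aut.toE (translation (g ∙ h)) x ≡ Aut.toE (translation g) (Aut.toE (translation h) x)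
    translation-∘E g h x = ≡.sym (trE-∘ g h x)

    translation-∘F : ∀ g h x → Aut.toF (translation (g ∙ h)) x ≡ Aut.toF (translation g) (Aut.toF (translation h) x)
    translation-∘F g h x = ≡.sym (trF-∘ g h x)

    translation-⁻¹V : ∀ g x → Aut.toV (translation (g ⁻¹)) x ≡ Aut.fromV (translation g) x
    translation-⁻¹V g x = refl

    translation-⁻¹E : ∀ g x → Aut.toE (translation (g ⁻¹)) x ≡ Aut.fromE (translation g) x
    translation-⁻¹E g x = refl

    translation-⁻¹F : ∀ g x → Aut.toF (translation (g ⁻¹)) x ≡ Aut.fromF (translation g) x
    translation-⁻¹F g x = refl

    translation-ε : (∀ x → Aut.toV (translation ε) x ≡ x) × (∀ x → Aut.toE (translation ε) x ≡ x) × (∀ x → Aut.toF (translation ε) x ≡ x)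
    translation-ε = trV-ε (Group.refl G) , trE-ε (Group.refl G) , trF-ε (Group.refl G)

  baseFlag : Flag Q
  baseFlag = flagAt zero ε

  private module RotationGenerators where
    aε : a ∙ ε ≈ ε ∙ a ↑ + 1
    aε = trans (identityʳ a) (sym (trans (identityˡ _) (↑-1 a)))
    bε : b ∙ ε ≈ ε ∙ b ↑ + 1
    bε = trans (identityʳ b) (sym (trans (identityˡ _) (↑-1 b)))
    a∉ : vx ε ≢ vx a
    a∉ e = let (k , f) = CV.coset-≡⇒ ε a e in a∉B k (trans f (identityˡ _))
    b∉ : fy ε ≢ fy b
    b∉ e = let (k , f) = CF.coset-≡⇒ ε b e in b∉A k (trans f (identityˡ _))
    a′≈ : (a ∙ ε) ′ ≈ b ⁻¹
    a′≈ = trans (∙-cong (identityʳ a) ba≈) (\\-leftDividesˡ a (b ⁻¹))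
    v₀∈ : _≤ve_ pre (vx ε) (rep (a ∙ ε))
    v₀∈ = subst (λ v → _≤ve_ pre v (rep (a ∙ ε))) (≡.trans (CV.coset-cong (trans a′≈ (sym (identityˡ _)))) (vx-∙b ε -[1+ 0 ])) (⇒ve′ (a ∙ ε))
    -- This is Φ¹. Its edge is the coset of a, whose other element aba = b⁻¹ lies in ⟨b⟩, so the
    -- edge still contains the base vertex.
    Ψ₁ : Flag Q
    Ψ₁ = flag (vx ε) (rep (a ∙ ε)) (fy ε) v₀∈ (subst (_≤ef_ pre (rep (a ∙ ε))) (≡.sym (CF.coset-∙b (+ 1) aε)) (⇒ef (a ∙ ε))) refl
    distinct-a : rep ε ≢ rep (a ∙ ε)
    distinct-a e = Sum.[_,_]′ (λ s → a∉B (+ 0) (trans (sym (identityʳ a)) (sym s)))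
      (λ s → b∉A (+ 0) (trans (sym (⁻¹-involutive b)) (trans (⁻¹-cong (trans (sym a′≈) (sym s))) ε⁻¹≈ε))) (rep-≡⇒ ε (a ∙ ε) e)
    e₀∋ : _≤ef_ pre (rep ε) (fy b)
    e₀∋ = subst (_≤ef_ pre (rep ε)) (≡.trans (fy-′-b ε) (CF.coset-cong (identityˡ b))) (⇒ef′ ε)
    Ψ₂ : Flag Q
    Ψ₂ = flag (vx ε) (rep ε) (fy b) (⇒ve ε) e₀∋ refl
    distinct-b : rep ε ≢ rep (b ∙ ε)
    distinct-b e = Sum.[_,_]′ (λ s → b∉A (+ 0) (trans (sym (identityʳ b)) (sym s)))
      (λ s → a∉B -[1+ 1 ] (begin
        a ≈⟨ solve 2 (λ a b → a ⊜ b ⁱ ⊙ (b ⁱ ⊙ ((b ⊙ one) ⊙ (b ⊙ a)))) (Group.refl G) a b ⟩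
        b ⁻¹ ∙ (b ⁻¹ ∙ (b ∙ ε) ′) ≈⟨ ∙-congˡ (∙-congˡ (sym s)) ⟩
        b ⁻¹ ∙ (b ⁻¹ ∙ ε) ≈⟨ ∙-congˡ (identityʳ _) ⟩
        b ⁻¹ ∙ b ⁻¹ ∎)) (rep-≡⇒ ε (b ∙ ε) e)

    adj-a₁ : Adj Q #1 baseFlag Ψ₁
    adj-a₁ = refl , distinct-a , refl
    adj-a₀ : Adj Q #0 Ψ₁ (flagAt zero (a ∙ ε))
    adj-a₀ = (λ e → a∉ (≡.trans e (CV.coset-cong (identityʳ a)))) , refl , CF.coset-∙b (+ 1) aε
    adj-b₂ : Adj Q #2 baseFlag Ψ₂
    adj-b₂ = refl , refl , b∉
    adj-b₁ : Adj Q #1 Ψ₂ (flagAt zero (b ∙ ε))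
    adj-b₁ = CV.coset-∙b (+ 1) bε , distinct-b , CF.coset-cong (sym (identityʳ b))

  rotGens : RotGens Q baseFlag (translation a) (translation b)
  rotGens =
    (Ψ₁ , adj-a₁ , subst (Adj Q #0 Ψ₁) (≡.sym (translation-flag a zero ε)) adj-a₀) ,
    (Ψ₂ , adj-b₂ , subst (Adj Q #1 Ψ₂) (≡.sym (translation-flag b zero ε)) adj-b₁)
    where open RotationGenerators

  private
    side : Flag Q → Fin 2
    side Ψ = proj₁ (flagAt-surjective Ψ)

    sameSide : Fin 2 → Bool
    sameSide zero = true
    sameSide (suc zero) = false

    sameSide-injective : ∀ i j → sameSide i ≡ sameSide j → i ≡ j
    sameSide-injective zero zero _ = refl
    sameSide-injective (suc zero) (suc zero) _ = refl
    sameSide-injective zero (suc zero) ()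
    sameSide-injective (suc zero) zero ()

    -- On one side, any two of the three cosets determine the group element, so adjacent flags on
    -- the same side would coincide.
    adjacent-sides : ∀ i j g h → ¬ Adj Q i (flagAt j g) (flagAt j h)
    adjacent-sides #0 zero g h (d , e , f) = d (CV.coset-cong (rep-fy g h e f))
    adjacent-sides #0 (suc zero) g h (d , e , f) = d (CV.coset-cong (′-cong (rep-fy g h e f)))
    adjacent-sides #1 zero g h (v , d , f) = d (rep-cong (determined v f))
    -- The vertex coset is that of gba while the face coset is that of g, so `determined` does not
    -- apply; uniqueness of normal forms shows a^x = 1 instead.
    adjacent-sides #1 (suc zero) g h (v , d , f) =
      let (x , hx) = CF.coset-≡⇒ g h f
          (y , hy) = CV.coset-≡⇒ (g ′) (h ′) v
          (dx , _) = normalForm-unique (x - + 1) -[1+ 0 ] (- + 1) (-[1+ 0 ] + y) (begin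
            a ↑ (x - + 1) ∙ b ⁻¹ ≈⟨ ∙-congʳ (↑-+ a x -[1+ 0 ]) ⟩
            a ↑ x ∙ a ⁻¹ ∙ b ⁻¹ ≈⟨ trans (assoc _ _ _) (∙-congˡ (sym ba≈)) ⟩
            a ↑ x ∙ (b ∙ a) ≈⟨ solve 3 (λ g u w → u ⊙ w ⊜ g ⁱ ⊙ ((g ⊙ u) ⊙ w)) (Group.refl G) g (a ↑ x) (b ∙ a) ⟩
            g ⁻¹ ∙ (g ∙ a ↑ x ∙ (b ∙ a)) ≈⟨ ∙-congˡ (trans (′-cong (sym hx)) hy) ⟩
            g ⁻¹ ∙ (g ′ ∙ b ↑ y) ≈⟨ solve 3 (λ g w u → g ⁱ ⊙ (g ⊙ w ⊙ u) ⊜ w ⊙ u) (Group.refl G) g (b ∙ a) (b ↑ y) ⟩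
            b ∙ a ∙ b ↑ y ≈⟨ ∙-congʳ ba≈ ⟩
            a ⁻¹ ∙ b ⁻¹ ∙ b ↑ y ≈⟨ trans (assoc _ _ _) (∙-congˡ (sym (↑-pred b y))) ⟩
            a ⁻¹ ∙ b ↑ (-[1+ 0 ] + y) ∎)
      in d (rep-cong (sym (trans hx (trans (∙-congˡ (a-∣ (∣-resp (lem x) dx))) (identityʳ g)))))
      where
      lem : ∀ x → x - + 1 - - + 1 ≡ x
      lem = solve-∀
    adjacent-sides #2 zero g h (v , e , d) = d (CF.coset-cong (rep-vx g h e v))
    adjacent-sides #2 (suc zero) g h (v , e , d) = d (CF.coset-cong (Sum.[_,_]′ (λ s → s)
      (λ s → ⊥-elim (vx-′ h (≡.trans (CV.coset-cong (sym (trans (′-cong s) (′-involutive h)))) v))) (rep-≡⇒ g h e)))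

    flag-colour : Flag Q → Bool
    flag-colour Ψ = sameSide (side Ψ)

    on-side : ∀ Ψ → ∃ λ h → flagAt (side Ψ) h ≡ Ψ
    on-side Ψ = proj₂ (flagAt-surjective Ψ)

    colour-≡⇒ : ∀ Φ Ψ → flag-colour Φ ≡ flag-colour Ψ → ∃ λ i → ∃₂ λ g h → flagAt i g ≡ Φ × flagAt i h ≡ Ψ
    colour-≡⇒ Φ Ψ e = let (g , r) = on-side Φ ; (h , s) = on-side Ψ in side Φ , g , h , r ,
      ≡.trans (cong (λ i → flagAt i h) (sameSide-injective (side Φ) (side Ψ) e)) s

    module TranslationHom where
      open FlagGraph Q hiding (≈F⇒≡)
      module A = Group autGroup

      f : Carrier → Automorphism
      f g = wrap (translation g)

      f-cong : ∀ {g h} → g ≈ h → f g ≈ᴬ f h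
      f-cong e = pointwise (translation-cong e)

      f-injective : ∀ {g h} → f g ≈ᴬ f h → g ≈ h
      f-injective (pointwise e) = translation-injective e

      f-∙ : ∀ g h → f (g ∙ h) ≈ᴬ compose (f g) (f h)
      f-∙ g h = to-compose (f (g ∙ h)) (f g) (f h) (translation-∘V g h) (translation-∘E g h) (translation-∘F g h)

      f-⁻¹ : ∀ g → f (g ⁻¹) ≈ᴬ invᴬ (f g)
      f-⁻¹ g = to-inverse (f (g ⁻¹)) (f g) (translation-⁻¹V g) (translation-⁻¹E g) (translation-⁻¹F g)

      f-ε : f ε ≈ᴬ idᴬ
      f-ε = let (p , q , r) = translation-ε in to-identity (f ε) p q r

      evalᴬ : Automorphism → Automorphism → Word → Automorphism
      evalᴬ = Evaluation.eval autGroup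

      f-eval : ∀ s t w → f (Evaluation.eval G s t w) ≈ᴬ evalᴬ (f s) (f t) w
      f-eval = eval-hom G autGroup f f-∙ f-⁻¹ f-ε

      f-eval⁻¹ : ∀ w → f (Evaluation.eval G (a ⁻¹) (b ⁻¹) w) ≈ᴬ evalᴬ (invᴬ (f a)) (invᴬ (f b)) w
      f-eval⁻¹ w = A.trans
        (f-eval (a ⁻¹) (b ⁻¹) w) (Evaluation.eval-cong autGroup (f-⁻¹ a) (f-⁻¹ b) w)

      regular-pullback : Evaluation.Regular autGroup (f a) (f b) → Evaluation.Regular G a b
      regular-pullback regular w e = f-injective (A.trans
          (A.trans (f-eval⁻¹ w) (regular w e′)) (A.sym f-ε))
        where
        e′ : evalᴬ (f a) (f b) w ≈ᴬ idᴬ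
        e′ = A.trans (A.sym (f-eval a b w))
          (A.trans (f-cong e) f-ε)

      module R = Rotations Q (translation a) (translation b)

      letter : Letter → Carrier
      letter (⁺ s₁) = a
      letter (⁺ s₂) = b
      letter (⁻ s₁) = a ⁻¹
      letter (⁻ s₂) = b ⁻¹

      eval-∷ : ∀ x w → Evaluation.eval G a b (x ∷ w) ≡ letter x ∙ Evaluation.eval G a b w
      eval-∷ (⁺ s₁) w = refl
      eval-∷ (⁺ s₂) w = refl
      eval-∷ (⁻ s₁) w = refl
      eval-∷ (⁻ s₂) w = refl

      evalL-f : ∀ x → wrap (evalL Q (translation a) (translation b) x) ≈ᴬ f (letter x)
      evalL-f (⁺ s₁) = A.refl
      evalL-f (⁺ s₂) = A.refl
      evalL-f (⁻ s₁) = A.trans (inverse-wrap (f a)) (A.sym (f-⁻¹ a))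
      evalL-f (⁻ s₂) = A.trans (inverse-wrap (f b)) (A.sym (f-⁻¹ b))

      ev-f : ∀ w → R.ev w ≈ᴬ f (Evaluation.eval G a b w)
      ev-f [] = A.trans identity-wrap (A.sym f-ε)
      ev-f (x ∷ w) = subst (λ g → R.ev (x ∷ w) ≈ᴬ f g) (≡.sym (eval-∷ x w))
        (A.trans (R.ev-∷ x w)
        (A.trans
          (A.∙-cong (evalL-f x) (ev-f w))
          (A.sym (f-∙ (letter x) (Evaluation.eval G a b w)))))

      regular : (α : Aut Q) → _≈F_ Q (act Q α baseFlag) (adj #1 baseFlag) → Evaluation.Regular autGroup (f a) (f b)
      regular α e = Rotations.Based.reflection⇒regular Q (translation a) (translation b) baseFlag rotGens (wrap α) (≈F⇒≡ e)

  -- Left translations are transitive on each side. An automorphism taking the base flag to its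
  -- 1-neighbour would invert the generators among automorphisms, and since translation is faithful,
  -- this regularity would pull back to `G`.
  nonregular⇒chiral : ¬ Evaluation.Regular G a b → Chiral Q
  nonregular⇒chiral nonregular = flag-colour , flips , transitive , not-transitive
    where
    flips : ∀ i Φ Ψ → Adj Q i Φ Ψ → flag-colour Φ ≢ flag-colour Ψ
    flips i Φ Ψ d e = from (colour-≡⇒ Φ Ψ e)
      where
      from : (∃ λ j → ∃₂ λ g h → flagAt j g ≡ Φ × flagAt j h ≡ Ψ) → ⊥
      from (j , g , h , refl , refl) = adjacent-sides i j g h d
    transitive : ∀ Φ Ψ → flag-colour Φ ≡ flag-colour Ψ → ∃ λ α → _≈F_ Q (act Q α Φ) Ψ
    transitive Φ Ψ e = from (colour-≡⇒ Φ Ψ e)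
      where
      from : (∃ λ j → ∃₂ λ g h → flagAt j g ≡ Φ × flagAt j h ≡ Ψ) → ∃ λ α → _≈F_ Q (act Q α Φ) Ψ
      from (j , g , h , refl , refl) = translation (h ∙ g ⁻¹) , cong fv same , cong fe same , cong ff same
        where
        same : act Q (translation (h ∙ g ⁻¹)) (flagAt j g) ≡ flagAt j h
        same = ≡.trans (translation-flag (h ∙ g ⁻¹) j g) (flagAt-cong j (//-rightDividesˡ g h))
    not-transitive : ¬ (∀ Φ Ψ → ∃ λ α → _≈F_ Q (act Q α Φ) Ψ)
    not-transitive all = nonregular (TranslationHom.regular-pullback
      (TranslationHom.regular (proj₁ (all baseFlag Φ¹)) (proj₂ (all baseFlag Φ¹))))
      where
      Φ¹ : Flag Q
      Φ¹ = FlagGraph.adj Q #1 baseFlag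

  eval-translations : ∀ u v → Evaluation.eval G a b u ≈ Evaluation.eval G a b v →
    Rotations._≈Γ_ Q (translation a) (translation b) u v
  eval-translations u v e = Rotations.evaluate (A.trans (ev-f u)
    (A.trans (f-cong e) (A.sym (ev-f v))))
    where open TranslationHom

-- From quotients of the rotation group to covered polyhedra

module Covering (P : Polyhedron) (σ₁ σ₂ : Aut P) {G : Group 0ℓ 0ℓ} {a b : Group.Carrier G} {p q : ℕ}
    {{_ : NonZero p}} {{_ : NonZero q}} (T : IsTight G a b p q) (p≢1 : ¬ (+ p ∣ + 1)) (q≢1 : ¬ (+ q ∣ + 1))
    (hom : ∀ u v → Rotations._≈Γ_ P σ₁ σ₂ u v → Group._≈_ G (Evaluation.eval G a b u) (Evaluation.eval G a b v)) where
  open CosetPolyhedron T p≢1 q≢1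
  private
    Q : Polyhedron
    Q = cosetPolyhedron
    module FP = FlagGraph P
    module FQ = FlagGraph Q
    module RP = Rotations P σ₁ σ₂
    module RQ = Rotations Q (translation a) (translation b)
    module AP = Group FP.autGroup
    module AQ = Group FQ.autGroup

    image : ∀ {u v} → u RP.≈Γ v → RQ.ev u FQ.≈ᴬ RQ.ev v
    image {u} {v} e = RQ.evaluation (eval-translations u v (hom u v e))

    word : RotElt P σ₁ σ₂ → Word
    word (_ , w , _) = w

    value : (x : RotElt P σ₁ σ₂) → RP.ev (word x) FP.≈ᴬ FP.wrap (proj₁ x)
    value (_ , w , e) = FP.pointwise e

    -- A rotation comes with a word for it, and the same word is evaluated in the other polyhedron;
    -- `image` makes the result depend on the rotation only.
    h : RotElt P σ₁ σ₂ → RotElt Q (translation a) (translation b)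
    h x = evalW Q (translation a) (translation b) (word x) , word x , FQ.toPointwise (AQ.refl {RQ.ev (word x)})

  covers : Covers P σ₁ σ₂ Q (translation a) (translation b)
  covers = h , respects , multiplicative , generator₁ , generator₂
    where
    respects : ∀ x y → _≈A_ P (proj₁ x) (proj₁ y) → _≈A_ Q (proj₁ (h x)) (proj₁ (h y))
    respects x y e = FQ.toPointwise (image {word x} {word y} (RP.evaluate (AP.trans (value x) (AP.trans (FP.pointwise e) (AP.sym (value y))))))

    multiplicative : ∀ x y z → _≈A_ P (proj₁ z) (_∘A_ P (proj₁ x) (proj₁ y)) → _≈A_ Q (proj₁ (h z)) (_∘A_ Q (proj₁ (h x)) (proj₁ (h y)))
    multiplicative x y z e = FQ.toPointwise (AQ.trans (image {word z} {word x ++ word y} (RP.evaluate relation))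
        (AQ.trans (RQ.ev-++ (word x) (word y)) (AQ.sym (FQ.compose-wrap (RQ.ev (word x)) (RQ.ev (word y))))))
      where
      product : FQ.Automorphism
      product = FQ.wrap (_∘A_ Q (proj₁ (h x)) (proj₁ (h y)))
      ∘-xy : FP.wrap (proj₁ z) FP.≈ᴬ FP.compose (FP.wrap (proj₁ x)) (FP.wrap (proj₁ y))
      ∘-xy = AP.trans (FP.pointwise e) (FP.compose-wrap (FP.wrap (proj₁ x)) (FP.wrap (proj₁ y)))
      relation : RP.ev (word z) FP.≈ᴬ RP.ev (word x ++ word y)
      relation = AP.trans (value z) (AP.trans ∘-xy (AP.trans (AP.sym (AP.∙-cong (value x) (value y))) (AP.sym (RP.ev-++ (word x) (word y)))))

    generator₁ : ∀ x → _≈A_ P (proj₁ x) σ₁ → _≈A_ Q (proj₁ (h x)) (translation a)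
    generator₁ x e = FQ.toPointwise (AQ.trans (image {word x} {word₁} (RP.evaluate
      (AP.trans (value x) (AP.trans (FP.pointwise e) (AP.sym RP.ev-gen₁))))) RQ.ev-gen₁)

    generator₂ : ∀ x → _≈A_ P (proj₁ x) σ₂ → _≈A_ Q (proj₁ (h x)) (translation b)
    generator₂ x e = FQ.toPointwise (AQ.trans (image {word x} {word₂} (RP.evaluate
      (AP.trans (value x) (AP.trans (FP.pointwise e) (AP.sym RP.ev-gen₂))))) RQ.ev-gen₂)

  coversTightChiral : ¬ Evaluation.Regular G a b → CoversTightChiral P σ₁ σ₂ p q
  coversTightChiral nonregular = Q , baseFlag , translation a , translation b , rotGens , nonregular⇒chiral nonregular , hasType , tight , covers

  -- The absence of a cover only refutes non-regularity. Equality in `G` being decidable, the double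
  -- negation is removed for each relator separately.
  not-covering⇒regular : ¬ CoversTightChiral P σ₁ σ₂ p q → Evaluation.Regular G a b
  not-covering⇒regular none w e = decidable-stable (TightProps._≈?_ T (Evaluation.eval G (Group._⁻¹ G a) (Group._⁻¹ G b) w) (Group.ε G))
    (λ ne → none (coversTightChiral λ r → ne (r w e)))

-- Atomic chiral polyhedra

2^∤1 : ∀ k → ¬ (2^ (suc k) ∣ + 1)
2^∤1 k (divides c e) = ¬even1 (c * 2^ k , ≡.trans e (≡.trans (cong (c *_) (2^-suc k)) (lem c (2^ k))))
  where
  lem : ∀ c s → c * (+ 2 * s) ≡ + 2 * (c * s)
  lem = solve-∀

2^<2^suc : ∀ k → 2 ^ k < 2 ^ suc k
2^<2^suc k = ℕP.^-monoʳ-< 2 (s≤s (s≤s z≤n)) (ℕP.n<1+n k)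

-- The exponents are those of the theorem lowered by one, so that p/2 and q/2 are 2^α and 2^β
-- without subtraction.
module AtomicCase (α β : ℕ) (α<β : α < β) (P : Polyhedron) (Φ : Flag P) (σ₁ σ₂ : Aut P) (rot : RotGens P Φ σ₁ σ₂)
    (chiral : Chiral P) (ht : HasType P (2 ^ suc α) (2 ^ suc β)) (atomic : Atomic P σ₁ σ₂ (2 ^ suc α) (2 ^ suc β)) where
  open Rotations P σ₁ σ₂
  private
    instance
      p-nonZero : NonZero (2 ^ suc α)
      p-nonZero = 2^-nonZero {suc α}
      q-nonZero : NonZero (2 ^ suc β)
      q-nonZero = 2^-nonZero {suc β}

  open TightRotations P Φ σ₁ σ₂ rot chiral (2 ^ suc α) (2 ^ suc β) ht (proj₁ atomic) using (Γ-tight; module Reflect)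
  open TightProps Γ-tight
  open Group Γ using (_≈_; _∙_; ε)
  open Powers Γ
  open Involutions α β Γ-tight

  private
    module G = Group Γ

    z-commutes : Commute word₁ z
    z-commutes = CentralInvolution.b-half-commutes {{p-nonZero}} β Γ-tight (ℕP.^-monoʳ-≤ 2 (s≤s (ℕP.<⇒≤ α<β)))

    -- From p ≥ 2 and p < q one gets q ≥ 4, so the quotient by z still has a nontrivial b and
    -- carries a polyhedron.
    q>2 : ¬ (2^ β ∣ + 1)
    q>2 = large α<β
      where
      large : ∀ {k l} → k < l → ¬ (2^ l ∣ + 1)
      large {l = suc l} _ = 2^∤1 l

    module Modulo-z where
      Γ/z : Group 0ℓ 0ℓ
      Γ/z = Quotient.G/z Γ z (b-half-central β Γ-tight z-commutes) (b-half² β Γ-tight)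

      tight/z : IsTight Γ/z word₁ word₂ (2 ^ suc α) (2 ^ β)
      tight/z = quotient-tight β Γ-tight (b-half-central β Γ-tight z-commutes)

      hom : ∀ u v → u ≈Γ v → Group._≈_ Γ/z (Evaluation.eval Γ/z word₁ word₂ u) (Evaluation.eval Γ/z word₁ word₂ v)
      hom u v e = inj₁ (G.trans (G.reflexive (eval-word u)) (G.trans e (G.reflexive (≡.sym (eval-word v)))))

      regular : Evaluation.Regular Γ/z word₁ word₂
      regular = Covering.not-covering⇒regular P σ₁ σ₂ {{p-nonZero}} {{2^-nonZero {β}}} tight/z (2^∤1 α) q>2 hom
        (proj₂ (proj₂ atomic) (2 ^ β) (2^<2^suc β))

    -- The form of `α` means p ≥ 4: the coset polyhedron of Γ/y needs p/2 > 1, and p = 2 is handled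
    -- separately.
    module Modulo-y (γ : ℕ) (α≡ : α ≡ suc γ) (y-commutes : Commute word₂ y) where
      central : ∀ g → Commute y g
      central = b-half-central α swap y-commutes

      Γ/y : Group 0ℓ 0ℓ
      Γ/y = Quotient.G/z Γ y central (b-half² α swap)

      tight/y : IsTight Γ/y word₁ word₂ (2 ^ α) (2 ^ suc β)
      tight/y = TightProps.swap (quotient-tight α swap central)

      hom : ∀ u v → u ≈Γ v → Group._≈_ Γ/y (Evaluation.eval Γ/y word₁ word₂ u) (Evaluation.eval Γ/y word₁ word₂ v)
      hom u v e = inj₁ (G.trans (G.reflexive (eval-word u)) (G.trans e (G.reflexive (≡.sym (eval-word v)))))

      regular : Evaluation.Regular Γ/y word₁ word₂
      regular = Covering.not-covering⇒regular P σ₁ σ₂ {{2^-nonZero {α}}} {{q-nonZero}} tight/y (subst (λ k → ¬ (2^ k ∣ + 1)) (≡.sym α≡) (2^∤1 γ)) (2^∤1 β) hom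
        (proj₁ (proj₂ atomic) (2 ^ α) (2^<2^suc α))

      -- A relator inverts into ⟨y⟩ ∩ ⟨z⟩ = 1.
      Γ-regular : Evaluation.Regular Γ word₁ word₂
      Γ-regular w e = both (regular w (inj₁ e)) (Modulo-z.regular w (inj₁ e))
        where
        both : ∀ {g} → g ≈ ε ⊎ g ≈ y ∙ ε → g ≈ ε ⊎ g ≈ z ∙ ε → g ≈ ε
        both (inj₁ f) _ = f
        both (inj₂ _) (inj₁ f) = f
        both (inj₂ f) (inj₂ f′) = ⊥-elim (half∤ (proj₁ (independent (2^ α) (2^ β)
          (G.trans (G.sym (G.identityʳ y)) (G.trans (G.sym f) (G.trans f′ (G.identityʳ z)))))))
          where
          half∤ : ¬ (2^ (suc α) ∣ 2^ α)
          half∤ d = ℕP.<⇒≱ (2^<2^suc α) (ℕD.∣⇒≤ {{2^-nonZero {α}}} (∣⇒∣ᵤ d))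

    y-not-central : ¬ Commute y word₂
    y-not-central c = by-cases α refl
      where
      by-cases : ∀ k → α ≡ k → ⊥
      by-cases (suc γ) e = Reflect.not-regular (Modulo-y.Γ-regular γ e (G.sym c))
      -- For p = 2 there is no polyhedron of the quotient. Instead y = a, and commuting with b
      -- forces b² = 1, against q ≥ 4.
      by-cases zero e = q>2 (halve-∣ β (+ 1) (proj₂ (independent (+ 0) (+ 2) (G.sym b²≈ε))))
        where
        y≈a : y ≈ word₁
        y≈a = G.trans (↑-≡ word₁ (cong 2^ e)) (↑-1 word₁)
        b²≈ε : word₂ ↑ + 2 ≈ ε
        b²≈ε = commuting-involution word₁ word₂ (commute-cong y≈a (G.refl {word₂}) c) (a-∣ (∣-resp (cong (λ k → 2^ (suc k)) e) ∣-refl)) rel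

    classified : ChiralRelations α β Γ-tight
    classified = Sum.[_,_]′ (λ r → ⊥-elim (Reflect.not-regular r)) (λ c → c)
      (Classification.classification α β Γ-tight z-commutes Modulo-z.regular y-not-central)

    open WordPresentation _≈Γ_ ≈Γ-refl ≈Γ-sym ≈Γ-trans ≈Γ-cong ≈Γ-cancel using (PresentedBy; conclusion)

    presents : ∀ R → PresentedBy R → Presents P σ₁ σ₂ R
    presents R (sound , complete) = (λ w w′ e → FlagGraph.toPointwise (evaluation (sound w w′ e))) ,
      (λ w w′ e → complete w w′ (evaluate (FlagGraph.pointwise e)))

  result :
    (suc α ≡ 3 × 5 ≤ suc β × Σ Bool (λ s → Presents P σ₁ σ₂
      (ΓRel 8 (2 ^ suc β) (+ 3) (+ 1 + sgn s * + (2 ^ (suc β ∸ 2))) (-[1+ 2 ]) (-[1+ 0 ] + sgn s * + (2 ^ (suc β ∸ 2))))))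
    ⊎
    (suc β ≡ suc (suc α) × 4 ≤ suc α × Σ Bool (λ s → Presents P σ₁ σ₂
      (ΓRel (2 ^ suc α) (2 ^ suc (suc α)) (-[1+ 0 ] + + (2 ^ (suc α ∸ 1))) (-[1+ 2 ] + sgn s * + (2 ^ (suc α ∸ 1)))
        (+ 1 + + (2 ^ (suc α ∸ 1))) (+ 3 + sgn s * + (2 ^ (suc α ∸ 1))))))
  result = Sum.map
    (λ (e , l , s , p) → e , l , s , presents _ p)
    (λ (e , l , s , p) → e , l , s , presents _ p)
    (conclusion α β Γ-tight classified)

theorem4p14 : (α β : ℕ) → 1 ≤ α → α < β →
    (P : Polyhedron) (Φ : Flag P) (σ₁ σ₂ : Aut P) → RotGens P Φ σ₁ σ₂ →
    Chiral P → HasType P (2 ^ α) (2 ^ β) → Atomic P σ₁ σ₂ (2 ^ α) (2 ^ β) →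
    (α ≡ 3 × 5 ≤ β × Σ Bool (λ s → Presents P σ₁ σ₂
    (ΓRel 8 (2 ^ β) (+ 3) (+ 1 + sgn s * + (2 ^ (β ∸ 2)))
    (-[1+ 2 ]) (-[1+ 0 ] + sgn s * + (2 ^ (β ∸ 2))))))
    ⊎
    (β ≡ suc α × 4 ≤ α × Σ Bool (λ s → Presents P σ₁ σ₂
    (ΓRel (2 ^ α) (2 ^ suc α) (-[1+ 0 ] + + (2 ^ (α ∸ 1))) (-[1+ 2 ] + sgn s * + (2 ^ (α ∸ 1)))
    (+ 1 + + (2 ^ (α ∸ 1))) (+ 3 + sgn s * + (2 ^ (α ∸ 1))))))
theorem4p14 (suc α) (suc β) (s≤s z≤n) (s≤s α<β) P Φ σ₁ σ₂ rot chiral ht atomic =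
  AtomicCase.result α β α<β P Φ σ₁ σ₂ rot chiral ht atomic
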